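{- Let $B$ be acyclic and of finite Cartan type. If $x$ is a cluster variable of the principal-coefficients cluster algebra $\mathcal{A}_0(B)$ that is not contained in the initial seed, then ${\mathbf g}(x)=\nu(\mathbf{d}(x))$; equivalently $\mathbf{d}(x)=\eta({\mathbf g}(x))$.
   Context: $I$ finite, $|I|=n$; $B=[b_{ij}]_{i,j\in I}$ skew-symmetrizable integer matrix ($\delta(i)b_{ij}=-\delta(j)b_{ji}$, $\delta>0$), acyclic: the digraph on $I$ with $i\to j$ iff $b_{ij}<0$ has no directed cycle. Finite Cartan type: the Cartan companion $A$ ($a_{ii}=2$, $a_{ij}=-|b_{ij}|$) is a Cartan matrix of finite type. $V$ has basis of simple roots $\alpha_i$, simple co-roots $\alpha_i^\vee=\delta(i)^{ -1}\alpha_i$; fundamental weights $\rho_i\in V^*$ are dual to $\{\alpha_i^\vee\}$. Euler form: $E(\alpha_i^\vee,\alpha_j)=\min(b_{ij},0)$ for $i\neq j$, $E(\alpha_i^\vee,\alpha_i)=1$. $\nu:V\to V^*$ is linear with $\nu(\alpha_j)=-\sum_iE(\alpha_i^\vee,\alpha_j)\rho_i$; it is invertible with inverse $\eta$. $\mathcal{A}_0(B)$: initial cluster $(x_i)$, frozen variables $(y_i)$, extended exchange matrix $\binom{B}{\mathrm{Id}}$; mutation at $k$: $\tilde b'_{pq}=-\tilde b_{pq}$ if $p=k$ or $q=k$, else $\tilde b_{pq}+\operatorname{sgn}(\tilde b_{pk})[\tilde b_{pk}\tilde b_{kq}]_+$ ($[x]_+=\max(x,0)$), and $x_k\mapsto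 x_k^{ -1}(\prod_pz_p^{[\tilde b_{pk}]_+}+\prod_pz_p^{[-\tilde b_{pk}]_+})$ with $z_p$ the cluster/frozen variable of row $p$. Cluster variables are all those obtained by iterated mutations. ${\mathbf g}$-vector: $\mathcal{A}_0(B)$ is graded by $\bigoplus\mathbb Z\rho_i$ with $\deg x_i=\rho_i$, $\deg y_j=-\sum_ib_{ij}\rho_i$; each cluster variable $x$ is homogeneous and ${\mathbf g}(x)$ is its degree. Denominator vector: $x=N/\prod_ix_i^{d_i}$ uniquely with $d_i\in\mathbb Z$ and $N$ a polynomial in the $x_i$ not divisible by any $x_i$; $\mathbf{d}(x)=\sum_id_i\alpha_i$. -}

module Defs where

open import Data.Nat using (ℕ; zero; suc)
open import Data.Integer as ℤ using (ℤ; +_; -[1+_]; _+_; _*_; -_; _-_; _⊓_; _<_; ∣_∣)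
open import Data.Fin using (Fin; zero; suc; _≟_)
open import Data.Fin.Properties using ()
open import Data.Vec using (Vec; []; _∷_; replicate; zipWith; tabulate; lookup)
open import Data.Bool using (Bool; true; false; if_then_else_; _∨_)
import Data.Vec.Properties as VecP
import Data.Nat.Properties as ℕP
open import Data.List using (List; []; _∷_; _++_; concatMap; map; allFin; foldr; foldl)
open import Data.Product using (Σ; ∃; _×_; _,_; proj₁; proj₂)
open import Data.Sum using (_⊎_; inj₁; inj₂)
open import Relation.Binary.PropositionalEquality using (_≡_; _≢_)
open import Relation.Nullary using (¬_; yes; no)
open import Relation.Nullary.Decidable using (⌊_⌋)
open import Data.Product.Properties using (≡-dec)

sumFin : ∀ {n} → (Fin n → ℤ) → ℤ
sumFin {zero}  f = + 0
sumFin {suc n} f = f zero + sumFin (λ i → f (suc i))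

SkewSymmetrizable : ∀ {n} → (Fin n → Fin n → ℤ) → (Fin n → ℕ) → Set
SkewSymmetrizable B δ =
  (∀ i → 0 Data.Nat.< δ i) × (∀ i j → + δ i * B i j ≡ - (+ δ j * B j i))
  where import Data.Nat

data Walk⁺ {n} (B : Fin n → Fin n → ℤ) : Fin n → Fin n → Set where
  edge : ∀ {i j} → B i j < + 0 → Walk⁺ B i j
  step : ∀ {i j k} → B i j < + 0 → Walk⁺ B j k → Walk⁺ B i k

Acyclic : ∀ {n} → (Fin n → Fin n → ℤ) → Set
Acyclic B = ∀ i → ¬ Walk⁺ B i i

cartanCompanion : ∀ {n} → (Fin n → Fin n → ℤ) → Fin n → Fin n → ℤ
cartanCompanion B i j with i ≟ j
... | yes _ = + 2
... | no  _ = - (+ ∣ B i j ∣)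

-- A (symmetrizable by δ, i.e. δ(i) a_ij = δ(j) a_ji) is a Cartan matrix of
-- finite type: the symmetrized matrix (δ(i) a_ij) is positive definite.
FiniteType : ∀ {n} → (Fin n → Fin n → ℤ) → (Fin n → ℕ) → Set
FiniteType {n} A δ =
  (u : Fin n → ℤ) → (∃ λ i → u i ≢ + 0) →
  + 0 < sumFin (λ i → sumFin (λ j → u i * (+ δ i * A i j) * u j))

FiniteCartanType : ∀ {n} → (Fin n → Fin n → ℤ) → (Fin n → ℕ) → Set
FiniteCartanType B δ = FiniteType (cartanCompanion B) δ

-- a monomial  x^e y^f  is the pair of exponent vectors (e , f)
Monomial : ℕ → Set
Monomial n = Vec ℕ n × Vec ℕ n

_≟M_ : ∀ {n} (m m′ : Monomial n) → Relation.Nullary.Dec (m ≡ m′)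
_≟M_ = ≡-dec (VecP.≡-dec ℕP._≟_) (VecP.≡-dec ℕP._≟_)
  where import Relation.Nullary

-- a polynomial is a finite formal sum of terms (coefficient , monomial)
Poly : ℕ → Set
Poly n = List (ℤ × Monomial n)

coeff : ∀ {n} → Poly n → Monomial n → ℤ
coeff [] m = + 0
coeff ((c , m′) ∷ p) m with m′ ≟M m
... | yes _ = c + coeff p m
... | no  _ = coeff p m

_≈P_ : ∀ {n} → Poly n → Poly n → Set
p ≈P q = ∀ m → coeff p m ≡ coeff q m

zeroP : ∀ {n} → Poly n
zeroP = []

oneP : ∀ {n} → Poly n
oneP = (+ 1 , replicate _ 0 , replicate _ 0) ∷ []

_+P_ : ∀ {n} → Poly n → Poly n → Poly n
_+P_ = _++_

mulM : ∀ {n} → Monomial n → Monomial n → Monomial n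
mulM (e , f) (e′ , f′) = zipWith Data.Nat._+_ e e′ , zipWith Data.Nat._+_ f f′
  where import Data.Nat

_*P_ : ∀ {n} → Poly n → Poly n → Poly n
p *P q = concatMap (λ { (c , m) → map (λ { (c′ , m′) → (c * c′ , mulM m m′) }) q }) p

_^P_ : ∀ {n} → Poly n → ℕ → Poly n
p ^P zero  = oneP
p ^P suc k = p *P (p ^P k)

unitVec : ∀ {n} → Fin n → Vec ℕ n
unitVec i = tabulate (λ j → if ⌊ i ≟ j ⌋ then 1 else 0)

xP : ∀ {n} → Fin n → Poly n
xP i = (+ 1 , unitVec i , replicate _ 0) ∷ []

yP : ∀ {n} → Fin n → Poly n
yP j = (+ 1 , replicate _ 0 , unitVec j) ∷ []

_∣P_ : ∀ {n} → Poly n → Poly n → Set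
q ∣P p = ∃ λ r → p ≈P (q *P r)

-- Rational functions in x, y: fractions  num / den  (den ≠ 0)

Frac : ℕ → Set
Frac n = Poly n × Poly n

_≃_ : ∀ {n} → Frac n → Frac n → Set
(a , b) ≃ (c , d) = (a *P d) ≈P (c *P b)

_*F_ : ∀ {n} → Frac n → Frac n → Frac n
(a , b) *F (c , d) = (a *P c , b *P d)

_+F_ : ∀ {n} → Frac n → Frac n → Frac n
(a , b) +F (c , d) = ((a *P d) +P (c *P b) , b *P d)

invF : ∀ {n} → Frac n → Frac n
invF (a , b) = (b , a)

oneF : ∀ {n} → Frac n
oneF = (oneP , oneP)

_^F_ : ∀ {n} → Frac n → ℕ → Frac n
x ^F zero  = oneF
x ^F suc k = x *F (x ^F k)

polyF : ∀ {n} → Poly n → Frac n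
polyF p = (p , oneP)

pos : ℤ → ℕ
pos (+ k)    = k
pos -[1+ _ ] = 0

sgn* : ℤ → ℤ → ℤ
sgn* (+ zero)  c = + 0
sgn* (+ suc _) c = c
sgn* -[1+ _ ]  c = - c

-- rows of the extended exchange matrix: inj₁ i (cluster row), inj₂ j (frozen row)
Row : ℕ → Set
Row n = Fin n ⊎ Fin n

record Seed (n : ℕ) : Set where
  constructor seed
  field
    mat  : Row n → Fin n → ℤ
    clus : Fin n → Frac n
open Seed public

initialSeed : ∀ {n} → (Fin n → Fin n → ℤ) → Seed n
initialSeed B = seed m (λ i → polyF (xP i))
  where
  m : _ → _ → ℤ
  m (inj₁ i) j = B i j
  m (inj₂ i) j = if ⌊ i ≟ j ⌋ then + 1 else + 0

isK : ∀ {n} → Fin n → Row n → Bool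
isK k (inj₁ i) = ⌊ i ≟ k ⌋
isK k (inj₂ _) = false

mutMat : ∀ {n} → Fin n → (Row n → Fin n → ℤ) → Row n → Fin n → ℤ
mutMat k b p q =
  if isK k p ∨ ⌊ q ≟ k ⌋
  then - b p q
  else b p q + sgn* (b p k) (+ pos (b p k * b (inj₁ k) q))

zVar : ∀ {n} → Seed n → Row n → Frac n
zVar s (inj₁ i) = clus s i
zVar s (inj₂ j) = polyF (yP j)

prodF : ∀ {n} → List (Frac n) → Frac n
prodF = foldr _*F_ oneF

allRows : ∀ {n} → List (Row n)
allRows = map inj₁ (allFin _) ++ map inj₂ (allFin _)

mutVar : ∀ {n} → Seed n → Fin n → Frac n
mutVar s k =
  (prodF (map (λ p → zVar s p ^F pos (mat s p k)) allRows)
   +F prodF (map (λ p → zVar s p ^F pos (- mat s p k)) allRows))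
  *F invF (clus s k)

mutate : ∀ {n} → Fin n → Seed n → Seed n
mutate k s = seed (mutMat k (mat s)) (λ i → if ⌊ i ≟ k ⌋ then mutVar s k else clus s i)

mutateSeq : ∀ {n} → (Fin n → Fin n → ℤ) → List (Fin n) → Seed n
mutateSeq B ks = foldl (λ s k → mutate k s) (initialSeed B) ks

IsClusterVariable : ∀ {n} → (Fin n → Fin n → ℤ) → Frac n → Set
IsClusterVariable B x = ∃ λ ks → ∃ λ k → x ≡ clus (mutateSeq B ks) k

-- degree of x^e y^f : Σ e_i ρ_i + Σ_j f_j (-Σ_i b_ij ρ_i), in ρ-coordinates
degM : ∀ {n} → (Fin n → Fin n → ℤ) → Monomial n → Fin n → ℤ
degM B (e , f) i = + lookup e i - sumFin (λ j → B i j * + lookup f j)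

HomogP : ∀ {n} → (Fin n → Fin n → ℤ) → Poly n → (Fin n → ℤ) → Set
HomogP B p a = ∀ m → coeff p m ≢ + 0 → ∀ i → degM B m i ≡ a i

NonzeroP : ∀ {n} → Poly n → Set
NonzeroP p = ¬ (p ≈P zeroP)

HasDegree : ∀ {n} → (Fin n → Fin n → ℤ) → Frac n → (Fin n → ℤ) → Set
HasDegree B x g =
  ∃ λ P → ∃ λ Q → ∃ λ a → ∃ λ b →
    NonzeroP P × NonzeroP Q × x ≃ (P , Q) ×
    HomogP B P a × HomogP B Q b × (∀ i → g i ≡ a i - b i)

xMon : ∀ {n} → (Fin n → ℕ) → Poly n
xMon e = (+ 1 , tabulate e , replicate _ 0) ∷ []

-- d is the denominator vector of x:
-- x = N / ∏ x_i^{d_i} with N a polynomial not divisible by any x_i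
IsDenominatorVector : ∀ {n} → Frac n → (Fin n → ℤ) → Set
IsDenominatorVector x d =
  ∃ λ N → (x ≃ (N *P xMon (λ i → pos (- d i)) , xMon (λ i → pos (d i))))
        × (∀ i → ¬ (xP i ∣P N))

-- Euler form  E(α_i^∨, α_j)
euler : ∀ {n} → (Fin n → Fin n → ℤ) → Fin n → Fin n → ℤ
euler B i j = if ⌊ i ≟ j ⌋ then + 1 else (B i j ⊓ + 0)

-- ν(Σ_j d_j α_j) = Σ_i (- Σ_j E(α_i^∨, α_j) d_j) ρ_i, in ρ-coordinates
ν : ∀ {n} → (Fin n → Fin n → ℤ) → (Fin n → ℤ) → Fin n → ℤ
ν B d i = - sumFin (λ j → euler B i j * d j)

-- The c-vectors c_i of a seed (the columns of the frozen part of its exchange matrix) and the vectors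
-- e_i dual to them under the Euler form E determine each other, and ν(e_i) is the g-vector of the i-th
-- cluster variable. Mutation preserves the following: the c_i are roots, E(c_i, c_j) = 0 if c_i is
-- positive and c_j negative, and E(c_i, c_j) ≤ 0 if i ≠ j and both have the same sign. As E is positive
-- definite, this yields sign coherence, and it forces every e_i to be either nonnegative or one of the
-- vectors attached to the initial variables. Put den_i = e_i in the first case and −α_j in the second.
-- Then den satisfies the max-plus exchange relation. Cluster variables being subtraction-free fractions,
-- their orders of vanishing along x_l satisfy the same relation, so the order of the i-th
-- cluster variable is −den_i. By the Laurent phenomenon, obtained from the equality of the upper bounds
-- of adjacent clusters, den_i is therefore its denominator vector. A variable with e_i of the second kind
-- has a numerator of degree 0 free of the y_j, hence is an initial one.
module Submission where

open import Defs
open import Data.Nat as ℕ using (ℕ; zero; suc)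
import Data.Nat.Properties as ℕP
open import Data.Integer as ℤ using (ℤ; +_; -[1+_]; _+_; _*_; -_; _-_; _⊓_; _⊔_; _≤_; _<_; ∣_∣; +≤+; +<+; 0ℤ; 1ℤ)
import Data.Integer.Properties as ℤP
open import Data.Integer.Tactic.RingSolver using (solve-∀)
import Data.Nat.Tactic.RingSolver as ℕSolver
open import Data.Fin as Fin using (Fin; zero; suc; _≟_)
import Data.Fin.Properties as FinP
import Data.Nat.DivMod as ℕDM
open import Data.Bool using (true; false; if_then_else_)
open import Data.List using (List; []; _∷_; _++_; map; allFin; foldr; foldl; length)
import Data.List
import Data.Vec.Properties as VecP
import Data.List.Properties as ListP
open import Data.List.Relation.Unary.Any as Any using (Any; here; there)
open import Data.Vec as Vec using (Vec; []; _∷_; zipWith; lookup; tabulate; replicate)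
open import Data.Rational as ℚ using (ℚ; 0ℚ; 1ℚ)
import Data.Rational.Properties as ℚP
import Data.Rational.Solver
import Data.Rational.Unnormalised as ℚᵘ
import Data.Rational.Unnormalised.Properties as ℚᵘP
open import Algebra.Structures using (IsCommutativeRing)
open import Data.Product using (Σ; ∃; _×_; _,_; proj₁; proj₂)
open import Data.Sum using (_⊎_; inj₁; inj₂; [_,_]′)
open import Data.Unit using (⊤; tt)
open import Data.Empty using (⊥; ⊥-elim)
open import Function using (_∘_; case_of_)
open import Relation.Binary.PropositionalEquality
open import Relation.Nullary using (¬_; yes; no; Dec)
open import Relation.Nullary.Decidable using (⌊_⌋; ¬?; _×-dec_; decidable-stable)
open import Relation.Binary.Definitions using (tri<; tri≈; tri>)

-- Integer inequalities and sums

-- Roots are described by the Euler form alone, without modules over a quiver. The vanishing of Hom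
-- spaces that mutation of c-vectors calls for becomes an inequality for the form, and
-- Auslander-Reiten translation becomes the Coxeter transformation `Φ`, an isometry: a
-- counterexample contains no projective, so it moves along its `Φ`-orbit forever, and positive
-- definiteness forbids that. A pigeonhole modulo an integer stands in for finiteness of the root
-- system. Initial variables are the obstacle in the exchange relations, because their vectors
-- -`I i` are not their denominator vectors. Hence vectors are tested only against those vanishing
-- at the initial variables that both clusters share, and `Truncated` supplies signs there. Orders
-- of vanishing alone give no denominator vector, since a fraction produced by mutations may have a
-- denominator that is not a monomial; this is what the Laurent phenomenon settles. Coprimality in
-- its proof is expressed by gradings: a homogeneous binomial can be divided out as soon as the
-- other factor has a single term of lowest weight.

0≤+ : ∀ {a b} → 0ℤ ≤ a → 0ℤ ≤ b → 0ℤ ≤ a + b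
0≤+ = ℤP.+-mono-≤

0<+≤ : ∀ {a b} → 0ℤ < a → 0ℤ ≤ b → 0ℤ < a + b
0<+≤ = ℤP.+-mono-<-≤

0≤* : ∀ {a b} → 0ℤ ≤ a → 0ℤ ≤ b → 0ℤ ≤ a * b
0≤* {+ m} {+ n} _ _ = subst (0ℤ ≤_) (ℤP.pos-* m n) (+≤+ ℕ.z≤n)

0<* : ∀ {a b} → 0ℤ < a → 0ℤ < b → 0ℤ < a * b
0<* {+ suc m} {+ suc n} _ _ = +<+ (ℕ.s≤s ℕ.z≤n)
0<* {+ zero} (+<+ ()) _
0<* {+ suc _} {+ zero} _ (+<+ ())

0≤-neg : ∀ {a} → a ≤ 0ℤ → 0ℤ ≤ - a
0≤-neg = ℤP.neg-mono-≤

neg-≤0 : ∀ {a} → 0ℤ ≤ a → - a ≤ 0ℤ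
neg-≤0 = ℤP.neg-mono-≤

0≤neg⇒≤0 : ∀ {a} → 0ℤ ≤ - a → a ≤ 0ℤ
0≤neg⇒≤0 {a} p = subst (_≤ 0ℤ) (ℤP.neg-involutive a) (ℤP.neg-mono-≤ p)

0≤∣neg : ∀ {a} → - a ≤ 0ℤ → 0ℤ ≤ a
0≤∣neg {a} p = subst (0ℤ ≤_) (ℤP.neg-involutive a) (ℤP.neg-mono-≤ p)

*≤0 : ∀ {a b} → 0ℤ ≤ a → b ≤ 0ℤ → a * b ≤ 0ℤ
*≤0 {a} {b} p q = 0≤neg⇒≤0 (subst (0ℤ ≤_) (sym (ℤP.neg-distribʳ-* a b)) (0≤* p (0≤-neg q)))

*≤0′ : ∀ {a b} → a ≤ 0ℤ → 0ℤ ≤ b → a * b ≤ 0ℤ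
*≤0′ {a} {b} p q = subst (_≤ 0ℤ) (ℤP.*-comm b a) (*≤0 q p)

≤by : ∀ {a b} c → 0ℤ ≤ c → b - a ≡ c → a ≤ b
≤by c p e = ℤP.0≤i-j⇒j≤i (subst (0ℤ ≤_) (sym e) p)

<by : ∀ {a b} c → 0ℤ < c → b - a ≡ c → a < b
<by {a} {b} c p e = subst₂ _<_ (ℤP.+-identityʳ a) (lem a b) (ℤP.+-monoʳ-< a (subst (0ℤ <_) (sym e) p))
  where
  lem : ∀ a b → a + (b - a) ≡ b
  lem = solve-∀

0≤- : ∀ {a b} → a ≤ b → 0ℤ ≤ b - a
0≤- = ℤP.i≤j⇒0≤j-i

0<- : ∀ {a b} → a < b → 0ℤ < b - a
0<- {a} {b} p = subst₂ _<_ (ℤP.+-inverseʳ a) refl (ℤP.+-monoˡ-< (- a) p)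

≤∧≢⇒< : ∀ {a b} → a ≤ b → a ≢ b → a < b
≤∧≢⇒< = ℤP.≤∧≢⇒<

<⇒⊥ : ∀ {a} → 0ℤ < a → a ≤ 0ℤ → ⊥
<⇒⊥ p q = ℤP.<⇒≱ p q

0<⇒1≤ : ∀ {a} → 0ℤ < a → 1ℤ ≤ a
0<⇒1≤ (+<+ p) = +≤+ p

*-cancel-0< : ∀ {a b} → 0ℤ < a → 0ℤ < a * b → 0ℤ < b
*-cancel-0< {a} {b} p q with ℤP.<-cmp 0ℤ b
... | tri< r _ _ = r
... | tri≈ _ refl _ = ⊥-elim (ℤP.<-irrefl (sym (ℤP.*-zeroʳ a)) q)
... | tri> _ _ r = ⊥-elim (<⇒⊥ q (*≤0 (ℤP.<⇒≤ p) (ℤP.<⇒≤ r)))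

*-cancel-0≤ : ∀ {a b} → 0ℤ < a → 0ℤ ≤ a * b → 0ℤ ≤ b
*-cancel-0≤ {a} {b} p q with ℤP.≤-total 0ℤ b
... | inj₁ r = r
... | inj₂ r with b ℤ.≟ 0ℤ
...   | yes refl = ℤP.≤-refl
...   | no ne = ⊥-elim (<⇒⊥ (subst (0ℤ <_) (sym (ℤP.neg-distribʳ-* a b)) (0<* p (ℤP.neg-mono-< (≤∧≢⇒< r ne)))) (neg-≤0 q))

*-cancel-0 : ∀ {a b} → 0ℤ < a → a * b ≡ 0ℤ → b ≡ 0ℤ
*-cancel-0 {+ suc n} {b} p e = ℤP.*-cancelˡ-≡ (+ suc n) b 0ℤ (trans e (sym (ℤP.*-zeroʳ (+ suc n))))
*-cancel-0 {+ zero} (+<+ ()) _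

*-cancelˡ : ∀ {a b c} → 0ℤ < a → a * b ≡ a * c → b ≡ c
*-cancelˡ {+ suc n} {b} {c} p e = ℤP.*-cancelˡ-≡ (+ suc n) b c e
*-cancelˡ {+ zero} (+<+ ()) _

-‿0 : ∀ {a b} → a - b ≡ 0ℤ → a ≡ b
-‿0 {a} {b} = ℤP.i-j≡0⇒i≡j a b

-- The quotient is kept as data because coefficients of expansions in c-vectors are later read off
-- from it.
record _∣ᶻ_ (d a : ℤ) : Set where
  constructor _,_
  field
    quotient : ℤ
    equality : a ≡ d * quotient

∣-pos : ∀ {d a} → 0ℤ < d → d ∣ᶻ a → 0ℤ < a → d ≤ a
∣-pos {d} p (q , refl) r = ≤by (d * (q - 1ℤ)) (0≤* (ℤP.<⇒≤ p) (0≤- (0<⇒1≤ (*-cancel-0< p r)))) (lem d q)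
  where
  lem : ∀ d q → d * q - d ≡ d * (q - 1ℤ)
  lem = solve-∀

∣-neg : ∀ {d a} → d ∣ᶻ a → d ∣ᶻ (- a)
∣-neg {d} (q , refl) = - q , ℤP.neg-distribʳ-* d q

∣-+ : ∀ {d a b} → d ∣ᶻ a → d ∣ᶻ b → d ∣ᶻ (a + b)
∣-+ {d} (q , refl) (r , refl) = q + r , sym (ℤP.*-distribˡ-+ d q r)

∣-resp : ∀ {d a b} → a ≡ b → d ∣ᶻ a → d ∣ᶻ b
∣-resp refl x = x

-- ∑ and ⟪_⟫ are opaque because unification cannot see through the recursion of sumFin.
opaque
  ∑ : ∀ {n} → (Fin n → ℤ) → ℤ
  ∑ = sumFin

  sum-cong : ∀ {n} {f g : Fin n → ℤ} → (∀ i → f i ≡ g i) → ∑ f ≡ ∑ g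
  sum-cong {zero} e = refl
  sum-cong {suc n} {f} {g} e = cong₂ _+_ (e zero) (sum-cong {n} {f ∘ suc} {g ∘ suc} (λ i → e (suc i)))

  sum-+ : ∀ {n} (f g : Fin n → ℤ) → ∑ (λ i → f i + g i) ≡ ∑ f + ∑ g
  sum-+ {zero} f g = refl
  sum-+ {suc n} f g rewrite sum-+ (f ∘ suc) (g ∘ suc) = lem (f zero) (g zero) (∑ (f ∘ suc)) (∑ (g ∘ suc))
    where
    lem : ∀ a b c d → a + b + (c + d) ≡ a + c + (b + d)
    lem = solve-∀

  sum-* : ∀ {n} a (f : Fin n → ℤ) → ∑ (λ i → a * f i) ≡ a * ∑ f
  sum-* {zero} a f = sym (ℤP.*-zeroʳ a)
  sum-* {suc n} a f rewrite sum-* a (λ i → f (suc i)) = sym (ℤP.*-distribˡ-+ a (f zero) (∑ (f ∘ suc)))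

  sum-0 : ∀ {n} {f : Fin n → ℤ} → (∀ i → f i ≡ 0ℤ) → ∑ f ≡ 0ℤ
  sum-0 {zero} e = refl
  sum-0 {suc n} {f} e = cong₂ _+_ (e zero) (sum-0 {n} {f ∘ suc} (λ i → e (suc i)))

  sum-single : ∀ {n} (f : Fin n → ℤ) i → (∀ j → j ≢ i → f j ≡ 0ℤ) → ∑ f ≡ f i
  sum-single {suc n} f zero z = trans (cong (λ v → f zero + v) (sum-0 {n} {f ∘ suc} (λ j → z (suc j) (λ ())))) (ℤP.+-identityʳ (f zero))
  sum-single {suc n} f (suc i) z = trans (cong₂ _+_ (z zero (λ ())) (sum-single (f ∘ suc) i (λ j ne → z (suc j) (λ e → ne (FinP.suc-injective e))))) (ℤP.+-identityˡ (f (suc i)))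

  sum-≥0 : ∀ {n} {f : Fin n → ℤ} → (∀ i → 0ℤ ≤ f i) → 0ℤ ≤ ∑ f
  sum-≥0 {zero} p = ℤP.≤-refl
  sum-≥0 {suc n} {f} p = 0≤+ (p zero) (sum-≥0 {n} {f ∘ suc} (λ i → p (suc i)))

  sum-≥term : ∀ {n} {f : Fin n → ℤ} → (∀ i → 0ℤ ≤ f i) → ∀ i → f i ≤ ∑ f
  sum-≥term {suc n} {f} p zero = ≤by (∑ (f ∘ suc)) (sum-≥0 {n} {f ∘ suc} (λ i → p (suc i))) (lem (f zero) (∑ (f ∘ suc)))
    where
    lem : ∀ a b → a + b - a ≡ b
    lem = solve-∀
  sum-≥term {suc n} {f} p (suc i) = ℤP.≤-trans (sum-≥term {n} {f ∘ suc} (λ i → p (suc i)) i) (≤by (f zero) (p zero) (lem (f zero) (∑ (f ∘ suc))))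
    where
    lem : ∀ a b → a + b - b ≡ a
    lem = solve-∀

  sum-swap : ∀ {m n} (f : Fin m → Fin n → ℤ) →
    ∑ (λ i → ∑ (λ j → f i j)) ≡ ∑ (λ j → ∑ (λ i → f i j))
  sum-swap {zero} {n} f = sym (sum-0 {n} {λ _ → 0ℤ} (λ _ → refl))
  sum-swap {suc m} {n} f = trans (cong (λ v → ∑ (f zero) + v) (sum-swap (f ∘ suc))) (sym (sum-+ (f zero) (λ j → ∑ (λ i → f (suc i) j))))

sum-neg : ∀ {n} (f : Fin n → ℤ) → ∑ (λ i → - f i) ≡ - ∑ f
sum-neg f = trans (sum-cong (λ i → sym (ℤP.-1*i≡-i (f i)))) (trans (sum-* (- 1ℤ) f) (ℤP.-1*i≡-i (∑ f)))

sum-≤0 : ∀ {n} {f : Fin n → ℤ} → (∀ i → f i ≤ 0ℤ) → ∑ f ≤ 0ℤ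
sum-≤0 {n} {f} p = 0≤neg⇒≤0 (subst (0ℤ ≤_) (sum-neg f) (sum-≥0 (λ i → 0≤-neg (p i))))

sum-terms-0 : ∀ {n} {f : Fin n → ℤ} → (∀ i → 0ℤ ≤ f i) → ∑ f ≤ 0ℤ → ∀ i → f i ≡ 0ℤ
sum-terms-0 p e i = ℤP.≤-antisym (ℤP.≤-trans (sum-≥term p i) e) (p i)

sum-pos-ex : ∀ {n} {f : Fin n → ℤ} → 0ℤ < ∑ f → ∃ λ i → 0ℤ < f i
sum-pos-ex {n} {f} p with FinP.any? (λ i → 0ℤ ℤ.<? f i)
... | yes r = r
... | no r = ⊥-elim (<⇒⊥ p (sum-≤0 (λ i → ℤP.≮⇒≥ (λ q → r (i , q)))))

-- Bilinear forms on integer vectors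

Vect : ℕ → Set
Vect n = Fin n → ℤ

Form : ℕ → Set
Form n = Fin n → Fin n → ℤ

_ᵀ : ∀ {n} → Form n → Form n
(F ᵀ) i j = F j i

lincomb : ∀ {m n} → (Fin m → ℤ) → (Fin m → Vect n) → Vect n
lincomb t c i = ∑ (λ r → t r * c r i)

axpy : ∀ {n} → ℤ → Vect n → Vect n → Vect n
axpy a y x i = x i + a * y i

0v : ∀ {n} → Vect n
0v _ = 0ℤ

α : ∀ {n} → Fin n → Vect n
α l i = if ⌊ i ≟ l ⌋ then 1ℤ else 0ℤ

α-diag : ∀ {n} (l : Fin n) → α l l ≡ 1ℤ
α-diag l with l ≟ l
... | yes _ = refl
... | no ne = ⊥-elim (ne refl)

α-off : ∀ {n} {l i : Fin n} → i ≢ l → α l i ≡ 0ℤ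
α-off {l = l} {i} ne with i ≟ l
... | yes e = ⊥-elim (ne e)
... | no _ = refl

sum-α : ∀ {n} (f : Fin n → ℤ) l → ∑ (λ i → α l i * f i) ≡ f l
sum-α f l = trans (sum-single (λ i → α l i * f i) l (λ j ne → trans (cong (_* f j) (α-off ne)) (ℤP.*-zeroˡ (f j))))
  (trans (cong (_* f l) (α-diag l)) (ℤP.*-identityˡ (f l)))

opaque
  ⟪_⟫ : ∀ {n} → Form n → Vect n → Vect n → ℤ
  ⟪ F ⟫ x y = ∑ (λ i → ∑ (λ j → x i * F i j * y j))

  E-unfold : ∀ {n} {F : Form n} {x y} → ⟪ F ⟫ x y ≡ ∑ (λ i → ∑ (λ j → x i * F i j * y j))
  E-unfold = refl

  E-cong : ∀ {n} (F : Form n) {x x′ y y′} → (∀ i → x i ≡ x′ i) → (∀ i → y i ≡ y′ i) → ⟪ F ⟫ x y ≡ ⟪ F ⟫ x′ y′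
  E-cong F p q = sum-cong (λ i → sum-cong (λ j → cong₂ (λ a b → a * F i j * b) (p i) (q j)))

  E-T : ∀ {n} (F : Form n) x y → ⟪ F ᵀ ⟫ x y ≡ ⟪ F ⟫ y x
  E-T F x y = trans (sum-swap (λ i j → x i * F j i * y j)) (sum-cong (λ i → sum-cong (λ j → lem (x j) (F i j) (y i))))
    where
    lem : ∀ a b c → a * b * c ≡ c * b * a
    lem = solve-∀

  E-axpyˡ : ∀ {n} (F : Form n) a x y z → ⟪ F ⟫ (axpy a y x) z ≡ ⟪ F ⟫ x z + a * ⟪ F ⟫ y z
  E-axpyˡ F a x y z = begin
    ∑ (λ i → ∑ (λ j → (x i + a * y i) * F i j * z j))
      ≡⟨ sum-cong (λ i → sum-cong (λ j → lem a (x i) (y i) (F i j) (z j))) ⟩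
    ∑ (λ i → ∑ (λ j → x i * F i j * z j + a * (y i * F i j * z j)))
      ≡⟨ sum-cong (λ i → trans (sum-+ (λ j → x i * F i j * z j) (λ j → a * (y i * F i j * z j)))
           (cong (λ v → ∑ (λ j → x i * F i j * z j) + v) (sum-* a (λ j → y i * F i j * z j)))) ⟩
    ∑ (λ i → ∑ (λ j → x i * F i j * z j) + a * ∑ (λ j → y i * F i j * z j))
      ≡⟨ sum-+ (λ i → ∑ (λ j → x i * F i j * z j)) (λ i → a * ∑ (λ j → y i * F i j * z j)) ⟩
    ⟪ F ⟫ x z + ∑ (λ i → a * ∑ (λ j → y i * F i j * z j))
      ≡⟨ cong (λ v → ⟪ F ⟫ x z + v) (sum-* a (λ i → ∑ (λ j → y i * F i j * z j))) ⟩
    ⟪ F ⟫ x z + a * ⟪ F ⟫ y z ∎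
    where
    open ≡-Reasoning
    lem : ∀ a x y f z → (x + a * y) * f * z ≡ x * f * z + a * (y * f * z)
    lem = solve-∀

  E-0ˡ : ∀ {n} (F : Form n) {x} y → (∀ i → x i ≡ 0ℤ) → ⟪ F ⟫ x y ≡ 0ℤ
  E-0ˡ F {x} y z = sum-0 (λ i → sum-0 (λ j → cong (λ a → a * F i j * y j) (z i)))

  E-expandˡ : ∀ {n} (F : Form n) x y → ⟪ F ⟫ x y ≡ ∑ (λ l → x l * ∑ (λ j → F l j * y j))
  E-expandˡ F x y = sum-cong (λ i → trans (sum-cong (λ j → ℤP.*-assoc (x i) (F i j) (y j)))
    (sum-* (x i) (λ j → F i j * y j)))

module _ {n} (F : Form n) where

  E-congˡ : ∀ {x x′ y} → (∀ i → x i ≡ x′ i) → ⟪ F ⟫ x y ≡ ⟪ F ⟫ x′ y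
  E-congˡ p = E-cong F p (λ _ → refl)

  E-congʳ : ∀ {x y y′} → (∀ i → y i ≡ y′ i) → ⟪ F ⟫ x y ≡ ⟪ F ⟫ x y′
  E-congʳ p = E-cong F (λ _ → refl) p

  E-scaleˡ : ∀ a x y → ⟪ F ⟫ (λ i → a * x i) y ≡ a * ⟪ F ⟫ x y
  E-scaleˡ a x y = begin
    ⟪ F ⟫ (λ i → a * x i) y ≡⟨ E-congˡ (λ i → sym (ℤP.+-identityˡ (a * x i))) ⟩
    ⟪ F ⟫ (axpy a x 0v) y ≡⟨ E-axpyˡ F a 0v x y ⟩
    ⟪ F ⟫ 0v y + a * ⟪ F ⟫ x y ≡⟨ cong (_+ a * ⟪ F ⟫ x y) (E-0ˡ F y (λ _ → refl)) ⟩
    0ℤ + a * ⟪ F ⟫ x y ≡⟨ ℤP.+-identityˡ (a * ⟪ F ⟫ x y) ⟩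
    a * ⟪ F ⟫ x y ∎
    where open ≡-Reasoning

  E-negˡ : ∀ x y → ⟪ F ⟫ (λ i → - x i) y ≡ - ⟪ F ⟫ x y
  E-negˡ x y = trans (E-congˡ (λ i → sym (ℤP.-1*i≡-i (x i)))) (trans (E-scaleˡ (- 1ℤ) x y) (ℤP.-1*i≡-i (⟪ F ⟫ x y)))

  E-+ˡ : ∀ x y z → ⟪ F ⟫ (λ i → x i + y i) z ≡ ⟪ F ⟫ x z + ⟪ F ⟫ y z
  E-+ˡ x y z = trans (E-congˡ (λ i → cong (λ v → x i + v) (sym (ℤP.*-identityˡ (y i)))))
    (trans (E-axpyˡ F 1ℤ x y z) (cong (λ v → ⟪ F ⟫ x z + v) (ℤP.*-identityˡ (⟪ F ⟫ y z))))

  E--ˡ : ∀ x y z → ⟪ F ⟫ (λ i → x i - y i) z ≡ ⟪ F ⟫ x z - ⟪ F ⟫ y z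
  E--ˡ x y z = trans (E-+ˡ x (λ i → - y i) z) (cong (λ v → ⟪ F ⟫ x z + v) (E-negˡ y z))

opaque
  unfolding ∑
  E-lincombˡ : ∀ {m n} (F : Form n) (t : Fin m → ℤ) (c : Fin m → Vect n) y →
    ⟪ F ⟫ (lincomb t c) y ≡ ∑ (λ r → t r * ⟪ F ⟫ (c r) y)
  E-lincombˡ {zero} F t c y = E-0ˡ F y (λ _ → refl)
  E-lincombˡ {suc m} F t c y = trans (E-+ˡ F (λ i → t zero * c zero i) (lincomb (t ∘ suc) (c ∘ suc)) y)
    (cong₂ _+_ (E-scaleˡ F (t zero) (c zero) y) (E-lincombˡ F (t ∘ suc) (c ∘ suc) y))

module _ {n} (F : Form n) where

  E-axpyʳ : ∀ a x y z → ⟪ F ⟫ x (axpy a y z) ≡ ⟪ F ⟫ x z + a * ⟪ F ⟫ x y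
  E-axpyʳ a x y z = trans (sym (E-T F (axpy a y z) x)) (trans (E-axpyˡ (F ᵀ) a z y x)
    (cong₂ (λ u v → u + a * v) (E-T F z x) (E-T F y x)))

  E-0ʳ : ∀ x {y} → (∀ i → y i ≡ 0ℤ) → ⟪ F ⟫ x y ≡ 0ℤ
  E-0ʳ x {y} z = trans (sym (E-T F y x)) (E-0ˡ (F ᵀ) x z)

  E-negʳ : ∀ x y → ⟪ F ⟫ x (λ i → - y i) ≡ - ⟪ F ⟫ x y
  E-negʳ x y = trans (sym (E-T F _ x)) (trans (E-negˡ (F ᵀ) y x) (cong -_ (E-T F y x)))

  E-scaleʳ : ∀ a x y → ⟪ F ⟫ x (λ i → a * y i) ≡ a * ⟪ F ⟫ x y
  E-scaleʳ a x y = trans (sym (E-T F _ x)) (trans (E-scaleˡ (F ᵀ) a y x) (cong (a *_) (E-T F y x)))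

  E-+ʳ : ∀ x y z → ⟪ F ⟫ x (λ i → y i + z i) ≡ ⟪ F ⟫ x y + ⟪ F ⟫ x z
  E-+ʳ x y z = trans (sym (E-T F _ x)) (trans (E-+ˡ (F ᵀ) y z x) (cong₂ _+_ (E-T F y x) (E-T F z x)))

  E--ʳ : ∀ x y z → ⟪ F ⟫ x (λ i → y i - z i) ≡ ⟪ F ⟫ x y - ⟪ F ⟫ x z
  E--ʳ x y z = trans (sym (E-T F _ x)) (trans (E--ˡ (F ᵀ) y z x) (cong₂ _-_ (E-T F y x) (E-T F z x)))

  E-lincombʳ : ∀ {m} x (t : Fin m → ℤ) (c : Fin m → Vect n) →
    ⟪ F ⟫ x (lincomb t c) ≡ ∑ (λ r → t r * ⟪ F ⟫ x (c r))
  E-lincombʳ x t c = trans (sym (E-T F _ x)) (trans (E-lincombˡ (F ᵀ) t c x) (sum-cong (λ r → cong (t r *_) (E-T F (c r) x))))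

  E-αˡ : ∀ l y → ⟪ F ⟫ (α l) y ≡ ∑ (λ j → F l j * y j)
  E-αˡ l y = trans (E-expandˡ F (α l) y) (sum-α (λ l → ∑ (λ j → F l j * y j)) l)

  E-sumˡ : ∀ x y → ⟪ F ⟫ x y ≡ ∑ (λ l → x l * ⟪ F ⟫ (α l) y)
  E-sumˡ x y = trans (E-expandˡ F x y) (sum-cong (λ l → cong (x l *_) (sym (E-αˡ l y))))

module _ {n} (F : Form n) where

  E-αʳ : ∀ x l → ⟪ F ⟫ x (α l) ≡ ∑ (λ i → F i l * x i)
  E-αʳ x l = trans (sym (E-T F (α l) x)) (E-αˡ (F ᵀ) l x)

  E-sumʳ : ∀ x y → ⟪ F ⟫ x y ≡ ∑ (λ l → y l * ⟪ F ⟫ x (α l))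
  E-sumʳ x y = trans (sym (E-T F y x)) (trans (E-sumˡ (F ᵀ) y x) (sum-cong (λ l → cong (y l *_) (E-T F (α l) x))))

  E-αα : ∀ i j → ⟪ F ⟫ (α i) (α j) ≡ F i j
  E-αα i j = trans (E-αˡ F i (α j)) (trans (sum-cong (λ l → ℤP.*-comm (F i l) (α j l))) (sum-α (λ l → F i l) j))

Nonneg Nonpos : ∀ {n} → Vect n → Set
Nonneg x = ∀ i → 0ℤ ≤ x i
Nonpos x = ∀ i → x i ≤ 0ℤ

Off : ∀ {n} → (Fin n → Set) → Vect n → Set
Off P x = ∀ i → P i → x i ≡ 0ℤ

-- Euler forms, their roots and the Coxeter transformation

-- Here `F i j` is E(α_i, α_j), that is `δ i` times E(α_i^∨, α_j). The fields `u` and `v` record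
-- that this entry is divisible by both `δ i` and `δ j`, and `h` is an ordering of the vertices for
-- which `F` is triangular. The axioms are symmetric under transposition, which makes `dual`
-- possible.
record EulerForm (n : ℕ) : Set where
  field
    F    : Form n
    δ    : Vect n
    δ>0  : ∀ i → 0ℤ < δ i
    diag : ∀ i → F i i ≡ δ i
    off  : ∀ i j → i ≢ j → F i j ≤ 0ℤ
    u v  : Form n
    F≡δu : ∀ i j → F i j ≡ δ i * u i j
    F≡δv : ∀ i j → F i j ≡ δ j * v i j
    h    : Fin n → ℤ
    tri  : ∀ i j → i ≢ j → h i ≤ h j → F i j ≡ 0ℤ
    posdef : ∀ x → (∃ λ i → x i ≢ 0ℤ) → 0ℤ < ⟪ F ⟫ x x
    -- dimension vectors of the indecomposable projectives and injectives
    P I  : Fin n → Vect n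
    P-spec : ∀ i x → ⟪ F ⟫ (P i) x ≡ δ i * x i
    I-spec : ∀ i x → ⟪ F ⟫ x (I i) ≡ δ i * x i

-- The Euler form of the opposite orientation: projectives and injectives change places and heights
-- are reversed. It serves to deduce red mutations from green ones.
dual : ∀ {n} → EulerForm n → EulerForm n
dual 𝓔 = record
  { F = F ᵀ ; δ = δ ; δ>0 = δ>0 ; diag = diag ; off = λ i j ne → off j i (≢-sym ne)
  ; u = v ᵀ ; v = u ᵀ ; F≡δu = λ i j → F≡δv j i ; F≡δv = λ i j → F≡δu j i
  ; h = λ i → - h i ; tri = λ i j ne p → tri j i (≢-sym ne) (ℤP.neg-cancel-≤ p)
  ; posdef = λ x nz → subst (0ℤ <_) (sym (E-T F x x)) (posdef x nz)
  ; P = I ; I = P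
  ; P-spec = λ i x → trans (E-T F (I i) x) (I-spec i x)
  ; I-spec = λ i x → trans (E-T F x (P i)) (P-spec i x) }
  where open EulerForm 𝓔

pp np : ∀ {n} → Vect n → Vect n
pp x i = x i ⊔ 0ℤ
np x i = (- x i) ⊔ 0ℤ

pp-nonneg : ∀ {n} (x : Vect n) → Nonneg (pp x)
pp-nonneg x i = ℤP.i≤j⊔i (x i) 0ℤ

np-nonneg : ∀ {n} (x : Vect n) → Nonneg (np x)
np-nonneg x i = ℤP.i≤j⊔i (- x i) 0ℤ

pp-np : ∀ {n} (x : Vect n) i → x i ≡ pp x i - np x i
pp-np x i with x i
... | + zero = refl
... | + suc m = sym (ℤP.+-identityʳ (+ suc m))
... | -[1+ m ] = refl

pp-np-disj : ∀ {n} (x : Vect n) i → pp x i ≡ 0ℤ ⊎ np x i ≡ 0ℤ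
pp-np-disj x i with x i
... | + zero = inj₁ refl
... | + suc m = inj₂ refl
... | -[1+ m ] = inj₁ refl

nonneg-nonpos-0 : ∀ {a} → 0ℤ ≤ a → a ≤ 0ℤ → a ≡ 0ℤ
nonneg-nonpos-0 p q = ℤP.≤-antisym q p

module Euler {n} (𝓔 : EulerForm n) where
  open EulerForm 𝓔

  E : Vect n → Vect n → ℤ
  E = ⟪ F ⟫

  -- Disjoint supports leave only off-diagonal entries of `F`, none of which is positive.
  E-disj : ∀ {x y} → Nonneg x → Nonneg y → (∀ i → x i ≡ 0ℤ ⊎ y i ≡ 0ℤ) → E x y ≤ 0ℤ
  E-disj {x} {y} p q dj = subst (_≤ 0ℤ) (sym E-unfold) (sum-≤0 (λ i → sum-≤0 (λ j → term i j)))
    where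
    term : ∀ i j → x i * F i j * y j ≤ 0ℤ
    term i j with i ≟ j
    ... | no ne = *≤0′ (*≤0 (p i) (off i j ne)) (q j)
    ... | yes refl with dj i
    ...   | inj₁ z = ℤP.≤-reflexive (trans (cong (λ a → a * F i i * y i) z) (cong (_* y i) (ℤP.*-zeroˡ (F i i))))
    ...   | inj₂ z = ℤP.≤-reflexive (trans (cong (x i * F i i *_) z) (ℤP.*-zeroʳ (x i * F i i)))

  zero-or-nonzero : (x : Vect n) → (∀ i → x i ≡ 0ℤ) ⊎ (∃ λ i → x i ≢ 0ℤ)
  zero-or-nonzero x with FinP.any? (λ i → ¬? (x i ℤ.≟ 0ℤ))
  ... | yes r = inj₂ r
  ... | no r = inj₁ (λ i → decidable-stable (x i ℤ.≟ 0ℤ) (λ ne → r (i , ne)))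

  E≥0 : ∀ x → 0ℤ ≤ E x x
  E≥0 x with zero-or-nonzero x
  ... | inj₁ z = ℤP.≤-reflexive (sym (E-0ˡ F x z))
  ... | inj₂ nz = ℤP.<⇒≤ (posdef x nz)

  E-def : ∀ x → E x x ≤ 0ℤ → ∀ i → x i ≡ 0ℤ
  E-def x p with zero-or-nonzero x
  ... | inj₁ z = z
  ... | inj₂ nz = ⊥-elim (<⇒⊥ (posdef x nz) p)

  nondegʳ : ∀ x → (∀ y → E y x ≡ 0ℤ) → ∀ i → x i ≡ 0ℤ
  nondegʳ x z = E-def x (ℤP.≤-reflexive (z x))

  -- A numerical substitute for real roots. Divisibility on each side separately is stronger than
  -- integrality of the reflection along x, which involves only the sum of both pairings; it holds
  -- for simple roots and survives `Φ` and mutation.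
  record IsRoot (d : ℤ) (x : Vect n) : Set where
    field
      norm : E x x ≡ d
      divˡ : ∀ y → d ∣ᶻ E x y
      divʳ : ∀ y → d ∣ᶻ E y x
  open IsRoot public

  root-neg : ∀ {d x} → IsRoot d x → IsRoot d (λ i → - x i)
  root-neg {d} {x} r = record
    { norm = trans (E-negˡ F x _) (trans (cong -_ (E-negʳ F x x)) (trans (ℤP.neg-involutive (E x x)) (norm r)))
    ; divˡ = λ y → ∣-resp (sym (E-negˡ F x y)) (∣-neg (divˡ r y))
    ; divʳ = λ y → ∣-resp (sym (E-negʳ F y x)) (∣-neg (divʳ r y)) }

  -- Both E x x⁺ and E x⁺ x are positive multiples of d when x⁺ ≠ 0; together with x⁻ ≠ 0
  -- this would force E x x > d.
  sign-coherent : ∀ {d x} → 0ℤ < d → E x x ≡ d → d ∣ᶻ E x (pp x) → d ∣ᶻ E (pp x) x → Nonneg x ⊎ Nonpos x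
  sign-coherent {d} {x} d>0 nm dl dr with zero-or-nonzero (pp x) | zero-or-nonzero (np x)
  ... | inj₁ z | _ = inj₂ (λ i → subst (_≤ 0ℤ) (sym (trans (pp-np x i) (trans (cong (_- np x i) (z i)) (ℤP.+-identityˡ (- np x i))))) (neg-≤0 (np-nonneg x i)))
  ... | inj₂ _ | inj₁ z = inj₁ (λ i → subst (0ℤ ≤_) (sym (trans (pp-np x i) (trans (cong (λ w → pp x i - w) (z i)) (ℤP.+-identityʳ (pp x i))))) (pp-nonneg x i))
  ... | inj₂ nzp | inj₂ nzn = ⊥-elim (impossible (E p p) (E q q) (E p q) (E q p) d d>0 (posdef p nzp) (posdef q nzn)
        (E-disj (pp-nonneg x) (np-nonneg x) (pp-np-disj x))
        (E-disj (np-nonneg x) (pp-nonneg x) (λ i → [ inj₂ , inj₁ ]′ (pp-np-disj x i)))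
        (trans (sym nm) xx) (∣-resp xp dl) (∣-resp px dr))
    where
    p = pp x
    q = np x
    xp : E x p ≡ E p p - E q p
    xp = trans (E-congˡ F (pp-np x)) (E--ˡ F p q p)
    px : E p x ≡ E p p - E p q
    px = trans (E-congʳ F (pp-np x)) (E--ʳ F p p q)
    xx : E x x ≡ (E p p - E p q) - (E q p - E q q)
    xx = trans (E-cong F (pp-np x) (pp-np x)) (trans (E--ˡ F p q _) (cong₂ _-_ (E--ʳ F p p q) (E--ʳ F q p q)))
    impossible : ∀ a b s t d → 0ℤ < d → 0ℤ < a → 0ℤ < b → s ≤ 0ℤ → t ≤ 0ℤ → d ≡ (a - s) - (t - b) →
      d ∣ᶻ (a - t) → d ∣ᶻ (a - s) → ⊥
    impossible a b s t d d>0 a>0 b>0 s≤0 t≤0 e d1 d2 = <⇒⊥ (0<+≤ (0<+≤ (0<+≤ b>0 (ℤP.<⇒≤ b>0)) (0≤-neg s≤0)) (0≤-neg t≤0))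
      (0≤neg⇒≤0 (subst (0ℤ ≤_) (lem a b s t d e) (0≤+ (0≤- (∣-pos d>0 d1 (0<+≤ a>0 (0≤-neg t≤0)))) (0≤- (∣-pos d>0 d2 (0<+≤ a>0 (0≤-neg s≤0)))))))
      where
      lem : ∀ a b s t d → d ≡ (a - s) - (t - b) → (a - t - d) + (a - s - d) ≡ - (b + b - s - t)
      lem a b s t _ refl = lem′ a b s t
        where
        lem′ : ∀ a b s t → (a - t - ((a - s) - (t - b))) + (a - s - ((a - s) - (t - b))) ≡ - (b + b - s - t)
        lem′ = solve-∀

  root-sign : ∀ {d x} → 0ℤ < d → IsRoot d x → Nonneg x ⊎ Nonpos x
  root-sign {d} {x} d>0 r = sign-coherent d>0 (norm r) (divˡ r (pp x)) (divʳ r (pp x))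

  root-not-both : ∀ {d x} → 0ℤ < d → IsRoot d x → Nonneg x → Nonpos x → ⊥
  root-not-both {d} {x} d>0 r p q = ℤP.<-irrefl (trans (sym (E-0ˡ F x (λ i → nonneg-nonpos-0 (p i) (q i)))) (norm r)) d>0

  -- Truncations at height `t`. As `F` vanishes from lower to strictly higher vertices, low parts
  -- are left orthogonal to high parts (`lo-hi`), as if one part were a subrepresentation.
  hi lo : ℤ → Vect n → Vect n
  hi t x i = if ⌊ t ℤ.<? h i ⌋ then x i else 0ℤ
  lo t x i = if ⌊ t ℤ.<? h i ⌋ then 0ℤ else x i

  hi+lo : ∀ t x i → x i ≡ hi t x i + lo t x i
  hi+lo t x i with t ℤ.<? h i
  ... | yes _ = sym (ℤP.+-identityʳ (x i))
  ... | no _ = sym (ℤP.+-identityˡ (x i))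

  hi-nonneg : ∀ t {x} → Nonneg x → Nonneg (hi t x)
  hi-nonneg t p i with t ℤ.<? h i
  ... | yes _ = p i
  ... | no _ = ℤP.≤-refl

  lo-nonneg : ∀ t {x} → Nonneg x → Nonneg (lo t x)
  lo-nonneg t p i with t ℤ.<? h i
  ... | yes _ = ℤP.≤-refl
  ... | no _ = p i

  hi-off : ∀ t {P x} → Off P x → Off P (hi t x)
  hi-off t o i pi with t ℤ.<? h i
  ... | yes _ = o i pi
  ... | no _ = refl

  lo-off : ∀ t {P x} → Off P x → Off P (lo t x)
  lo-off t o i pi with t ℤ.<? h i
  ... | yes _ = refl
  ... | no _ = o i pi

  hi-lo-disj : ∀ t x y i → hi t x i ≡ 0ℤ ⊎ lo t y i ≡ 0ℤ
  hi-lo-disj t x y i with t ℤ.<? h i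
  ... | yes _ = inj₂ refl
  ... | no _ = inj₁ refl

  lo-hi : ∀ t x y → E (lo t x) (hi t y) ≡ 0ℤ
  lo-hi t x y = trans E-unfold (sum-0 (λ i → sum-0 (term i)))
    where
    term : ∀ i j → lo t x i * F i j * hi t y j ≡ 0ℤ
    term i j with t ℤ.<? h i | t ℤ.<? h j
    ... | yes _ | _ = refl
    ... | no _ | no _ = ℤP.*-zeroʳ (x i * F i j)
    ... | no p | yes q = trans (cong (λ a → x i * a * y j) (tri i j (λ { refl → p q }) (ℤP.≤-trans (ℤP.≮⇒≥ p) (ℤP.<⇒≤ q))))
      (cong (_* y j) (ℤP.*-zeroʳ (x i)))

  hi-zero : ∀ t x → (∀ i → hi t x i ≡ 0ℤ) → ∀ l → t < h l → x l ≡ 0ℤ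
  hi-zero t x z l q with t ℤ.<? h l | z l
  ... | yes _ | e = e
  ... | no p | _ = ⊥-elim (p q)

  lo-zero : ∀ t x → (∀ i → lo t x i ≡ 0ℤ) → ∀ l → h l ≤ t → x l ≡ 0ℤ
  lo-zero t x z l q with t ℤ.<? h l | z l
  ... | yes p | _ = ⊥-elim (ℤP.<⇒≱ p q)
  ... | no _ | e = e

  -- If E β _ = E _ γ, as happens for γ = −Φβ, then β = P_i and γ = I_i on the support at hand.
  -- Splitting at any height gives E β β = E β₁ β₁ + E γ₂ γ₂ − E β₁ γ₂ with both squares
  -- multiples of d = E β β, so one of β₁, γ₂ vanishes.
  module Truncated {P : Fin n → Set} {d β γ} (d>0 : 0ℤ < d) (β≥0 : Nonneg β) (γ≥0 : Nonneg γ) (oβ : Off P β) (oγ : Off P γ)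
    (eq : ∀ x → Off P x → E β x ≡ E x γ) (nm : E β β ≡ d) (dv : ∀ x → Off P x → d ∣ᶻ E β x) where

    split : ∀ t → (∀ l → t < h l → β l ≡ 0ℤ) ⊎ (∀ l → h l ≤ t → γ l ≡ 0ℤ)
    split t with zero-or-nonzero (hi t β) | zero-or-nonzero (lo t γ)
    ... | inj₁ z | _ = inj₁ (hi-zero t β z)
    ... | inj₂ _ | inj₁ z = inj₂ (lo-zero t γ z)
    ... | inj₂ nz₁ | inj₂ nz₂ = ⊥-elim (impossible (E β₁ β₁) (E γ₂ γ₂) (E β₁ γ₂) (E β₂ γ₂) (posdef β₁ nz₁) (posdef γ₂ nz₂)
        (E-disj (hi-nonneg t β≥0) (lo-nonneg t γ≥0) (hi-lo-disj t β γ))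
        (∣-resp e1 (dv β₁ o1)) (∣-resp e2 (dv γ₂ o2)) e3
        (trans (sym nm) (trans (E-congʳ F (hi+lo t β)) (trans (E-+ʳ F β β₁ β₂) (cong₂ _+_ e1 e4)))))
      where
      β₁ = hi t β
      β₂ = lo t β
      γ₁ = hi t γ
      γ₂ = lo t γ
      o1 = hi-off t oβ
      o2 = lo-off t oγ
      e1 : E β β₁ ≡ E β₁ β₁
      e1 = trans (E-congˡ F (hi+lo t β)) (trans (E-+ˡ F β₁ β₂ β₁) (trans (cong (λ w → E β₁ β₁ + w) (lo-hi t β β)) (ℤP.+-identityʳ (E β₁ β₁))))
      e2 : E β γ₂ ≡ E γ₂ γ₂
      e2 = trans (eq γ₂ o2) (trans (E-congʳ F (hi+lo t γ)) (trans (E-+ʳ F γ₂ γ₁ γ₂) (trans (cong (_+ E γ₂ γ₂) (lo-hi t γ γ)) (ℤP.+-identityˡ (E γ₂ γ₂)))))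
      e3 : E γ₂ γ₂ ≡ E β₁ γ₂ + E β₂ γ₂
      e3 = trans (sym e2) (trans (E-congˡ F (hi+lo t β)) (E-+ˡ F β₁ β₂ γ₂))
      e4 : E β β₂ ≡ E β₂ γ₂
      e4 = trans (eq β₂ (lo-off t oβ)) (trans (E-congʳ F (hi+lo t γ)) (trans (E-+ʳ F β₂ γ₁ γ₂) (trans (cong (_+ E β₂ γ₂) (lo-hi t β γ)) (ℤP.+-identityˡ (E β₂ γ₂)))))
      impossible : ∀ a c s r → 0ℤ < a → 0ℤ < c → s ≤ 0ℤ → d ∣ᶻ a → d ∣ᶻ c → c ≡ s + r → d ≡ a + r → ⊥
      impossible a c s r a>0 c>0 s≤0 da dc refl ed = <⇒⊥ d>0 (0≤neg⇒≤0 (subst (0ℤ ≤_) (lem d a s r ed)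
        (0≤+ (0≤+ (0≤- (∣-pos d>0 da a>0)) (0≤- (∣-pos d>0 dc c>0))) (0≤-neg s≤0))))
        where
        lem : ∀ d a s r → d ≡ a + r → (a - d) + (s + r - d) + - s ≡ - d
        lem _ a s r refl = lem′ a s r
          where
          lem′ : ∀ a s r → (a - (a + r)) + (s + r - (a + r)) + - s ≡ - (a + r)
          lem′ = solve-∀

    α-off-P : ∀ {l} → ¬ P l → Off P (α l)
    α-off-P {l} np i pi = α-off (λ { refl → np pi })

    -- Split at the height of `l` itself. If β vanishes above it, column `l` of `F` meets β only on
    -- the diagonal. Otherwise γ vanishes at all heights up to `h l`, and these are the only places
    -- where row `l` of `F` is nonzero.
    value : ∀ l → ¬ P l → (E β (α l) ≡ δ l * β l) ⊎ (E β (α l) ≡ 0ℤ × γ l ≡ 0ℤ)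
    value l np with split (h l)
    ... | inj₁ z = inj₁ (trans (E-αʳ F β l) (trans (sum-single (λ i → F i l * β i) l term) (cong (_* β l) (diag l))))
      where
      term : ∀ j → j ≢ l → F j l * β j ≡ 0ℤ
      term j ne with h l ℤ.<? h j
      ... | yes p = trans (cong (F j l *_) (z j p)) (ℤP.*-zeroʳ (F j l))
      ... | no p = cong (_* β j) (tri j l ne (ℤP.≮⇒≥ p))
    ... | inj₂ z = inj₂ (trans (eq (α l) (α-off-P np)) (trans (E-αˡ F l γ) (sum-0 term)) , z l ℤP.≤-refl)
      where
      term : ∀ j → F l j * γ j ≡ 0ℤ
      term j with h j ℤ.≤? h l
      ... | yes p = trans (cong (F l j *_) (z j p)) (ℤP.*-zeroʳ (F l j))
      ... | no p = cong (_* γ j) (tri l j (λ { refl → p ℤP.≤-refl }) (ℤP.<⇒≤ (ℤP.≰⇒> p)))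

    value≥0 : ∀ l → ¬ P l → 0ℤ ≤ E β (α l)
    value≥0 l np with value l np
    ... | inj₁ e = subst (0ℤ ≤_) (sym e) (0≤* (ℤP.<⇒≤ (δ>0 l)) (β≥0 l))
    ... | inj₂ (e , _) = ℤP.≤-reflexive (sym e)

    E≥0-off : (∀ l → Dec (P l)) → ∀ y → Nonneg y → Off P y → 0ℤ ≤ E β y
    E≥0-off P? y y≥0 oy = subst (0ℤ ≤_) (sym (E-sumʳ F β y)) (sum-≥0 term)
      where
      term : ∀ l → 0ℤ ≤ y l * E β (α l)
      term l with P? l
      ... | no np = 0≤* (y≥0 l) (value≥0 l np)
      ... | yes p = ℤP.≤-reflexive (sym (cong (_* E β (α l)) (oy l p)))

  -- The Coxeter transformation

  κ : Vect n → Vect n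
  κ x i = ∑ (λ j → v j i * x j)

  κ-spec : ∀ x i → E x (α i) ≡ δ i * κ x i
  κ-spec x i = trans (E-αʳ F x i) (trans (sum-cong (λ j → trans (cong (_* x j) (F≡δv j i)) (ℤP.*-assoc (δ i) (v j i) (x j)))) (sum-* (δ i) (λ j → v j i * x j)))

  opaque
   -- It sends `P i` to -`I i`; on dimension vectors of indecomposables that are not projective it
   -- is Auslander-Reiten translation, and `Φ-spec` is the Auslander-Reiten formula.
   Φ : Vect n → Vect n
   Φ x = lincomb (λ i → - κ x i) I

   Φ-spec : ∀ y x → E y (Φ x) ≡ - E x y
   Φ-spec y x = begin
     E y (Φ x)                              ≡⟨ E-lincombʳ F y (λ i → - κ x i) I ⟩
     ∑ (λ i → - κ x i * E y (I i))          ≡⟨ sum-cong (λ i → trans (cong (- κ x i *_) (I-spec i y)) (lem (κ x i) (δ i) (y i))) ⟩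
     ∑ (λ i → - (y i * (δ i * κ x i)))      ≡⟨ sum-neg (λ i → y i * (δ i * κ x i)) ⟩
     - ∑ (λ i → y i * (δ i * κ x i))        ≡⟨ cong -_ (sum-cong (λ i → cong (y i *_) (sym (κ-spec x i)))) ⟩
     - ∑ (λ i → y i * E x (α i))            ≡⟨ cong -_ (sym (E-sumʳ F x y)) ⟩
     - E x y ∎
     where
     open ≡-Reasoning
     lem : ∀ k d y → - k * (d * y) ≡ - (y * (d * k))
     lem = solve-∀

  Φ-iso : ∀ x y → E (Φ x) (Φ y) ≡ E x y
  Φ-iso x y = trans (Φ-spec (Φ x) y) (trans (cong -_ (Φ-spec y x)) (ℤP.neg-involutive (E x y)))

  Φ-axpy : ∀ {a x y z} → (∀ i → x i ≡ axpy a y z i) → ∀ i → Φ x i ≡ axpy a (Φ y) (Φ z) i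
  Φ-axpy {a} {x} {y} {z} e i = -‿0 (nondegʳ (λ i → Φ x i - axpy a (Φ y) (Φ z) i) orth i)
    where
    lem : ∀ p q a → (- (p + a * q)) - (- p + a * - q) ≡ 0ℤ
    lem = solve-∀
    orth : ∀ w → E w (λ i → Φ x i - axpy a (Φ y) (Φ z) i) ≡ 0ℤ
    orth w = begin
      E w (λ i → Φ x i - axpy a (Φ y) (Φ z) i)       ≡⟨ E--ʳ F w (Φ x) _ ⟩
      E w (Φ x) - E w (axpy a (Φ y) (Φ z))           ≡⟨ cong₂ _-_ (trans (Φ-spec w x) (cong -_ (trans (E-congˡ F e) (E-axpyˡ F a z y w)))) (E-axpyʳ F a w (Φ y) (Φ z)) ⟩
      (- (E z w + a * E y w)) - (E w (Φ z) + a * E w (Φ y)) ≡⟨ cong₂ (λ p q → (- (E z w + a * E y w)) - (p + a * q)) (Φ-spec w z) (Φ-spec w y) ⟩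
      (- (E z w + a * E y w)) - (- E z w + a * - E y w)     ≡⟨ lem (E z w) (E y w) a ⟩
      0ℤ ∎
      where open ≡-Reasoning

  opaque
   -- The inverse of `Φ`, sending `I i` to -`P i`. It converts left pairings into right pairings, so
   -- that one-sided divisibility suffices for a root, and it yields the vector `f` of a `Cone` from
   -- `e k`.
   Ψ : Vect n → Vect n
   Ψ y = lincomb (λ i → - ∑ (λ j → u i j * y j)) P

   Ψ-spec : ∀ y x → E (Ψ y) x ≡ - E x y
   Ψ-spec y x = begin
     E (Ψ y) x                                  ≡⟨ E-lincombˡ F (λ i → - k i) P x ⟩
     ∑ (λ i → - k i * E (P i) x)                ≡⟨ sum-cong (λ i → trans (cong (- k i *_) (P-spec i x)) (lem (k i) (δ i) (x i))) ⟩
     ∑ (λ i → - (x i * (δ i * k i)))            ≡⟨ sum-neg (λ i → x i * (δ i * k i)) ⟩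
     - ∑ (λ i → x i * (δ i * k i))              ≡⟨ cong -_ (sum-cong (λ i → cong (x i *_) (sym (k-spec i)))) ⟩
     - ∑ (λ i → x i * E (α i) y)                ≡⟨ cong -_ (sym (E-sumˡ F x y)) ⟩
     - E x y ∎
     where
     open ≡-Reasoning
     k : Vect n
     k i = ∑ (λ j → u i j * y j)
     k-spec : ∀ i → E (α i) y ≡ δ i * k i
     k-spec i = trans (E-αˡ F i y) (trans (sum-cong (λ j → trans (cong (_* y j) (F≡δu i j)) (ℤP.*-assoc (δ i) (u i j) (y j)))) (sum-* (δ i) (λ j → u i j * y j)))
     lem : ∀ k d y → - k * (d * y) ≡ - (y * (d * k))
     lem = solve-∀

  divˡ-from-divʳ : ∀ {d x} → (∀ y → d ∣ᶻ E y x) → ∀ y → d ∣ᶻ E x y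
  divˡ-from-divʳ {d} {x} dv y = ∣-resp (trans (cong -_ (Ψ-spec y x)) (ℤP.neg-involutive (E x y))) (∣-neg (dv (Ψ y)))

  Φ-root : ∀ {d x} → IsRoot d x → IsRoot d (Φ x)
  Φ-root {d} {x} r = record
    { norm = trans (Φ-iso x x) (norm r)
    ; divˡ = divˡ-from-divʳ dv
    ; divʳ = dv }
    where
    dv : ∀ y → d ∣ᶻ E y (Φ x)
    dv y = ∣-resp (sym (Φ-spec y x)) (∣-neg (divˡ r y))

  -- The second alternative says that x is projective.
  Φ-positive : ∀ {d x} → 0ℤ < d → IsRoot d x → Nonneg x →
    Nonneg (Φ x) ⊎ (Nonpos (Φ x) × (∀ y → Nonneg y → 0ℤ ≤ E x y))
  Φ-positive {d} {x} d>0 r x≥0 = [ inj₁ , (λ q → inj₂ (q , proj q)) ]′ (root-sign d>0 (Φ-root r))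
    where
    eq : ∀ y → E x y ≡ E y (λ i → - Φ x i)
    eq y = sym (trans (E-negʳ F y (Φ x)) (trans (cong -_ (Φ-spec y x)) (ℤP.neg-involutive (E x y))))
    proj : Nonpos (Φ x) → ∀ y → Nonneg y → 0ℤ ≤ E x y
    proj q y y≥0 = Truncated.E≥0-off {P = λ _ → ⊥} {γ = λ i → - Φ x i} d>0 x≥0 (λ i → 0≤-neg (q i)) (λ _ ()) (λ _ ())
      (λ y _ → eq y) (norm r) (λ y _ → divˡ r y) (λ _ → no (λ ())) y y≥0 (λ _ ())

  Φ-neg : ∀ x i → Φ (λ i → - x i) i ≡ - Φ x i
  Φ-neg x i = begin
    Φ (λ i → - x i) i        ≡⟨ Φ-axpy {a = - 1ℤ} {y = x} {z = 0v} (λ i → trans (sym (ℤP.-1*i≡-i (x i))) (sym (ℤP.+-identityˡ (- 1ℤ * x i)))) i ⟩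
    Φ 0v i + - 1ℤ * Φ x i    ≡⟨ cong (_+ - 1ℤ * Φ x i) (nondegʳ (Φ 0v) (λ y → trans (Φ-spec y 0v) (cong -_ (E-0ˡ F y (λ _ → refl)))) i) ⟩
    0ℤ + - 1ℤ * Φ x i        ≡⟨ ℤP.+-identityˡ (- 1ℤ * Φ x i) ⟩
    - 1ℤ * Φ x i             ≡⟨ ℤP.-1*i≡-i (Φ x i) ⟩
    - Φ x i ∎
    where open ≡-Reasoning

-- Orbits of roots under the Coxeter transformation

module Orbits {n} (𝓔 : EulerForm n) where
  open EulerForm 𝓔
  open Euler 𝓔

  Φ^ : ℕ → Vect n → Vect n
  Φ^ zero x = x
  Φ^ (suc t) x = Φ (Φ^ t x)

  Φ^-root : ∀ {d x} t → IsRoot d x → IsRoot d (Φ^ t x)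
  Φ^-root zero r = r
  Φ^-root (suc t) r = Φ-root (Φ^-root t r)

  Φ^-+ : ∀ s k x → Φ^ (s ℕ.+ k) x ≡ Φ^ s (Φ^ k x)
  Φ^-+ zero k x = refl
  Φ^-+ (suc s) k x = cong Φ (Φ^-+ s k x)

  orbitSum : ℕ → Vect n → Vect n
  orbitSum zero z = 0v
  orbitSum (suc k) z i = orbitSum k z i + Φ^ k z i

  -- By `Φ-spec`, the symmetrized pairing of y with w equals E y w - E y (Φ w), so the sum over the
  -- orbit telescopes.
  orbitSum-E : ∀ k z y → E (orbitSum k z) y + E y (orbitSum k z) ≡ E y z - E y (Φ^ k z)
  orbitSum-E zero z y = trans (cong₂ _+_ (E-0ˡ F y (λ _ → refl)) (E-0ʳ F y (λ _ → refl))) (sym (ℤP.+-inverseʳ (E y z)))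
  orbitSum-E (suc k) z y = begin
    E (orbitSum (suc k) z) y + E y (orbitSum (suc k) z)  ≡⟨ cong₂ _+_ (E-+ˡ F s w y) (E-+ʳ F y s w) ⟩
    (E s y + E w y) + (E y s + E y w)                    ≡⟨ lem1 (E s y) (E w y) (E y s) (E y w) ⟩
    (E s y + E y s) + (E w y + E y w)                    ≡⟨ cong (_+ (E w y + E y w)) (orbitSum-E k z y) ⟩
    (E y z - E y w) + (E w y + E y w)                    ≡⟨ lem2 (E y z) (E y w) (E w y) ⟩
    E y z - - E w y                                      ≡⟨ cong (λ q → E y z - q) (sym (Φ-spec y w)) ⟩
    E y z - E y (Φ w) ∎
    where
    open ≡-Reasoning
    s = orbitSum k z
    w = Φ^ k z
    lem1 : ∀ a b c d → (a + b) + (c + d) ≡ (a + c) + (b + d)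
    lem1 = solve-∀
    lem2 : ∀ a b c → (a - b) + (c + b) ≡ a - - c
    lem2 = solve-∀

  orbitSum≥ : ∀ k {z} → (∀ t → Nonneg (Φ^ t z)) → ∀ i → z i ≤ orbitSum (suc k) z i
  orbitSum≥ zero {z} p i = ℤP.≤-reflexive (sym (ℤP.+-identityˡ (z i)))
  orbitSum≥ (suc k) {z} p i = ℤP.≤-trans (orbitSum≥ k p i) (≤by (Φ^ (suc k) z i) (p (suc k) i) (lem (orbitSum (suc k) z i) (Φ^ (suc k) z i)))
    where
    lem : ∀ a b → a + b - a ≡ b
    lem = solve-∀

  -- Over a full period the telescoping sum is zero. The orbit sum then has norm 0 and vanishes,
  -- although it dominates the positive root z.
  no-period : ∀ {d z} k → 0ℤ < d → IsRoot d z → (∀ t → Nonneg (Φ^ t z)) → (∀ i → Φ^ (suc k) z i ≡ z i) → ⊥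
  no-period {d} {z} k d>0 r p e = root-not-both d>0 r (p 0) (λ i → ℤP.≤-trans (orbitSum≥ k p i) (ℤP.≤-reflexive (E-def S S0 i)))
    where
    S = orbitSum (suc k) z
    SS : E S S + E S S ≡ 0ℤ
    SS = trans (orbitSum-E (suc k) z S) (trans (cong (λ w → E S z - w) (E-congʳ F e)) (ℤP.+-inverseʳ (E S z)))
    S0 : E S S ≤ 0ℤ
    S0 = 0≤neg⇒≤0 (≤by (E S S) (E≥0 S) (trans (lem (E S S)) (trans (cong (λ w → E S S - w) SS) (ℤP.+-identityʳ (E S S)))))
      where
      lem : ∀ a → - a - 0ℤ ≡ a - (a + a)
      lem = solve-∀

  -- Roots of equal norm d that agree modulo M with M² > 4d coincide.
  congruent-roots : ∀ {d x y} M → 0ℤ < M → + 4 * d < M * M → IsRoot d x → IsRoot d y → (w : Vect n) →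
    (∀ i → x i - y i ≡ M * w i) → ∀ i → x i ≡ y i
  congruent-roots {d} {x} {y} M M>0 big rx ry w e with zero-or-nonzero w
  ... | inj₁ z = λ i → -‿0 (trans (e i) (trans (cong (M *_) (z i)) (ℤP.*-zeroʳ M)))
  ... | inj₂ nz = ⊥-elim (<⇒⊥ (0<+≤ (0<- big) (0≤+ (0≤* (0≤* (ℤP.<⇒≤ M>0) (ℤP.<⇒≤ M>0)) (0≤- (0<⇒1≤ (posdef w nz)))) (E≥0 (λ i → x i + y i)))) (ℤP.≤-reflexive total))
    where
    lem : ∀ a b c d m w → (a - b) - (c - d) ≡ m * (m * w) → (a + b) + (c + d) ≡ a + d + (a + d) - m * (m * w)
    lem a b c d m w eq = trans (l1 a b c d) (cong (λ q → a + d + (a + d) - q) eq)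
      where
      l1 : ∀ a b c d → (a + b) + (c + d) ≡ a + d + (a + d) - ((a - b) - (c - d))
      l1 = solve-∀
    diff : (E x x - E x y) - (E y x - E y y) ≡ M * (M * E w w)
    diff = begin
      (E x x - E x y) - (E y x - E y y) ≡⟨ cong₂ _-_ (sym (E--ʳ F x x y)) (sym (E--ʳ F y x y)) ⟩
      E x (λ i → x i - y i) - E y (λ i → x i - y i) ≡⟨ sym (E--ˡ F x y (λ i → x i - y i)) ⟩
      E (λ i → x i - y i) (λ i → x i - y i) ≡⟨ E-cong F e e ⟩
      E (λ i → M * w i) (λ i → M * w i)     ≡⟨ E-scaleˡ F M w (λ i → M * w i) ⟩
      M * E w (λ i → M * w i)               ≡⟨ cong (M *_) (E-scaleʳ F M w w) ⟩
      M * (M * E w w) ∎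
      where open ≡-Reasoning
    total : (M * M - + 4 * d) + (M * M * (E w w - 1ℤ) + E (λ i → x i + y i) (λ i → x i + y i)) ≡ 0ℤ
    total = begin
      (M * M - + 4 * d) + (M * M * (E w w - 1ℤ) + E (λ i → x i + y i) (λ i → x i + y i))
        ≡⟨ cong (λ q → (M * M - + 4 * d) + (M * M * (E w w - 1ℤ) + q)) sumE ⟩
      (M * M - + 4 * d) + (M * M * (E w w - 1ℤ) + (d + d + (d + d) - M * (M * E w w)))
        ≡⟨ l2 M d (E w w) ⟩
      0ℤ ∎
      where
      open ≡-Reasoning
      l2 : ∀ m d w → (m * m - + 4 * d) + (m * m * (w - 1ℤ) + (d + d + (d + d) - m * (m * w))) ≡ 0ℤ
      l2 = solve-∀
      sumE : E (λ i → x i + y i) (λ i → x i + y i) ≡ d + d + (d + d) - M * (M * E w w)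
      sumE = trans (E-+ˡ F x y (λ i → x i + y i)) (trans (cong₂ _+_ (E-+ʳ F x x y) (E-+ʳ F y x y))
        (trans (lem (E x x) (E x y) (E y x) (E y y) M (E w w) diff) (cong₂ (λ a b → a + b + (a + b) - M * (M * E w w)) (norm rx) (norm ry))))

  -- Among the first M^n + 1 members of the orbit two have the same residues modulo M. By
  -- `congruent-roots` they coincide, and the orbit is periodic from there on, against `no-period`.
  no-positive-orbit : ∀ {d x} → 0ℤ < d → IsRoot d x → (∀ t → Nonneg (Φ^ t x)) → ⊥
  no-positive-orbit {+ suc m} {x} d>0 r p = clash (FinP.pigeonhole ℕP.≤-refl code)
    where
    d = + suc m
    -- `congruent-roots` asks for M² > 4d; with M = 5d one has 4d < M ≤ M².
    M = 5 ℕ.* suc m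
    residue : ℕ → Fin n → Fin M
    residue t i = Fin.fromℕ< (ℕDM.m%n<n ∣ Φ^ t x i ∣ M)
    code : Fin (suc (M ℕ.^ n)) → Fin (M ℕ.^ n)
    code t = Fin.funToFin (residue (Fin.toℕ t))
    big : + 4 * d < + M * + M
    big = subst₂ _<_ (ℤP.pos-* 4 (suc m)) (ℤP.pos-* M M) (+<+ (ℕP.<-≤-trans
      (ℕP.*-monoˡ-< (suc m) {4} {5} ℕP.≤-refl) (ℕP.m≤m*n M M)))
    clash : (∃ λ i → ∃ λ j → i Fin.< j × code i ≡ code j) → ⊥
    clash (i , j , i<j , e) = no-period k d>0 (Φ^-root s r) (λ t → subst Nonneg (Φ^-+ t s x) (p (t ℕ.+ s)))
      (λ l → trans (cong (λ z → z l) (trans (sym (Φ^-+ (suc k) s x)) (cong (λ q → Φ^ q x) sk))) (sym (congruent-roots (+ M) (+<+ (ℕ.s≤s ℕ.z≤n)) big (Φ^-root s r) (Φ^-root t r) (λ l → proj₁ (cong-mod l)) (λ l → proj₂ (cong-mod l)) l)))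
      where
      s = Fin.toℕ i
      t = Fin.toℕ j
      k = t ℕ.∸ suc s
      sk : suc k ℕ.+ s ≡ t
      sk = trans (sym (ℕP.+-suc k s)) (ℕP.m∸n+n≡m i<j)
      res : ∀ l → residue s l ≡ residue t l
      res l = trans (sym (FinP.finToFun-funToFin (residue s) l)) (trans (cong (λ c → Fin.finToFun c l) e) (FinP.finToFun-funToFin (residue t) l))
      cong-mod : ∀ l → ∃ λ w → Φ^ s x l - Φ^ t x l ≡ + M * w
      cong-mod l = + (a ℕ./ M) - + (b ℕ./ M) , (begin
        Φ^ s x l - Φ^ t x l    ≡⟨ cong₂ _-_ (sym (ℤP.0≤i⇒+∣i∣≡i (p s l))) (sym (ℤP.0≤i⇒+∣i∣≡i (p t l))) ⟩
        + a - + b              ≡⟨ cong₂ _-_ (ex a) (ex b) ⟩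
        (+ (a ℕ.% M) + + (a ℕ./ M) * + M) - (+ (b ℕ.% M) + + (b ℕ./ M) * + M)
          ≡⟨ cong (λ q → (+ (a ℕ.% M) + + (a ℕ./ M) * + M) - (+ q + + (b ℕ./ M) * + M)) (sym rem) ⟩
        (+ (a ℕ.% M) + + (a ℕ./ M) * + M) - (+ (a ℕ.% M) + + (b ℕ./ M) * + M) ≡⟨ lem (+ (a ℕ.% M)) (+ (a ℕ./ M)) (+ (b ℕ./ M)) (+ M) ⟩
        + M * (+ (a ℕ./ M) - + (b ℕ./ M)) ∎)
        where
        open ≡-Reasoning
        a = ∣ Φ^ s x l ∣
        b = ∣ Φ^ t x l ∣
        ex : ∀ c → + c ≡ + (c ℕ.% M) + + (c ℕ./ M) * + M
        ex c = trans (cong +_ (ℕDM.m≡m%n+[m/n]*n c M)) (trans (ℤP.pos-+ (c ℕ.% M) _) (cong (λ q → + (c ℕ.% M) + q) (ℤP.pos-* (c ℕ./ M) M)))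
        rem : a ℕ.% M ≡ b ℕ.% M
        rem = trans (sym (FinP.toℕ-fromℕ< (ℕDM.m%n<n a M))) (trans (cong Fin.toℕ (res l)) (FinP.toℕ-fromℕ< (ℕDM.m%n<n b M)))
        lem : ∀ r p q m → (r + p * m) - (r + q * m) ≡ m * (p - q)
        lem = solve-∀
  no-positive-orbit {+ zero} (+<+ ())

  record PosRoot (x : Vect n) : Set where
    field
      {size} : ℤ
      size>0 : 0ℤ < size
      isRoot : IsRoot size x
      nonneg : Nonneg x
  open PosRoot

  square>0 : ∀ {x} → PosRoot x → 0ℤ < E x x
  square>0 r = subst (0ℤ <_) (sym (norm (isRoot r))) (size>0 r)

  not-nonpos : ∀ {x} → PosRoot x → Nonpos x → ⊥
  not-nonpos r = root-not-both (size>0 r) (isRoot r) (nonneg r)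

  Φ-dichotomy : ∀ {x} → PosRoot x → PosRoot (Φ x) ⊎ (Nonpos (Φ x) × (∀ y → Nonneg y → 0ℤ ≤ E x y))
  Φ-dichotomy r = [ (λ p → inj₁ (record { size>0 = size>0 r ; isRoot = Φ-root (isRoot r) ; nonneg = p })) , inj₂ ]′
    (Φ-positive (size>0 r) (isRoot r) (nonneg r))

  -- Numerical version of: if f is a quotient of gᵐ with kernel k and Hom(g,h) = 0, then Hom(f,h) = 0.
  -- A counterexample contains no projective, so it stays one under Φ; but no root has a positive Φ-orbit.
  record Quotient (m : ℤ) (f g k h : Vect n) : Set where
    field
      m≥0 : 0ℤ ≤ m
      rf  : PosRoot f
      rg  : PosRoot g
      rk  : PosRoot k
      rh  : PosRoot h
      k≡  : ∀ i → - k i ≡ axpy (- m) g f i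
      fg  : E f g ≡ 0ℤ
      gh  : E g h ≤ 0ℤ
      fh  : 0ℤ < E f h

  module _ {m f g k h} (q : Quotient m f g k h) where
    open Quotient q

    private
      k-E : ∀ y → - E k y ≡ E f y + - m * E g y
      k-E y = trans (sym (E-negˡ F k y)) (trans (E-congˡ F k≡) (E-axpyˡ F (- m) f g y))

    -- Each vector fails to be projective for its own reason. E f k = -E f f and E k h = m·E g h - E
    -- f h are negative, which excludes f and k; E h (Φ f) = -E f h is negative, which excludes h;
    -- and Φ g ≤ 0 would make Φ f = m·Φ g - Φ k nonpositive.
    quotient-Φ : Quotient m (Φ f) (Φ g) (Φ k) (Φ h)
    quotient-Φ = [ (λ rΦf → [ (λ rΦk → [ (λ rΦg → [ (λ rΦh → go rΦf rΦk rΦg rΦh)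
      , (λ (_ , ph) → ⊥-elim (h-proj rΦf ph)) ]′ (Φ-dichotomy rh))
      , (λ (Φg≤0 , _) → ⊥-elim (g-proj rΦf rΦk Φg≤0)) ]′ (Φ-dichotomy rg))
      , (λ (_ , pk) → ⊥-elim (k-proj pk)) ]′ (Φ-dichotomy rk))
      , (λ (_ , pf) → ⊥-elim (f-proj pf)) ]′ (Φ-dichotomy rf)
      where
      Φk≡ : ∀ i → - Φ k i ≡ axpy (- m) (Φ g) (Φ f) i
      Φk≡ i = trans (sym (Φ-neg k i)) (Φ-axpy {a = - m} {y = g} {z = f} k≡ i)
      f-proj : (∀ y → Nonneg y → 0ℤ ≤ E f y) → ⊥
      f-proj pf = <⇒⊥ (square>0 rf) (subst (_≤ 0ℤ) ff (neg-≤0 (pf k (nonneg rk))))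
        where
        ff : - E f k ≡ E f f
        ff = trans (sym (E-negʳ F f k)) (trans (E-congʳ F k≡) (trans (E-axpyʳ F (- m) f g f) (trans (cong (λ z → E f f + - m * z) fg) (lem (E f f) m))))
          where
          lem : ∀ a m → a + - m * 0ℤ ≡ a
          lem = solve-∀
      k-proj : (∀ y → Nonneg y → 0ℤ ≤ E k y) → ⊥
      k-proj pk = <⇒⊥ (0<+≤ fh (0≤+ (pk h (nonneg rh)) (0≤* m≥0 (0≤-neg gh)))) (ℤP.≤-reflexive (trans (cong (λ z → E f h + (z + m * - E g h)) (trans (sym (ℤP.neg-involutive (E k h))) (cong -_ (k-E h)))) (lem (E f h) (E g h) m)))
        where
        lem : ∀ a b m → a + (- (a + - m * b) + m * - b) ≡ 0ℤ
        lem = solve-∀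
      g-proj : PosRoot (Φ f) → PosRoot (Φ k) → Nonpos (Φ g) → ⊥
      g-proj rΦf rΦk Φg≤0 = not-nonpos rΦf (λ i → subst (_≤ 0ℤ) (eq i) (ℤP.+-mono-≤ (*≤0 m≥0 (Φg≤0 i)) (neg-≤0 (nonneg rΦk i))))
        where
        lem : ∀ m g f → m * g + (f + - m * g) ≡ f
        lem = solve-∀
        eq : ∀ i → m * Φ g i + - Φ k i ≡ Φ f i
        eq i = trans (cong (λ z → m * Φ g i + z) (Φk≡ i)) (lem m (Φ g i) (Φ f i))
      h-proj : PosRoot (Φ f) → (∀ y → Nonneg y → 0ℤ ≤ E h y) → ⊥
      h-proj rΦf ph = <⇒⊥ fh (subst (_≤ 0ℤ) (trans (cong -_ (Φ-spec h f)) (ℤP.neg-involutive (E f h))) (neg-≤0 (ph (Φ f) (nonneg rΦf))))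
      go : PosRoot (Φ f) → PosRoot (Φ k) → PosRoot (Φ g) → PosRoot (Φ h) → Quotient m (Φ f) (Φ g) (Φ k) (Φ h)
      go rΦf rΦk rΦg rΦh = record
        { m≥0 = m≥0 ; rf = rΦf ; rg = rΦg ; rk = rΦk ; rh = rΦh ; k≡ = Φk≡
        ; fg = trans (Φ-iso f g) fg ; gh = subst (_≤ 0ℤ) (sym (Φ-iso g h)) gh
        ; fh = subst (0ℤ <_) (sym (Φ-iso f h)) fh }

  no-quotient : ∀ {m f g k h} → Quotient m f g k h → ⊥
  no-quotient {m} {f} {g} {k} {h} q = no-positive-orbit (size>0 (Quotient.rh q)) (isRoot (Quotient.rh q)) (λ t → nonneg (Quotient.rh (orbit t)))
    where
    orbit : ∀ t → Quotient m (Φ^ t f) (Φ^ t g) (Φ^ t k) (Φ^ t h)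
    orbit zero = q
    orbit (suc t) = quotient-Φ (orbit t)

  -- Numerical version of: if s is a subobject of b with cokernel gᵐ and Hom(h,b) = 0, then Hom(h,s) = 0.
  record Subobject (m : ℤ) (s b g h : Vect n) : Set where
    field
      m>0 : 0ℤ < m
      rs  : PosRoot s
      rb  : PosRoot b
      rg  : PosRoot g
      rh  : PosRoot h
      b≡  : ∀ i → b i ≡ axpy m g s i
      gb  : E g b ≡ 0ℤ
      hb  : E h b ≤ 0ℤ
      hs  : 0ℤ < E h s

  module _ {m s b g h} (q : Subobject m s b g h) where
    open Subobject q

    -- If h were projective, E h b = E h s + m·E h g would be positive. E s (Φ h) = -E h s and E g s
    -- = -m·E g g are negative, which excludes s and g; and Φ b ≤ 0 would force Φ s = Φ b - m·Φ g to
    -- be nonpositive.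
    subobject-Φ : Subobject m (Φ s) (Φ b) (Φ g) (Φ h)
    subobject-Φ = [ (λ rΦh → [ (λ rΦs → [ (λ rΦg → [ (λ rΦb → go rΦs rΦb rΦg rΦh)
      , (λ (Φb≤0 , _) → ⊥-elim (b-proj rΦs rΦg Φb≤0)) ]′ (Φ-dichotomy rb))
      , (λ (_ , pg) → ⊥-elim (g-proj pg)) ]′ (Φ-dichotomy rg))
      , (λ (_ , ps) → ⊥-elim (s-proj rΦh ps)) ]′ (Φ-dichotomy rs))
      , (λ (_ , ph) → ⊥-elim (h-proj ph)) ]′ (Φ-dichotomy rh)
      where
      Φb≡ : ∀ i → Φ b i ≡ axpy m (Φ g) (Φ s) i
      Φb≡ = Φ-axpy {a = m} {y = g} {z = s} b≡
      E-b : ∀ y → E y b ≡ E y s + m * E y g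
      E-b y = trans (E-congʳ F b≡) (E-axpyʳ F m y g s)
      h-proj : (∀ y → Nonneg y → 0ℤ ≤ E h y) → ⊥
      h-proj ph = <⇒⊥ (subst (0ℤ <_) (sym (E-b h)) (0<+≤ hs (0≤* (ℤP.<⇒≤ m>0) (ph g (nonneg rg))))) hb
      s-proj : PosRoot (Φ h) → (∀ y → Nonneg y → 0ℤ ≤ E s y) → ⊥
      s-proj rΦh ps = <⇒⊥ hs (subst (_≤ 0ℤ) (trans (cong -_ (Φ-spec s h)) (ℤP.neg-involutive (E h s))) (neg-≤0 (ps (Φ h) (nonneg rΦh))))
      g-proj : (∀ y → Nonneg y → 0ℤ ≤ E g y) → ⊥
      g-proj pg = <⇒⊥ (0<+≤ (0<* m>0 (square>0 rg)) (pg s (nonneg rs))) (ℤP.≤-reflexive (trans (ℤP.+-comm (m * E g g) (E g s)) (trans (sym (E-b g)) gb)))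
      b-proj : PosRoot (Φ s) → PosRoot (Φ g) → Nonpos (Φ b) → ⊥
      b-proj rΦs rΦg Φb≤0 = not-nonpos rΦs (λ i → ℤP.≤-trans (≤by (m * Φ g i) (0≤* (ℤP.<⇒≤ m>0) (nonneg rΦg i)) (trans (cong (_- Φ s i) (Φb≡ i)) (lem (Φ s i) (m * Φ g i)))) (Φb≤0 i))
        where
        lem : ∀ a b → a + b - a ≡ b
        lem = solve-∀
      go : PosRoot (Φ s) → PosRoot (Φ b) → PosRoot (Φ g) → PosRoot (Φ h) → Subobject m (Φ s) (Φ b) (Φ g) (Φ h)
      go rΦs rΦb rΦg rΦh = record
        { m>0 = m>0 ; rs = rΦs ; rb = rΦb ; rg = rΦg ; rh = rΦh ; b≡ = Φb≡
        ; gb = trans (Φ-iso g b) gb ; hb = subst (_≤ 0ℤ) (sym (Φ-iso h b)) hb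
        ; hs = subst (0ℤ <_) (sym (Φ-iso h s)) hs }

  no-subobject : ∀ {m s b g h} → Subobject m s b g h → ⊥
  no-subobject {m} {s} {b} {g} {h} q = no-positive-orbit (size>0 (Subobject.rh q)) (isRoot (Subobject.rh q)) (λ t → nonneg (Subobject.rh (orbit t)))
    where
    orbit : ∀ t → Subobject m (Φ^ t s) (Φ^ t b) (Φ^ t g) (Φ^ t h)
    orbit zero = q
    orbit (suc t) = subobject-Φ (orbit t)

-- Seeds and their mutations

infix 8 _⁺
_⁺ : ℤ → ℤ
x ⁺ = + pos x

⁺-nonneg : ∀ x → 0ℤ ≤ x ⁺
⁺-nonneg x = +≤+ ℕ.z≤n

⁺-pos : ∀ {x} → 0ℤ ≤ x → x ⁺ ≡ x
⁺-pos {+ _} _ = refl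

⁺-neg : ∀ {x} → x ≤ 0ℤ → x ⁺ ≡ 0ℤ
⁺-neg {+ zero} _ = refl
⁺-neg { -[1+ _ ]} _ = refl
⁺-neg {+ suc _} (+≤+ ())

⁺-diff : ∀ x → x ≡ x ⁺ - (- x) ⁺
⁺-diff (+ zero) = refl
⁺-diff (+ suc m) = sym (ℤP.+-identityʳ (+ suc m))
⁺-diff -[1+ m ] = refl

⁺-disj : ∀ x → x ⁺ ≡ 0ℤ ⊎ (- x) ⁺ ≡ 0ℤ
⁺-disj x = [ (λ p → inj₂ (⁺-neg (neg-≤0 p))) , (λ p → inj₁ (⁺-neg p)) ]′ (ℤP.≤-total 0ℤ x)

⁺-scale : ∀ {a} x → 0ℤ ≤ a → a * x ⁺ ≡ (a * x) ⁺
⁺-scale {a} x p = [ (λ q → trans (cong (a *_) (⁺-pos q)) (sym (⁺-pos (0≤* p q))))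
  , (λ q → trans (cong (a *_) (⁺-neg q)) (trans (ℤP.*-zeroʳ a) (sym (⁺-neg (*≤0 p q))))) ]′ (ℤP.≤-total 0ℤ x)

sgn-pos : ∀ {x} c → 0ℤ < x → sgn* x c ≡ c
sgn-pos {+ suc _} c _ = refl
sgn-pos {+ zero} c (+<+ ())

sgn-neg : ∀ {x} c → x < 0ℤ → sgn* x c ≡ - c
sgn-neg { -[1+ _ ]} c _ = refl
sgn-neg {+ _} c (+<+ ())

-- The form of the mutation rule in positive parts. Once the sign of x is known one of its terms
-- simplifies, so that a whole column of c-vector entries changes by a multiple of column k.
sgn-formula : ∀ x y → sgn* x ((x * y) ⁺) ≡ x * y ⁺ + (- x) ⁺ * y
sgn-formula x y with ℤP.<-cmp x 0ℤ
... | tri> _ _ p = trans (sgn-pos _ p) (trans (sym (⁺-scale y (ℤP.<⇒≤ p))) (sym (trans (cong (λ w → x * y ⁺ + w * y) (⁺-neg (neg-≤0 (ℤP.<⇒≤ p)))) (ℤP.+-identityʳ (x * y ⁺)))))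
... | tri≈ _ refl _ = refl
... | tri< p _ _ = begin
  sgn* x ((x * y) ⁺)              ≡⟨ sgn-neg _ p ⟩
  - ((x * y) ⁺)                   ≡⟨ cong (λ w → - (w ⁺)) (lem1 x y) ⟩
  - ((- x * - y) ⁺)               ≡⟨ cong -_ (sym (⁺-scale (- y) mx)) ⟩
  - (- x * (- y) ⁺)               ≡⟨ lem2 x ((- y) ⁺) ⟩
  x * (- y) ⁺                     ≡⟨ lem3 x y (y ⁺) ((- y) ⁺) (⁺-diff y) ⟩
  x * y ⁺ + - x * y               ≡⟨ cong (λ w → x * y ⁺ + w * y) (sym (⁺-pos mx)) ⟩
  x * y ⁺ + (- x) ⁺ * y ∎
  where
  open ≡-Reasoning
  mx : 0ℤ ≤ - x
  mx = 0≤-neg (ℤP.<⇒≤ p)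
  lem1 : ∀ x y → x * y ≡ - x * - y
  lem1 = solve-∀
  lem2 : ∀ x y → - (- x * y) ≡ x * y
  lem2 = solve-∀
  lem3 : ∀ x y p q → y ≡ p - q → x * q ≡ x * p + - x * y
  lem3 x y p q refl = l x p q
    where
    l : ∀ x p q → x * q ≡ x * p + - x * (p - q)
    l = solve-∀

record MutB {n} (k : Fin n) (b b′ : Form n) : Set where
  field
    row   : ∀ j → b′ k j ≡ - b k j
    col   : ∀ i → b′ i k ≡ - b i k
    inner : ∀ i j → i ≢ k → j ≢ k → b′ i j ≡ b i j + sgn* (b i k) ((b i k * b k j) ⁺)

module _ {n} (𝓔 : EulerForm n) where
  open EulerForm 𝓔
  open Euler 𝓔

  -- Through `ω` the sign of an exchange matrix entry `b k j` compares the two pairings of `c k`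
  -- with `c j`; together with the sign conditions this determines them well enough to control the
  -- mutation.
  record CSeed (c : Fin n → Vect n) (b : Form n) : Set where
    field
      root : ∀ i → IsRoot (δ i) (c i)
      ω    : ∀ i j → δ i * b i j ≡ E (c i) (c j) - E (c j) (c i)
      pos-neg   : ∀ i j → Nonneg (c i) → Nonpos (c j) → E (c i) (c j) ≡ 0ℤ
      pos-pos   : ∀ i j → i ≢ j → Nonneg (c i) → Nonneg (c j) → E (c i) (c j) ≤ 0ℤ
      neg-neg   : ∀ i j → i ≢ j → Nonpos (c i) → Nonpos (c j) → E (c i) (c j) ≤ 0ℤ

  record MutC (k : Fin n) (m : Vect n) (c c′ : Fin n → Vect n) : Set where
    field
      at-k  : ∀ i → c′ k i ≡ - c k i
      off-k : ∀ j → j ≢ k → ∀ i → c′ j i ≡ axpy (m j) (c k) (c j) i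

IsRoot-resp : ∀ {n} (𝓔 : EulerForm n) {d x y} → (∀ i → x i ≡ y i) → Euler.IsRoot 𝓔 d x → Euler.IsRoot 𝓔 d y
IsRoot-resp 𝓔 e r = record
  { norm = trans (sym (E-cong F e e)) (norm r)
  ; divˡ = λ z → ∣-resp (E-congˡ F e) (divˡ r z)
  ; divʳ = λ z → ∣-resp (E-congʳ F e) (divʳ r z) }
  where
  open EulerForm 𝓔
  open Euler 𝓔

module CSeedFacts {n} (𝓔 : EulerForm n) {c b} (S : CSeed 𝓔 c b) where
  open EulerForm 𝓔
  open Euler 𝓔
  open CSeed S public

  M : Form n
  M i j = E (c i) (c j)

  sign : ∀ i → Nonneg (c i) ⊎ Nonpos (c i)
  sign i = root-sign (δ>0 i) (root i)

  not-both : ∀ i → Nonneg (c i) → Nonpos (c i) → ⊥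
  not-both i = root-not-both (δ>0 i) (root i)

  M-diag : ∀ i → M i i ≡ δ i
  M-diag i = norm (root i)

  b-skew : ∀ i j → δ i * b i j ≡ - (δ j * b j i)
  b-skew i j = trans (ω i j) (trans (lem (M i j) (M j i)) (cong -_ (sym (ω j i))))
    where
    lem : ∀ a b → a - b ≡ - (b - a)
    lem = solve-∀

  b-diag : ∀ i → b i i ≡ 0ℤ
  b-diag i = *-cancel-0 (δ>0 i) (trans (ω i i) (ℤP.+-inverseʳ (M i i)))

  ⁺-skew : ∀ i j → δ i * (b i j) ⁺ ≡ δ j * (- b j i) ⁺
  ⁺-skew i j = trans (⁺-scale (b i j) (ℤP.<⇒≤ (δ>0 i))) (trans (cong _⁺ (trans (b-skew i j) (ℤP.neg-distribʳ-* (δ j) (b j i)))) (sym (⁺-scale (- b j i) (ℤP.<⇒≤ (δ>0 j)))))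

  -- Both entries are multiples of δ i and of δ j; if neither vanished, c i + c j would have norm ≤ 0.
  M-one-zero : ∀ i j → i ≢ j → Nonneg (c i) → Nonneg (c j) → M i j ≡ 0ℤ ⊎ M j i ≡ 0ℤ
  M-one-zero i j ne pi pj with M i j ℤ.≟ 0ℤ | M j i ℤ.≟ 0ℤ
  ... | yes z | _ = inj₁ z
  ... | no _ | yes z = inj₂ z
  ... | no p | no q = ⊥-elim (not-both i pi ci≤0)
    where
    neg-bound : ∀ {d a} → 0ℤ < d → d ∣ᶻ a → a ≤ 0ℤ → a ≢ 0ℤ → 0ℤ ≤ - a - d
    neg-bound d>0 dv le ne = 0≤- (∣-pos d>0 (∣-neg dv) (ℤP.neg-mono-< (≤∧≢⇒< le ne)))
    s : Vect n
    s l = c i l + c j l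
    lem : ∀ di dj x y → (di + x) + (y + dj) ≡ - ((- x - di) + (- y - dj))
    lem = solve-∀
    ss : E s s ≤ 0ℤ
    ss = subst (_≤ 0ℤ) (sym (trans (E-+ˡ F (c i) (c j) s) (trans (cong₂ _+_ (trans (E-+ʳ F (c i) (c i) (c j)) (cong (_+ M i j) (M-diag i))) (trans (E-+ʳ F (c j) (c i) (c j)) (cong (λ w → M j i + w) (M-diag j)))) (lem (δ i) (δ j) (M i j) (M j i)))))
      (neg-≤0 (0≤+ (neg-bound (δ>0 i) (divˡ (root i) (c j)) (pos-pos i j ne pi pj) p) (neg-bound (δ>0 j) (divˡ (root j) (c i)) (pos-pos j i (≢-sym ne) pj pi) q)))
    ci≤0 : Nonpos (c i)
    ci≤0 l = ℤP.≤-trans (≤by (c j l) (pj l) (l1 (c i l) (c j l))) (ℤP.≤-reflexive (E-def s ss l))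
      where
      l1 : ∀ a b → a + b - a ≡ b
      l1 = solve-∀

-- Mutation at a positive c-vector

module Green {n} (𝓔 : EulerForm n) {c b} (S : CSeed 𝓔 c b) (k : Fin n) (green : Nonneg (c k))
  {c′ b′} (mb : MutB k b b′) (mc : MutC 𝓔 k (λ j → (b k j) ⁺) c c′) where
  open EulerForm 𝓔
  open Euler 𝓔
  open Orbits 𝓔
  open CSeedFacts 𝓔 S
  open MutB mb
  open MutC mc

  m : Vect n
  m j = (b k j) ⁺

  -- In the case `reflected` the new vector c j + m j · c k is the reflection of c j along c k,
  -- which is why its norm does not change.
  data Kind (j : Fin n) : Set where
    reflected : 0ℤ < m j → M k j ≡ 0ℤ → M j k ≡ - (m j * δ k) → Kind j
    fixed+ : m j ≡ 0ℤ → Nonneg (c j) → M j k ≡ 0ℤ → M k j ≤ 0ℤ → Kind j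
    fixed- : m j ≡ 0ℤ → Nonpos (c j) → M k j ≡ 0ℤ → 0ℤ ≤ M j k → Kind j

  -- If `b k j` is positive, `ω` gives M k j > M j k. For positive c j both are ≤ 0 and one of them
  -- is 0, so it is M k j; for negative c j this is `pos-neg`. If `b k j` is not positive, the
  -- inequality is reversed and the same facts apply.
  kind : ∀ j → j ≢ k → Kind j
  kind j ne with 0ℤ ℤ.<? b k j
  ... | yes p = reflected (subst (0ℤ <_) (sym mj) p) kj (trans (lem (M k j) (M j k) (δ k * b k j) kj (ω k j)) (cong -_ (trans (ℤP.*-comm (δ k) (b k j)) (cong (_* δ k) (sym mj)))))
    where
    mj : m j ≡ b k j
    mj = ⁺-pos (ℤP.<⇒≤ p)
    kj : M k j ≡ 0ℤ
    kj = [ (λ pj → [ (λ z → z) , (λ z → ⊥-elim (<⇒⊥ (0<* (δ>0 k) p) (subst (_≤ 0ℤ) (trans (sym (trans (cong (λ w → M k j - w) z) (ℤP.+-identityʳ (M k j)))) (sym (ω k j))) (pos-pos k j (≢-sym ne) green pj)))) ]′ (M-one-zero k j (≢-sym ne) green pj))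
         , pos-neg k j green ]′ (sign j)
    lem : ∀ x y z → x ≡ 0ℤ → z ≡ x - y → y ≡ - z
    lem _ y _ refl refl = l y
      where
      l : ∀ y → y ≡ - (0ℤ - y)
      l = solve-∀
  ... | no p = [ (λ pj → fixed+ mj pj (jk pj) (pos-pos k j (≢-sym ne) green pj)) , (λ qj → fixed- mj qj (pos-neg k j green qj) (0≤∣neg (subst (_≤ 0ℤ) (trans (ω k j) (trans (cong (_- M j k) (pos-neg k j green qj)) (ℤP.+-identityˡ (- M j k)))) δb≤0))) ]′ (sign j)
    where
    mj : m j ≡ 0ℤ
    mj = ⁺-neg (ℤP.≮⇒≥ p)
    δb≤0 : δ k * b k j ≤ 0ℤ
    δb≤0 = *≤0 (ℤP.<⇒≤ (δ>0 k)) (ℤP.≮⇒≥ p)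
    jk : Nonneg (c j) → M j k ≡ 0ℤ
    jk pj = [ (λ z → ℤP.≤-antisym (pos-pos j k ne pj green) (0≤∣neg (subst (_≤ 0ℤ) (trans (ω k j) (trans (cong (_- M j k) z) (ℤP.+-identityˡ (- M j k)))) δb≤0)))
            , (λ z → z) ]′ (M-one-zero k j (≢-sym ne) green pj)

  E-off : ∀ j → j ≢ k → ∀ y → E (c′ j) y ≡ E (c j) y + m j * E (c k) y
  E-off j ne y = trans (E-congˡ F (off-k j ne)) (E-axpyˡ F (m j) (c j) (c k) y)

  E-offʳ : ∀ j → j ≢ k → ∀ y → E y (c′ j) ≡ E y (c j) + m j * E y (c k)
  E-offʳ j ne y = trans (E-congʳ F (off-k j ne)) (E-axpyʳ F (m j) y (c k) (c j))

  E-k : ∀ y → E (c′ k) y ≡ - E (c k) y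
  E-k y = trans (E-congˡ F at-k) (E-negˡ F (c k) y)

  E-kʳ : ∀ y → E y (c′ k) ≡ - E y (c k)
  E-kʳ y = trans (E-congʳ F at-k) (E-negʳ F y (c k))

  M′ : Form n
  M′ i j = E (c′ i) (c′ j)

  M′-off : ∀ i j → i ≢ k → j ≢ k → M′ i j ≡ (M i j + m j * M i k) + m i * (M k j + m j * δ k)
  M′-off i j ni nj = trans (E-off i ni (c′ j)) (cong₂ (λ x y → x + m i * y) (E-offʳ j nj (c i)) (trans (E-offʳ j nj (c k)) (cong (λ w → M k j + m j * w) (M-diag k))))

  M′-k : ∀ j → j ≢ k → M′ k j ≡ - (M k j + m j * δ k)
  M′-k j nj = trans (E-k (c′ j)) (cong -_ (trans (E-offʳ j nj (c k)) (cong (λ w → M k j + m j * w) (M-diag k))))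

  M′-kʳ : ∀ j → j ≢ k → M′ j k ≡ - (M j k + m j * δ k)
  M′-kʳ j nj = trans (E-kʳ (c′ j)) (cong -_ (trans (E-off j nj (c k)) (cong (λ w → M j k + m j * w) (M-diag k))))

  M′-refl : ∀ i j → i ≢ k → j ≢ k → M i k ≡ - (m i * δ k) → M′ i j ≡ M i j + m i * M k j
  M′-refl i j ni nj e = trans (M′-off i j ni nj) (lem (M i j) (m i) (m j) (M i k) (M k j) (δ k) e)
    where
    lem : ∀ a mi mj x y d → x ≡ - (mi * d) → (a + mj * x) + mi * (y + mj * d) ≡ a + mi * y
    lem a mi mj _ y d refl = l a mi mj y d
      where
      l : ∀ a mi mj y d → (a + mj * - (mi * d)) + mi * (y + mj * d) ≡ a + mi * y
      l = solve-∀

  M′-fixed : ∀ i j → i ≢ k → j ≢ k → m i ≡ 0ℤ → M′ i j ≡ M i j + m j * M i k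
  M′-fixed i j ni nj e = trans (M′-off i j ni nj) (trans (cong (λ w → (M i j + m j * M i k) + w * (M k j + m j * δ k)) e) (ℤP.+-identityʳ (M i j + m j * M i k)))

  c′-fixed : ∀ j → j ≢ k → m j ≡ 0ℤ → ∀ i → c′ j i ≡ c j i
  c′-fixed j ne e i = trans (off-k j ne i) (trans (cong (λ w → c j i + w * c k i) e) (ℤP.+-identityʳ (c j i)))

  old-neg : ∀ j → j ≢ k → Nonpos (c′ j) → Nonpos (c j)
  old-neg j ne p i = ℤP.≤-trans (≤by (m j * c k i) (0≤* (⁺-nonneg (b k j)) (green i)) (trans (cong (_- c j i) (off-k j ne i)) (lem (c j i) (m j * c k i)))) (p i)
    where
    lem : ∀ a b → a + b - a ≡ b
    lem = solve-∀

  c′k≤0 : Nonpos (c′ k)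
  c′k≤0 i = subst (_≤ 0ℤ) (sym (at-k i)) (neg-≤0 (green i))

  root′ : ∀ j → IsRoot (δ j) (c′ j)
  root′ j with j ≟ k
  ... | yes refl = IsRoot-resp 𝓔 (λ i → sym (at-k i)) (root-neg (root k))
  ... | no ne = record
    { norm = nm (kind j ne)
    ; divˡ = λ y → ∣-resp (sym (E-off j ne y)) (∣-+ (divˡ (root j) y) (dv (divˡ (root k) y)))
    ; divʳ = λ y → ∣-resp (sym (E-offʳ j ne y)) (∣-+ (divʳ (root j) y) (dv (divʳ (root k) y))) }
    where
    -- By skew-symmetrizability `m j * δ k` equals `δ j * (- b j k) ⁺`; this trades the divisor
    -- `δ k` for `δ j`.
    dv : ∀ {a} → δ k ∣ᶻ a → δ j ∣ᶻ (m j * a)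
    dv (q , refl) = (- b j k) ⁺ * q , trans (lem (m j) (δ k) q) (trans (cong (_* q) (⁺-skew k j)) (ℤP.*-assoc (δ j) _ q))
      where
      lem : ∀ m d q → m * (d * q) ≡ d * m * q
      lem = solve-∀
    nm : Kind j → E (c′ j) (c′ j) ≡ δ j
    nm (reflected _ z e) = trans (M′-refl j j ne ne e) (trans (cong (λ w → M j j + m j * w) z) (trans (cong (λ w → M j j + w) (ℤP.*-zeroʳ (m j))) (trans (ℤP.+-identityʳ (M j j)) (M-diag j))))
    nm (fixed+ z _ _ _) = trans (E-cong F (c′-fixed j ne z) (c′-fixed j ne z)) (M-diag j)
    nm (fixed- z _ _ _) = trans (E-cong F (c′-fixed j ne z) (c′-fixed j ne z)) (M-diag j)

  not-both′ : ∀ i → Nonneg (c′ i) → Nonpos (c′ i) → ⊥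
  not-both′ i = root-not-both (δ>0 i) (root′ i)

  ω′ : ∀ i j → δ i * b′ i j ≡ M′ i j - M′ j i
  ω′ i j with i ≟ k | j ≟ k
  ... | yes refl | yes refl = trans (cong (δ k *_) (trans (row k) (cong -_ (b-diag k)))) (trans (ℤP.*-zeroʳ (δ k)) (sym (ℤP.+-inverseʳ (M′ k k))))
  ... | yes refl | no nj = trans (cong (δ k *_) (row j)) (trans (sym (ℤP.neg-distribʳ-* (δ k) (b k j))) (trans (cong -_ (ω k j)) (trans (lem (M k j) (M j k) (m j * δ k)) (sym (cong₂ _-_ (M′-k j nj) (M′-kʳ j nj))))))
    where
    lem : ∀ a b d → - (a - b) ≡ - (a + d) - - (b + d)
    lem = solve-∀
  ... | no ni | yes refl = trans (cong (δ i *_) (col i)) (trans (sym (ℤP.neg-distribʳ-* (δ i) (b i k))) (trans (cong -_ (ω i k)) (trans (lem (M i k) (M k i) (m i * δ k)) (sym (cong₂ _-_ (M′-kʳ i ni) (M′-k i ni))))))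
    where
    lem : ∀ a b d → - (a - b) ≡ - (a + d) - - (b + d)
    lem = solve-∀
  ... | no ni | no nj = begin
    δ i * b′ i j
      ≡⟨ cong (δ i *_) (trans (inner i j ni nj) (cong (λ w → b i j + w) (sgn-formula (b i k) (b k j)))) ⟩
    δ i * (b i j + (b i k * m j + (- b i k) ⁺ * b k j))
      ≡⟨ lem1 (δ i) (b i j) (b i k) (m j) ((- b i k) ⁺) (b k j) ⟩
    δ i * b i j + (δ i * b i k * m j + δ i * (- b i k) ⁺ * b k j)
      ≡⟨ cong₂ (λ x y → x + (y * m j + δ i * (- b i k) ⁺ * b k j)) (ω i j) (b-skew i k) ⟩
    (M i j - M j i) + (- (δ k * b k i) * m j + δ i * (- b i k) ⁺ * b k j)
      ≡⟨ cong (λ x → (M i j - M j i) + (- (δ k * b k i) * m j + x * b k j)) (sym (⁺-skew k i)) ⟩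
    (M i j - M j i) + (- (δ k * b k i) * m j + δ k * m i * b k j)
      ≡⟨ cong (λ x → (M i j - M j i) + (- (δ k * b k i) * m j + x)) (lem2 (δ k) (m i) (b k j)) ⟩
    (M i j - M j i) + (- (δ k * b k i) * m j + m i * (δ k * b k j))
      ≡⟨ cong₂ (λ x y → (M i j - M j i) + (- x * m j + m i * y)) (ω k i) (ω k j) ⟩
    (M i j - M j i) + (- (M k i - M i k) * m j + m i * (M k j - M j k))
      ≡⟨ lem3 (M i j) (M j i) (M k i) (M i k) (M k j) (M j k) (m i) (m j) (δ k) ⟩
    ((M i j + m j * M i k) + m i * (M k j + m j * δ k)) - ((M j i + m i * M j k) + m j * (M k i + m i * δ k))
      ≡⟨ sym (cong₂ _-_ (M′-off i j ni nj) (M′-off j i nj ni)) ⟩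
    M′ i j - M′ j i ∎
    where
    open ≡-Reasoning
    lem1 : ∀ d a x m y z → d * (a + (x * m + y * z)) ≡ d * a + (d * x * m + d * y * z)
    lem1 = solve-∀
    lem2 : ∀ d m z → d * m * z ≡ m * (d * z)
    lem2 = solve-∀
    lem3 : ∀ a a′ x x′ y y′ p q d → (a - a′) + (- (x - x′) * q + p * (y - y′)) ≡ ((a + q * x′) + p * (y + q * d)) - ((a′ + p * y′) + q * (x + p * d))
    lem3 = solve-∀

  posRoot : ∀ {d x} → 0ℤ < d → IsRoot d x → Nonneg x → PosRoot x
  posRoot p r q = record { size>0 = p ; isRoot = r ; nonneg = q }

  negate : ∀ {d x} → 0ℤ < d → IsRoot d x → Nonpos x → PosRoot (λ i → - x i)
  negate p r q = posRoot p (root-neg r) (λ i → 0≤-neg (q i))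

  -- If c i < 0 and c′ i > 0 then c′ i is a quotient of (c k)ᵐ with kernel − c i.
  crossing : ∀ i → i ≢ k → Nonpos (c i) → Nonneg (c′ i) → ∀ {h} → PosRoot h → E (c k) h ≤ 0ℤ → E (c′ i) h ≤ 0ℤ
  crossing i ni neg pos′ {h} rh le with kind i ni
  ... | fixed+ z _ _ _ = ⊥-elim (not-both i (λ l → subst (0ℤ ≤_) (c′-fixed i ni z l) (pos′ l)) neg)
  ... | fixed- z _ _ _ = ⊥-elim (not-both i (λ l → subst (0ℤ ≤_) (c′-fixed i ni z l) (pos′ l)) neg)
  ... | reflected m>0 _ e = ℤP.≮⇒≥ (λ p → no-quotient {m i} {c′ i} {c k} {λ l → - c i l} {h} (record
    { m≥0 = ℤP.<⇒≤ m>0 ; rf = posRoot (δ>0 i) (root′ i) pos′ ; rg = posRoot (δ>0 k) (root k) green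
    ; rk = negate (δ>0 i) (root i) neg ; rh = rh
    ; k≡ = λ l → trans (ℤP.neg-involutive (c i l)) (trans (lem (c i l) (m i) (c k l)) (cong (λ w → w + - m i * c k l) (sym (off-k i ni l))))
    ; fg = trans (E-off i ni (c k)) (trans (cong₂ (λ x y → x + m i * y) e (M-diag k)) (ℤP.+-inverseˡ (m i * δ k)))
    ; gh = le ; fh = p }))
    where
    lem : ∀ a m b → a ≡ a + m * b + - m * b
    lem = solve-∀

  M-ck-off : ∀ i j → i ≢ k → E (c′ i) (c j) ≡ M i j + m i * M k j
  M-ck-off i j ni = E-off i ni (c j)

  pos-neg′ : ∀ i j → Nonneg (c′ i) → Nonpos (c′ j) → M′ i j ≡ 0ℤ
  pos-neg′ i j pi qj with i ≟ k | j ≟ k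
  ... | yes refl | _ = ⊥-elim (not-both′ k pi c′k≤0)
  ... | no ni | yes refl = trans (M′-kʳ i ni) (cong -_ (z (kind i ni)))
    where
    z : Kind i → M i k + m i * δ k ≡ 0ℤ
    z (reflected _ _ e) = trans (cong (_+ m i * δ k) e) (ℤP.+-inverseˡ (m i * δ k))
    z (fixed+ e _ e′ _) = cong₂ (λ x y → x + y * δ k) e′ e
    z (fixed- e q _ _) = ⊥-elim (not-both i (λ l → subst (0ℤ ≤_) (c′-fixed i ni e l) (pi l)) q)
  ... | no ni | no nj = go (sign i) (kind i ni)
    where
    negj : Nonpos (c j)
    negj = old-neg j nj qj
    kj0 : M k j ≡ 0ℤ
    kj0 = pos-neg k j green negj
    go : Nonneg (c i) ⊎ Nonpos (c i) → Kind i → M′ i j ≡ 0ℤ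
    go (inj₁ p) (reflected _ _ e) = trans (M′-refl i j ni nj e) (trans (cong₂ (λ x y → x + m i * y) (pos-neg i j p negj) kj0) (trans (ℤP.+-identityˡ (m i * 0ℤ)) (ℤP.*-zeroʳ (m i))))
    go (inj₁ p) (fixed+ e _ e′ _) = trans (M′-fixed i j ni nj e) (trans (cong₂ (λ x y → x + m j * y) (pos-neg i j p negj) e′) (trans (ℤP.+-identityˡ (m j * 0ℤ)) (ℤP.*-zeroʳ (m j))))
    go (inj₁ p) (fixed- _ q _ _) = ⊥-elim (not-both i p q)
    go (inj₂ q) (fixed+ e _ _ _) = ⊥-elim (not-both i (λ l → subst (0ℤ ≤_) (c′-fixed i ni e l) (pi l)) q)
    go (inj₂ q) (fixed- e _ _ _) = ⊥-elim (not-both i (λ l → subst (0ℤ ≤_) (c′-fixed i ni e l) (pi l)) q)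
    -- Here c i passes from negative to positive. `neg-neg` gives M i j ≤ 0, and `crossing` against
    -- the positive root -c j gives the opposite inequality.
    go (inj₂ q) (reflected _ _ e) = trans eq (ℤP.≤-antisym (neg-neg i j (λ { refl → not-both′ i pi qj }) q negj) (0≤∣neg (subst (_≤ 0ℤ) val (crossing i ni q pi (negate (δ>0 j) (root j) negj) (ℤP.≤-reflexive (trans (E-negʳ F (c k) (c j)) (cong -_ kj0)))))))
      where
      simp : ∀ {x} → M i j + m i * M k j ≡ x → M i j ≡ x
      simp r = trans (sym (trans (cong (λ w → M i j + m i * w) kj0) (trans (cong (λ w → M i j + w) (ℤP.*-zeroʳ (m i))) (ℤP.+-identityʳ (M i j))))) r
      eq : M′ i j ≡ M i j
      eq = trans (M′-refl i j ni nj e) (sym (simp refl))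
      val : E (c′ i) (λ l → - c j l) ≡ - M i j
      val = trans (E-negʳ F (c′ i) (c j)) (cong -_ (trans (M-ck-off i j ni) (sym (simp refl))))

  pos-pos′ : ∀ i j → i ≢ j → Nonneg (c′ i) → Nonneg (c′ j) → M′ i j ≤ 0ℤ
  pos-pos′ i j ne pi pj with i ≟ k | j ≟ k
  ... | yes refl | _ = ⊥-elim (not-both′ k pi c′k≤0)
  ... | no _ | yes refl = ⊥-elim (not-both′ k pj c′k≤0)
  ... | no ni | no nj = go (sign i) (sign j) (kind i ni)
    where
    contra : ∀ {A : Set} → m i ≡ 0ℤ → Nonpos (c i) → A
    contra e q = ⊥-elim (not-both i (λ l → subst (0ℤ ≤_) (c′-fixed i ni e l) (pi l)) q)
    go : Nonneg (c i) ⊎ Nonpos (c i) → Nonneg (c j) ⊎ Nonpos (c j) → Kind i → M′ i j ≤ 0ℤ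
    go (inj₁ p) (inj₁ q) (reflected _ _ e) = subst (_≤ 0ℤ) (sym (M′-refl i j ni nj e)) (ℤP.+-mono-≤ (pos-pos i j ne p q) (*≤0 (⁺-nonneg (b k i)) (pos-pos k j (≢-sym nj) green q)))
    go (inj₁ p) (inj₁ q) (fixed+ e _ e′ _) = subst (_≤ 0ℤ) (sym (M′-fixed i j ni nj e)) (ℤP.+-mono-≤ (pos-pos i j ne p q) (ℤP.≤-reflexive (trans (cong (m j *_) e′) (ℤP.*-zeroʳ (m j)))))
    go (inj₁ p) (inj₂ q) (reflected _ _ e) = ℤP.≤-reflexive (trans (M′-refl i j ni nj e) (trans (cong₂ (λ x y → x + m i * y) (pos-neg i j p q) (pos-neg k j green q)) (trans (ℤP.+-identityˡ (m i * 0ℤ)) (ℤP.*-zeroʳ (m i)))))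
    go (inj₁ p) (inj₂ q) (fixed+ e _ e′ _) = ℤP.≤-reflexive (trans (M′-fixed i j ni nj e) (trans (cong₂ (λ x y → x + m j * y) (pos-neg i j p q) e′) (trans (ℤP.+-identityˡ (m j * 0ℤ)) (ℤP.*-zeroʳ (m j)))))
    go (inj₁ p) _ (fixed- _ q _ _) = ⊥-elim (not-both i p q)
    go (inj₂ p) _ (fixed+ e _ _ _) = contra e p
    go (inj₂ p) _ (fixed- e _ _ _) = contra e p
    go (inj₂ p) (inj₁ q) (reflected _ _ e) = subst (_≤ 0ℤ) (trans (M-ck-off i j ni) (sym (M′-refl i j ni nj e))) (crossing i ni p pi (posRoot (δ>0 j) (root j) q) (pos-pos k j (≢-sym nj) green q))
    go (inj₂ p) (inj₂ q) (reflected _ _ e) = subst (_≤ 0ℤ) (sym (trans (M′-refl i j ni nj e) (trans (cong (λ w → M i j + m i * w) (pos-neg k j green q)) (trans (cong (λ w → M i j + w) (ℤP.*-zeroʳ (m i))) (ℤP.+-identityʳ (M i j)))))) (neg-neg i j ne p q)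

  neg-neg′ : ∀ i j → i ≢ j → Nonpos (c′ i) → Nonpos (c′ j) → M′ i j ≤ 0ℤ
  neg-neg′ i j ne qi qj with i ≟ k | j ≟ k
  ... | yes refl | yes refl = ⊥-elim (ne refl)
  ... | yes refl | no nj = subst (_≤ 0ℤ) (sym (M′-k j nj)) (neg-≤0 (subst (λ w → 0ℤ ≤ w + m j * δ k) (sym (pos-neg k j green (old-neg j nj qj))) (subst (0ℤ ≤_) (sym (ℤP.+-identityˡ (m j * δ k))) (0≤* (⁺-nonneg (b k j)) (ℤP.<⇒≤ (δ>0 k))))))
  ... | no ni | yes refl = subst (_≤ 0ℤ) (sym (M′-kʳ i ni)) (neg-≤0 (z (kind i ni)))
    where
    z : Kind i → 0ℤ ≤ M i k + m i * δ k
    z (reflected _ _ e) = ℤP.≤-reflexive (sym (trans (cong (_+ m i * δ k) e) (ℤP.+-inverseˡ (m i * δ k))))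
    z (fixed+ _ p _ _) = ⊥-elim (not-both i p (old-neg i ni qi))
    z (fixed- e _ _ p) = 0≤+ p (ℤP.≤-reflexive (sym (cong (_* δ k) e)))
  ... | no ni | no nj = go (kind i ni) (kind j nj)
    where
    negi : Nonpos (c i)
    negi = old-neg i ni qi
    negj : Nonpos (c j)
    negj = old-neg j nj qj
    go : Kind i → Kind j → M′ i j ≤ 0ℤ
    go (reflected _ _ e) _ = subst (_≤ 0ℤ) (sym (trans (M′-refl i j ni nj e) (trans (cong (λ w → M i j + m i * w) (pos-neg k j green negj)) (trans (cong (λ w → M i j + w) (ℤP.*-zeroʳ (m i))) (ℤP.+-identityʳ (M i j)))))) (neg-neg i j ne negi negj)
    go (fixed+ _ p _ _) _ = ⊥-elim (not-both i p negi)
    go (fixed- _ _ _ _) (fixed+ _ p _ _) = ⊥-elim (not-both j p negj)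
    go (fixed- e _ _ _) (fixed- e′ _ _ _) = subst (_≤ 0ℤ) (sym (trans (M′-fixed i j ni nj e) (trans (cong (λ w → M i j + w * M i k) e′) (ℤP.+-identityʳ (M i j))))) (neg-neg i j ne negi negj)
    -- In module terms -c′ j is a subobject of -c j with cokernel a power of c k. As -c i has no Hom
    -- to -c j, it has none to -c′ j.
    go (fixed- e _ _ _) (reflected m>0 kj0 e′) = ℤP.≮⇒≥ (λ p → no-subobject {m j} {λ l → - c′ j l} {λ l → - c j l} {c k} {λ l → - c i l} (record
      { m>0 = m>0 ; rs = negate (δ>0 j) (root′ j) qj ; rb = negate (δ>0 j) (root j) negj ; rg = posRoot (δ>0 k) (root k) green
      ; rh = negate (δ>0 i) (root i) negi
      ; b≡ = λ l → trans (lem (c j l) (m j) (c k l)) (cong (λ w → - w + m j * c k l) (sym (off-k j nj l)))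
      ; gb = trans (E-negʳ F (c k) (c j)) (cong -_ kj0)
      ; hb = subst (_≤ 0ℤ) (sym (negneg (c i) (c j))) (neg-neg i j ne negi negj)
      ; hs = subst (0ℤ <_) (sym (trans (negneg (c i) (c′ j)) (E-congˡ F (λ l → sym (c′-fixed i ni e l))))) p }))
      where
      lem : ∀ a m b → - a ≡ - (a + m * b) + m * b
      lem = solve-∀
      negneg : ∀ x y → E (λ l → - x l) (λ l → - y l) ≡ E x y
      negneg x y = trans (E-negˡ F x _) (trans (cong -_ (E-negʳ F x y)) (ℤP.neg-involutive (E x y)))

  seed′ : CSeed 𝓔 c′ b′
  seed′ = record { root = root′ ; ω = ω′ ; pos-neg = pos-neg′ ; pos-pos = pos-pos′ ; neg-neg = neg-neg′ }

module _ {n} (𝓔 𝓕 : EulerForm n) where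
  private
    module A = EulerForm 𝓔
    module B = EulerForm 𝓕

  -- Transposing the form and negating everything exchanges green and red mutations.
  CSeed-flip : (∀ x y → ⟪ B.F ⟫ x y ≡ ⟪ A.F ⟫ y x) → (∀ i → B.δ i ≡ A.δ i) → ∀ {c b} →
    CSeed 𝓔 c b → CSeed 𝓕 (λ i l → - c i l) (λ i j → - b i j)
  CSeed-flip fl δ≡ {c} {b} S = record
    { root = λ i → record
        { norm = trans (nn (c i) (c i)) (trans (norm (root i)) (sym (δ≡ i)))
        ; divˡ = λ y → subst (_∣ᶻ ⟪ B.F ⟫ (λ l → - c i l) y) (sym (δ≡ i)) (∣-resp (sym (trans (E-negˡ B.F (c i) y) (cong -_ (fl (c i) y)))) (∣-neg (divʳ (root i) y)))
        ; divʳ = λ y → subst (_∣ᶻ ⟪ B.F ⟫ y (λ l → - c i l)) (sym (δ≡ i)) (∣-resp (sym (trans (E-negʳ B.F y (c i)) (cong -_ (fl y (c i))))) (∣-neg (divˡ (root i) y))) }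
    ; ω = λ i j → trans (cong (_* - b i j) (δ≡ i)) (trans (sym (ℤP.neg-distribʳ-* (A.δ i) (b i j))) (trans (cong -_ (ω i j)) (trans (lem (⟪ A.F ⟫ (c i) (c j)) (⟪ A.F ⟫ (c j) (c i))) (sym (cong₂ _-_ (nn (c i) (c j)) (nn (c j) (c i)))))))
    ; pos-neg = λ i j p q → trans (nn (c i) (c j)) (pos-neg j i (λ l → 0≤∣neg (q l)) (λ l → 0≤neg⇒≤0 (p l)))
    ; pos-pos = λ i j ne p q → subst (_≤ 0ℤ) (sym (nn (c i) (c j))) (neg-neg j i (≢-sym ne) (λ l → 0≤neg⇒≤0 (q l)) (λ l → 0≤neg⇒≤0 (p l)))
    ; neg-neg = λ i j ne p q → subst (_≤ 0ℤ) (sym (nn (c i) (c j))) (pos-pos j i (≢-sym ne) (λ l → 0≤∣neg (q l)) (λ l → 0≤∣neg (p l))) }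
    where
    open CSeed S
    open Euler 𝓔 using (norm; divˡ; divʳ)
    nn : ∀ x y → ⟪ B.F ⟫ (λ l → - x l) (λ l → - y l) ≡ ⟪ A.F ⟫ y x
    nn x y = trans (E-negˡ B.F x (λ l → - y l)) (trans (cong -_ (E-negʳ B.F x y)) (trans (ℤP.neg-involutive (⟪ B.F ⟫ x y)) (fl x y)))
    lem : ∀ a b → - (a - b) ≡ b - a
    lem = solve-∀

sgn*-neg : ∀ x c → sgn* (- x) c ≡ - sgn* x c
sgn*-neg (+ zero) c = refl
sgn*-neg (+ suc _) c = refl
sgn*-neg -[1+ _ ] c = sym (ℤP.neg-involutive c)

MutB-neg : ∀ {n} {k : Fin n} {b b′ : Form n} → MutB k b b′ → MutB k (λ i j → - b i j) (λ i j → - b′ i j)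
MutB-neg {k = k} {b} {b′} mb = record
  { row = λ j → cong -_ (row j)
  ; col = λ i → cong -_ (col i)
  ; inner = λ i j ni nj → trans (cong -_ (inner i j ni nj)) (trans (ℤP.neg-distrib-+ (b i j) _)
      (cong (λ w → - b i j + w) (trans (sym (sgn*-neg (b i k) _)) (cong (λ w → sgn* (- b i k) (w ⁺)) (lem (b i k) (b k j)))))) }
  where
  open MutB mb
  lem : ∀ x y → x * y ≡ - x * - y
  lem = solve-∀

module _ {n} (𝓔 : EulerForm n) where
  open EulerForm 𝓔
  open Euler 𝓔

  CSeed-resp : ∀ {c c′ b b′} → (∀ i l → c i l ≡ c′ i l) → (∀ i j → b i j ≡ b′ i j) → CSeed 𝓔 c b → CSeed 𝓔 c′ b′
  CSeed-resp {c} {c′} ce be S = record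
    { root = λ i → IsRoot-resp 𝓔 (ce i) (root i)
    ; ω = λ i j → trans (cong (δ i *_) (sym (be i j))) (trans (ω i j) (cong₂ _-_ (M≡ i j) (M≡ j i)))
    ; pos-neg = λ i j p q → trans (sym (M≡ i j)) (pos-neg i j (back⁺ i p) (back⁻ j q))
    ; pos-pos = λ i j ne p q → subst (_≤ 0ℤ) (M≡ i j) (pos-pos i j ne (back⁺ i p) (back⁺ j q))
    ; neg-neg = λ i j ne p q → subst (_≤ 0ℤ) (M≡ i j) (neg-neg i j ne (back⁻ i p) (back⁻ j q)) }
    where
    open CSeed S
    M≡ : ∀ i j → E (c i) (c j) ≡ E (c′ i) (c′ j)
    M≡ i j = E-cong F (ce i) (ce j)
    back⁺ : ∀ i → Nonneg (c′ i) → Nonneg (c i)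
    back⁺ i p l = subst (0ℤ ≤_) (sym (ce i l)) (p l)
    back⁻ : ∀ i → Nonpos (c′ i) → Nonpos (c i)
    back⁻ i p l = subst (_≤ 0ℤ) (sym (ce i l)) (p l)

  mutate-green : ∀ {c b k c′ b′} → CSeed 𝓔 c b → Nonneg (c k) → MutB k b b′ → MutC 𝓔 k (λ j → (b k j) ⁺) c c′ → CSeed 𝓔 c′ b′
  mutate-green S green mb mc = Green.seed′ 𝓔 S _ green mb mc

  mutate-red : ∀ {c b k c′ b′} → CSeed 𝓔 c b → Nonpos (c k) → MutB k b b′ → MutC 𝓔 k (λ j → (- b k j) ⁺) c c′ → CSeed 𝓔 c′ b′
  mutate-red {c} {b} {k} {c′} {b′} S red mb mc = CSeed-resp (λ i l → ℤP.neg-involutive (c′ i l)) (λ i j → ℤP.neg-involutive (b′ i j))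
    (CSeed-flip (dual 𝓔) 𝓔 (λ x y → sym (E-T F y x)) (λ _ → refl)
      (Green.seed′ (dual 𝓔) (CSeed-flip 𝓔 (dual 𝓔) (E-T F) (λ _ → refl) S) k (λ l → 0≤-neg (red l)) (MutB-neg mb) mc′))
    where
    open MutC mc
    lem : ∀ a m b → - (a + m * b) ≡ - a + m * - b
    lem = solve-∀
    mc′ : MutC (dual 𝓔) k (λ j → (- b k j) ⁺) (λ i l → - c i l) (λ i l → - c′ i l)
    mc′ = record
      { at-k = λ i → cong -_ (at-k i)
      ; off-k = λ j ne i → trans (cong -_ (off-k j ne i)) (lem (c j i) ((- b k j) ⁺) (c k i)) }

  -- e p is the vector with ν (e p) = g-vector of the p-th cluster variable;
  -- the pairing with c is the duality between g- and c-vectors.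
  record ESeed (c e : Fin n → Vect n) : Set where
    field
      pair-diag : ∀ p → E (c p) (e p) ≡ - δ p
      pair-off  : ∀ q p → q ≢ p → E (c q) (e p) ≡ 0ℤ
      ediv      : ∀ p y → δ p ∣ᶻ E y (e p)
      einj      : ∀ x → (∀ p → E x (e p) ≡ 0ℤ) → ∀ i → x i ≡ 0ℤ

  record MutE (k : Fin n) (m : Vect n) (e e′ : Fin n → Vect n) : Set where
    field
      at-k  : ∀ i → e′ k i ≡ - e k i + lincomb m e i
      off-k : ∀ j → j ≢ k → ∀ i → e′ j i ≡ e j i

  ∣-∑ : ∀ {m d} {f : Fin m → ℤ} → (∀ i → d ∣ᶻ f i) → d ∣ᶻ ∑ f
  ∣-∑ {m} {d} {f} dv = ∑ (λ i → _∣ᶻ_.quotient (dv i)) , trans (sum-cong (λ i → _∣ᶻ_.equality (dv i))) (sum-* d (λ i → _∣ᶻ_.quotient (dv i)))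

  -- The two mutations are adjoint for the pairing: the condition relating `m̃` and `m` makes the
  -- multiple of c k added to c q cancel against the coefficient of e q in the new e k.
  mutate-E : ∀ {c e c′ e′ k} {m m̃ : Vect n} → ESeed c e → MutC 𝓔 k m c c′ → MutE k m̃ e e′ →
    (∀ q → δ q * m̃ q ≡ δ k * m q) → m̃ k ≡ 0ℤ → ESeed c′ e′
  mutate-E {c} {e} {c′} {e′} {k} {m} {m̃} S mc me mm m̃k = record
    { pair-diag = λ p → pd p (p ≟ k)
    ; pair-off = λ q p ne → po q p ne (q ≟ k) (p ≟ k)
    ; ediv = λ p y → ed p y (p ≟ k)
    ; einj = ej }
    where
    open ESeed S
    module C = MutC mc
    module E′ = MutE me
    Ek : ∀ x → E x (e′ k) ≡ - E x (e k) + ∑ (λ r → m̃ r * E x (e r))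
    Ek x = trans (E-congʳ F E′.at-k) (trans (E-+ʳ F x (λ i → - e k i) (lincomb m̃ e)) (cong₂ _+_ (E-negʳ F x (e k)) (E-lincombʳ F x m̃ e)))
    Σc : ∀ q → ∑ (λ r → m̃ r * E (c q) (e r)) ≡ - (δ k * m q)
    Σc q = trans (sum-single (λ r → m̃ r * E (c q) (e r)) q (λ r ne → trans (cong (m̃ r *_) (pair-off q r (≢-sym ne))) (ℤP.*-zeroʳ (m̃ r))))
      (trans (cong (m̃ q *_) (pair-diag q)) (trans (lem (m̃ q) (δ q)) (cong -_ (mm q))))
      where
      lem : ∀ a b → a * - b ≡ - (b * a)
      lem = solve-∀
    ckek : E (c k) (e′ k) ≡ δ k
    ckek = trans (Ek (c k)) (trans (cong₂ (λ x y → - x + y) (pair-diag k) (trans (Σc k) (cong -_ (trans (sym (mm k)) (trans (cong (δ k *_) m̃k) (ℤP.*-zeroʳ (δ k))))))) (trans (ℤP.+-identityʳ (- - δ k)) (ℤP.neg-involutive (δ k))))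
    cqek : ∀ q → q ≢ k → E (c q) (e′ k) ≡ - (δ k * m q)
    cqek q ne = trans (Ek (c q)) (trans (cong₂ (λ x y → - x + y) (pair-off q k ne) (Σc q)) (ℤP.+-identityˡ (- (δ k * m q))))
    C-k : ∀ y → E (c′ k) y ≡ - E (c k) y
    C-k y = trans (E-congˡ F C.at-k) (E-negˡ F (c k) y)
    C-off : ∀ q → q ≢ k → ∀ y → E (c′ q) y ≡ E (c q) y + m q * E (c k) y
    C-off q ne y = trans (E-congˡ F (C.off-k q ne)) (E-axpyˡ F (m q) (c q) (c k) y)
    C-off₀ : ∀ q p → q ≢ k → p ≢ k → E (c′ q) (e′ p) ≡ E (c q) (e p)
    C-off₀ q p nq np = trans (C-off q nq (e′ p)) (trans (cong₂ (λ x y → x + m q * y) (E-congʳ F (E′.off-k p np)) (trans (E-congʳ F (E′.off-k p np)) (pair-off k p (≢-sym np))))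
      (trans (cong (λ w → E (c q) (e p) + w) (ℤP.*-zeroʳ (m q))) (ℤP.+-identityʳ (E (c q) (e p)))))
    pd : ∀ p → Dec (p ≡ k) → E (c′ p) (e′ p) ≡ - δ p
    pd p (yes refl) = trans (C-k (e′ k)) (cong -_ ckek)
    pd p (no np) = trans (C-off₀ p p np np) (pair-diag p)
    po : ∀ q p → q ≢ p → Dec (q ≡ k) → Dec (p ≡ k) → E (c′ q) (e′ p) ≡ 0ℤ
    po q p ne (yes refl) (yes refl) = ⊥-elim (ne refl)
    po q p ne (yes refl) (no np) = trans (C-k (e′ p)) (cong -_ (trans (E-congʳ F (E′.off-k p np)) (pair-off k p ne)))
    po q p ne (no nq) (yes refl) = trans (C-off q nq (e′ k)) (trans (cong₂ (λ x y → x + m q * y) (cqek q nq) ckek) (lem (δ k) (m q)))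
      where
      lem : ∀ d m → - (d * m) + m * d ≡ 0ℤ
      lem = solve-∀
    po q p ne (no nq) (no np) = trans (C-off₀ q p nq np) (pair-off q p ne)
    ed : ∀ p y → Dec (p ≡ k) → δ p ∣ᶻ E y (e′ p)
    ed p y (no np) = ∣-resp (sym (E-congʳ F (E′.off-k p np))) (ediv p y)
    ed p y (yes refl) = ∣-resp (sym (Ek y)) (∣-+ (∣-neg (ediv k y)) (∣-∑ (λ r → term r (ediv r y))))
      where
      term : ∀ r {a} → δ r ∣ᶻ a → δ k ∣ᶻ (m̃ r * a)
      term r (q , refl) = m r * q , trans (lem (m̃ r) (δ r) q) (trans (cong (_* q) (mm r)) (ℤP.*-assoc (δ k) (m r) q))
        where
        lem : ∀ a b q → a * (b * q) ≡ b * a * q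
        lem = solve-∀
    ej : ∀ x → (∀ p → E x (e′ p) ≡ 0ℤ) → ∀ i → x i ≡ 0ℤ
    ej x z = einj x (λ p → old p (p ≟ k))
      where
      off0 : ∀ p → p ≢ k → E x (e p) ≡ 0ℤ
      off0 p np = trans (sym (E-congʳ F (E′.off-k p np))) (z p)
      Σ0 : ∑ (λ r → m̃ r * E x (e r)) ≡ 0ℤ
      Σ0 = sum-0 (λ r → t r (r ≟ k))
        where
        t : ∀ r → Dec (r ≡ k) → m̃ r * E x (e r) ≡ 0ℤ
        t r (yes refl) = cong (_* E x (e k)) m̃k
        t r (no nr) = trans (cong (m̃ r *_) (off0 r nr)) (ℤP.*-zeroʳ (m̃ r))
      old : ∀ p → Dec (p ≡ k) → E x (e p) ≡ 0ℤ
      old p (no np) = off0 p np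
      old p (yes refl) = trans (sym (ℤP.neg-involutive (E x (e k)))) (cong -_ (trans (sym (trans (cong (λ w → - E x (e k) + w) Σ0) (ℤP.+-identityʳ (- E x (e k))))) (trans (sym (Ek x)) (z k))))

-- Signs of the vectors e p

sum-≥two : ∀ {n} {f : Fin n → ℤ} i j → i ≢ j → (∀ l → 0ℤ ≤ f l) → f i + f j ≤ ∑ f
sum-≥two {n} {f} i j ne p = ≤by (∑ g) (sum-≥0 g≥0) eq
  where
  g : Fin n → ℤ
  g l = f l + - 1ℤ * (α i l * f l + α j l * f l)
  g≥0 : ∀ l → 0ℤ ≤ g l
  g≥0 l with l ≟ i | l ≟ j
  ... | yes refl | yes refl = ⊥-elim (ne refl)
  ... | yes refl | no _ = ℤP.≤-reflexive (sym (lem (f l)))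
    where
    lem : ∀ a → a + - 1ℤ * (1ℤ * a + 0ℤ * a) ≡ 0ℤ
    lem = solve-∀
  ... | no _ | yes refl = ℤP.≤-reflexive (sym (lem (f l)))
    where
    lem : ∀ a → a + - 1ℤ * (0ℤ * a + 1ℤ * a) ≡ 0ℤ
    lem = solve-∀
  ... | no _ | no _ = subst (0ℤ ≤_) (sym (lem (f l))) (p l)
    where
    lem : ∀ a → a + - 1ℤ * (0ℤ * a + 0ℤ * a) ≡ a
    lem = solve-∀
  eq : ∑ f - (f i + f j) ≡ ∑ g
  eq = begin
    ∑ f - (f i + f j)                                          ≡⟨ cong (λ w → ∑ f - w) (sym (cong₂ _+_ (sum-α f i) (sum-α f j))) ⟩
    ∑ f - (∑ (λ l → α i l * f l) + ∑ (λ l → α j l * f l))      ≡⟨ cong (λ w → ∑ f - w) (sym (sum-+ (λ l → α i l * f l) (λ l → α j l * f l))) ⟩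
    ∑ f - ∑ (λ l → α i l * f l + α j l * f l)                  ≡⟨ cong (λ w → ∑ f + w) (sym (ℤP.-1*i≡-i (∑ (λ l → α i l * f l + α j l * f l)))) ⟩
    ∑ f + - 1ℤ * ∑ (λ l → α i l * f l + α j l * f l)           ≡⟨ cong (λ w → ∑ f + w) (sym (sum-* (- 1ℤ) (λ l → α i l * f l + α j l * f l))) ⟩
    ∑ f + ∑ (λ l → - 1ℤ * (α i l * f l + α j l * f l))         ≡⟨ sym (sum-+ f (λ l → - 1ℤ * (α i l * f l + α j l * f l))) ⟩
    ∑ g ∎
    where open ≡-Reasoning

sum-≤two : ∀ {n} {f : Fin n → ℤ} i j → i ≢ j → (∀ l → l ≢ i → f l ≤ 0ℤ) → ∑ f ≤ f i + f j
sum-≤two {n} {f} i j ne p = ≤by (- ∑ f + (f i + f j)) (≥0 (sum-≥two i j ne g≥0)) (lem (∑ f) (f i + f j))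
  where
  g : Fin n → ℤ
  g l = α i l * f i + - f l
  g≥0 : ∀ l → 0ℤ ≤ g l
  g≥0 l with l ≟ i
  ... | yes refl = ℤP.≤-reflexive (sym (l1 (f l)))
    where
    l1 : ∀ a → 1ℤ * a + - a ≡ 0ℤ
    l1 = solve-∀
  ... | no nl = subst (0ℤ ≤_) (sym (trans (cong (_+ - f l) (ℤP.*-zeroˡ (f i))) (ℤP.+-identityˡ (- f l)))) (0≤-neg (p l nl))
  ∑g : ∑ g ≡ f i + - ∑ f
  ∑g = trans (sum-+ (λ l → α i l * f i) (λ l → - f l)) (cong₂ _+_ (sum-α (λ _ → f i) i) (sum-neg f))
  lem : ∀ a b → b - a ≡ - a + b
  lem = solve-∀
  ≥0 : g i + g j ≤ ∑ g → 0ℤ ≤ - ∑ f + (f i + f j)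
  ≥0 q = subst (0ℤ ≤_) (trans (cong₂ (λ x y → x - (y + g j)) ∑g gi) (trans (cong (λ w → f i + - ∑ f - (0ℤ + w)) gj) (l2 (f i) (f j) (∑ f)))) (0≤- q)
    where
    gi : g i ≡ 0ℤ
    gi = trans (cong (λ w → w * f i + - f i) (α-diag i)) (l3 (f i))
      where
      l3 : ∀ a → 1ℤ * a + - a ≡ 0ℤ
      l3 = solve-∀
    gj : g j ≡ - f j
    gj = trans (cong (λ w → w * f i + - f j) (α-off (≢-sym ne))) (ℤP.+-identityˡ (- f j))
    l2 : ∀ a b s → a + - s - (0ℤ + - b) ≡ - s + (a + b)
    l2 = solve-∀

⊔⊓-split : ∀ a → a ≡ (a ⊔ 0ℤ) + (a ⊓ 0ℤ)
⊔⊓-split (+ zero) = refl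
⊔⊓-split (+ suc m) = sym (ℤP.+-identityʳ (+ suc m))
⊔⊓-split -[1+ m ] = refl

⊔⊓-disj : ∀ a → (a ⊔ 0ℤ) * (a ⊓ 0ℤ) ≡ 0ℤ
⊔⊓-disj (+ zero) = refl
⊔⊓-disj (+ suc m) = ℤP.*-zeroʳ (+ suc m)
⊔⊓-disj -[1+ m ] = refl

module Signs {n} (𝓔 : EulerForm n) {c e b} (CS : CSeed 𝓔 c b) (ES : ESeed 𝓔 c e) where
  open EulerForm 𝓔
  open Euler 𝓔
  open CSeedFacts 𝓔 CS
  open ESeed ES

  -- The coefficients are the pairings with the dual vectors, integral by `ediv`, and `einj` kills
  -- the remainder. Thus the c-vectors form a basis of the lattice.
  expand : ∀ x → ∃ λ a → (∀ i → x i ≡ lincomb a c i) × (∀ q → E x (e q) ≡ - (δ q * a q))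
  expand x = a , (λ i → -‿0 (einj (λ i → x i - lincomb a c i) orth i)) , xe
    where
    open _∣ᶻ_
    a : Vect n
    a q = - quotient (ediv q x)
    xe : ∀ q → E x (e q) ≡ - (δ q * a q)
    xe q = trans (equality (ediv q x)) (lem (δ q) (quotient (ediv q x)))
      where
      lem : ∀ d q → d * q ≡ - (d * - q)
      lem = solve-∀
    ce : ∀ p → E (lincomb a c) (e p) ≡ - (δ p * a p)
    ce p = trans (E-lincombˡ F a c (e p)) (trans (sum-single (λ r → a r * E (c r) (e p)) p (λ r ne → trans (cong (a r *_) (pair-off r p ne)) (ℤP.*-zeroʳ (a r))))
      (trans (cong (a p *_) (pair-diag p)) (lem (a p) (δ p))))
      where
      lem : ∀ a d → a * - d ≡ - (d * a)
      lem = solve-∀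
    orth : ∀ p → E (λ i → x i - lincomb a c i) (e p) ≡ 0ℤ
    orth p = trans (E--ˡ F x (lincomb a c) (e p)) (trans (cong₂ _-_ (xe p) (ce p)) (ℤP.+-inverseʳ (- (δ p * a p))))

  c-nondegˡ : ∀ x → (∀ s → E x (c s) ≡ 0ℤ) → ∀ i → x i ≡ 0ℤ
  c-nondegˡ x z = E-def x (ℤP.≤-reflexive (let (a , ex , _) = expand x in
    trans (E-congʳ F ex) (trans (E-lincombʳ F x a c) (sum-0 (λ r → trans (cong (a r *_) (z r)) (ℤP.*-zeroʳ (a r)))))))

  c-nondegʳ : ∀ x → (∀ s → E (c s) x ≡ 0ℤ) → ∀ i → x i ≡ 0ℤ
  c-nondegʳ x z = E-def x (ℤP.≤-reflexive (let (a , ex , _) = expand x in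
    trans (E-congˡ F ex) (trans (E-lincombˡ F a c x) (sum-0 (λ r → trans (cong (a r *_) (z r)) (ℤP.*-zeroʳ (a r)))))))

  E-lincomb₂ : ∀ a a′ → E (lincomb a c) (lincomb a′ c) ≡ ∑ (λ q → ∑ (λ r → a q * (a′ r * M q r)))
  E-lincomb₂ a a′ = trans (E-lincombˡ F a c (lincomb a′ c)) (sum-cong (λ q → trans (cong (a q *_) (E-lincombʳ F (c q) a′ c)) (sym (sum-* (a q) (λ r → a′ r * M q r)))))

  lincomb-+ : ∀ a a₁ a₂ → (∀ q → a q ≡ a₁ q + a₂ q) → ∀ i → lincomb a c i ≡ lincomb a₁ c i + lincomb a₂ c i
  lincomb-+ a a₁ a₂ p i = trans (sum-cong (λ q → trans (cong (_* c q i) (p q)) (ℤP.*-distribʳ-+ (c q i) (a₁ q) (a₂ q)))) (sum-+ (λ q → a₁ q * c q i) (λ q → a₂ q * c q i))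

  -- Of the expansion of e k only the nonpositive coefficients at negative c's survive,
  -- since the complementary part y satisfies E y y ≤ 0.
  e-nonneg : ∀ k → Nonpos (c k) → Nonneg (e k)
  e-nonneg k neg i = subst (0ℤ ≤_) (sym ek≡) (sum-≥0 (λ q → term q (sign q)))
    where
    a : Vect n
    a = proj₁ (expand (e k))
    part₁ part₂ : ∀ {q} → Nonneg (c q) ⊎ Nonpos (c q) → ℤ → ℤ
    part₁ (inj₁ _) x = x
    part₁ (inj₂ _) x = x ⊔ 0ℤ
    part₂ (inj₁ _) x = 0ℤ
    part₂ (inj₂ _) x = x ⊓ 0ℤ
    parts : ∀ {q} (s : Nonneg (c q) ⊎ Nonpos (c q)) x → x ≡ part₁ s x + part₂ s x
    parts (inj₁ _) x = sym (ℤP.+-identityʳ x)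
    parts (inj₂ _) x = ⊔⊓-split x
    a₁ a₂ : Vect n
    a₁ q = part₁ (sign q) (a q)
    a₂ q = part₂ (sign q) (a q)
    y rest : Vect n
    y = lincomb a₁ c
    rest = lincomb a₂ c
    split : ∀ i → e k i ≡ y i + rest i
    split i = trans (proj₁ (proj₂ (expand (e k))) i) (lincomb-+ a a₁ a₂ (λ q → parts (sign q) (a q)) i)
    yek : E y (e k) ≤ 0ℤ
    yek = subst (_≤ 0ℤ) (sym (trans (E-lincombˡ F a₁ c (e k)) (sum-single (λ r → a₁ r * E (c r) (e k)) k (λ r ne → trans (cong (a₁ r *_) (pair-off r k ne)) (ℤP.*-zeroʳ (a₁ r))))))
      (*≤0 (k≥0 (sign k)) (subst (_≤ 0ℤ) (sym (pair-diag k)) (neg-≤0 (ℤP.<⇒≤ (δ>0 k)))))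
      where
      k≥0 : ∀ s → 0ℤ ≤ part₁ {k} s (a k)
      k≥0 (inj₁ p) = ⊥-elim (not-both k p neg)
      k≥0 (inj₂ _) = ℤP.i≤j⊔i (a k) 0ℤ
    -- Positive c against negative c contributes 0 by `pos-neg`. For two different negative c's the
    -- coefficients have opposite signs and the pairing is ≤ 0; on the diagonal the positive and the
    -- negative part of one number multiply to 0.
    yrest : 0ℤ ≤ E y rest
    yrest = subst (0ℤ ≤_) (sym (E-lincomb₂ a₁ a₂)) (sum-≥0 (λ q → sum-≥0 (λ r → t q r (sign q) (sign r))))
      where
      t : ∀ q r (s : Nonneg (c q) ⊎ Nonpos (c q)) (s′ : Nonneg (c r) ⊎ Nonpos (c r)) → 0ℤ ≤ part₁ s (a q) * (part₂ s′ (a r) * M q r)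
      t q r s (inj₁ _) = ℤP.≤-reflexive (sym (ℤP.*-zeroʳ (part₁ s (a q))))
      t q r (inj₁ p) (inj₂ p′) = ℤP.≤-reflexive (sym (trans (cong (λ w → a q * ((a r ⊓ 0ℤ) * w)) (pos-neg q r p p′)) (l (a q) (a r ⊓ 0ℤ))))
        where
        l : ∀ x y → x * (y * 0ℤ) ≡ 0ℤ
        l = solve-∀
      t q r (inj₂ p) (inj₂ p′) with q ≟ r
      ... | yes refl = ℤP.≤-reflexive (sym (trans (sym (ℤP.*-assoc (a q ⊔ 0ℤ) (a q ⊓ 0ℤ) (M q q))) (cong (_* M q q) (⊔⊓-disj (a q)))))
      ... | no ne = 0≤* (ℤP.i≤j⊔i (a q) 0ℤ) (subst (0ℤ ≤_) (l (a r ⊓ 0ℤ) (M q r)) (0≤* (0≤-neg (ℤP.i⊓j≤j (a r) 0ℤ)) (0≤-neg (neg-neg q r ne p p′))))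
        where
        l : ∀ x y → - x * - y ≡ x * y
        l = solve-∀
    yy : E y y ≤ 0ℤ
    yy = ℤP.≤-trans (≤by (E y rest) yrest (trans (cong (_- E y y) (trans (E-congʳ F split) (E-+ʳ F y y rest))) (l (E y y) (E y rest)))) yek
      where
      l : ∀ a b → a + b - a ≡ b
      l = solve-∀
    ek≡ : e k i ≡ rest i
    ek≡ = trans (split i) (trans (cong (_+ rest i) (E-def y yy i)) (ℤP.+-identityˡ (rest i)))
    term : ∀ q (s : Nonneg (c q) ⊎ Nonpos (c q)) → 0ℤ ≤ part₂ s (a q) * c q i
    term q (inj₁ _) = ℤP.≤-refl
    term q (inj₂ p) = subst (0ℤ ≤_) (l (a q ⊓ 0ℤ) (c q i)) (0≤* (0≤-neg (ℤP.i⊓j≤j (a q) 0ℤ)) (0≤-neg (p i)))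
      where
      l : ∀ x y → - x * - y ≡ x * y
      l = solve-∀

  -- f = Φ⁻¹ (e k) lies in the cone of the positive c's.
  record Cone (k : Fin n) : Set where
    field
      f t  : Vect n
      f-E  : ∀ y → E f y ≡ - E y (e k)
      f≡   : ∀ i → f i ≡ lincomb t c i
      t≥0  : ∀ r → 0ℤ ≤ t r
      t-pos : ∀ r → t r ≢ 0ℤ → Nonneg (c r)
      t-k  : t k ≡ 1ℤ

    f-c : ∀ q → q ≢ k → E f (c q) ≡ 0ℤ
    f-c q ne = trans (f-E (c q)) (cong -_ (pair-off q k ne))

    f-ck : E f (c k) ≡ δ k
    f-ck = trans (f-E (c k)) (trans (cong -_ (pair-diag k)) (ℤP.neg-involutive (δ k)))

    f-lin : ∀ y → E f y ≡ ∑ (λ r → t r * E (c r) y)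
    f-lin y = trans (E-congˡ F f≡) (E-lincombˡ F t c y)

    f-nonneg : Nonneg f
    f-nonneg i = subst (0ℤ ≤_) (sym (f≡ i)) (sum-≥0 term)
      where
      term : ∀ r → 0ℤ ≤ t r * c r i
      term r with t r ℤ.≟ 0ℤ
      ... | yes z = ℤP.≤-reflexive (sym (cong (_* c r i) z))
      ... | no nz = 0≤* (t≥0 r) (t-pos r nz i)

    f-norm : E f f ≡ δ k
    f-norm = trans (E-congʳ F f≡) (trans (E-lincombʳ F f t c) (trans (sum-single (λ r → t r * E f (c r)) k (λ r ne → trans (cong (t r *_) (f-c r ne)) (ℤP.*-zeroʳ (t r))))
      (trans (cong₂ _*_ t-k f-ck) (ℤP.*-identityˡ (δ k)))))

  -- As in `e-nonneg`, with the sides of E exchanged: the coefficients at negative c's and the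
  -- negative coefficients at positive c's make up a vector y with E y y ≤ E f y ≤ 0, so y vanishes.
  -- That the coefficient at `k` is exactly 1 is a separate argument, `TooBig`.
  cone-construction : ∀ k → Nonneg (c k) → Cone k
  cone-construction k ck≥0 = record { f = f ; t = t ; f-E = Ψ-spec (e k) ; f≡ = f≡ ; t≥0 = λ r → t0 r (sign r) ; t-pos = λ r → tp r (sign r) ; t-k = tk≡1 }
    where
    f : Vect n
    f = Ψ (e k)
    a : Vect n
    a = proj₁ (expand f)
    part₁ part₂ : ∀ {q} → Nonneg (c q) ⊎ Nonpos (c q) → ℤ → ℤ
    part₁ (inj₁ _) x = x ⊓ 0ℤ
    part₁ (inj₂ _) x = x
    part₂ (inj₁ _) x = x ⊔ 0ℤ
    part₂ (inj₂ _) x = 0ℤ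
    parts : ∀ {q} (s : Nonneg (c q) ⊎ Nonpos (c q)) x → x ≡ part₁ s x + part₂ s x
    parts (inj₁ _) x = trans (⊔⊓-split x) (ℤP.+-comm (x ⊔ 0ℤ) (x ⊓ 0ℤ))
    parts (inj₂ _) x = sym (ℤP.+-identityʳ x)
    a₁ t : Vect n
    a₁ q = part₁ (sign q) (a q)
    t q = part₂ (sign q) (a q)
    t0 : ∀ r (s : Nonneg (c r) ⊎ Nonpos (c r)) → 0ℤ ≤ part₂ s (a r)
    t0 r (inj₁ _) = ℤP.i≤j⊔i (a r) 0ℤ
    t0 r (inj₂ _) = ℤP.≤-refl
    tp : ∀ r (s : Nonneg (c r) ⊎ Nonpos (c r)) → part₂ s (a r) ≢ 0ℤ → Nonneg (c r)
    tp r (inj₁ p) _ = p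
    tp r (inj₂ _) nz = ⊥-elim (nz refl)
    t≥0 : ∀ r → 0ℤ ≤ t r
    t≥0 r = t0 r (sign r)
    t-pos : ∀ r → t r ≢ 0ℤ → Nonneg (c r)
    t-pos r = tp r (sign r)
    y rest : Vect n
    y = lincomb a₁ c
    rest = lincomb t c
    split : ∀ i → f i ≡ y i + rest i
    split i = trans (proj₁ (proj₂ (expand f)) i) (lincomb-+ a a₁ t (λ q → parts (sign q) (a q)) i)
    f-c : ∀ q → q ≢ k → E f (c q) ≡ 0ℤ
    f-c q ne = trans (Ψ-spec (e k) (c q)) (cong -_ (pair-off q k ne))
    f-ck : E f (c k) ≡ δ k
    f-ck = trans (Ψ-spec (e k) (c k)) (trans (cong -_ (pair-diag k)) (ℤP.neg-involutive (δ k)))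
    fy : E f y ≤ 0ℤ
    fy = subst (_≤ 0ℤ) (sym (trans (E-lincombʳ F f a₁ c) (trans (sum-single (λ r → a₁ r * E f (c r)) k (λ r ne → trans (cong (a₁ r *_) (f-c r ne)) (ℤP.*-zeroʳ (a₁ r)))) (cong (a₁ k *_) f-ck))))
      (*≤0′ (k≤0 (sign k)) (ℤP.<⇒≤ (δ>0 k)))
      where
      k≤0 : ∀ s → part₁ {k} s (a k) ≤ 0ℤ
      k≤0 (inj₁ _) = ℤP.i⊓j≤j (a k) 0ℤ
      k≤0 (inj₂ p) = ⊥-elim (not-both k ck≥0 p)
    resty : 0ℤ ≤ E rest y
    resty = subst (0ℤ ≤_) (sym (E-lincomb₂ t a₁)) (sum-≥0 (λ q → sum-≥0 (λ r → w q r (sign q) (sign r))))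
      where
      w : ∀ q r (s : Nonneg (c q) ⊎ Nonpos (c q)) (s′ : Nonneg (c r) ⊎ Nonpos (c r)) → 0ℤ ≤ part₂ s (a q) * (part₁ s′ (a r) * M q r)
      w q r (inj₂ _) s′ = ℤP.≤-refl
      w q r (inj₁ p) (inj₂ p′) = ℤP.≤-reflexive (sym (trans (cong (λ w → (a q ⊔ 0ℤ) * (a r * w)) (pos-neg q r p p′)) (l (a q ⊔ 0ℤ) (a r))))
        where
        l : ∀ x y → x * (y * 0ℤ) ≡ 0ℤ
        l = solve-∀
      w q r (inj₁ p) (inj₁ p′) with q ≟ r
      ... | yes refl = ℤP.≤-reflexive (sym (trans (sym (ℤP.*-assoc (a q ⊔ 0ℤ) (a q ⊓ 0ℤ) (M q q))) (cong (_* M q q) (⊔⊓-disj (a q)))))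
      ... | no ne = 0≤* (ℤP.i≤j⊔i (a q) 0ℤ) (subst (0ℤ ≤_) (l (a r ⊓ 0ℤ) (M q r)) (0≤* (0≤-neg (ℤP.i⊓j≤j (a r) 0ℤ)) (0≤-neg (pos-pos q r ne p p′))))
        where
        l : ∀ x y → - x * - y ≡ x * y
        l = solve-∀
    yy : E y y ≤ 0ℤ
    yy = ℤP.≤-trans (≤by (E rest y) resty (trans (cong (_- E y y) (trans (E-congˡ F split) (E-+ˡ F y rest y))) (l (E y y) (E rest y)))) fy
      where
      l : ∀ a b → a + b - a ≡ b
      l = solve-∀
    f≡ : ∀ i → f i ≡ lincomb t c i
    f≡ i = trans (split i) (trans (cong (_+ rest i) (E-def y yy i)) (ℤP.+-identityˡ (rest i)))
    ff : E f f ≡ t k * δ k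
    ff = trans (E-congʳ F f≡) (trans (E-lincombʳ F f t c) (trans (sum-single (λ r → t r * E f (c r)) k (λ r ne → trans (cong (t r *_) (f-c r ne)) (ℤP.*-zeroʳ (t r)))) (cong (t k *_) f-ck)))
    col : ∀ q → E f (c q) ≡ ∑ (λ r → t r * M r q)
    col q = trans (E-congˡ F f≡) (E-lincombˡ F t c (c q))
    tk>0 : 0ℤ < t k
    tk>0 with t k ℤ.≟ 0ℤ
    ... | no nz = ≤∧≢⇒< (t≥0 k) (≢-sym nz)
    ... | yes z = ⊥-elim (ℤP.<-irrefl (trans (sym (E-0ˡ F (c k) (E-def f (ℤP.≤-reflexive (trans ff (cong (_* δ k) z)))))) f-ck) (δ>0 k))
    -- If t k > 1, every r in the support of t has a neighbour r′ in the support with M r′ r ≤ − δ r,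
    -- so the sum of c r over the support has norm ≤ 0.
    module TooBig (tk>1 : 1ℤ < t k) where
      -- E f (c q) is smaller than its diagonal term t q · δ q: it equals δ k when q = k, where t k
      -- > 1, and 0 otherwise. Hence some off-diagonal term is negative.
      predecessor : ∀ q → t q ≢ 0ℤ → ∃ λ r → r ≢ q × t r ≢ 0ℤ × M r q < 0ℤ
      predecessor q nz = found (sum-pos-ex {f = g} g>0)
        where
        tq>0 : 0ℤ < t q
        tq>0 = ≤∧≢⇒< (t≥0 q) (≢-sym nz)
        g : Vect n
        g r = α q r * (t r * M r q) + - (t r * M r q)
        ∑g : ∑ g ≡ t q * δ q - E f (c q)
        ∑g = trans (sum-+ (λ r → α q r * (t r * M r q)) (λ r → - (t r * M r q))) (cong₂ _+_ (trans (sum-α (λ r → t r * M r q) q) (cong (t q *_) (M-diag q))) (trans (sum-neg (λ r → t r * M r q)) (cong -_ (sym (col q)))))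
        g>0 : 0ℤ < ∑ g
        g>0 with q ≟ k
        ... | yes refl = subst (0ℤ <_) (sym (trans ∑g (trans (cong (λ w → t k * δ k - w) f-ck) (l (t k) (δ k))))) (0<* (0<- tk>1) (δ>0 k))
          where
          l : ∀ t d → t * d - d ≡ (t - 1ℤ) * d
          l = solve-∀
        ... | no ne = subst (0ℤ <_) (sym (trans ∑g (trans (cong (λ w → t q * δ q - w) (f-c q ne)) (ℤP.+-identityʳ (t q * δ q))))) (0<* tq>0 (δ>0 q))
        found : (∃ λ r → 0ℤ < g r) → ∃ λ r → r ≢ q × t r ≢ 0ℤ × M r q < 0ℤ
        found (r , p) = r , r≢q , tr≢0 , Mneg
          where
          r≢q : r ≢ q
          r≢q refl = ℤP.<-irrefl (sym (trans (cong (λ w → w * (t r * M r r) + - (t r * M r r)) (α-diag r)) (l (t r * M r r)))) p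
            where
            l : ∀ x → 1ℤ * x + - x ≡ 0ℤ
            l = solve-∀
          g≡ : g r ≡ - (t r * M r q)
          g≡ = trans (cong (λ w → w * (t r * M r q) + - (t r * M r q)) (α-off r≢q)) (ℤP.+-identityˡ (- (t r * M r q)))
          tr≢0 : t r ≢ 0ℤ
          tr≢0 z = ℤP.<-irrefl (sym (trans g≡ (cong (λ w → - (w * M r q)) z))) p
          Mneg : M r q < 0ℤ
          Mneg = ≤∧≢⇒< (pos-pos r q r≢q (t-pos r tr≢0) (t-pos q nz)) (λ z → ℤP.<-irrefl (sym (trans g≡ (trans (cong (λ w → - (t r * w)) z) (cong -_ (ℤP.*-zeroʳ (t r)))))) p)
      χ : Vect n
      χ r = if ⌊ t r ℤ.≟ 0ℤ ⌋ then 0ℤ else 1ℤ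
      χ-cases : ∀ r → (t r ≡ 0ℤ × χ r ≡ 0ℤ) ⊎ (t r ≢ 0ℤ × χ r ≡ 1ℤ)
      χ-cases r with t r ℤ.≟ 0ℤ
      ... | yes z = inj₁ (z , refl)
      ... | no nz = inj₂ (nz , refl)
      σ : Vect n
      σ = lincomb χ c
      vc : ∀ q → t q ≢ 0ℤ → E σ (c q) ≤ 0ℤ
      vc q nz = subst (_≤ 0ℤ) (sym (E-lincombˡ F χ c (c q))) (bound (predecessor q nz) (χ-cases q))
        where
        others : ∀ r → r ≢ q → χ r * M r q ≤ 0ℤ
        others r ne with χ-cases r
        ... | inj₁ (_ , z) = ℤP.≤-reflexive (cong (_* M r q) z)
        ... | inj₂ (nz′ , z) = subst (λ w → w * M r q ≤ 0ℤ) (sym z) (*≤0 {1ℤ} (+≤+ ℕ.z≤n) (pos-pos r q ne (t-pos r nz′) (t-pos q nz)))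
        bound : (∃ λ r → r ≢ q × t r ≢ 0ℤ × M r q < 0ℤ) → (t q ≡ 0ℤ × χ q ≡ 0ℤ) ⊎ (t q ≢ 0ℤ × χ q ≡ 1ℤ) → ∑ (λ r → χ r * M r q) ≤ 0ℤ
        bound _ (inj₁ (z , _)) = ⊥-elim (nz z)
        bound (r , ne , tr , neg) (inj₂ (_ , χq)) = ℤP.≤-trans (sum-≤two {f = λ r → χ r * M r q} q r (≢-sym ne) others) (two (χ-cases r))
          where
          two : (t r ≡ 0ℤ × χ r ≡ 0ℤ) ⊎ (t r ≢ 0ℤ × χ r ≡ 1ℤ) → χ q * M q q + χ r * M r q ≤ 0ℤ
          two (inj₁ (z , _)) = ⊥-elim (tr z)
          two (inj₂ (_ , χr)) = 0≤neg⇒≤0 (subst (0ℤ ≤_) (sym (trans (cong₂ (λ x y → - (x * M q q + y * M r q)) χq χr) (trans (cong (λ w → - (1ℤ * w + 1ℤ * M r q)) (M-diag q)) (l (δ q) (M r q)))))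
            (0≤- (∣-pos (δ>0 q) (∣-neg (divʳ (root q) (c r))) (ℤP.neg-mono-< neg))))
            where
            l : ∀ d m → - (1ℤ * d + 1ℤ * m) ≡ - m - d
            l = solve-∀
      vv : E σ σ ≤ 0ℤ
      vv = subst (_≤ 0ℤ) (sym (E-lincombʳ F σ χ c)) (sum-≤0 term)
        where
        term : ∀ q → χ q * E σ (c q) ≤ 0ℤ
        term q with χ-cases q
        ... | inj₁ (_ , z) = ℤP.≤-reflexive (cong (_* E σ (c q)) z)
        ... | inj₂ (nz , z) = subst (λ w → w * E σ (c q) ≤ 0ℤ) (sym z) (*≤0 {1ℤ} (+≤+ ℕ.z≤n) (vc q nz))
      absurd : ⊥
      absurd = not-both k ck≥0 (λ i → ℤP.≤-trans (ck≤σ i) (ℤP.≤-reflexive (E-def σ vv i)))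
        where
        term : ∀ i r → 0ℤ ≤ χ r * c r i
        term i r with χ-cases r
        ... | inj₁ (_ , z) = ℤP.≤-reflexive (sym (cong (_* c r i) z))
        ... | inj₂ (nz , z) = 0≤* (subst (0ℤ ≤_) (sym z) (+≤+ ℕ.z≤n)) (t-pos r nz i)
        χk : χ k ≡ 1ℤ
        χk with χ-cases k
        ... | inj₁ (z , _) = ⊥-elim (ℤP.<-irrefl (sym z) tk>0)
        ... | inj₂ (_ , z) = z
        ck≤σ : ∀ i → c k i ≤ σ i
        ck≤σ i = subst (_≤ σ i) (trans (cong (_* c k i) χk) (ℤP.*-identityˡ (c k i))) (sum-≥term {f = λ r → χ r * c r i} (term i) k)
    tk≡1 : t k ≡ 1ℤ
    tk≡1 = ℤP.≤-antisym (ℤP.≮⇒≥ TooBig.absurd) (0<⇒1≤ tk>0)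

  opaque
    cone : ∀ k → Nonneg (c k) → Cone k
    cone = cone-construction

module _ {n} (𝓔 : EulerForm n) where
  open EulerForm 𝓔
  open Euler 𝓔

  -- x = −I_i, the vector attached to the initial cluster variable x_i.
  record InitAt (d : ℤ) (x : Vect n) (i : Fin n) : Set where
    field
      size : d ≡ δ i
      coord : ∀ y → E y x ≡ - (δ i * y i)

  data Status (d : ℤ) (x : Vect n) : Set where
    noninitial : Nonneg x → Status d x
    initial    : ∀ i → InitAt d x i → Status d x

  open InitAt public

  InitAt-unique : ∀ {d d′ x i j} → InitAt d x i → InitAt d′ x j → i ≡ j
  InitAt-unique {i = i} {j} p q with i ≟ j
  ... | yes e = e
  ... | no ne = ⊥-elim (<⇒⊥ (δ>0 i) (ℤP.≤-reflexive (trans (sym (trans (cong (δ i *_) (α-diag i)) (ℤP.*-identityʳ (δ i)))) (ℤP.neg-injective (trans (sym (coord p (α i))) (trans (coord q (α i)) (cong -_ (trans (cong (δ j *_) (α-off (≢-sym ne))) (ℤP.*-zeroʳ (δ j))))))))))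

  E-nonneg-coord : ∀ {d x i} → InitAt d x i → Nonneg x → x i ≡ 0ℤ
  E-nonneg-coord {x = x} {i} p x≥0 = ℤP.≤-antisym (0≤neg⇒≤0 (*-cancel-0≤ (δ>0 i) (subst (0ℤ ≤_) (trans (coord p x) (ℤP.neg-distribʳ-* (δ i) (x i))) (E≥0 x)))) (x≥0 i)

  -- E x x = -δ i · x i would be both ≥ 0 and ≤ 0, so x = 0, against E (α i) x = -δ i.
  not-nonneg : ∀ {d x i} → InitAt d x i → Nonneg x → ⊥
  not-nonneg {x = x} {i} p x≥0 = <⇒⊥ (δ>0 i) (ℤP.≤-reflexive (trans (sym (trans (cong (δ i *_) (α-diag i)) (ℤP.*-identityʳ (δ i)))) (ℤP.neg-injective (trans (sym (coord p (α i))) (E-0ʳ F (α i) x0)))))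
    where
    x0 : ∀ l → x l ≡ 0ℤ
    x0 = E-def x (ℤP.≤-reflexive (trans (coord p x) (cong -_ (trans (cong (δ i *_) (E-nonneg-coord p x≥0)) (ℤP.*-zeroʳ (δ i))))))

module Statuses {n} (𝓔 : EulerForm n) {c e b} (CS : CSeed 𝓔 c b) (ES : ESeed 𝓔 c e) where
  open EulerForm 𝓔
  open Euler 𝓔
  open CSeedFacts 𝓔 CS
  open ESeed ES
  open Signs 𝓔 CS ES public

  module Classify (k : Fin n) (ck≥0 : Nonneg (c k)) where
    open Cone (cone k ck≥0)

    f-div : ∀ y → δ k ∣ᶻ E f y
    f-div y = ∣-resp (sym (f-E y)) (∣-neg (ediv k y))

    ek≡Φf : ∀ i → e k i ≡ Φ f i
    ek≡Φf i = -‿0 (nondegʳ (λ i → e k i - Φ f i) orth i)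
      where
      orth : ∀ y → E y (λ i → e k i - Φ f i) ≡ 0ℤ
      orth y = trans (E--ʳ F y (e k) (Φ f)) (trans (cong (λ w → E y (e k) - w) (trans (Φ-spec y f) (trans (cong -_ (f-E y)) (ℤP.neg-involutive (E y (e k)))))) (ℤP.+-inverseʳ (E y (e k))))

    ek-root : IsRoot (δ k) (e k)
    ek-root = record
      { norm = trans (E-cong F ek≡Φf ek≡Φf) (trans (Φ-iso f f) f-norm)
      ; divˡ = divˡ-from-divʳ (ediv k)
      ; divʳ = ediv k }

    -- `Truncated` makes every E f (α l) nonnegative, and each is a multiple of δ k, while the sum
    -- of f l · E f (α l) is E f f = δ k. So a single vertex i carries the whole sum, with f i = 1.
    -- This means f = P_i, and e k = -I_i.
    module Negative (neg : Nonpos (e k)) where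
      module T = Truncated {P = λ _ → ⊥} {δ k} {f} {λ i → - e k i} (δ>0 k) f-nonneg (λ i → 0≤-neg (neg i)) (λ _ ()) (λ _ ())
        (λ x _ → trans (f-E x) (sym (E-negʳ F x (e k)))) f-norm (λ x _ → f-div x)

      φ : Vect n
      φ l = f l * E f (α l)

      φ≥0 : ∀ l → 0ℤ ≤ φ l
      φ≥0 l = 0≤* (f-nonneg l) (T.value≥0 l (λ ()))

      ∑φ : ∑ φ ≡ δ k
      ∑φ = trans (sym (E-sumʳ F f f)) f-norm

      at : (∃ λ i → 0ℤ < φ i) → Status 𝓔 (δ k) (e k)
      at (i , p) = initial i (record { size = δ≡ ; coord = λ y → trans (sym (ℤP.neg-involutive (E y (e k)))) (cong -_ (trans (sym (f-E y)) (fy y))) })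
        where
        Efi>0 : 0ℤ < E f (α i)
        Efi>0 = ≤∧≢⇒< (T.value≥0 i (λ ())) (λ z → ℤP.<-irrefl (sym (trans (cong (f i *_) (sym z)) (ℤP.*-zeroʳ (f i)))) p)
        fi>0 : 0ℤ < f i
        fi>0 = ≤∧≢⇒< (f-nonneg i) (λ z → ℤP.<-irrefl (cong (_* E f (α i)) z) p)
        δ≤Ef : δ k ≤ E f (α i)
        δ≤Ef = ∣-pos (δ>0 k) (f-div (α i)) Efi>0
        φi≤δ : φ i ≤ δ k
        φi≤δ = subst (φ i ≤_) ∑φ (sum-≥term φ≥0 i)
        δ≤φi : δ k ≤ φ i
        δ≤φi = ≤by ((f i - 1ℤ) * E f (α i) + (E f (α i) - δ k)) (0≤+ (0≤* (0≤- (0<⇒1≤ fi>0)) (ℤP.<⇒≤ Efi>0)) (0≤- δ≤Ef)) (l (f i) (E f (α i)) (δ k))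
          where
          l : ∀ a b d → a * b - d ≡ (a - 1ℤ) * b + (b - d)
          l = solve-∀
        Efi≤δ : E f (α i) ≤ δ k
        Efi≤δ = ≤by ((f i - 1ℤ) * E f (α i) + (δ k - φ i)) (0≤+ (0≤* (0≤- (0<⇒1≤ fi>0)) (ℤP.<⇒≤ Efi>0)) (0≤- φi≤δ)) (l (f i) (E f (α i)) (δ k))
          where
          l : ∀ a b d → d - b ≡ (a - 1ℤ) * b + (d - a * b)
          l = solve-∀
        Efi : E f (α i) ≡ δ k
        Efi = ℤP.≤-antisym Efi≤δ δ≤Ef
        fi≡1 : f i ≡ 1ℤ
        fi≡1 = *-cancelˡ (δ>0 k) (trans (ℤP.*-comm (δ k) (f i)) (trans (trans (cong (f i *_) (sym Efi)) (ℤP.≤-antisym φi≤δ δ≤φi)) (sym (ℤP.*-identityʳ (δ k)))))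
        δ≡ : δ k ≡ δ i
        δ≡ with T.value i (λ ())
        ... | inj₁ q = trans (sym Efi) (trans q (trans (cong (δ i *_) fi≡1) (ℤP.*-identityʳ (δ i))))
        ... | inj₂ (q , _) = ⊥-elim (ℤP.<-irrefl (sym q) Efi>0)
        Ef0 : ∀ l → l ≢ i → E f (α l) ≡ 0ℤ
        Ef0 l ne with T.value l (λ ())
        ... | inj₂ (q , _) = q
        ... | inj₁ q = trans q (trans (cong (δ l *_) fl0) (ℤP.*-zeroʳ (δ l)))
          where
          φl0 : φ l ≤ 0ℤ
          φl0 = ≤by (δ k - (φ i + φ l) + (φ i - δ k)) (0≤+ (0≤- (subst (φ i + φ l ≤_) ∑φ (sum-≥two {f = φ} i l (≢-sym ne) φ≥0))) (0≤- δ≤φi)) (lem (φ i) (φ l) (δ k))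
            where
            lem : ∀ a b d → 0ℤ - b ≡ d - (a + b) + (a - d)
            lem = solve-∀
          fl0 : f l ≡ 0ℤ
          fl0 with f l ℤ.≟ 0ℤ
          ... | yes z = z
          ... | no nz = ⊥-elim (<⇒⊥ (0<* fl>0 (subst (0ℤ <_) (sym q) (0<* (δ>0 l) fl>0))) φl0)
            where
            fl>0 : 0ℤ < f l
            fl>0 = ≤∧≢⇒< (f-nonneg l) (≢-sym nz)
        fy : ∀ y → E f y ≡ δ i * y i
        fy y = trans (E-sumʳ F f y) (trans (sum-single (λ l → y l * E f (α l)) i (λ l ne → trans (cong (y l *_) (Ef0 l ne)) (ℤP.*-zeroʳ (y l))))
          (trans (ℤP.*-comm (y i) (E f (α i))) (cong (_* y i) (trans Efi δ≡))))

      result : Status 𝓔 (δ k) (e k)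
      result = at (sum-pos-ex {f = φ} (subst (0ℤ <_) (sym ∑φ) (δ>0 k)))

    status⁺ : Status 𝓔 (δ k) (e k)
    status⁺ = [ noninitial , Negative.result ]′ (root-sign (δ>0 k) ek-root)

  opaque
   status : ∀ k → Status 𝓔 (δ k) (e k)
   status k = [ Classify.status⁺ k , (λ p → noninitial (e-nonneg k p)) ]′ (sign k)

  Init : Fin n → Fin n → Set
  Init p i = InitAt 𝓔 (δ p) (e p) i

  init-c : ∀ {p i} → Init p i → c p i ≡ 1ℤ
  init-c {p} {i} I = *-cancelˡ (δ>0 i) (trans (ℤP.neg-injective (trans (sym (coord I (c p))) (trans (pair-diag p) (cong -_ (size I))))) (sym (ℤP.*-identityʳ (δ i))))

  init-c-off : ∀ {p i q} → Init p i → q ≢ p → c q i ≡ 0ℤ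
  init-c-off {p} {i} {q} I ne = *-cancel-0 (δ>0 i) (ℤP.neg-injective (trans (sym (coord I (c q))) (pair-off q p ne)))

  init-pos : ∀ {p i} → Init p i → Nonneg (c p)
  init-pos {p} {i} I = [ (λ q → q) , (λ q → ⊥-elim (<⇒⊥ (+<+ (ℕ.s≤s ℕ.z≤n)) (subst (_≤ 0ℤ) (init-c I) (q i)))) ]′ (sign p)

  init-inj : ∀ {p q i} → Init p i → Init q i → p ≡ q
  init-inj {p} {q} {i} I J with p ≟ q
  ... | yes e = e
  ... | no ne with trans (sym (init-c I)) (init-c-off J ne)
  ...   | ()

  module _ {p i} (I : Init p i) where
    open Cone (cone p (init-pos I))

    cone-coord : ∀ y → E f y ≡ δ i * y i
    cone-coord y = trans (f-E y) (trans (cong -_ (coord I y)) (ℤP.neg-involutive (δ i * y i)))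

    cone-e : ∀ q → - (δ q * t q) ≡ δ i * e q i
    cone-e q = trans (sym (trans (f-lin (e q)) (trans (sum-single (λ r → t r * E (c r) (e q)) q (λ r ne → trans (cong (t r *_) (pair-off r q ne)) (ℤP.*-zeroʳ (t r))))
      (trans (cong (t q *_) (pair-diag q)) (lem (t q) (δ q)))))) (cone-coord (e q))
      where
      lem : ∀ a b → a * - b ≡ - (b * a)
      lem = solve-∀

    -- The cone vector belonging to p is the projective at i. Pairing it with e q gives δ i · e q i
    -- = -δ q · t q, which is ≤ 0. It expresses that a variable sharing a cluster with x_i has no
    -- x_i in its denominator.
    compat : ∀ {q} → Nonneg (e q) → e q i ≡ 0ℤ
    compat {q} p≥0 = ℤP.≤-antisym (0≤neg⇒≤0 (*-cancel-0≤ (δ>0 i) (subst (0ℤ ≤_) (trans (sym (ℤP.neg-involutive (δ q * t q))) (trans (cong -_ (cone-e q)) (ℤP.neg-distribʳ-* (δ i) (e q i)))) (0≤* (ℤP.<⇒≤ (δ>0 q)) (t≥0 q))))) (p≥0 i)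

    cone-t : ∀ {q} → Nonneg (e q) → t q ≡ 0ℤ
    cone-t {q} p≥0 = *-cancel-0 (δ>0 q) (ℤP.neg-injective (trans (cone-e q) (trans (cong (δ i *_) (compat p≥0)) (ℤP.*-zeroʳ (δ i)))))

    -- For positive c s the cone vector f of p satisfies 0 = E f (c s), the sum of t r · M r s. The
    -- coefficient t s vanishes by `cone-t` and all other terms are ≤ 0, so each is 0; at r = p the
    -- coefficient is 1.
    M-init : ∀ {s} → Nonneg (e s) → M p s ≡ 0ℤ
    M-init {s} es≥0 = [ at-pos , pos-neg p s (init-pos I) ]′ (sign s)
      where
      s≢p : s ≢ p
      s≢p refl = not-nonneg 𝓔 I es≥0
      at-pos : Nonneg (c s) → M p s ≡ 0ℤ
      at-pos cs≥0 = ℤP.neg-injective (trans (sym (trans (cong (λ w → - (w * M p s)) t-k) (cong -_ (ℤP.*-identityˡ (M p s))))) (sum-terms-0 {f = λ r → - (t r * M r s)} term total p))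
        where
        term : ∀ r → 0ℤ ≤ - (t r * M r s)
        term r with r ≟ s
        ... | yes refl = ℤP.≤-reflexive (sym (cong (λ w → - (w * M r r)) (cone-t es≥0)))
        ... | no ne with t r ℤ.≟ 0ℤ
        ...   | yes z = ℤP.≤-reflexive (sym (cong (λ w → - (w * M r s)) z))
        ...   | no nz = 0≤-neg (*≤0 (t≥0 r) (pos-pos r s ne (t-pos r nz) cs≥0))
        total : ∑ (λ r → - (t r * M r s)) ≤ 0ℤ
        total = ℤP.≤-reflexive (trans (sum-neg (λ r → t r * M r s)) (cong -_ (trans (sym (f-lin (c s))) (f-c s s≢p))))

  -- Dually to M-init: c q is a combination of the projectives P_j with −I_j among the e's.
  init-orth : ∀ {q j} → Init q j → ∀ x → (∀ p i → Init p i → x i ≡ 0ℤ) → E (c q) x ≡ 0ℤ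
  init-orth {q} {j} I x ox = trans (E-congˡ F (λ i → -‿0 (c-nondegˡ (λ i → c q i - lincomb κ′ fs i) orth i)))
    (trans (E-lincombˡ F κ′ fs x) (sum-0 (λ r → term r (status r))))
    where
    fs : Fin n → Vect n
    fs r = Ψ (e r)
    fs-E : ∀ r y → E (fs r) y ≡ - E y (e r)
    fs-E r y = Ψ-spec (e r) y
    coef : ∀ {r} → Status 𝓔 (δ r) (e r) → ℤ → ℤ
    coef (noninitial _) k = 0ℤ
    coef (initial _ _) k = k
    -- The coefficient is M q r / δ r at initial r. At the other r it may be set to 0, because M q r
    -- vanishes there by `M-init`.
    κ′ : Vect n
    κ′ r = coef (status r) (_∣ᶻ_.quotient (divʳ (root r) (c q)))
    κM : ∀ r → κ′ r * δ r ≡ M q r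
    κM r with status r
    ... | noninitial p = sym (M-init I p)
    ... | initial _ _ = trans (ℤP.*-comm _ (δ r)) (sym (_∣ᶻ_.equality (divʳ (root r) (c q))))
    orth : ∀ s → E (λ i → c q i - lincomb κ′ fs i) (c s) ≡ 0ℤ
    orth s = trans (E--ˡ F (c q) (lincomb κ′ fs) (c s)) (trans (cong (λ w → M q s - w) (trans (E-lincombˡ F κ′ fs (c s)) (trans (sum-single (λ r → κ′ r * E (fs r) (c s)) s (λ r ne → trans (cong (κ′ r *_) (trans (fs-E r (c s)) (cong -_ (pair-off s r (≢-sym ne))))) (ℤP.*-zeroʳ (κ′ r))))
      (trans (cong (κ′ s *_) (trans (fs-E s (c s)) (trans (cong -_ (pair-diag s)) (ℤP.neg-involutive (δ s))))) (κM s))))) (ℤP.+-inverseʳ (M q s)))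
    term : ∀ r (st : Status 𝓔 (δ r) (e r)) → coef st (_∣ᶻ_.quotient (divʳ (root r) (c q))) * E (fs r) x ≡ 0ℤ
    term r (noninitial _) = refl
    term r (initial i J) = trans (cong (_∣ᶻ_.quotient (divʳ (root r) (c q)) *_) (trans (fs-E r x) (trans (cong -_ (coord J x)) (trans (ℤP.neg-involutive (δ i * x i)) (trans (cong (δ i *_) (ox r i J)) (ℤP.*-zeroʳ (δ i))))))) (ℤP.*-zeroʳ (_∣ᶻ_.quotient (divʳ (root r) (c q))))

-- Exchange relations for the vectors e p

-- This turns out to be the vector of degrees of the cluster variable in the y_l (`fval`).
plus : ∀ {n} {𝓔 : EulerForm n} {d x} → Status 𝓔 d x → Vect n
plus {x = x} (noninitial _) = x
plus (initial _ _) = 0v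

-- The denominator vector: x itself, or −α_i for the initial variable x_i.
den : ∀ {n} {𝓔 : EulerForm n} {d x} → Status 𝓔 d x → Vect n
den {x = x} (noninitial _) = x
den (initial i _) l = - α i l

module _ {n} (𝓔 : EulerForm n) where
  open EulerForm 𝓔
  open Euler 𝓔

  plus-nonneg : ∀ {d x} (s : Status 𝓔 d x) → Nonneg x → ∀ l → plus s l ≡ x l
  plus-nonneg (noninitial _) p l = refl
  plus-nonneg (initial i I) p l = ⊥-elim (not-nonneg 𝓔 I p)

  den-nonneg : ∀ {d x} (s : Status 𝓔 d x) → Nonneg x → ∀ l → den s l ≡ x l
  den-nonneg (noninitial _) p l = refl
  den-nonneg (initial i I) p l = ⊥-elim (not-nonneg 𝓔 I p)

  InitAt-resp : ∀ {d x x′ i} → (∀ l → x l ≡ x′ l) → InitAt 𝓔 d x i → InitAt 𝓔 d x′ i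
  InitAt-resp p I = record { size = size I ; coord = λ y → trans (sym (E-congʳ F p)) (coord I y) }

  plus-unique : ∀ {d x x′} (s : Status 𝓔 d x) (s′ : Status 𝓔 d x′) → (∀ l → x l ≡ x′ l) → ∀ l → plus s l ≡ plus s′ l
  plus-unique (noninitial _) (noninitial _) p l = p l
  plus-unique (noninitial q) (initial _ I) p l = ⊥-elim (not-nonneg 𝓔 I (λ l → subst (0ℤ ≤_) (p l) (q l)))
  plus-unique (initial _ I) (noninitial q) p l = ⊥-elim (not-nonneg 𝓔 I (λ l → subst (0ℤ ≤_) (sym (p l)) (q l)))
  plus-unique (initial _ _) (initial _ _) p l = refl

  den-unique : ∀ {d x x′} (s : Status 𝓔 d x) (s′ : Status 𝓔 d x′) → (∀ l → x l ≡ x′ l) → ∀ l → den s l ≡ den s′ l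
  den-unique (noninitial _) (noninitial _) p l = p l
  den-unique (noninitial q) (initial _ I) p l = ⊥-elim (not-nonneg 𝓔 I (λ l → subst (0ℤ ≤_) (p l) (q l)))
  den-unique (initial _ I) (noninitial q) p l = ⊥-elim (not-nonneg 𝓔 I (λ l → subst (0ℤ ≤_) (sym (p l)) (q l)))
  den-unique (initial _ I) (initial _ 𝓙) p l = cong (λ i → - α i l) (InitAt-unique 𝓔 (InitAt-resp p I) 𝓙)

module ExchangeVectors {n} (𝓔 : EulerForm n) {c e b} (CS : CSeed 𝓔 c b) (ES : ESeed 𝓔 c e) (k : Fin n) where
  open EulerForm 𝓔
  open Euler 𝓔
  open CSeedFacts 𝓔 CS
  open ESeed ES
  module S = Statuses 𝓔 CS ES

  A B : Vect n
  A q = (b q k) ⁺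
  B q = (- b q k) ⁺

  Ak≡0 : A k ≡ 0ℤ
  Ak≡0 = cong _⁺ (b-diag k)

  Bk≡0 : B k ≡ 0ℤ
  Bk≡0 = cong (λ w → (- w) ⁺) (b-diag k)

  c-lincomb : ∀ t q → E (c q) (lincomb t e) ≡ - (δ q * t q)
  c-lincomb t q = trans (E-lincombʳ F (c q) t e) (trans (sum-single (λ r → t r * E (c q) (e r)) q (λ r ne → trans (cong (t r *_) (pair-off q r (≢-sym ne))) (ℤP.*-zeroʳ (t r))))
    (trans (cong (t q *_) (pair-diag q)) (lem (t q) (δ q))))
    where
    lem : ∀ a d → a * - d ≡ - (d * a)
    lem = solve-∀

  -- Paired with any c q, this is the identity `ω q k`. Its image under ν says that both monomials
  -- of the exchange relation have the same degree.
  B-A : ∀ i → lincomb B e i ≡ lincomb A e i + c k i + Φ (c k) i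
  B-A i = -‿0 (S.c-nondegʳ (λ i → lincomb B e i - (lincomb A e i + c k i + Φ (c k) i)) orth i)
    where
    orth : ∀ q → E (c q) (λ i → lincomb B e i - (lincomb A e i + c k i + Φ (c k) i)) ≡ 0ℤ
    orth q = begin
      E (c q) (λ i → lincomb B e i - (lincomb A e i + c k i + Φ (c k) i))
        ≡⟨ E--ʳ F (c q) (lincomb B e) (λ i → lincomb A e i + c k i + Φ (c k) i) ⟩
      E (c q) (lincomb B e) - E (c q) (λ i → lincomb A e i + c k i + Φ (c k) i)
        ≡⟨ cong₂ _-_ (c-lincomb B q) (trans (E-+ʳ F (c q) (λ i → lincomb A e i + c k i) (Φ (c k))) (cong₂ _+_ (trans (E-+ʳ F (c q) (lincomb A e) (c k)) (cong (_+ M q k) (c-lincomb A q))) (Φ-spec (c q) (c k)))) ⟩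
      - (δ q * B q) - (- (δ q * A q) + M q k + - M k q)
        ≡⟨ lem1 (δ q) (B q) (A q) (M q k) (M k q) ⟩
      δ q * (A q - B q) - (M q k - M k q)
        ≡⟨ cong₂ (λ x y → δ q * x - y) (sym (⁺-diff (b q k))) (sym (ω q k)) ⟩
      δ q * b q k - δ q * b q k
        ≡⟨ ℤP.+-inverseʳ (δ q * b q k) ⟩
      0ℤ ∎
      where
      open ≡-Reasoning
      lem1 : ∀ d b a m m′ → - (d * b) - (- (d * a) + m + - m′) ≡ d * (a - b) - (m - m′)
      lem1 = solve-∀

  E-B-A : ∀ x → E x (lincomb B e) ≡ E x (lincomb A e) + E x (c k) - E (c k) x
  E-B-A x = trans (E-congʳ F B-A) (trans (E-+ʳ F x (λ i → lincomb A e i + c k i) (Φ (c k))) (cong₂ _+_ (E-+ʳ F x (lincomb A e) (c k)) (Φ-spec x (c k))))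

module Exchange {n} (𝓔 : EulerForm n) {c e b c′ e′ b′} (CS : CSeed 𝓔 c b) (ES : ESeed 𝓔 c e)
  (CS′ : CSeed 𝓔 c′ b′) (ES′ : ESeed 𝓔 c′ e′) (k : Fin n) (green : Nonneg (c k))
  (mc : MutC 𝓔 k (λ j → (b k j) ⁺) c c′) (me : MutE 𝓔 k (λ q → (- b q k) ⁺) e e′) where
  open EulerForm 𝓔
  open Euler 𝓔
  open CSeedFacts 𝓔 CS
  open ESeed ES
  module S′ = Statuses 𝓔 CS′ ES′
  module C = MutC mc
  module E′ = MutE me

  open ExchangeVectors 𝓔 CS ES k public
  open S using (Init; status)

  e⁺ : Fin n → Vect n
  e⁺ q = plus (status q)

  -- The vertices l whose initial variable x_l stays in the cluster under mutation at k. The vectors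
  -- compared below vanish there, so it is enough to pair them with vectors that vanish there too.
  𝓙 : Fin n → Set
  𝓙 l = ∃ λ p → p ≢ k × Init p l

  Init? : ∀ p l → Dec (Init p l)
  Init? p l = go (status p)
    where
    go : Status 𝓔 (δ p) (e p) → Dec (Init p l)
    go (noninitial h) = no (λ I → not-nonneg 𝓔 I h)
    go (initial i I) with i ≟ l
    ... | yes refl = yes I
    ... | no ne = no (λ I′ → ne (InitAt-unique 𝓔 I I′))

  𝓙? : ∀ l → Dec (𝓙 l)
  𝓙? l = FinP.any? (λ p → ¬? (p ≟ k) ×-dec Init? p l)

  -- An initial e q is -I_i and pairs with x to -δ i · x i, which is 0 off the support of x; so
  -- replacing it by 0 changes nothing.
  e⁺-E : ∀ x t → Off 𝓙 x → t k ≡ 0ℤ → E x (lincomb t e⁺) ≡ E x (lincomb t e)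
  e⁺-E x t ox tk = trans (E-lincombʳ F x t e⁺) (trans (sum-cong (λ q → term q (status q) (q ≟ k))) (sym (E-lincombʳ F x t e)))
    where
    term : ∀ q (s : Status 𝓔 (δ q) (e q)) → Dec (q ≡ k) → t q * E x (plus s) ≡ t q * E x (e q)
    term q (noninitial _) _ = refl
    term q (initial i I) (yes refl) = trans (cong (_* E x 0v) tk) (sym (cong (_* E x (e q)) tk))
    term q (initial i I) (no ne) = cong (t q *_) (trans (E-0ʳ F x (λ _ → refl)) (sym (trans (coord I x) (trans (cong (λ w → - (δ i * w)) (ox i (q , ne , I))) (cong -_ (ℤP.*-zeroʳ (δ i)))))))

  e⁺-init : ∀ {p i} → Init p i → ∀ q → e⁺ q i ≡ 0ℤ
  e⁺-init {p} {i} I q = go (status q)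
    where
    go : (s : Status 𝓔 (δ q) (e q)) → plus s i ≡ 0ℤ
    go (noninitial h) = S.compat I h
    go (initial _ _) = refl

  lincomb-init : ∀ {p i} → Init p i → ∀ t → lincomb t e⁺ i ≡ 0ℤ
  lincomb-init I t = sum-0 (λ q → trans (cong (t q *_) (e⁺-init I q)) (ℤP.*-zeroʳ (t q)))

  ck-off : Off 𝓙 (c k)
  ck-off i (p , ne , I) = S.init-c-off I (≢-sym ne)

  c′k≤0 : Nonpos (c′ k)
  c′k≤0 i = subst (_≤ 0ℤ) (sym (C.at-k i)) (neg-≤0 (green i))

  e′k≥0 : Nonneg (e′ k)
  e′k≥0 = S′.e-nonneg k c′k≤0

  init′ : ∀ {p i} → p ≢ k → Init p i → S′.Init p i
  init′ {p} ne I = InitAt-resp 𝓔 (λ l → sym (E′.off-k p ne l)) I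

  e′k-off : Off 𝓙 (e′ k)
  e′k-off i (p , ne , I) = S′.compat (init′ ne I) e′k≥0

  module NoninitialCase (ek≥0 : Nonneg (e k)) where

    -- M p k = 0 by `M-init`, so δ p · b p k = -M k p ≥ 0. Thus no initial vector occurs in the
    -- combination that defines e′ k.
    B-init : ∀ {p i} → Init p i → B p ≡ 0ℤ
    B-init {p} {i} I = ⁺-neg (neg-≤0 (*-cancel-0≤ (δ>0 p) (subst (0ℤ ≤_) (sym (trans (ω p k) (trans (cong (_- M k p) (S.M-init I ek≥0)) (ℤP.+-identityˡ (- M k p)))))
      (0≤-neg (pos-pos k p (λ { refl → not-nonneg 𝓔 I ek≥0 }) green (S.init-pos I))))))

    B≡ : ∀ l → lincomb B e l ≡ lincomb B e⁺ l
    B≡ l = sum-cong (λ q → term q (status q))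
      where
      term : ∀ q (s : Status 𝓔 (δ q) (e q)) → B q * e q l ≡ B q * plus s l
      term q (noninitial _) = refl
      term q (initial i I) = trans (cong (_* e q l) (B-init I)) (sym (ℤP.*-zeroʳ (B q)))

    e+e′ : ∀ l → e k l + e′ k l ≡ lincomb B e⁺ l
    e+e′ l = trans (cong (λ w → e k l + w) (trans (E′.at-k l) (cong (λ w → - e k l + w) (B≡ l)))) (lem (e k l) (lincomb B e⁺ l))
      where
      lem : ∀ a b → a + (- a + b) ≡ b
      lem = solve-∀

    -- The difference of the two exponents under the maximum. It is `Φ (c k)` corrected by multiples
    -- of injectives so as to vanish on `𝓙`; against vectors vanishing on `𝓙` it still pairs like
    -- `Φ (c k)`.
    z : Vect n
    z l = lincomb B e⁺ l - (c k l + lincomb A e⁺ l)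

    z-off : Off 𝓙 z
    z-off i j@(p , ne , I) = cong₂ _-_ (lincomb-init I B) (cong₂ _+_ (ck-off i j) (lincomb-init I A))

    E-z : ∀ x → Off 𝓙 x → E x z ≡ - E (c k) x
    E-z x ox = begin
      E x z ≡⟨ E--ʳ F x (lincomb B e⁺) (λ l → c k l + lincomb A e⁺ l) ⟩
      E x (lincomb B e⁺) - E x (λ l → c k l + lincomb A e⁺ l)
        ≡⟨ cong₂ _-_ (trans (e⁺-E x B ox Bk≡0) (E-B-A x)) (trans (E-+ʳ F x (c k) (lincomb A e⁺)) (cong (λ w → E x (c k) + w) (e⁺-E x A ox Ak≡0))) ⟩
      (E x (lincomb A e) + E x (c k) - E (c k) x) - (E x (c k) + E x (lincomb A e))
        ≡⟨ lem (E x (lincomb A e)) (E x (c k)) (E (c k) x) ⟩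
      - E (c k) x ∎
      where
      open ≡-Reasoning
      lem : ∀ a b d → (a + b - d) - (b + a) ≡ - d
      lem = solve-∀

    z-norm : E z z ≡ δ k
    z-norm = trans (E-z z z-off) (trans (cong -_ (E-z (c k) ck-off)) (trans (ℤP.neg-involutive (M k k)) (M-diag k)))

    z-div : ∀ x → δ k ∣ᶻ E z x
    z-div x = ∣-resp (sym zx) (∣-+ (divˡ (Φ-root (root k)) x) (∣-∑ 𝓔 (λ q → term q (status q))))
      where
      g : Vect n
      g q = A q * (E (e q) x - E (e⁺ q) x)
      term : ∀ q (s : Status 𝓔 (δ q) (e q)) → δ k ∣ᶻ (A q * (E (e q) x - E (plus s) x))
      term q (noninitial _) = 0ℤ , trans (cong (A q *_) (ℤP.+-inverseʳ (E (e q) x))) (trans (ℤP.*-zeroʳ (A q)) (sym (ℤP.*-zeroʳ (δ k))))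
      term q (initial i I) = go (divˡ-from-divʳ (ediv q) x)
        where
        go : δ q ∣ᶻ E (e q) x → δ k ∣ᶻ (A q * (E (e q) x - E 0v x))
        go (m , eq) = (- b k q) ⁺ * m , trans (cong (A q *_) (trans (cong₂ _-_ eq (E-0ˡ F x (λ _ → refl))) (ℤP.+-identityʳ (δ q * m)))) (trans (l (A q) (δ q) m) (trans (cong (_* m) (⁺-skew q k)) (ℤP.*-assoc (δ k) ((- b k q) ⁺) m)))
          where
          l : ∀ a d m → a * (d * m) ≡ d * a * m
          l = solve-∀
      lem : ∀ a c p a⁺ → (a + c + p) - (c + a⁺) ≡ p + (a - a⁺)
      lem = solve-∀
      zx : E z x ≡ E (Φ (c k)) x + ∑ g
      zx = begin
        E z x ≡⟨ E-congˡ F (λ l → trans (cong (_- (c k l + lincomb A e⁺ l)) (trans (sym (B≡ l)) (B-A l))) (lem (lincomb A e l) (c k l) (Φ (c k) l) (lincomb A e⁺ l))) ⟩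
        E (λ l → Φ (c k) l + (lincomb A e l - lincomb A e⁺ l)) x
          ≡⟨ E-+ˡ F (Φ (c k)) (λ l → lincomb A e l - lincomb A e⁺ l) x ⟩
        E (Φ (c k)) x + E (λ l → lincomb A e l - lincomb A e⁺ l) x
          ≡⟨ cong (λ w → E (Φ (c k)) x + w) (trans (E--ˡ F (lincomb A e) (lincomb A e⁺) x) (cong₂ _-_ (E-lincombˡ F A e x) (E-lincombˡ F A e⁺ x))) ⟩
        E (Φ (c k)) x + (∑ (λ q → A q * E (e q) x) - ∑ (λ q → A q * E (e⁺ q) x))
          ≡⟨ cong (λ w → E (Φ (c k)) x + w) (trans (cong (λ w → ∑ (λ q → A q * E (e q) x) + w) (sym (sum-neg (λ q → A q * E (e⁺ q) x)))) (trans (sym (sum-+ (λ q → A q * E (e q) x) (λ q → - (A q * E (e⁺ q) x)))) (sum-cong (λ q → l (A q) (E (e q) x) (E (e⁺ q) x))))) ⟩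
        E (Φ (c k)) x + ∑ g ∎
        where
        open ≡-Reasoning
        l : ∀ a p q → a * p + - (a * q) ≡ a * (p - q)
        l = solve-∀

    pp-off : Off 𝓙 (pp z)
    pp-off i j = cong (_⊔ 0ℤ) (z-off i j)

    ek-off : Off 𝓙 (e k)
    ek-off i (p , ne , I) = S.compat I ek≥0

    -- Sign coherence leaves two cases. If z were nonpositive, c k and -z would satisfy the
    -- hypotheses of `Truncated`, whence E (c k) (e k) ≥ 0; but this pairing is -δ k.
    z≥0 : Nonneg z
    z≥0 = [ (λ p → p) , (λ q → ⊥-elim (contra q)) ]′ (sign-coherent (δ>0 k) z-norm (z-div (pp z)) (∣-resp (sym (E-z (pp z) pp-off)) (∣-neg (divˡ (root k) (pp z)))))
      where
      contra : Nonpos z → ⊥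
      contra q = <⇒⊥ (δ>0 k) (0≤neg⇒≤0 (subst (0ℤ ≤_) (pair-diag k) (Truncated.E≥0-off {P = 𝓙} {δ k} {c k} {λ l → - z l} (δ>0 k) green (λ l → 0≤-neg (q l)) ck-off (λ i j → cong -_ (z-off i j))
        (λ x ox → sym (trans (E-negʳ F x z) (trans (cong -_ (E-z x ox)) (ℤP.neg-involutive (E (c k) x))))) (M-diag k) (λ x _ → divˡ (root k) x) 𝓙? (e k) ek≥0 ek-off)))

    A+c≤B : ∀ l → lincomb A e⁺ l + c k l ≤ lincomb B e⁺ l
    A+c≤B l = ≤by (z l) (z≥0 l) (lem (lincomb A e⁺ l) (c k l) (lincomb B e⁺ l))
      where
      lem : ∀ a c b → b - (a + c) ≡ b - (c + a)
      lem = solve-∀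

  module InitialCase {i} (Ik : Init k i) where

    -- When x_i leaves the cluster, the maximum is attained on the side of `A`, although e′ k is
    -- given by the side of `B`. That w vanishes expresses this.
    w : Vect n
    w l = e′ k l - (lincomb A e⁺ l + c k l)

    init-back : ∀ {p j} → S′.Init p j → 𝓙 j
    init-back {p} {j} I′ = p , ne , InitAt-resp 𝓔 (E′.off-k p ne) I′
      where
      ne : p ≢ k
      ne refl = not-nonneg 𝓔 I′ e′k≥0

    w-off : Off 𝓙 w
    w-off j jj@(p , ne , I) = cong₂ _-_ (e′k-off j jj) (cong₂ _+_ (lincomb-init I A) (ck-off j jj))

    E-w : ∀ x → E x w ≡ E x (e′ k) - (E x (lincomb A e⁺) + E x (c k))
    E-w x = trans (E--ʳ F x (e′ k) (λ l → lincomb A e⁺ l + c k l)) (cong (λ v → E x (e′ k) - v) (E-+ʳ F x (lincomb A e⁺) (c k)))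

    c-A⁺ : ∀ q → E (c q) (lincomb A e⁺) ≡ A q * E (c q) (e⁺ q)
    c-A⁺ q = trans (E-lincombʳ F (c q) A e⁺) (sum-single (λ r → A r * E (c q) (e⁺ r)) q (λ r ne → term r ne (status r)))
      where
      term : ∀ r → r ≢ q → (s : Status 𝓔 (δ r) (e r)) → A r * E (c q) (plus s) ≡ 0ℤ
      term r ne (noninitial _) = trans (cong (A r *_) (pair-off q r (≢-sym ne))) (ℤP.*-zeroʳ (A r))
      term r ne (initial _ _) = trans (cong (A r *_) (E-0ʳ F (c q) (λ _ → refl))) (ℤP.*-zeroʳ (A r))

    ck-A⁺ : E (c k) (lincomb A e⁺) ≡ 0ℤ
    ck-A⁺ = trans (c-A⁺ k) (cong (_* E (c k) (e⁺ k)) Ak≡0)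

    c′-E : ∀ q → q ≢ k → ∀ y → E (c′ q) y ≡ E (c q) y + (b k q) ⁺ * E (c k) y
    c′-E q ne y = trans (E-congˡ F (C.off-k q ne)) (E-axpyˡ F ((b k q) ⁺) (c q) (c k) y)

    -- For an initial q other than k, `init-orth` applies in the new seed, as w vanishes on `𝓙`. For
    -- the remaining q ≠ k the pairing reduces to -M k q, which `M-init` at the departing vertex
    -- makes 0.
    orth : ∀ q → E (c′ q) w ≡ 0ℤ
    orth q = go (q ≟ k)
      where
      at-other : q ≢ k → Nonneg (e q) → E (c′ q) w ≡ 0ℤ
      at-other ne eq≥0 = begin
        E (c′ q) w
          ≡⟨ E-w (c′ q) ⟩
        E (c′ q) (e′ k) - (E (c′ q) (lincomb A e⁺) + E (c′ q) (c k))
          ≡⟨ cong₂ (λ x y → x - y) (ESeed.pair-off ES′ q k ne) (cong₂ _+_ (trans (c′-E q ne (lincomb A e⁺)) (cong₂ (λ x y → x + (b k q) ⁺ * y) A⁺q ck-A⁺)) (trans (c′-E q ne (c k)) (cong (λ y → M q k + (b k q) ⁺ * y) (M-diag k)))) ⟩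
        0ℤ - ((- (δ q * A q) + (b k q) ⁺ * 0ℤ) + (M q k + (b k q) ⁺ * δ k))
          ≡⟨ cong (λ y → 0ℤ - ((- y + (b k q) ⁺ * 0ℤ) + (M q k + (b k q) ⁺ * δ k))) (⁺-skew q k) ⟩
        0ℤ - ((- (δ k * (- b k q) ⁺) + (b k q) ⁺ * 0ℤ) + (M q k + (b k q) ⁺ * δ k))
          ≡⟨ l1 (δ k) ((- b k q) ⁺) ((b k q) ⁺) (M q k) ⟩
        - (δ k * ((b k q) ⁺ - (- b k q) ⁺) + M q k)
          ≡⟨ cong (λ y → - (y + M q k)) (trans (cong (δ k *_) (sym (⁺-diff (b k q)))) (ω k q)) ⟩
        - ((M k q - M q k) + M q k)
          ≡⟨ l2 (M k q) (M q k) ⟩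
        - M k q
          ≡⟨ cong -_ (S.M-init Ik eq≥0) ⟩
        0ℤ ∎
        where
        open ≡-Reasoning
        A⁺q : E (c q) (lincomb A e⁺) ≡ - (δ q * A q)
        A⁺q = trans (c-A⁺ q) (trans (cong (A q *_) (trans (E-congʳ F (plus-nonneg 𝓔 (status q) eq≥0)) (pair-diag q))) (l (A q) (δ q)))
          where
          l : ∀ a d → a * - d ≡ - (d * a)
          l = solve-∀
        l1 : ∀ d p q m → 0ℤ - ((- (d * p) + q * 0ℤ) + (m + q * d)) ≡ - (d * (q - p) + m)
        l1 = solve-∀
        l2 : ∀ a b → - ((a - b) + b) ≡ - a
        l2 = solve-∀
      go : Dec (q ≡ k) → E (c′ q) w ≡ 0ℤ
      go (yes refl) = trans (E-w (c′ k)) (trans (cong₂ (λ x y → x - y) (ESeed.pair-diag ES′ k) (cong₂ _+_ (trans (neg (lincomb A e⁺)) (cong -_ ck-A⁺)) (trans (neg (c k)) (cong -_ (M-diag k))))) (l (δ k)))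
        where
        neg : ∀ y → E (c′ k) y ≡ - E (c k) y
        neg y = trans (E-congˡ F C.at-k) (E-negˡ F (c k) y)
        l : ∀ d → - d - (- 0ℤ + - d) ≡ 0ℤ
        l = solve-∀
      go (no ne) = by (status q)
        where
        by : Status 𝓔 (δ q) (e q) → E (c′ q) w ≡ 0ℤ
        by (noninitial h) = at-other ne h
        by (initial j I) = S′.init-orth (init′ ne I) w (λ p l I′ → w-off l (init-back I′))

    e′≡ : ∀ l → e′ k l ≡ lincomb A e⁺ l + c k l
    e′≡ l = -‿0 (S′.c-nondegʳ w orth l)

    -- Among vectors vanishing on `𝓙`, pairing with Y on the right and with c k on the left both
    -- give δ i · x i. So Y acts as the injective and c k as the projective at i once the vertices
    -- in `𝓙` are deleted.
    Y : Vect n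
    Y l = e′ k l - lincomb B e⁺ l

    Y-off : Off 𝓙 Y
    Y-off j jj@(p , ne , I) = cong₂ _-_ (e′k-off j jj) (lincomb-init I B)

    E-e′ : ∀ x → E x (e′ k) ≡ δ i * x i + E x (lincomb B e)
    E-e′ x = trans (E-congʳ F E′.at-k) (trans (E-+ʳ F x (λ l → - e k l) (lincomb B e)) (cong (_+ E x (lincomb B e)) (trans (E-negʳ F x (e k)) (trans (cong -_ (coord Ik x)) (ℤP.neg-involutive (δ i * x i))))))

    E-Y : ∀ x → Off 𝓙 x → E x Y ≡ δ i * x i
    E-Y x ox = trans (E--ʳ F x (e′ k) (lincomb B e⁺)) (trans (cong₂ _-_ (E-e′ x) (e⁺-E x B ox Bk≡0)) (lem (δ i * x i) (E x (lincomb B e))))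
      where
      lem : ∀ a b → a + b - b ≡ a
      lem = solve-∀

    E-ck : ∀ x → Off 𝓙 x → E (c k) x ≡ δ i * x i
    E-ck x ox = sym (-‿0 (trans (sym (l (δ i * x i) (E x (lincomb A e)) (E x (c k)) (E (c k) x))) (trans (sym (trans (E-w x) (cong₂ (λ p q → p - (q + E x (c k))) (trans (E-e′ x) (cong (λ v → δ i * x i + v) (E-B-A x))) (e⁺-E x A ox Ak≡0)))) (E-0ʳ F x (S′.c-nondegʳ w orth)))))
      where
      l : ∀ d a c c′ → (d + (a + c - c′)) - (a + c) ≡ d - c′
      l = solve-∀

    -- The negative part of Y has norm E (np Y) (pp Y) - δ i · np Y i. Both contributions are ≤ 0,
    -- so the negative part vanishes.
    Y≥0 : Nonneg Y
    Y≥0 l = subst (0ℤ ≤_) (sym (trans (pp-np Y l) (trans (cong (λ v → pp Y l - v) (np0 l)) (ℤP.+-identityʳ (pp Y l))))) (pp-nonneg Y l)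
      where
      np-off : Off 𝓙 (np Y)
      np-off j jj = cong (λ v → (- v) ⊔ 0ℤ) (Y-off j jj)
      np0 : ∀ l → np Y l ≡ 0ℤ
      np0 = E-def (np Y) (≤by (δ i * np Y i - E (np Y) (pp Y)) (0≤+ (0≤* (ℤP.<⇒≤ (δ>0 i)) (np-nonneg Y i)) (0≤-neg (E-disj (np-nonneg Y) (pp-nonneg Y) (λ l → [ inj₂ , inj₁ ]′ (pp-np-disj Y l)))))
        (trans (lem (E (np Y) (np Y)) (E (np Y) (pp Y))) (cong (_- E (np Y) (pp Y)) (trans (sym (trans (E-congʳ F (pp-np Y)) (E--ʳ F (np Y) (pp Y) (np Y)))) (E-Y (np Y) np-off)))))
        where
        lem : ∀ a b → 0ℤ - a ≡ b - a - b
        lem = solve-∀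

    module T = Truncated {P = 𝓙} {δ k} {c k} {Y} (δ>0 k) green Y≥0 ck-off Y-off
      (λ x ox → trans (E-ck x ox) (sym (E-Y x ox))) (M-diag k) (λ x _ → divˡ (root k) x)

    disjoint : ∀ l → l ≢ i → c k l ≡ 0ℤ ⊎ Y l ≡ 0ℤ
    disjoint l ne with 𝓙? l
    ... | yes j = inj₁ (ck-off l j)
    ... | no nj = [ (λ q → inj₁ (*-cancel-0 (δ>0 l) (trans (sym q) (trans (E-ck (α l) (T.α-off-P nj)) (trans (cong (δ i *_) (α-off (≢-sym ne))) (ℤP.*-zeroʳ (δ i))))))) , (λ (_ , q) → inj₂ q) ]′ (T.value l nj)

  e⁺′ : Vect n
  e⁺′ = plus (S′.status k)

  e⁺′≡ : ∀ l → e⁺′ l ≡ e′ k l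
  e⁺′≡ = plus-nonneg 𝓔 (S′.status k) e′k≥0

  exchange⁺ : ∀ l → e⁺ k l + e⁺′ l ≡ (lincomb A e⁺ l + c k l) ⊔ lincomb B e⁺ l
  exchange⁺ l = trans (cong (λ v → e⁺ k l + v) (e⁺′≡ l)) (go (status k))
    where
    go : (s : Status 𝓔 (δ k) (e k)) → plus s l + e′ k l ≡ (lincomb A e⁺ l + c k l) ⊔ lincomb B e⁺ l
    go (noninitial h) = trans (NoninitialCase.e+e′ h l) (sym (ℤP.i≤j⇒i⊔j≡j (NoninitialCase.A+c≤B h l)))
    go (initial i I) = trans (ℤP.+-identityˡ (e′ k l)) (trans (N.e′≡ l) (sym (ℤP.i≥j⇒i⊔j≡i (subst (lincomb B e⁺ l ≤_) (N.e′≡ l) (ℤP.0≤i-j⇒j≤i (N.Y≥0 l))))))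
      where
      module N = InitialCase I

  dn : Fin n → Vect n
  dn q = den (status q)

  dn′ : Vect n
  dn′ = den (S′.status k)

  -- Two things differ from `exchange⁺`: the summand c k is missing, and initial variables
  -- contribute -α_i. On `𝓙` both sides are 0, since a single p contributes and one of A p, B p is
  -- 0. At a departing i the -1 of x_i offsets c k i = 1. Elsewhere dropping c k leaves the maximum
  -- unchanged.
  exchange-den : ∀ l → dn k l + dn′ l ≡ lincomb A dn l ⊔ lincomb B dn l
  exchange-den l = trans (cong (λ v → dn k l + v) (den-nonneg 𝓔 (S′.status k) e′k≥0 l)) (go (𝓙? l))
    where
    go : Dec (𝓙 l) → dn k l + e′ k l ≡ lincomb A dn l ⊔ lincomb B dn l
    go (yes jj@(p , p≢k , I)) = trans (cong₂ _+_ (others k (≢-sym p≢k) (status k)) (e′k-off l jj)) (sym (trans (cong₂ _⊔_ (single A) (single B)) (zero-max (⁺-disj (b p k)))))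
      where
      others : ∀ q → q ≢ p → (s : Status 𝓔 (δ q) (e q)) → den s l ≡ 0ℤ
      others q ne (noninitial h) = S.compat I h
      others q ne (initial i I′) = cong -_ (α-off (λ { refl → ne (S.init-inj I′ I) }))
      at-p : (s : Status 𝓔 (δ p) (e p)) → den s l ≡ - 1ℤ
      at-p (noninitial h) = ⊥-elim (not-nonneg 𝓔 I h)
      at-p (initial i I′) = cong -_ (trans (cong (λ i → α i l) (InitAt-unique 𝓔 I′ I)) (α-diag l))
      single : ∀ t → lincomb t dn l ≡ t p * - 1ℤ
      single t = trans (sum-single (λ q → t q * dn q l) p (λ q ne → trans (cong (t q *_) (others q ne (status q))) (ℤP.*-zeroʳ (t q)))) (cong (t p *_) (at-p (status p)))
      nonpos : ∀ x → x ⁺ * - 1ℤ ≤ 0ℤ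
      nonpos x = *≤0 (⁺-nonneg x) (ℤP.neg-≤-pos {1} {0})
      zero-max : A p ≡ 0ℤ ⊎ B p ≡ 0ℤ → (A p * - 1ℤ) ⊔ (B p * - 1ℤ) ≡ 0ℤ
      zero-max (inj₁ z) = trans (cong (λ v → (v * - 1ℤ) ⊔ (B p * - 1ℤ)) z) (ℤP.i≥j⇒i⊔j≡i (nonpos (- b p k)))
      zero-max (inj₂ z) = trans (cong (λ v → (A p * - 1ℤ) ⊔ (v * - 1ℤ)) z) (ℤP.i≤j⇒i⊔j≡j (nonpos (b p k)))
    go (no nj) = trans (by (status k)) (sym (cong₂ _⊔_ (same A Ak≡0) (same B Bk≡0)))
      where
      same : ∀ t → t k ≡ 0ℤ → lincomb t dn l ≡ lincomb t e⁺ l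
      same t tk = sum-cong (λ q → term q (status q) (q ≟ k))
        where
        term : ∀ q (s : Status 𝓔 (δ q) (e q)) → Dec (q ≡ k) → t q * den s l ≡ t q * plus s l
        term q (noninitial _) _ = refl
        term q (initial i I) (yes refl) = trans (cong (_* - α i l) tk) (sym (cong (_* 0ℤ) tk))
        term q (initial i I) (no ne) = cong (t q *_) (cong -_ (α-off (λ { refl → nj (q , ne , I) })))
      by : (s : Status 𝓔 (δ k) (e k)) → den s l + e′ k l ≡ lincomb A e⁺ l ⊔ lincomb B e⁺ l
      by (noninitial h) = trans (N.e+e′ l) (sym (ℤP.i≤j⇒i⊔j≡j (ℤP.≤-trans (≤by (c k l) (green l) (lem (lincomb A e⁺ l) (c k l))) (N.A+c≤B l))))
        where
        module N = NoninitialCase h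
        lem : ∀ a c → a + c - a ≡ c
        lem = solve-∀
      by (initial i I) with l ≟ i
      ... | yes refl = trans (cong (λ v → - 1ℤ + v) (trans (N.e′≡ l) (cong₂ _+_ (lincomb-init I A) (S.init-c I)))) (sym (cong₂ _⊔_ (lincomb-init I A) (lincomb-init I B)))
        where
        module N = InitialCase I
      ... | no ne = trans (ℤP.+-identityˡ (e′ k l)) (max (N.disjoint l ne))
        where
        module N = InitialCase I
        B≤ : lincomb B e⁺ l ≤ e′ k l
        B≤ = ℤP.0≤i-j⇒j≤i (N.Y≥0 l)
        A≤ : lincomb A e⁺ l ≤ e′ k l
        A≤ = ≤by (c k l) (green l) (trans (cong (_- lincomb A e⁺ l) (N.e′≡ l)) (lem (lincomb A e⁺ l) (c k l)))
          where
          lem : ∀ a c → a + c - a ≡ c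
          lem = solve-∀
        max : c k l ≡ 0ℤ ⊎ N.Y l ≡ 0ℤ → e′ k l ≡ lincomb A e⁺ l ⊔ lincomb B e⁺ l
        max (inj₁ z) = sym (trans (ℤP.i≥j⇒i⊔j≡i (subst (lincomb B e⁺ l ≤_) eq B≤)) (sym eq))
          where
          eq : e′ k l ≡ lincomb A e⁺ l
          eq = trans (N.e′≡ l) (trans (cong (λ v → lincomb A e⁺ l + v) z) (ℤP.+-identityʳ (lincomb A e⁺ l)))
        max (inj₂ z) = sym (trans (ℤP.i≤j⇒i⊔j≡j (subst (lincomb A e⁺ l ≤_) eq A≤)) (sym eq))
          where
          eq : e′ k l ≡ lincomb B e⁺ l
          eq = -‿0 z

-- The Euler form of an acyclic exchange matrix

module Walks {n} (B : Form n) (acyclic : Acyclic B) where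

  WalkFrom : ℕ → Fin n → Set
  WalkFrom zero i = ⊤
  WalkFrom (suc k) i = ∃ λ j → B i j < 0ℤ × WalkFrom k j

  walk? : ∀ k i → Dec (WalkFrom k i)
  walk? zero i = yes tt
  walk? (suc k) i = FinP.any? (λ j → (B i j ℤ.<? 0ℤ) ×-dec walk? k j)

  vertex : ∀ k i → WalkFrom k i → Fin (suc k) → Fin n
  vertex k i w zero = i
  vertex (suc k) i (j , _ , w) (suc a) = vertex k j w a

  subwalk : ∀ k i w (a b : Fin (suc k)) → a Fin.< b → Walk⁺ B (vertex k i w a) (vertex k i w b)
  subwalk (suc k) i (j , p , w) zero (suc zero) _ = edge p
  subwalk (suc k) i (j , p , w) zero (suc (suc b)) _ = step p (subwalk k j w zero (suc b) (ℕ.s≤s ℕ.z≤n))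
  subwalk (suc k) i (j , p , w) (suc a) (suc b) (ℕ.s≤s q) = subwalk k j w a b q

  no-long-walk : ∀ i → ¬ WalkFrom n i
  no-long-walk i w = let (a , b , a<b , e) = FinP.pigeonhole ℕP.≤-refl (vertex n i w) in
    acyclic (vertex n i w a) (subst (Walk⁺ B (vertex n i w a)) (sym e) (subwalk n i w a b a<b))

  longest : ℕ → Fin n → ℕ
  longest zero i = 0
  longest (suc m) i = if ⌊ walk? (suc m) i ⌋ then suc m else longest m i

  longest-walk : ∀ m i → WalkFrom (longest m i) i
  longest-walk zero i = tt
  longest-walk (suc m) i with walk? (suc m) i
  ... | yes w = w
  ... | no _ = longest-walk m i

  longest-≤ : ∀ m i → longest m i ℕ.≤ m
  longest-≤ zero i = ℕ.z≤n
  longest-≤ (suc m) i with walk? (suc m) i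
  ... | yes _ = ℕP.≤-refl
  ... | no _ = ℕP.m≤n⇒m≤1+n (longest-≤ m i)

  ≤-longest : ∀ m i k → k ℕ.≤ m → WalkFrom k i → k ℕ.≤ longest m i
  ≤-longest zero i k p w = p
  ≤-longest (suc m) i k p w with walk? (suc m) i
  ... | yes _ = p
  ... | no nw with ℕP.m≤n⇒m<n∨m≡n p
  ...   | inj₁ (ℕ.s≤s q) = ≤-longest m i k q w
  ...   | inj₂ refl = ⊥-elim (nw w)

  -- A search up to length n is exhaustive, since a walk with n edges would repeat a vertex. Heights
  -- drop along edges and thus triangularize the Euler form.
  height : Fin n → ℕ
  height = longest n

  height<n : ∀ i → height i ℕ.< n
  height<n i = ℕP.≤∧≢⇒< (longest-≤ n i) (λ e → no-long-walk i (subst (λ k → WalkFrom k i) e (longest-walk n i)))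

  height-mono : ∀ i j → B i j < 0ℤ → height j ℕ.< height i
  height-mono i j p = ≤-longest n i (suc (height j)) (height<n j) (j , p , longest-walk n j)

module _ {n} (N : Form n) (h : Fin n → ℕ) (tri : ∀ l j → N l j ≢ 0ℤ → h j ℕ.< h l) (y : Vect n) where

  private
    approx : ℕ → Vect n
    approx zero l = 0ℤ
    approx (suc k) l = y l - ∑ (λ j → N l j * approx k j)

    stable : ∀ k l → h l ℕ.< k → approx (suc k) l ≡ approx k l
    stable (suc k) l (ℕ.s≤s p) = cong (λ w → y l - w) (sum-cong term)
      where
      term : ∀ j → N l j * approx (suc k) j ≡ N l j * approx k j
      term j with N l j ℤ.≟ 0ℤ
      ... | yes z = trans (cong (_* approx (suc k) j) z) (sym (cong (_* approx k j) z))
      ... | no nz = cong (N l j *_) (stable k j (ℕP.<-≤-trans (tri l j nz) p))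

  -- N is nilpotent, so iterating x ↦ y - N x from 0 becomes stationary: entry l no longer changes
  -- once more than h l steps are made.
  solve-triangular : ∀ K → (∀ l → h l ℕ.< K) → ∃ λ x → ∀ l → x l + ∑ (λ j → N l j * x j) ≡ y l
  solve-triangular K bd = approx K , λ l → trans (cong (_+ ∑ (λ j → N l j * approx K j)) (sym (stable K l (bd l)))) (lem (y l) _)
    where
    lem : ∀ a b → a - b + b ≡ a
    lem = solve-∀

scale-⊓ : ∀ {d} x → 0ℤ ≤ d → d * (x ⊓ 0ℤ) ≡ (d * x) ⊓ 0ℤ
scale-⊓ {d} x p = [ (λ q → trans (cong (d *_) (ℤP.i≤j⇒i⊓j≡i q)) (sym (ℤP.i≤j⇒i⊓j≡i (*≤0 p q))))
  , (λ q → trans (cong (d *_) (ℤP.i≥j⇒i⊓j≡j q)) (trans (ℤP.*-zeroʳ d) (sym (ℤP.i≥j⇒i⊓j≡j (0≤* p q))))) ]′ (ℤP.≤-total x 0ℤ)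

module FromMatrix {n} (B : Form n) (δ : Fin n → ℕ) (skew : SkewSymmetrizable B δ) (acyclic : Acyclic B) (fin : FiniteCartanType B δ) where
  open Walks B acyclic

  d : Vect n
  d i = + δ i

  d>0 : ∀ i → 0ℤ < d i
  d>0 i = +<+ (proj₁ skew i)

  sk : ∀ i j → d i * B i j ≡ - (d j * B j i)
  sk = proj₂ skew

  -B : Form n
  -B i j = - B i j

  F : Form n
  F i j = d i * euler B i j

  euler-diag : ∀ (A : Form n) i → euler A i i ≡ 1ℤ
  euler-diag A i with i ≟ i
  ... | yes _ = refl
  ... | no ne = ⊥-elim (ne refl)

  euler-off : ∀ (A : Form n) {i j} → i ≢ j → euler A i j ≡ A i j ⊓ 0ℤ
  euler-off A {i} {j} ne with i ≟ j
  ... | yes e = ⊥-elim (ne e)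
  ... | no _ = refl

  eq-or-not : (i j : Fin n) → i ≡ j ⊎ i ≢ j
  eq-or-not i j with i ≟ j
  ... | yes e = inj₁ e
  ... | no ne = inj₂ ne

  F≡v : ∀ i j → F i j ≡ d j * euler -B j i
  F≡v i j = [ (λ { refl → cong (d i *_) (trans (euler-diag B i) (sym (euler-diag -B i))) }) , distinct ]′ (eq-or-not i j)
   where
   open ≡-Reasoning
   distinct : i ≢ j → F i j ≡ d j * euler -B j i
   distinct ne = begin
    d i * euler B i j       ≡⟨ cong (d i *_) (euler-off B ne) ⟩
    d i * (B i j ⊓ 0ℤ)      ≡⟨ scale-⊓ (B i j) (ℤP.<⇒≤ (d>0 i)) ⟩
    (d i * B i j) ⊓ 0ℤ      ≡⟨ cong (_⊓ 0ℤ) (trans (sk i j) (ℤP.neg-distribʳ-* (d j) (B j i))) ⟩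
    (d j * - B j i) ⊓ 0ℤ    ≡⟨ sym (scale-⊓ (- B j i) (ℤP.<⇒≤ (d>0 j))) ⟩
    d j * (- B j i ⊓ 0ℤ)    ≡⟨ cong (d j *_) (sym (euler-off -B (≢-sym ne))) ⟩
    d j * euler -B j i ∎

  offdiag : Form n → Form n
  offdiag A l j = if ⌊ l ≟ j ⌋ then 0ℤ else euler A l j

  euler-split : ∀ A (x : Vect n) l → ∑ (λ j → euler A l j * x j) ≡ x l + ∑ (λ j → offdiag A l j * x j)
  euler-split A x l = trans (sum-cong term) (trans (sum-+ (λ j → α l j * x j) (λ j → offdiag A l j * x j)) (cong (_+ ∑ (λ j → offdiag A l j * x j)) (sum-α x l)))
    where
    term : ∀ j → euler A l j * x j ≡ α l j * x j + offdiag A l j * x j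
    term j with l ≟ j
    ... | yes refl = sym (trans (cong (λ w → w * x l + 0ℤ * x l) (α-diag l)) (ℤP.+-identityʳ (1ℤ * x l)))
    ... | no ne = sym (trans (cong (λ w → w * x j + (A l j ⊓ 0ℤ) * x j) (α-off (≢-sym ne))) (ℤP.+-identityˡ ((A l j ⊓ 0ℤ) * x j)))

  offdiag-neg : ∀ A l j → offdiag A l j ≢ 0ℤ → l ≢ j × A l j < 0ℤ
  offdiag-neg A l j nz with l ≟ j
  ... | yes _ = ⊥-elim (nz refl)
  ... | no ne = ne , ℤP.≰⇒> (λ p → nz (ℤP.i≥j⇒i⊓j≡j p))

  sk-sign : ∀ {i j} → - B i j < 0ℤ → B j i < 0ℤ
  sk-sign {i} {j} p = ℤP.neg-cancel-< (*-cancel-0< (d>0 j) (subst (0ℤ <_) (trans (sk i j) (ℤP.neg-distribʳ-* (d j) (B j i))) (0<* (d>0 i) (subst (0ℤ <_) (ℤP.neg-involutive (B i j)) (ℤP.neg-mono-< p)))))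

  Iv-data : ∀ i → ∃ λ x → ∀ l → x l + ∑ (λ j → offdiag B l j * x j) ≡ α i l
  Iv-data i = solve-triangular (offdiag B) height (λ l j nz → height-mono l j (proj₂ (offdiag-neg B l j nz))) (α i) n height<n

  -- Replacing B by -B reverses the edges, so the complement of the height to n takes over its role.
  Pv-data : ∀ i → ∃ λ x → ∀ l → x l + ∑ (λ j → offdiag -B l j * x j) ≡ α i l
  Pv-data i = solve-triangular (offdiag -B) (λ l → n ℕ.∸ height l)
    (λ l j nz → ℕP.∸-monoʳ-< (height-mono j l (sk-sign (proj₂ (offdiag-neg -B l j nz)))) (ℕP.<⇒≤ (height<n j))) (α i) (suc n) (λ l → ℕ.s≤s (ℕP.m∸n≤m n (height l)))

  opaque
    Iv Pv : Fin n → Vect n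
    Iv i = proj₁ (Iv-data i)
    Pv i = proj₁ (Pv-data i)

    Iv-eq : ∀ i l → ∑ (λ j → euler B l j * Iv i j) ≡ α i l
    Iv-eq i l = trans (euler-split B (Iv i) l) (proj₂ (Iv-data i) l)

    Pv-eq : ∀ i l → ∑ (λ j → euler -B l j * Pv i j) ≡ α i l
    Pv-eq i l = trans (euler-split -B (Pv i) l) (proj₂ (Pv-data i) l)

  α-sum : ∀ (x : Vect n) i → ∑ (λ l → x l * (d l * α i l)) ≡ d i * x i
  α-sum x i = trans (sum-cong (λ l → lem (x l) (d l) (α i l))) (trans (sum-α (λ l → d l * x l) i) refl)
    where
    lem : ∀ x d a → x * (d * a) ≡ a * (d * x)
    lem = solve-∀

  I-spec : ∀ i x → ⟪ F ⟫ x (Iv i) ≡ d i * x i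
  I-spec i x = trans (E-sumˡ F x (Iv i)) (trans (sum-cong (λ l → cong (x l *_) (trans (E-αˡ F l (Iv i)) (trans (sum-cong (λ j → ℤP.*-assoc (d l) (euler B l j) (Iv i j))) (trans (sum-* (d l) (λ j → euler B l j * Iv i j)) (cong (d l *_) (Iv-eq i l))))))) (α-sum x i))

  P-spec : ∀ i x → ⟪ F ⟫ (Pv i) x ≡ d i * x i
  P-spec i x = trans (E-sumʳ F (Pv i) x) (trans (sum-cong (λ l → cong (x l *_) (trans (E-αʳ F (Pv i) l) (trans (sum-cong (λ j → trans (cong (_* Pv i j) (F≡v j l)) (ℤP.*-assoc (d l) (euler -B l j) (Pv i j)))) (trans (sum-* (d l) (λ j → euler -B l j * Pv i j)) (cong (d l *_) (Pv-eq i l))))))) (α-sum x i))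

  ⊓-abs : ∀ x → x ⊓ 0ℤ + - x ⊓ 0ℤ ≡ - (+ ∣ x ∣)
  ⊓-abs (+ zero) = refl
  ⊓-abs (+ suc m) = refl
  ⊓-abs -[1+ m ] = refl

  cartan : ∀ i j → d i * cartanCompanion B i j ≡ F i j + F j i
  cartan i j = [ same , distinct ]′ (eq-or-not i j)
   where
   open ≡-Reasoning
   companion-diag : ∀ i → cartanCompanion B i i ≡ + 2
   companion-diag i with i ≟ i
   ... | yes _ = refl
   ... | no ne = ⊥-elim (ne refl)
   companion-off : i ≢ j → cartanCompanion B i j ≡ - (+ ∣ B i j ∣)
   companion-off ne with i ≟ j
   ... | yes e = ⊥-elim (ne e)
   ... | no _ = refl
   same : i ≡ j → d i * cartanCompanion B i j ≡ F i j + F j i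
   same refl = trans (cong (d i *_) (companion-diag i)) (trans (lem (d i)) (sym (cong (λ w → d i * w + d i * w) (euler-diag B i))))
    where
    lem : ∀ d → d * + 2 ≡ d * 1ℤ + d * 1ℤ
    lem = solve-∀
   distinct : i ≢ j → d i * cartanCompanion B i j ≡ F i j + F j i
   distinct ne = begin
    d i * cartanCompanion B i j                 ≡⟨ cong (d i *_) (companion-off ne) ⟩
    d i * - (+ ∣ B i j ∣)                       ≡⟨ cong (d i *_) (sym (⊓-abs (B i j))) ⟩
    d i * (B i j ⊓ 0ℤ + - B i j ⊓ 0ℤ)           ≡⟨ ℤP.*-distribˡ-+ (d i) (B i j ⊓ 0ℤ) (- B i j ⊓ 0ℤ) ⟩
    d i * (B i j ⊓ 0ℤ) + d i * (- B i j ⊓ 0ℤ)   ≡⟨ cong₂ (λ v w → d i * v + d i * w) (sym (euler-off B ne)) (sym (euler-off -B ne)) ⟩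
    F i j + d i * euler -B i j                  ≡⟨ cong (λ w → F i j + w) (sym (F≡v j i)) ⟩
    F i j + F j i ∎

  opaque
    unfolding ∑ ⟪_⟫
    quadratic : ∀ x → sumFin (λ i → sumFin (λ j → x i * (d i * cartanCompanion B i j) * x j)) ≡ ⟪ F ⟫ x x + ⟪ F ⟫ x x
    quadratic x = begin
      ∑ (λ i → ∑ (λ j → x i * (d i * cartanCompanion B i j) * x j))
        ≡⟨ sum-cong (λ i → trans (sum-cong (λ j → trans (cong (λ w → x i * w * x j) (cartan i j)) (lem (x i) (x j) (F i j) (F j i)))) (sum-+ (λ j → x i * F i j * x j) (λ j → x i * F j i * x j))) ⟩
      ∑ (λ i → ∑ (λ j → x i * F i j * x j) + ∑ (λ j → x i * F j i * x j))
        ≡⟨ sum-+ (λ i → ∑ (λ j → x i * F i j * x j)) (λ i → ∑ (λ j → x i * F j i * x j)) ⟩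
      ⟪ F ⟫ x x + ⟪ F ᵀ ⟫ x x
        ≡⟨ cong (λ w → ⟪ F ⟫ x x + w) (E-T F x x) ⟩
      ⟪ F ⟫ x x + ⟪ F ⟫ x x ∎
      where
      open ≡-Reasoning
      lem : ∀ a b f g → a * (f + g) * b ≡ a * f * b + a * g * b
      lem = solve-∀

  positive : ∀ x → (∃ λ i → x i ≢ 0ℤ) → 0ℤ < ⟪ F ⟫ x x
  positive x nz = ℤP.≰⇒> (λ p → <⇒⊥ (subst (0ℤ <_) (quadratic x) (fin x nz)) (ℤP.+-mono-≤ p p))

  𝓔 : EulerForm n
  𝓔 = record
    { F = F ; δ = d ; δ>0 = d>0
    ; diag = λ i → trans (cong (d i *_) (euler-diag B i)) (ℤP.*-identityʳ (d i))
    ; off = λ i j ne → *≤0 (ℤP.<⇒≤ (d>0 i)) (subst (_≤ 0ℤ) (sym (euler-off B ne)) (ℤP.i⊓j≤j (B i j) 0ℤ))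
    ; u = euler B ; v = λ i j → euler -B j i ; F≡δu = λ i j → refl ; F≡δv = F≡v
    ; h = λ i → + height i
    ; tri = λ i j ne p → trans (cong (d i *_) (trans (euler-off B ne) (ℤP.i≥j⇒i⊓j≡j (ℤP.≮⇒≥ (λ q → ℕP.<⇒≱ (height-mono i j q) (ℤP.drop‿+≤+ p)))))) (ℤP.*-zeroʳ (d i))
    ; posdef = positive ; P = Pv ; I = Iv ; P-spec = P-spec ; I-spec = I-spec }

  -- Chosen so that ν (e₀ p) = ρ_p, the degree of x_p.
  e₀ : Fin n → Vect n
  e₀ p i = - Iv p i

  α-root : ∀ i → Euler.IsRoot 𝓔 (d i) (α i)
  α-root i = record
    { norm = trans (E-αα F i i) (trans (cong (d i *_) (euler-diag B i)) (ℤP.*-identityʳ (d i)))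
    ; divˡ = λ y → ∑ (λ j → euler B i j * y j) , trans (E-αˡ F i y) (trans (sum-cong (λ j → ℤP.*-assoc (d i) (euler B i j) (y j))) (sum-* (d i) (λ j → euler B i j * y j)))
    ; divʳ = λ y → Euler.κ 𝓔 y i , Euler.κ-spec 𝓔 y i }

  α-not-nonpos : ∀ i → ¬ Nonpos (α {n} i)
  α-not-nonpos i p = <⇒⊥ (+<+ (ℕ.s≤s ℕ.z≤n)) (subst (_≤ 0ℤ) (α-diag i) (p i))

  F-skew : ∀ i j → d i * B i j ≡ F i j - F j i
  F-skew i j = [ same , distinct ]′ (eq-or-not i j)
   where
   open ≡-Reasoning
   *-self : ∀ {a} → a ≡ - a → a ≡ 0ℤ
   *-self {+ zero} _ = refl
   *-self {+ suc _} ()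
   *-self { -[1+ _ ]} ()
   same : i ≡ j → d i * B i j ≡ F i j - F j i
   same refl = trans (*-self (sk i i)) (sym (ℤP.+-inverseʳ (F i i)))
   lem : ∀ x → x ≡ x ⊓ 0ℤ - (- x ⊓ 0ℤ)
   lem (+ zero) = refl
   lem (+ suc m) = sym (ℤP.+-identityˡ (+ suc m))
   lem -[1+ m ] = sym (ℤP.+-identityʳ -[1+ m ])
   lem₂ : ∀ d a b → d * (a - b) ≡ d * a - d * b
   lem₂ = solve-∀
   distinct : i ≢ j → d i * B i j ≡ F i j - F j i
   distinct ne = begin
    d i * B i j                               ≡⟨ cong (d i *_) (lem (B i j)) ⟩
    d i * (B i j ⊓ 0ℤ - (- B i j ⊓ 0ℤ))       ≡⟨ lem₂ (d i) (B i j ⊓ 0ℤ) (- B i j ⊓ 0ℤ) ⟩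
    d i * (B i j ⊓ 0ℤ) - d i * (- B i j ⊓ 0ℤ) ≡⟨ cong₂ (λ v w → d i * v - d i * w) (sym (euler-off B ne)) (sym (euler-off -B ne)) ⟩
    F i j - d i * euler -B i j                ≡⟨ cong (λ w → F i j - w) (sym (F≡v j i)) ⟩
    F i j - F j i ∎

  cseed₀ : CSeed 𝓔 α B
  cseed₀ = record
    { root = α-root
    ; ω = λ i j → trans (F-skew i j) (sym (cong₂ _-_ (E-αα F i j) (E-αα F j i)))
    ; pos-neg = λ i j p q → ⊥-elim (α-not-nonpos j q)
    ; pos-pos = λ i j ne p q → subst (_≤ 0ℤ) (sym (E-αα F i j)) (EulerForm.off 𝓔 i j ne)
    ; neg-neg = λ i j ne p q → ⊥-elim (α-not-nonpos i p) }

  e₀-E : ∀ p x → ⟪ F ⟫ x (e₀ p) ≡ - (d p * x p)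
  e₀-E p x = trans (E-negʳ F x (Iv p)) (cong -_ (I-spec p x))

  eseed₀ : ESeed 𝓔 α e₀
  eseed₀ = record
    { pair-diag = λ p → trans (e₀-E p (α p)) (cong -_ (trans (cong (d p *_) (α-diag p)) (ℤP.*-identityʳ (d p))))
    ; pair-off = λ q p ne → trans (e₀-E p (α q)) (cong -_ (trans (cong (d p *_) (α-off (≢-sym ne))) (ℤP.*-zeroʳ (d p))))
    ; ediv = λ p y → - y p , trans (e₀-E p y) (ℤP.neg-distribʳ-* (d p) (y p))
    ; einj = λ x z p → *-cancel-0 (d>0 p) (ℤP.neg-injective (trans (sym (e₀-E p x)) (z p))) }

  initAt₀ : ∀ p → InitAt 𝓔 (d p) (e₀ p) p
  initAt₀ p = record { size = refl ; coord = e₀-E p }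

  opaque
    unfolding ∑
    d*ν : ∀ x l → d l * ν B x l ≡ - ⟪ F ⟫ (α l) x
    d*ν x l = trans (sym (ℤP.neg-distribʳ-* (d l) (sumFin (λ j → euler B l j * x j)))) (cong -_ (sym (trans (E-αˡ F l x) (trans (sum-cong (λ j → ℤP.*-assoc (d l) (euler B l j) (x j))) (sum-* (d l) (λ j → euler B l j * x j))))))

-- Mutation of extended exchange matrices

cvec : ∀ {n} → (Row n → Fin n → ℤ) → Fin n → Vect n
cvec m k j = m (inj₂ j) k

bmat : ∀ {n} → (Row n → Fin n → ℤ) → Form n
bmat m i j = m (inj₁ i) j

exp⁺ exp⁻ : ∀ {n} → (Row n → Fin n → ℤ) → Fin n → Vect n
exp⁺ m k q = (bmat m q k) ⁺
exp⁻ m k q = (- bmat m q k) ⁺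

module _ {n} (k : Fin n) (m : Row n → Fin n → ℤ) where

  mutMat-col : ∀ p → mutMat k m p k ≡ - m p k
  mutMat-col p with isK k p | k ≟ k
  ... | true | _ = refl
  ... | false | yes _ = refl
  ... | false | no ne = ⊥-elim (ne refl)

  mutMat-row : ∀ j → mutMat k m (inj₁ k) j ≡ - m (inj₁ k) j
  mutMat-row j with k ≟ k
  ... | yes _ = refl
  ... | no ne = ⊥-elim (ne refl)

  mutMat-off : ∀ p j → p ≢ inj₁ k → j ≢ k → mutMat k m p j ≡ m p j + (m p k * (m (inj₁ k) j) ⁺ + (- m p k) ⁺ * m (inj₁ k) j)
  mutMat-off (inj₁ i) j np nj with i ≟ k | j ≟ k
  ... | yes refl | _ = ⊥-elim (np refl)
  ... | no _ | yes e = ⊥-elim (nj e)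
  ... | no _ | no _ = cong (λ w → m (inj₁ i) j + w) (sgn-formula (m (inj₁ i) k) (m (inj₁ k) j))
  mutMat-off (inj₂ i) j np nj with j ≟ k
  ... | yes e = ⊥-elim (nj e)
  ... | no _ = cong (λ w → m (inj₂ i) j + w) (sgn-formula (m (inj₂ i) k) (m (inj₁ k) j))

  mutB : MutB k (bmat m) (bmat (mutMat k m))
  mutB = record
    { row = mutMat-row
    ; col = λ i → mutMat-col (inj₁ i)
    ; inner = λ i j ni nj → trans (mutMat-off (inj₁ i) j (λ { refl → ni refl }) nj) (cong (λ w → m (inj₁ i) j + w) (sym (sgn-formula (m (inj₁ i) k) (m (inj₁ k) j)))) }

  mutC-green : (𝓔 : EulerForm n) → Nonneg (cvec m k) → MutC 𝓔 k (λ j → (bmat m k j) ⁺) (cvec m) (cvec (mutMat k m))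
  mutC-green 𝓔 green = record
    { at-k = λ i → mutMat-col (inj₂ i)
    ; off-k = λ j ne i → trans (mutMat-off (inj₂ i) j (λ ()) ne) (cong (λ w → m (inj₂ i) j + w) (lem (m (inj₂ i) k) (m (inj₁ k) j) (green i))) }
    where
    lem : ∀ c b → 0ℤ ≤ c → c * b ⁺ + (- c) ⁺ * b ≡ b ⁺ * c
    lem c b p = trans (cong (λ w → c * b ⁺ + w * b) (⁺-neg (neg-≤0 p))) (trans (ℤP.+-identityʳ (c * b ⁺)) (ℤP.*-comm c (b ⁺)))

  mutC-red : (𝓔 : EulerForm n) → Nonpos (cvec m k) → MutC 𝓔 k (λ j → (- bmat m k j) ⁺) (cvec m) (cvec (mutMat k m))
  mutC-red 𝓔 red = record
    { at-k = λ i → mutMat-col (inj₂ i)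
    ; off-k = λ j ne i → trans (mutMat-off (inj₂ i) j (λ ()) ne) (cong (λ w → m (inj₂ i) j + w) (lem (m (inj₂ i) k) (m (inj₁ k) j) (red i))) }
    where
    lem : ∀ c b → c ≤ 0ℤ → c * b ⁺ + (- c) ⁺ * b ≡ (- b) ⁺ * c
    lem c b p = trans (cong (λ w → c * b ⁺ + w * b) (⁺-pos (0≤-neg p))) (l c b (b ⁺) ((- b) ⁺) (⁺-diff b))
      where
      l : ∀ c b p q → b ≡ p - q → c * p + - c * b ≡ q * c
      l c _ p q refl = l′ c p q
        where
        l′ : ∀ c p q → c * p + - c * (p - q) ≡ q * c
        l′ = solve-∀

-- Mutation of c-vectors and e-vectors together

module Mutation {n} (𝓔 : EulerForm n) where
  open EulerForm 𝓔

  record Valid (m : Row n → Fin n → ℤ) (e : Fin n → Vect n) : Set where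
    field
      cseed : CSeed 𝓔 (cvec m) (bmat m)
      eseed : ESeed 𝓔 (cvec m) e
    open CSeedFacts 𝓔 cseed public using (sign; not-both; b-diag; b-skew; ⁺-skew)
    open Statuses 𝓔 cseed eseed public using (status)

  -- What a mutation must supply for the cluster variables: `tropical` for degrees, `max-plus` for
  -- degrees in the y_l, `max-den` for orders along the x_l.
  record Step (k : Fin n) (m : Row n → Fin n → ℤ) {e e′ : Fin n → Vect n} (V : Valid m e) (V′ : Valid (mutMat k m) e′) : Set where
    field
      tropical : (Nonneg (cvec m k) × (∀ l → e′ k l ≡ - e k l + lincomb (exp⁻ m k) e l)) ⊎ (Nonpos (cvec m k) × (∀ l → e′ k l ≡ - e k l + lincomb (exp⁺ m k) e l))
      e-off : ∀ p → p ≢ k → ∀ l → e′ p l ≡ e p l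
      max-plus : ∀ l → plus (Valid.status V k) l + plus (Valid.status V′ k) l ≡
        (lincomb (exp⁺ m k) (λ q → plus (Valid.status V q)) l + (cvec m k l) ⁺) ⊔ (lincomb (exp⁻ m k) (λ q → plus (Valid.status V q)) l + (- cvec m k l) ⁺)
      max-den : ∀ l → den (Valid.status V k) l + den (Valid.status V′ k) l ≡ lincomb (exp⁺ m k) (λ q → den (Valid.status V q)) l ⊔ lincomb (exp⁻ m k) (λ q → den (Valid.status V q)) l

  module _ (k : Fin n) (m : Row n → Fin n → ℤ) {e : Fin n → Vect n} (V : Valid m e) where
    open Valid V

    private
      b = bmat m
      c = cvec m
      A B : Vect n
      A q = (b q k) ⁺
      B q = (- b q k) ⁺
      m′ = mutMat k m
      Ak≡0 : A k ≡ 0ℤ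
      Ak≡0 = cong _⁺ (b-diag k)
      Bk≡0 : B k ≡ 0ℤ
      Bk≡0 = cong (λ w → (- w) ⁺) (b-diag k)

      new : Vect n → Fin n → Vect n
      new t q l = if ⌊ q ≟ k ⌋ then - e k l + lincomb t e l else e q l

      new-k : ∀ t l → new t k l ≡ - e k l + lincomb t e l
      new-k t l with k ≟ k
      ... | yes _ = refl
      ... | no ne = ⊥-elim (ne refl)

      new-off : ∀ t q → q ≢ k → ∀ l → new t q l ≡ e q l
      new-off t q ne l with q ≟ k
      ... | yes e = ⊥-elim (ne e)
      ... | no _ = refl

      mutE : ∀ t → MutE 𝓔 k t e (new t)
      mutE t = record { at-k = new-k t ; off-k = new-off t }

      lincomb-swap : ∀ {x y : Fin n → Vect n} t → t k ≡ 0ℤ → ∀ l → (∀ q → q ≢ k → x q l ≡ y q l) → lincomb t x l ≡ lincomb t y l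
      lincomb-swap {x} {y} t tk l p = sum-cong (λ q → term q (q ≟ k))
        where
        term : ∀ q → Dec (q ≡ k) → t q * x q l ≡ t q * y q l
        term q (yes refl) = trans (cong (_* x k l) tk) (sym (cong (_* y k l) tk))
        term q (no ne) = cong (t q *_) (p q ne)

    green-step : Nonneg (c k) → ∃ λ e′ → Σ (Valid m′ e′) (Step k m V)
    green-step green = new B , V′ , record
      { tropical = inj₁ (green , new-k B)
      ; e-off = new-off B
      ; max-plus = λ l → trans (X.exchange⁺ l) (cong₂ _⊔_ (cong (λ w → lincomb A X.e⁺ l + w) (sym (⁺-pos (green l)))) (trans (sym (ℤP.+-identityʳ (lincomb B X.e⁺ l))) (cong (λ w → lincomb B X.e⁺ l + w) (sym (⁺-neg (neg-≤0 (green l)))))))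
      ; max-den = X.exchange-den }
      where
      V′ : Valid m′ (new B)
      V′ = record
        { cseed = mutate-green 𝓔 cseed green (mutB k m) (mutC-green k m 𝓔 green)
        ; eseed = mutate-E 𝓔 eseed (mutC-green k m 𝓔 green) (mutE B) (λ q → sym (⁺-skew k q)) Bk≡0 }
      module X = Exchange 𝓔 cseed eseed (Valid.cseed V′) (Valid.eseed V′) k green (mutC-green k m 𝓔 green) (mutE B)

    -- Seen from the new seed, the mutation back at k is green. Its exchange relations are the
    -- required ones, with the two variables and the two monomials interchanged.
    red-step : Nonpos (c k) → ∃ λ e′ → Σ (Valid m′ e′) (Step k m V)
    red-step red = new A , V′ , record
      { tropical = inj₂ (red , new-k A)
      ; e-off = new-off A
      ; max-plus = λ l → trans (ℤP.+-comm (plus (status k) l) (plus (V′.status k) l)) (trans (X.exchange⁺ l) (trans (ℤP.⊔-comm (lincomb X.A X.e⁺ l + cvec m′ k l) (lincomb X.B X.e⁺ l)) (cong₂ _⊔_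
          (trans (swap {f = plus} (λ l q s s′ p → plus-unique 𝓔 s s′ p l) X.B A (λ q → cong _⁺ (negb q)) Ak≡0 l) (trans (sym (ℤP.+-identityʳ (lincomb A (λ q → plus (status q)) l))) (cong (λ w → lincomb A (λ q → plus (status q)) l + w) (sym (⁺-neg (red l))))))
          (cong₂ _+_ (swap {f = plus} (λ l q s s′ p → plus-unique 𝓔 s s′ p l) X.A B (λ q → cong _⁺ (mutMat-col k m (inj₁ q))) Bk≡0 l) (trans (mutMat-col k m (inj₂ l)) (sym (⁺-pos (0≤-neg (red l)))))))))
      ; max-den = λ l → trans (ℤP.+-comm (den (status k) l) (den (V′.status k) l)) (trans (X.exchange-den l) (trans (ℤP.⊔-comm (lincomb X.A X.dn l) (lincomb X.B X.dn l)) (cong₂ _⊔_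
          (swap {f = den} (λ l q s s′ p → den-unique 𝓔 s s′ p l) X.B A (λ q → cong _⁺ (negb q)) Ak≡0 l)
          (swap {f = den} (λ l q s s′ p → den-unique 𝓔 s s′ p l) X.A B (λ q → cong _⁺ (mutMat-col k m (inj₁ q))) Bk≡0 l)))) }
      where
      V′ : Valid m′ (new A)
      V′ = record
        { cseed = mutate-red 𝓔 cseed red (mutB k m) (mutC-red k m 𝓔 red)
        ; eseed = mutate-E 𝓔 eseed (mutC-red k m 𝓔 red) (mutE A) (λ q → ⁺-skew q k) Ak≡0 }
      module V′ = Valid V′
      module M = MutC (mutC-red k m 𝓔 red)
      mc : MutC 𝓔 k (λ j → (bmat m′ k j) ⁺) (cvec m′) c
      mc = record
        { at-k = λ i → trans (sym (ℤP.neg-involutive (c k i))) (cong -_ (sym (M.at-k i)))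
        ; off-k = λ j ne i → trans (lem (c j i) ((- b k j) ⁺) (c k i)) (cong₂ _+_ (sym (M.off-k j ne i)) (cong₂ _*_ (cong _⁺ (sym (mutMat-row k m j))) (sym (M.at-k i)))) }
        where
        lem : ∀ a t x → a ≡ a + t * x + t * - x
        lem = solve-∀
      negb : ∀ q → - bmat m′ q k ≡ b q k
      negb q = trans (cong -_ (mutMat-col k m (inj₁ q))) (ℤP.neg-involutive (b q k))
      me : MutE 𝓔 k (λ q → (- bmat m′ q k) ⁺) (new A) e
      me = record
        { at-k = λ l → trans (lem (e k l) (lincomb A e l)) (cong₂ _+_ (cong -_ (sym (new-k A l))) (trans (lincomb-swap {e} {new A} A Ak≡0 l (λ q ne → sym (new-off A q ne l))) (sum-cong (λ q → cong (λ w → w ⁺ * new A q l) (sym (negb q))))))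
        ; off-k = λ q ne l → sym (new-off A q ne l) }
        where
        lem : ∀ a s → a ≡ - (- a + s) + s
        lem = solve-∀
      green′ : Nonneg (cvec m′ k)
      green′ i = subst (0ℤ ≤_) (sym (M.at-k i)) (0≤-neg (red i))
      module X = Exchange 𝓔 (Valid.cseed V′) (Valid.eseed V′) cseed eseed k green′ mc me
      swap : {f : ∀ {d x} → Status 𝓔 d x → Vect n} →
        (∀ l q (s : Status 𝓔 (δ q) (new A q)) (s′ : Status 𝓔 (δ q) (e q)) → (∀ l → new A q l ≡ e q l) → f s l ≡ f s′ l) →
        ∀ t t′ → (∀ q → t q ≡ t′ q) → t′ k ≡ 0ℤ → ∀ l → lincomb t (λ q → f (V′.status q)) l ≡ lincomb t′ (λ q → f (status q)) l
      swap {f} un t t′ tt′ tk l = trans (sum-cong (λ q → cong (_* f (V′.status q) l) (tt′ q))) (lincomb-swap {λ q → f (V′.status q)} {λ q → f (status q)} t′ tk l (λ q ne → un l q (V′.status q) (status q) (new-off A q ne)))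

    mutation-step : ∃ λ e′ → Σ (Valid m′ e′) (Step k m V)
    mutation-step = [ green-step , red-step ]′ (sign k)

-- Polynomials as linear functionals on functions of the exponent

-- Two instances are used: the integers, where coefficients are read off, and the rationals, where
-- the fractions that represent cluster variables have values.
record EvalRing : Set₁ where
  infixl 6 _⊕_
  infixl 7 _⊗_
  field
    K : Set
    _⊕_ _⊗_ : K → K → K
    ⊝_ : K → K
    0K 1K : K
    isCR : IsCommutativeRing _≡_ _⊕_ _⊗_ ⊝_ 0K 1K
    ι : ℤ → K
    ι-+ : ∀ a b → ι (a + b) ≡ ι a ⊕ ι b
    ι-* : ∀ a b → ι (a * b) ≡ ι a ⊗ ι b
    ι-0 : ι 0ℤ ≡ 0K
    ι-1 : ι 1ℤ ≡ 1K
  open IsCommutativeRing isCR public using ()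
    renaming (+-assoc to ⊕-assoc; +-comm to ⊕-comm; +-identityˡ to ⊕-identityˡ; +-identityʳ to ⊕-identityʳ; *-assoc to ⊗-assoc; *-comm to ⊗-comm;
      *-identityˡ to ⊗-identityˡ; *-identityʳ to ⊗-identityʳ; distribˡ to ⊗-distribˡ; distribʳ to ⊗-distribʳ; zeroˡ to ⊗-zeroˡ; zeroʳ to ⊗-zeroʳ)

  ⊕-interchange : ∀ a b c d → (a ⊕ b) ⊕ (c ⊕ d) ≡ (a ⊕ c) ⊕ (b ⊕ d)
  ⊕-interchange a b c d = begin
    (a ⊕ b) ⊕ (c ⊕ d) ≡⟨ ⊕-assoc a b (c ⊕ d) ⟩
    a ⊕ (b ⊕ (c ⊕ d)) ≡⟨ cong (a ⊕_) (trans (sym (⊕-assoc b c d)) (trans (cong (_⊕ d) (⊕-comm b c)) (⊕-assoc c b d))) ⟩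
    a ⊕ (c ⊕ (b ⊕ d)) ≡⟨ sym (⊕-assoc a c (b ⊕ d)) ⟩
    (a ⊕ c) ⊕ (b ⊕ d) ∎
    where open ≡-Reasoning

  ⊗-interchange : ∀ a b c d → (a ⊗ b) ⊗ (c ⊗ d) ≡ (a ⊗ c) ⊗ (b ⊗ d)
  ⊗-interchange a b c d = begin
    (a ⊗ b) ⊗ (c ⊗ d) ≡⟨ ⊗-assoc a b (c ⊗ d) ⟩
    a ⊗ (b ⊗ (c ⊗ d)) ≡⟨ cong (a ⊗_) (trans (sym (⊗-assoc b c d)) (trans (cong (_⊗ d) (⊗-comm b c)) (⊗-assoc c b d))) ⟩
    a ⊗ (c ⊗ (b ⊗ d)) ≡⟨ sym (⊗-assoc a c (b ⊗ d)) ⟩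
    (a ⊗ c) ⊗ (b ⊗ d) ∎
    where open ≡-Reasoning

ℤ-ring : EvalRing
ℤ-ring = record { isCR = ℤP.+-*-isCommutativeRing ; ι = λ z → z ; ι-+ = λ _ _ → refl ; ι-* = λ _ _ → refl ; ι-0 = refl ; ι-1 = refl }

module Pairing (R : EvalRing) {n : ℕ} where
  open EvalRing R

  ⟨_,_⟩ : Poly n → (Monomial n → K) → K
  ⟨ [] , φ ⟩ = 0K
  ⟨ (c , m) ∷ p , φ ⟩ = ι c ⊗ φ m ⊕ ⟨ p , φ ⟩

  ⟨⟩-cong : ∀ p {φ ψ} → (∀ m → φ m ≡ ψ m) → ⟨ p , φ ⟩ ≡ ⟨ p , ψ ⟩
  ⟨⟩-cong [] e = refl
  ⟨⟩-cong ((c , m) ∷ p) e = cong₂ (λ a b → ι c ⊗ a ⊕ b) (e m) (⟨⟩-cong p e)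

  ⟨⟩-++ : ∀ p q φ → ⟨ p ++ q , φ ⟩ ≡ ⟨ p , φ ⟩ ⊕ ⟨ q , φ ⟩
  ⟨⟩-++ [] q φ = sym (⊕-identityˡ _)
  ⟨⟩-++ ((c , m) ∷ p) q φ = trans (cong (ι c ⊗ φ m ⊕_) (⟨⟩-++ p q φ)) (sym (⊕-assoc _ _ _))

  ⟨⟩-⊕ : ∀ p φ ψ → ⟨ p , (λ m → φ m ⊕ ψ m) ⟩ ≡ ⟨ p , φ ⟩ ⊕ ⟨ p , ψ ⟩
  ⟨⟩-⊕ [] φ ψ = sym (⊕-identityˡ 0K)
  ⟨⟩-⊕ ((c , m) ∷ p) φ ψ = trans (cong₂ _⊕_ (⊗-distribˡ (ι c) (φ m) (ψ m)) (⟨⟩-⊕ p φ ψ)) (⊕-interchange _ _ _ _)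

  ⟨⟩-⊗ : ∀ p a φ → ⟨ p , (λ m → a ⊗ φ m) ⟩ ≡ a ⊗ ⟨ p , φ ⟩
  ⟨⟩-⊗ [] a φ = sym (⊗-zeroʳ a)
  ⟨⟩-⊗ ((c , m) ∷ p) a φ = trans (cong₂ _⊕_ (trans (sym (⊗-assoc (ι c) a (φ m))) (trans (cong (_⊗ φ m) (⊗-comm (ι c) a)) (⊗-assoc a (ι c) (φ m)))) (⟨⟩-⊗ p a φ)) (sym (⊗-distribˡ a _ _))

  ⟨⟩-map : ∀ (g : ℤ × Monomial n → ℤ × Monomial n) c (s : Monomial n → Monomial n) → (∀ c′ m′ → g (c′ , m′) ≡ (c * c′ , s m′)) →
    ∀ q φ → ⟨ map g q , φ ⟩ ≡ ι c ⊗ ⟨ q , (λ m → φ (s m)) ⟩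
  ⟨⟩-map g c s e [] φ = sym (⊗-zeroʳ (ι c))
  ⟨⟩-map g c s e ((c′ , m′) ∷ q) φ rewrite e c′ m′ = trans (cong₂ _⊕_ (trans (cong (_⊗ φ (s m′)) (ι-* c c′)) (⊗-assoc (ι c) (ι c′) (φ (s m′)))) (⟨⟩-map g c s e q φ)) (sym (⊗-distribˡ (ι c) _ _))

  ⟨⟩-* : ∀ p q φ → ⟨ p *P q , φ ⟩ ≡ ⟨ p , (λ m → ⟨ q , (λ m′ → φ (mulM m m′)) ⟩) ⟩
  ⟨⟩-* [] q φ = refl
  ⟨⟩-* ((c , m) ∷ p) q φ = trans (⟨⟩-++ (map _ q) (p *P q) φ) (cong₂ _⊕_ (⟨⟩-map _ c (mulM m) (λ _ _ → refl) q φ) (⟨⟩-* p q φ))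

  remove : Monomial n → Poly n → Poly n
  remove m [] = []
  remove m ((c , m′) ∷ p) = if ⌊ m′ ≟M m ⌋ then remove m p else (c , m′) ∷ remove m p

  remove-length : ∀ m p → length (remove m p) ℕ.≤ length p
  remove-length m [] = ℕ.z≤n
  remove-length m ((c , m′) ∷ p) with m′ ≟M m
  ... | yes _ = ℕP.m≤n⇒m≤1+n (remove-length m p)
  ... | no _ = ℕ.s≤s (remove-length m p)

  remove-same : ∀ m p → coeff (remove m p) m ≡ 0ℤ
  remove-same m [] = refl
  remove-same m ((c , m′) ∷ p) with m′ ≟M m
  ... | yes _ = remove-same m p
  ... | no ne with m′ ≟M m
  ...   | yes e = ⊥-elim (ne e)
  ...   | no _ = remove-same m p

  remove-other : ∀ m {m″} p → m″ ≢ m → coeff (remove m p) m″ ≡ coeff p m″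
  remove-other m [] ne = refl
  remove-other m {m″} ((c , m′) ∷ p) ne with m′ ≟M m
  remove-other m {m″} ((c , m′) ∷ p) ne | yes refl with m′ ≟M m″
  ... | yes e = ⊥-elim (ne (sym e))
  ... | no _ = remove-other m p ne
  remove-other m {m″} ((c , m′) ∷ p) ne | no _ with m′ ≟M m″
  ... | yes _ = cong (λ w → c + w) (remove-other m p ne)
  ... | no _ = remove-other m p ne

  ⟨⟩-remove : ∀ m p φ → ⟨ p , φ ⟩ ≡ ι (coeff p m) ⊗ φ m ⊕ ⟨ remove m p , φ ⟩
  ⟨⟩-remove m [] φ = sym (trans (cong (_⊕ 0K) (trans (cong (_⊗ φ m) ι-0) (⊗-zeroˡ (φ m)))) (⊕-identityˡ 0K))
  ⟨⟩-remove m ((c , m′) ∷ p) φ with m′ ≟M m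
  ... | yes refl = trans (cong (ι c ⊗ φ m ⊕_) (⟨⟩-remove m p φ)) (trans (sym (⊕-assoc _ _ _)) (cong (_⊕ ⟨ remove m p , φ ⟩) (trans (sym (⊗-distribʳ (φ m) (ι c) (ι (coeff p m)))) (cong (_⊗ φ m) (sym (ι-+ c (coeff p m)))))))
  ... | no _ = trans (cong (ι c ⊗ φ m′ ⊕_) (⟨⟩-remove m p φ)) (trans (sym (⊕-assoc _ _ _)) (trans (cong (_⊕ ⟨ remove m p , φ ⟩) (⊕-comm _ _)) (⊕-assoc _ _ _)))

  -- A list may repeat a monomial, and repeated terms may cancel. Therefore all occurrences of the
  -- head monomial are removed at once and replaced by their total coefficient; the bound on the
  -- length makes the recursion terminate.
  ⟨⟩-support : ∀ p {φ ψ} → (∀ m → coeff p m ≢ 0ℤ → φ m ≡ ψ m) → ⟨ p , φ ⟩ ≡ ⟨ p , ψ ⟩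
  ⟨⟩-support p {φ} {ψ} = go (length p) p ℕP.≤-refl
    where
    go : ∀ l p → length p ℕ.≤ l → (∀ m → coeff p m ≢ 0ℤ → φ m ≡ ψ m) → ⟨ p , φ ⟩ ≡ ⟨ p , ψ ⟩
    go l [] _ e = refl
    go (suc l) p@((c , m) ∷ r) (ℕ.s≤s b) e = trans (⟨⟩-remove m p φ) (trans (cong₂ _⊕_ first rest) (sym (⟨⟩-remove m p ψ)))
      where
      first : ι (coeff p m) ⊗ φ m ≡ ι (coeff p m) ⊗ ψ m
      first with coeff p m ℤ.≟ 0ℤ
      ... | yes z = trans (cong (λ w → ι w ⊗ φ m) z) (trans (trans (cong (_⊗ φ m) ι-0) (⊗-zeroˡ (φ m))) (sym (trans (cong (λ w → ι w ⊗ ψ m) z) (trans (cong (_⊗ ψ m) ι-0) (⊗-zeroˡ (ψ m))))))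
      ... | no nz = cong (ι (coeff p m) ⊗_) (e m nz)
      short : length (remove m p) ℕ.≤ l
      short with m ≟M m
      ... | yes _ = ℕP.≤-trans (remove-length m r) b
      ... | no ne = ⊥-elim (ne refl)
      rest : ⟨ remove m p , φ ⟩ ≡ ⟨ remove m p , ψ ⟩
      rest = go l (remove m p) short (λ m″ nz → e m″ (λ z → nz (back m″ z)))
        where
        back : ∀ m″ → coeff p m″ ≡ 0ℤ → coeff (remove m p) m″ ≡ 0ℤ
        back m″ z with m″ ≟M m
        ... | yes refl = remove-same m p
        ... | no ne = trans (remove-other m p ne) z

  ⟨⟩-null : ∀ p {φ} → (∀ m → coeff p m ≢ 0ℤ → φ m ≡ 0K) → ⟨ p , φ ⟩ ≡ 0K
  ⟨⟩-null p z = trans (⟨⟩-support p {ψ = λ _ → 0K ⊗ 0K} (λ m nz → trans (z m nz) (sym (⊗-zeroˡ 0K)))) (trans (⟨⟩-⊗ p 0K (λ _ → 0K)) (⊗-zeroˡ _))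

module ℤPair {n : ℕ} = Pairing ℤ-ring {n}

indicator : ∀ {n} → Monomial n → Monomial n → ℤ
indicator m m′ = if ⌊ m′ ≟M m ⌋ then 1ℤ else 0ℤ

indicator-same : ∀ {n} (m : Monomial n) → indicator m m ≡ 1ℤ
indicator-same m with m ≟M m
... | yes _ = refl
... | no ne = ⊥-elim (ne refl)

indicator-other : ∀ {n} {m m′ : Monomial n} → m′ ≢ m → indicator m m′ ≡ 0ℤ
indicator-other {m = m} {m′} ne with m′ ≟M m
... | yes e = ⊥-elim (ne e)
... | no _ = refl

module _ {n : ℕ} where
  open ℤPair {n}

  coeff≡⟨⟩ : ∀ p m → coeff p m ≡ ⟨ p , indicator m ⟩
  coeff≡⟨⟩ [] m = refl
  coeff≡⟨⟩ ((c , m′) ∷ p) m with m′ ≟M m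
  ... | yes _ = cong₂ _+_ (sym (ℤP.*-identityʳ c)) (coeff≡⟨⟩ p m)
  ... | no _ = trans (coeff≡⟨⟩ p m) (sym (trans (cong (_+ ⟨ p , indicator m ⟩) (ℤP.*-zeroʳ c)) (ℤP.+-identityˡ _)))

  coeff-++ : ∀ (p q : Poly n) m → coeff (p ++ q) m ≡ coeff p m + coeff q m
  coeff-++ p q m = trans (coeff≡⟨⟩ (p ++ q) m) (trans (⟨⟩-++ p q (indicator m)) (sym (cong₂ _+_ (coeff≡⟨⟩ p m) (coeff≡⟨⟩ q m))))

  ⟨⟩-single : ∀ p m φ → (∀ m′ → coeff p m′ ≢ 0ℤ → m′ ≢ m → φ m′ ≡ 0ℤ) → ⟨ p , φ ⟩ ≡ coeff p m * φ m
  ⟨⟩-single p m φ z = begin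
    ⟨ p , φ ⟩                                  ≡⟨ ⟨⟩-support p (λ m′ nz → term m′ nz (m′ ≟M m)) ⟩
    ⟨ p , (λ m′ → φ m * indicator m m′) ⟩      ≡⟨ ⟨⟩-⊗ p (φ m) (indicator m) ⟩
    φ m * ⟨ p , indicator m ⟩                  ≡⟨ cong (φ m *_) (sym (coeff≡⟨⟩ p m)) ⟩
    φ m * coeff p m                            ≡⟨ ℤP.*-comm (φ m) (coeff p m) ⟩
    coeff p m * φ m ∎
    where
    open ≡-Reasoning
    term : ∀ m′ → coeff p m′ ≢ 0ℤ → Dec (m′ ≡ m) → φ m′ ≡ φ m * indicator m m′
    term m′ nz (yes refl) = sym (trans (cong (φ m *_) (indicator-same m)) (ℤP.*-identityʳ (φ m)))
    term m′ nz (no ne) = trans (z m′ nz ne) (sym (trans (cong (φ m *_) (indicator-other ne)) (ℤP.*-zeroʳ (φ m))))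

-- Base-K keys: additive and injective on exponents with digit sum < K

module Key (K : ℕ) where

  keyV : ∀ {l} → Vec ℕ l → ℕ → ℕ
  keyV [] z = z
  keyV (e ∷ v) z = e ℕ.+ K ℕ.* keyV v z

  key : ∀ {n} → Monomial n → ℕ
  key (e , f) = keyV e (keyV f 0)

  keyV-+ : ∀ {l} (v v′ : Vec ℕ l) z z′ → keyV (zipWith ℕ._+_ v v′) (z ℕ.+ z′) ≡ keyV v z ℕ.+ keyV v′ z′
  keyV-+ [] [] z z′ = refl
  keyV-+ (e ∷ v) (e′ ∷ v′) z z′ = trans (cong (λ w → e ℕ.+ e′ ℕ.+ K ℕ.* w) (keyV-+ v v′ z z′)) (lem e e′ K (keyV v z) (keyV v′ z′))
    where
    lem : ∀ a b k x y → a ℕ.+ b ℕ.+ k ℕ.* (x ℕ.+ y) ≡ a ℕ.+ k ℕ.* x ℕ.+ (b ℕ.+ k ℕ.* y)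
    lem = ℕSolver.solve-∀

  key-* : ∀ {n} (m m′ : Monomial n) → key (mulM m m′) ≡ key m ℕ.+ key m′
  key-* (e , f) (e′ , f′) = trans (cong (keyV (zipWith ℕ._+_ e e′)) (keyV-+ f f′ 0 0)) (keyV-+ e e′ (keyV f 0) (keyV f′ 0))

  keyV-injective : ∀ {l} (v v′ : Vec ℕ l) {z z′} → Vec.sum v ℕ.< K → Vec.sum v′ ℕ.< K → keyV v z ≡ keyV v′ z′ → v ≡ v′ × z ≡ z′
  keyV-injective [] [] _ _ e = refl , e
  keyV-injective (a ∷ v) (a′ ∷ v′) {z} {z′} b b′ e = let (ev , ez) = keyV-injective v v′ (ℕP.≤-<-trans (ℕP.m≤n+m (Vec.sum v) a) b) (ℕP.≤-<-trans (ℕP.m≤n+m (Vec.sum v′) a′) b′) tails in cong₂ _∷_ heads ev , ez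
    where
    instance
      K≢0 : ℕ.NonZero K
      K≢0 = ℕ.>-nonZero (ℕP.≤-<-trans ℕ.z≤n b)
    mod : ∀ a x → a ℕ.< K → (a ℕ.+ K ℕ.* x) ℕ.% K ≡ a
    mod a x p = trans (cong (λ w → (a ℕ.+ w) ℕ.% K) (ℕP.*-comm K x)) (trans (ℕDM.[m+kn]%n≡m%n a x K) (ℕDM.m<n⇒m%n≡m p))
    heads : a ≡ a′
    heads = trans (sym (mod a (keyV v z) (ℕP.≤-<-trans (ℕP.m≤m+n a (Vec.sum v)) b))) (trans (cong (ℕ._% K) e) (mod a′ (keyV v′ z′) (ℕP.≤-<-trans (ℕP.m≤m+n a′ (Vec.sum v′)) b′)))
    tails : keyV v z ≡ keyV v′ z′
    tails = ℕP.*-cancelˡ-≡ _ _ K (ℕP.+-cancelˡ-≡ a _ _ (trans e (cong (ℕ._+ K ℕ.* keyV v′ z′) (sym heads))))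

  Small : ∀ {n} → Monomial n → Set
  Small (e , f) = Vec.sum e ℕ.< K × Vec.sum f ℕ.< K

  key-injective : ∀ {n} {m m′ : Monomial n} → Small m → Small m′ → key m ≡ key m′ → m ≡ m′
  key-injective {m = e , f} {e′ , f′} (b , c) (b′ , c′) eq = let (p , q) = keyV-injective e e′ b b′ eq in cong₂ _,_ p (proj₁ (keyV-injective f f′ c c′ q))

bound : ∀ {n} → Poly n → ℕ
bound [] = 0
bound ((c , e , f) ∷ p) = Vec.sum e ℕ.+ Vec.sum f ℕ.+ bound p

coeff-bound : ∀ {n} (p : Poly n) m → coeff p m ≢ 0ℤ → Vec.sum (proj₁ m) ℕ.≤ bound p × Vec.sum (proj₂ m) ℕ.≤ bound p
coeff-bound [] m nz = ⊥-elim (nz refl)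
coeff-bound ((c , m′@(e , f)) ∷ p) m nz with m′ ≟M m
... | yes refl = ℕP.≤-trans (ℕP.m≤m+n (Vec.sum e) (Vec.sum f)) (ℕP.m≤m+n _ (bound p)) , ℕP.≤-trans (ℕP.m≤n+m (Vec.sum f) (Vec.sum e)) (ℕP.m≤m+n _ (bound p))
... | no _ = let (a , b) = coeff-bound p m nz in ℕP.≤-trans a (ℕP.m≤n+m (bound p) _) , ℕP.≤-trans b (ℕP.m≤n+m (bound p) _)

small : ∀ {n} (p : Poly n) {K} → bound p ℕ.< K → ∀ m → coeff p m ≢ 0ℤ → Key.Small K m
small p b m nz = let (x , y) = coeff-bound p m nz in ℕP.≤-<-trans x b , ℕP.≤-<-trans y b

coeff-member : ∀ {n} (p : Poly n) m → coeff p m ≢ 0ℤ → Any (λ t → proj₂ t ≡ m) p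
coeff-member [] m nz = ⊥-elim (nz refl)
coeff-member ((c , m′) ∷ p) m nz with m′ ≟M m
... | yes e = here e
... | no _ = there (coeff-member p m nz)

find-support : ∀ {n} (p : Poly n) {Q : Monomial n → Set} → (∀ m → Dec (Q m)) →
  (∃ λ m → coeff p m ≢ 0ℤ × Q m) ⊎ (∀ m → coeff p m ≢ 0ℤ → ¬ Q m)
find-support p {Q} Q? with Any.any? (λ t → ¬? (coeff p (proj₂ t) ℤ.≟ 0ℤ) ×-dec Q? (proj₂ t)) p
... | yes a = let ((_ , m) , q) = Any.satisfied a in inj₁ (m , q)
... | no na = inj₂ (λ m nz q → na (Any.map (λ { refl → nz , q }) (coeff-member p m nz)))

minimize : ∀ {n} (p : Poly n) {Q : Monomial n → Set} (Q? : ∀ m → Dec (Q m)) (k : Monomial n → ℕ) → (∃ λ m → coeff p m ≢ 0ℤ × Q m) →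
  ∃ λ m → (coeff p m ≢ 0ℤ × Q m) × (∀ m′ → coeff p m′ ≢ 0ℤ → Q m′ → k m ℕ.≤ k m′)
minimize p {Q} Q? k (m , nz , q) = go (k m) m nz q ℕP.≤-refl
  where
  go : ∀ b m → coeff p m ≢ 0ℤ → Q m → k m ℕ.≤ b → ∃ λ m → (coeff p m ≢ 0ℤ × Q m) × (∀ m′ → coeff p m′ ≢ 0ℤ → Q m′ → k m ℕ.≤ k m′)
  go b m nz q le with find-support p (λ m′ → Q? m′ ×-dec (k m′ ℕP.<? k m))
  ... | inj₂ none = m , (nz , q) , λ m′ nz′ q′ → ℕP.≮⇒≥ (λ lt → none m′ nz′ (q′ , lt))
  go zero m nz q le | inj₁ (m′ , nz′ , q′ , lt) = ⊥-elim (ℕP.n≮0 (ℕP.<-≤-trans lt le))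
  go (suc b) m nz q le | inj₁ (m′ , nz′ , q′ , lt) = go b m′ nz′ q′ (ℕP.≤-pred (ℕP.<-≤-trans lt le))

-- Orders of vanishing

record Weight (n : ℕ) : Set where
  field
    wt   : Monomial n → ℤ
    wt-* : ∀ m m′ → wt (mulM m m′) ≡ wt m + wt m′

record IsMin {n} (w : Weight n) (p : Poly n) (a : ℤ) : Set where
  constructor isMin
  open Weight w
  field
    attained : ∃ λ m → coeff p m ≢ 0ℤ × wt m ≡ a
    lower    : ∀ m → coeff p m ≢ 0ℤ → a ≤ wt m

module _ {n} {w : Weight n} where
  open Weight w
  open ℤPair {n}
  open IsMin

  IsMin-unique : ∀ {p q a b} → p ≈P q → IsMin w p a → IsMin w q b → a ≡ b
  IsMin-unique {p} {q} e P Q = let (m , nz , x) = attained P ; (m′ , nz′ , x′) = attained Q in ℤP.≤-antisym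
    (subst (_ ≤_) x′ (lower P m′ (λ z → nz′ (trans (sym (e m′)) z)))) (subst (_ ≤_) x (lower Q m (λ z → nz (trans (e m) z))))

  AtLeast : Poly n → ℤ → Set
  AtLeast p a = ∀ m → coeff p m ≢ 0ℤ → a ≤ wt m

  AtLeast-* : ∀ {p q a b} → AtLeast p a → AtLeast q b → AtLeast (p *P q) (a + b)
  AtLeast-* {p} {q} {a} {b} P Q M nz with (a + b) ℤ.≤? wt M
  ... | yes le = le
  ... | no gt = ⊥-elim (nz (trans (coeff≡⟨⟩ (p *P q) M) (trans (⟨⟩-* p q (indicator M)) (⟨⟩-null p (λ m nzm → ⟨⟩-null q (λ m′ nzm′ →
    indicator-other (λ e → gt (subst (a + b ≤_) (trans (sym (wt-* m m′)) (cong wt e)) (ℤP.+-mono-≤ (P m nzm) (Q m′ nzm′))))))))))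

  AtLeast-++ : ∀ {p q a} → AtLeast p a → AtLeast q a → AtLeast (p ++ q) a
  AtLeast-++ {p} {q} P Q m nz with coeff p m ℤ.≟ 0ℤ
  ... | no nzp = P m nzp
  ... | yes zp = Q m (λ zq → nz (trans (coeff-++ p q m) (cong₂ _+_ zp zq)))

  +-≤-cancel : ∀ {a b x y} → a ≤ x → b ≤ y → x + y ≡ a + b → x ≡ a × y ≡ b
  +-≤-cancel {a} {b} {x} {y} p q e = ℤP.≤-antisym (≤by (y - b) (0≤- q) (trans (lem a x y b) (cong (λ v → v + (y - b)) (trans (cong (λ w → a + b - w) e) (ℤP.+-inverseʳ (a + b))) ⟨trans⟩ ℤP.+-identityˡ (y - b)))) p
    , ℤP.≤-antisym (≤by (x - a) (0≤- p) (trans (lem′ a x y b) (cong (λ v → v + (x - a)) (trans (cong (λ w → a + b - w) e) (ℤP.+-inverseʳ (a + b))) ⟨trans⟩ ℤP.+-identityˡ (x - a)))) q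
    where
    infixl 4 _⟨trans⟩_
    _⟨trans⟩_ : ∀ {a b c : ℤ} → a ≡ b → b ≡ c → a ≡ c
    _⟨trans⟩_ = trans
    lem : ∀ a x y b → a - x ≡ (a + b - (x + y)) + (y - b)
    lem = solve-∀
    lem′ : ∀ a x y b → b - y ≡ (a + b - (x + y)) + (x - a)
    lem′ = solve-∀

  -- The monomials of least weight in p and q, with ties broken by an injective key, contribute the only
  -- term of their weight and key to the product.
  IsMin-* : ∀ {p q a b} → IsMin w p a → IsMin w q b → IsMin w (p *P q) (a + b)
  IsMin-* {p} {q} {a} {b} P Q = isMin (mulM m₁ m₂ , nonzero , trans (wt-* m₁ m₂) (cong₂ _+_ w₁ w₂)) (AtLeast-* {p} {q} (lower P) (lower Q))
    where
    -- One base for both factors: keys have to be injective on each support and additive across the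
    -- product.
    K = suc (bound p ℕ.+ bound q)
    open Key K
    pick : ∀ (p : Poly n) a → (∃ λ m → coeff p m ≢ 0ℤ × wt m ≡ a) → ∃ λ m → (coeff p m ≢ 0ℤ × wt m ≡ a) × (∀ m′ → coeff p m′ ≢ 0ℤ → wt m′ ≡ a → key m ℕ.≤ key m′)
    pick p a = minimize p (λ m → wt m ℤ.≟ a) key
    m₁ = proj₁ (pick p a (attained P))
    m₂ = proj₁ (pick q b (attained Q))
    nz₁ = proj₁ (proj₁ (proj₂ (pick p a (attained P))))
    nz₂ = proj₁ (proj₁ (proj₂ (pick q b (attained Q))))
    w₁ = proj₂ (proj₁ (proj₂ (pick p a (attained P))))
    w₂ = proj₂ (proj₁ (proj₂ (pick q b (attained Q))))
    only : ∀ m m′ → coeff p m ≢ 0ℤ → coeff q m′ ≢ 0ℤ → mulM m m′ ≡ mulM m₁ m₂ → m ≡ m₁ × m′ ≡ m₂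
    only m m′ nz nz′ e = key-injective (small p bp m nz) (small p bp m₁ nz₁) (sym k₁) , key-injective (small q bq m′ nz′) (small q bq m₂ nz₂) (sym k₂)
      where
      bp = ℕ.s≤s (ℕP.m≤m+n (bound p) (bound q))
      bq = ℕ.s≤s (ℕP.m≤n+m (bound q) (bound p))
      ws : wt m ≡ a × wt m′ ≡ b
      ws = +-≤-cancel (lower P m nz) (lower Q m′ nz′) (trans (sym (wt-* m m′)) (trans (cong wt e) (trans (wt-* m₁ m₂) (cong₂ _+_ w₁ w₂))))
      ks : key m ℕ.+ key m′ ≡ key m₁ ℕ.+ key m₂
      ks = trans (sym (key-* m m′)) (trans (cong key e) (key-* m₁ m₂))
      le₁ = proj₂ (proj₂ (pick p a (attained P))) m nz (proj₁ ws)
      le₂ = proj₂ (proj₂ (pick q b (attained Q))) m′ nz′ (proj₂ ws)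
      k₁ : key m₁ ≡ key m
      k₁ = ℕP.≤-antisym le₁ (ℕP.+-cancelʳ-≤ (key m₂) (key m) (key m₁) (ℕP.≤-trans (ℕP.+-monoʳ-≤ (key m) le₂) (ℕP.≤-reflexive ks)))
      k₂ : key m₂ ≡ key m′
      k₂ = ℕP.+-cancelˡ-≡ (key m) (key m₂) (key m′) (trans (cong (ℕ._+ key m₂) (sym k₁)) (sym ks))
    inner : Monomial n → ℤ
    inner m = ⟨ q , (λ m′ → indicator (mulM m₁ m₂) (mulM m m′)) ⟩
    coeff* : coeff (p *P q) (mulM m₁ m₂) ≡ coeff p m₁ * (coeff q m₂ * 1ℤ)
    coeff* = trans (coeff≡⟨⟩ (p *P q) (mulM m₁ m₂)) (trans (⟨⟩-* p q (indicator (mulM m₁ m₂))) (trans (⟨⟩-single p m₁ inner other) (cong (coeff p m₁ *_) same)))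
      where
      other : ∀ m → coeff p m ≢ 0ℤ → m ≢ m₁ → inner m ≡ 0ℤ
      other m nz ne = trans (⟨⟩-single q m₂ _ (λ m′ nz′ _ → indicator-other (λ e → ne (proj₁ (only m m′ nz nz′ e)))))
        (trans (cong (coeff q m₂ *_) (indicator-other (λ e → ne (proj₁ (only m m₂ nz nz₂ e))))) (ℤP.*-zeroʳ (coeff q m₂)))
      same : inner m₁ ≡ coeff q m₂ * 1ℤ
      same = trans (⟨⟩-single q m₂ _ (λ m′ nz′ ne → indicator-other (λ e → ne (proj₂ (only m₁ m′ nz₁ nz′ e))))) (cong (coeff q m₂ *_) (indicator-same (mulM m₁ m₂)))
    nonzero : coeff (p *P q) (mulM m₁ m₂) ≢ 0ℤ
    nonzero z = [ nz₁ , (λ e → nz₂ (trans (sym (ℤP.*-identityʳ (coeff q m₂))) e)) ]′ (ℤP.i*j≡0⇒i≡0∨j≡0 (coeff p m₁) (trans (sym coeff*) z))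
  IsMin-exists : ∀ p → (∃ λ m → coeff p m ≢ 0ℤ) → ∃ λ a → IsMin w p a
  IsMin-exists p (m₀ , nz₀) = go ∣ wt m₀ - lowest ∣ m₀ nz₀ ℕP.≤-refl
    where
    -- A lower bound over all listed terms, cancelled ones included. It only measures the descent,
    -- so the value 0 for the empty list is harmless.
    minimum : Poly n → ℤ
    minimum [] = 0ℤ
    minimum ((c , m) ∷ r) = wt m ⊓ minimum r
    lowest = minimum p
    member-≥ : ∀ (r : Poly n) {m} → Any (λ t → proj₂ t ≡ m) r → minimum r ≤ wt m
    member-≥ ((c , m) ∷ r) (here refl) = ℤP.i⊓j≤i (wt m) (minimum r)
    member-≥ ((c , m) ∷ r) (there x) = ℤP.≤-trans (ℤP.i⊓j≤j (wt m) (minimum r)) (member-≥ r x)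
    go : ∀ k m → coeff p m ≢ 0ℤ → ∣ wt m - lowest ∣ ℕ.≤ k → ∃ λ a → IsMin w p a
    go k m nz le with find-support p (λ m′ → wt m′ ℤ.<? wt m)
    ... | inj₂ none = wt m , isMin (m , nz , refl) (λ m′ nz′ → ℤP.≮⇒≥ (none m′ nz′))
    ... | inj₁ (m′ , nz′ , lt) = descend k (ℕP.<-≤-trans dist le)
      where
      dist : ∣ wt m′ - lowest ∣ ℕ.< ∣ wt m - lowest ∣
      dist = ℤP.drop‿+<+ (subst₂ _<_ (sym (ℤP.0≤i⇒+∣i∣≡i (0≤- (member-≥ p (coeff-member p m′ nz′))))) (sym (ℤP.0≤i⇒+∣i∣≡i (0≤- (member-≥ p (coeff-member p m nz))))) (ℤP.+-monoˡ-< (- lowest) lt))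
      descend : ∀ k → ∣ wt m′ - lowest ∣ ℕ.< k → ∃ λ a → IsMin w p a
      descend (suc k) (ℕ.s≤s lt′) = go k m′ nz′ lt′

-- Evaluation of polynomials

negP : ∀ {n} → Poly n → Poly n
negP = map (λ (c , m) → (- 1ℤ * c , m))

coeff-diff : ∀ {n} (p q : Poly n) m → coeff (p ++ negP q) m ≡ coeff p m - coeff q m
coeff-diff p q m = trans (coeff-++ p (negP q) m) (cong (λ w → coeff p m + w) (trans (coeff≡⟨⟩ (negP q) m)
  (trans (ℤPair.⟨⟩-map _ (- 1ℤ) (λ m → m) (λ _ _ → refl) q (indicator m)) (trans (cong (- 1ℤ *_) (sym (coeff≡⟨⟩ q m))) (ℤP.-1*i≡-i (coeff q m))))))

module Eval (R : EvalRing) {n : ℕ} where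
  open EvalRing R
  open Pairing R {n}

  infixr 8 _↑_
  _↑_ : K → ℕ → K
  a ↑ zero = 1K
  a ↑ suc k = a ⊗ a ↑ k

  ↑-+ : ∀ a k l → a ↑ (k ℕ.+ l) ≡ a ↑ k ⊗ a ↑ l
  ↑-+ a zero l = sym (⊗-identityˡ _)
  ↑-+ a (suc k) l = trans (cong (a ⊗_) (↑-+ a k l)) (sym (⊗-assoc a _ _))

  monoV : ∀ {l} → Vec ℕ l → (Fin l → K) → K
  monoV [] ρ = 1K
  monoV (e ∷ v) ρ = ρ zero ↑ e ⊗ monoV v (ρ ∘ suc)

  mono : Monomial n → (Row n → K) → K
  mono (e , f) ρ = monoV e (ρ ∘ inj₁) ⊗ monoV f (ρ ∘ inj₂)

  monoV-+ : ∀ {l} (v v′ : Vec ℕ l) ρ → monoV (zipWith ℕ._+_ v v′) ρ ≡ monoV v ρ ⊗ monoV v′ ρ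
  monoV-+ [] [] ρ = sym (⊗-identityˡ 1K)
  monoV-+ (e ∷ v) (e′ ∷ v′) ρ = trans (cong₂ _⊗_ (↑-+ (ρ zero) e e′) (monoV-+ v v′ (ρ ∘ suc))) (⊗-interchange _ _ _ _)

  mono-* : ∀ m m′ ρ → mono (mulM m m′) ρ ≡ mono m ρ ⊗ mono m′ ρ
  mono-* (e , f) (e′ , f′) ρ = trans (cong₂ _⊗_ (monoV-+ e e′ (ρ ∘ inj₁)) (monoV-+ f f′ (ρ ∘ inj₂))) (⊗-interchange _ _ _ _)

  monoV-0 : ∀ {l} ρ → monoV (replicate l 0) ρ ≡ 1K
  monoV-0 {zero} ρ = refl
  monoV-0 {suc l} ρ = trans (⊗-identityˡ _) (monoV-0 {l} (ρ ∘ suc))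

  monoV-single : ∀ {l} (g : Fin l → ℕ) i → (∀ j → j ≢ i → g j ≡ 0) → ∀ ρ → monoV (tabulate g) ρ ≡ ρ i ↑ g i
  monoV-single {suc l} g zero z ρ = trans (cong (ρ zero ↑ g zero ⊗_) (rest l (g ∘ suc) (λ j → z (suc j) (λ ())) (ρ ∘ suc))) (⊗-identityʳ _)
    where
    rest : ∀ l (g : Fin l → ℕ) → (∀ j → g j ≡ 0) → ∀ ρ → monoV (tabulate g) ρ ≡ 1K
    rest zero g z ρ = refl
    rest (suc l) g z ρ rewrite z zero = trans (⊗-identityˡ _) (rest l (g ∘ suc) (z ∘ suc) (ρ ∘ suc))
  monoV-single {suc l} g (suc i) z ρ rewrite z zero (λ ()) = trans (⊗-identityˡ _) (monoV-single (g ∘ suc) i (λ j ne → z (suc j) (λ { refl → ne refl })) (ρ ∘ suc))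

  eval : Poly n → (Row n → K) → K
  eval p ρ = ⟨ p , (λ m → mono m ρ) ⟩

  eval-++ : ∀ p q ρ → eval (p ++ q) ρ ≡ eval p ρ ⊕ eval q ρ
  eval-++ p q ρ = ⟨⟩-++ p q _

  eval-* : ∀ p q ρ → eval (p *P q) ρ ≡ eval p ρ ⊗ eval q ρ
  eval-* p q ρ = begin
    eval (p *P q) ρ                                    ≡⟨ ⟨⟩-* p q (λ m → mono m ρ) ⟩
    ⟨ p , (λ m → ⟨ q , (λ m′ → mono (mulM m m′) ρ) ⟩) ⟩ ≡⟨ ⟨⟩-cong p (λ m → trans (⟨⟩-cong q (λ m′ → mono-* m m′ ρ)) (trans (⟨⟩-⊗ q (mono m ρ) (λ m′ → mono m′ ρ)) (⊗-comm _ _))) ⟩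
    ⟨ p , (λ m → eval q ρ ⊗ mono m ρ) ⟩                ≡⟨ ⟨⟩-⊗ p (eval q ρ) (λ m → mono m ρ) ⟩
    eval q ρ ⊗ eval p ρ                                ≡⟨ ⊗-comm _ _ ⟩
    eval p ρ ⊗ eval q ρ ∎
    where open ≡-Reasoning

  -- Equal coefficients do not mean equal lists. The difference of p and q has no support, so it
  -- pairs to 0 with every function.
  ⟨⟩-≈ : ∀ {p q} → p ≈P q → ∀ φ → ⟨ p , φ ⟩ ≡ ⟨ q , φ ⟩
  ⟨⟩-≈ {p} {q} e φ = trans (sym (lem ⟨ p , φ ⟩ ⟨ q , φ ⟩)) (trans (cong (_⊕ ⟨ q , φ ⟩) diff) (⊕-identityˡ _))
    where
    coeff0 : ∀ m → coeff (p ++ negP q) m ≡ 0ℤ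
    coeff0 m = trans (coeff-diff p q m) (trans (cong (_- coeff q m) (e m)) (ℤP.+-inverseʳ (coeff q m)))
    -1⊕1 : ι (- 1ℤ) ⊕ 1K ≡ 0K
    -1⊕1 = trans (cong (ι (- 1ℤ) ⊕_) (sym ι-1)) (trans (sym (ι-+ (- 1ℤ) 1ℤ)) ι-0)
    lem : ∀ a b → (a ⊕ ι (- 1ℤ) ⊗ b) ⊕ b ≡ a
    lem a b = trans (⊕-assoc _ _ _) (trans (cong (a ⊕_) (trans (cong (ι (- 1ℤ) ⊗ b ⊕_) (sym (⊗-identityˡ b))) (trans (sym (⊗-distribʳ b _ _)) (trans (cong (_⊗ b) -1⊕1) (⊗-zeroˡ b))))) (⊕-identityʳ a))
    diff : ⟨ p , φ ⟩ ⊕ ι (- 1ℤ) ⊗ ⟨ q , φ ⟩ ≡ 0K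
    diff = trans (cong (⟨ p , φ ⟩ ⊕_) (sym (⟨⟩-map _ (- 1ℤ) (λ m → m) (λ _ _ → refl) q φ))) (trans (sym (⟨⟩-++ p (negP q) φ)) (⟨⟩-null (p ++ negP q) (λ m nz → ⊥-elim (nz (coeff0 m)))))

  eval-≈ : ∀ {p q} → p ≈P q → ∀ ρ → eval p ρ ≡ eval q ρ
  eval-≈ {p} {q} e ρ = ⟨⟩-≈ {p} {q} e (λ m → mono m ρ)

  term : ℤ → Monomial n → Poly n
  term c m = (c , m) ∷ []

  eval-term : ∀ m ρ → eval (term 1ℤ m) ρ ≡ mono m ρ
  eval-term m ρ = trans (⊕-identityʳ _) (trans (cong (_⊗ mono m ρ) ι-1) (⊗-identityˡ _))

  eval-one : ∀ ρ → eval oneP ρ ≡ 1K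
  eval-one ρ = trans (eval-term (replicate n 0 , replicate n 0) ρ) (trans (cong₂ _⊗_ (monoV-0 (ρ ∘ inj₁)) (monoV-0 (ρ ∘ inj₂))) (⊗-identityˡ 1K))

  unit-off : ∀ (i j : Fin n) → j ≢ i → (if ⌊ i ≟ j ⌋ then 1 else 0) ≡ 0
  unit-off i j ne with i ≟ j
  ... | yes e = ⊥-elim (ne (sym e))
  ... | no _ = refl

  unit-diag : ∀ (i : Fin n) → (if ⌊ i ≟ i ⌋ then 1 else 0) ≡ 1
  unit-diag i with i ≟ i
  ... | yes _ = refl
  ... | no ne = ⊥-elim (ne refl)

  monoV-unit : ∀ i ρ → monoV (unitVec i) ρ ≡ ρ i
  monoV-unit i ρ = trans (monoV-single _ i (unit-off i) ρ) (trans (cong (ρ i ↑_) (unit-diag i)) (⊗-identityʳ (ρ i)))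

  eval-x : ∀ i ρ → eval (xP i) ρ ≡ ρ (inj₁ i)
  eval-x i ρ = trans (eval-term (unitVec i , replicate n 0) ρ) (trans (cong₂ _⊗_ (monoV-unit i (ρ ∘ inj₁)) (monoV-0 (ρ ∘ inj₂))) (⊗-identityʳ _))

  eval-y : ∀ i ρ → eval (yP i) ρ ≡ ρ (inj₂ i)
  eval-y i ρ = trans (eval-term (replicate n 0 , unitVec i) ρ) (trans (cong₂ _⊗_ (monoV-0 (ρ ∘ inj₁)) (monoV-unit i (ρ ∘ inj₂))) (⊗-identityˡ _))

  eval-xMon : ∀ e ρ → eval (xMon e) ρ ≡ monoV (tabulate e) (ρ ∘ inj₁)
  eval-xMon e ρ = trans (eval-term (tabulate e , replicate n 0) ρ) (trans (cong (monoV (tabulate e) (ρ ∘ inj₁) ⊗_) (monoV-0 (ρ ∘ inj₂))) (⊗-identityʳ _))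

module FromIntegers (R : EvalRing) {n : ℕ} where
  open EvalRing R
  module A = Pairing R {n}
  module B = Pairing ℤ-ring {n}
  module EA = Eval R {n}
  module EB = Eval ℤ-ring {n}

  ι-⟨⟩ : ∀ p φ → A.⟨ p , (λ m → ι (φ m)) ⟩ ≡ ι B.⟨ p , φ ⟩
  ι-⟨⟩ [] φ = sym ι-0
  ι-⟨⟩ ((c , m) ∷ p) φ = trans (cong₂ _⊕_ (sym (ι-* c (φ m))) (ι-⟨⟩ p φ)) (sym (ι-+ _ _))

  ι-↑ : ∀ a k → ι a EA.↑ k ≡ ι (a EB.↑ k)
  ι-↑ a zero = sym ι-1
  ι-↑ a (suc k) = trans (cong (ι a ⊗_) (ι-↑ a k)) (sym (ι-* a _))

  ι-monoV : ∀ {l} (v : Vec ℕ l) ρ → EA.monoV v (λ i → ι (ρ i)) ≡ ι (EB.monoV v ρ)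
  ι-monoV [] ρ = sym ι-1
  ι-monoV (e ∷ v) ρ = trans (cong₂ _⊗_ (ι-↑ (ρ zero) e) (ι-monoV v (ρ ∘ suc))) (sym (ι-* _ _))

  ι-eval : ∀ p ρ → EA.eval p (λ r → ι (ρ r)) ≡ ι (EB.eval p ρ)
  ι-eval p ρ = trans (A.⟨⟩-cong p (λ (e , f) → trans (cong₂ _⊗_ (ι-monoV e (ρ ∘ inj₁)) (ι-monoV f (ρ ∘ inj₂))) (sym (ι-* _ _)))) (ι-⟨⟩ p _)

module _ {n : ℕ} where
  open ℤPair {n}
  open Eval ℤ-ring {n}

  ↑-pos : ∀ {a} k → 0ℤ < a → 0ℤ < a ↑ k
  ↑-pos zero p = +<+ (ℕ.s≤s ℕ.z≤n)
  ↑-pos (suc k) p = 0<* p (↑-pos k p)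

  ↑-* : ∀ a k l → (a ↑ k) ↑ l ≡ a ↑ (k ℕ.* l)
  ↑-* a k zero = cong (a ↑_) (sym (ℕP.*-zeroʳ k))
  ↑-* a k (suc l) = trans (cong (a ↑ k *_) (↑-* a k l)) (trans (sym (↑-+ a k (k ℕ.* l))) (cong (a ↑_) (sym (ℕP.*-suc k l))))

  -- Substituting x_i = T^(Kⁱ) turns monomials into powers of T with distinct exponents; divisibility
  -- of the lowest coefficient by T = 1 + ∣coefficient∣ makes it zero.
  vanishing : ∀ (r : Poly n) → (∀ ρ → (∀ z → 0ℤ < ρ z) → eval r ρ ≡ 0ℤ) → ∀ m → coeff r m ≡ 0ℤ
  vanishing r van m with find-support r {λ _ → ⊤} (λ _ → yes tt)
  ... | inj₂ none = decidable-stable (coeff r m ℤ.≟ 0ℤ) (λ nz → none m nz tt)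
  ... | inj₁ (m′ , nz′ , _) = ⊥-elim (nz₀ c≡0)
    where
    K = suc (bound r)
    open Key K
    best = minimize r {λ _ → ⊤} (λ _ → yes tt) key (m′ , nz′ , tt)
    m₀ = proj₁ best
    nz₀ = proj₁ (proj₁ (proj₂ best))
    least : ∀ m → coeff r m ≢ 0ℤ → key m₀ ℕ.≤ key m
    least m nz = proj₂ (proj₂ best) m nz tt
    T : ℤ
    T = + suc ∣ coeff r m₀ ∣
    ptV : ∀ {l} → ℤ → Fin l → ℤ
    ptV S zero = S
    ptV S (suc i) = ptV (S ↑ K) i
    top : ℤ → ℕ → ℤ
    top S zero = S
    top S (suc l) = top (S ↑ K) l
    ptV-pos : ∀ {l S} → 0ℤ < S → (i : Fin l) → 0ℤ < ptV S i
    ptV-pos p zero = p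
    ptV-pos p (suc i) = ptV-pos (↑-pos K p) i
    top-pos : ∀ {S} l → 0ℤ < S → 0ℤ < top S l
    top-pos zero p = p
    top-pos (suc l) p = top-pos l (↑-pos K p)
    keyV-mono : ∀ {l} (v : Vec ℕ l) S z → monoV v (ptV S) * top S l ↑ z ≡ S ↑ keyV v z
    keyV-mono [] S z = ℤP.*-identityˡ _
    keyV-mono {suc l} (e ∷ v) S z = trans (ℤP.*-assoc (S ↑ e) _ _) (trans (cong (S ↑ e *_) (trans (keyV-mono v (S ↑ K) z) (↑-* S K (keyV v z)))) (sym (↑-+ S e (K ℕ.* keyV v z))))
    ρ : Row n → ℤ
    ρ (inj₁ i) = ptV T i
    ρ (inj₂ i) = ptV (top T n) i
    T>0 : 0ℤ < T
    T>0 = +<+ (ℕ.s≤s ℕ.z≤n)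
    ρ-pos : ∀ z → 0ℤ < ρ z
    ρ-pos (inj₁ i) = ptV-pos T>0 i
    ρ-pos (inj₂ i) = ptV-pos (top-pos n T>0) i
    mono-key : ∀ m → mono m ρ ≡ T ↑ key m
    mono-key (e , f) = trans (cong (monoV e (ptV T) *_) (trans (sym (ℤP.*-identityʳ _)) (keyV-mono f (top T n) 0))) (keyV-mono e T (keyV f 0))
    k₀ = key m₀
    -- What remains of a monomial after T to the power k₀ + 1 is taken out. On the rest of the
    -- support keys exceed k₀, so the truncated subtraction is exact.
    θ : Monomial n → ℤ
    θ m = if ⌊ m ≟M m₀ ⌋ then 0ℤ else T ↑ (key m ℕ.∸ suc k₀)
    expand-key : ∀ m → coeff r m ≢ 0ℤ → mono m ρ ≡ T ↑ k₀ * (indicator m₀ m + T * θ m)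
    expand-key m nz with m ≟M m₀
    ... | yes refl = trans (mono-key m) (sym (trans (cong (λ w → T ↑ k₀ * (1ℤ + w)) (ℤP.*-zeroʳ T)) (ℤP.*-identityʳ (T ↑ k₀))))
    ... | no ne = trans (mono-key m) (trans (cong (T ↑_) (sym split)) (trans (↑-+ T k₀ (suc (key m ℕ.∸ suc k₀))) (cong (T ↑ k₀ *_) (sym (ℤP.+-identityˡ (T * T ↑ (key m ℕ.∸ suc k₀)))))))
      where
      k₀<k : k₀ ℕ.< key m
      k₀<k = ℕP.≤∧≢⇒< (least m nz) (λ e → ne (key-injective (small r ℕP.≤-refl m nz) (small r ℕP.≤-refl m₀ nz₀) (sym e)))
      split : k₀ ℕ.+ suc (key m ℕ.∸ suc k₀) ≡ key m
      split = trans (ℕP.+-suc k₀ _) (ℕP.m+[n∸m]≡n k₀<k)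
    total : T ↑ k₀ * (coeff r m₀ + T * ⟨ r , θ ⟩) ≡ 0ℤ
    total = begin
      T ↑ k₀ * (coeff r m₀ + T * ⟨ r , θ ⟩)                   ≡⟨ cong (λ w → T ↑ k₀ * w) (cong₂ _+_ (coeff≡⟨⟩ r m₀) (sym (⟨⟩-⊗ r T θ))) ⟩
      T ↑ k₀ * (⟨ r , indicator m₀ ⟩ + ⟨ r , (λ m → T * θ m) ⟩) ≡⟨ cong (T ↑ k₀ *_) (sym (⟨⟩-⊕ r (indicator m₀) (λ m → T * θ m))) ⟩
      T ↑ k₀ * ⟨ r , (λ m → indicator m₀ m + T * θ m) ⟩        ≡⟨ sym (⟨⟩-⊗ r (T ↑ k₀) (λ m → indicator m₀ m + T * θ m)) ⟩
      ⟨ r , (λ m → T ↑ k₀ * (indicator m₀ m + T * θ m)) ⟩      ≡⟨ sym (⟨⟩-support r expand-key) ⟩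
      eval r ρ                                                 ≡⟨ van ρ ρ-pos ⟩
      0ℤ ∎
      where open ≡-Reasoning
    c≡ : coeff r m₀ + T * ⟨ r , θ ⟩ ≡ 0ℤ
    c≡ = *-cancel-0 (↑-pos k₀ T>0) total
    c≡0 : coeff r m₀ ≡ 0ℤ
    c≡0 = trans (sym (ℤP.+-identityʳ (coeff r m₀))) (trans (cong (λ w → coeff r m₀ + w) (sym (trans (cong (T *_) x≡0) (ℤP.*-zeroʳ T)))) c≡)
      where
      x = ⟨ r , θ ⟩
      abs≡ : ∣ coeff r m₀ ∣ ≡ suc ∣ coeff r m₀ ∣ ℕ.* ∣ x ∣
      abs≡ = trans (cong ∣_∣ (lem (coeff r m₀) (T * x) c≡)) (trans (ℤP.∣-i∣≡∣i∣ (T * x)) (ℤP.abs-* T x))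
        where
        lem : ∀ a b → a + b ≡ 0ℤ → a ≡ - b
        lem a b e = trans (l a b) (trans (cong (_- b) e) (ℤP.+-identityˡ (- b)))
          where
          l : ∀ a b → a ≡ a + b - b
          l = solve-∀
      x≡0 : x ≡ 0ℤ
      x≡0 = ℤP.∣i∣≡0⇒i≡0 (zero-factor ∣ coeff r m₀ ∣ ∣ x ∣ abs≡)
        where
        zero-factor : ∀ a b → a ≡ suc a ℕ.* b → b ≡ 0
        zero-factor a zero _ = refl
        zero-factor a (suc b) e = ⊥-elim (ℕP.<-irrefl e (ℕP.<-≤-trans (ℕP.n<1+n a) (ℕP.m≤m*n (suc a) (suc b))))

-- Rational points

↑ℤ : ℤ → ℚ
↑ℤ z = ℚ.fromℚᵘ (ℚᵘ.mkℚᵘ z 0)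

private
  ↑ℤ-toᵘ : ∀ z → ℚ.toℚᵘ (↑ℤ z) ℚᵘ.≃ ℚᵘ.mkℚᵘ z 0
  ↑ℤ-toᵘ z = ℚP.toℚᵘ-fromℚᵘ (ℚᵘ.mkℚᵘ z 0)

↑ℤ-+ : ∀ a b → ↑ℤ (a + b) ≡ ↑ℤ a ℚ.+ ↑ℤ b
↑ℤ-+ a b = ℚP.toℚᵘ-injective (begin
  ℚ.toℚᵘ (↑ℤ (a + b))                        ≈⟨ ↑ℤ-toᵘ (a + b) ⟩
  ℚᵘ.mkℚᵘ (a + b) 0                          ≈⟨ ℚᵘ.*≡* (lem a b) ⟩
  ℚᵘ.mkℚᵘ a 0 ℚᵘ.+ ℚᵘ.mkℚᵘ b 0               ≈⟨ ℚᵘP.≃-sym (ℚᵘP.+-cong (↑ℤ-toᵘ a) (↑ℤ-toᵘ b)) ⟩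
  ℚ.toℚᵘ (↑ℤ a) ℚᵘ.+ ℚ.toℚᵘ (↑ℤ b)           ≈⟨ ℚᵘP.≃-sym (ℚP.toℚᵘ-homo-+ (↑ℤ a) (↑ℤ b)) ⟩
  ℚ.toℚᵘ (↑ℤ a ℚ.+ ↑ℤ b) ∎)
  where
  open ℚᵘP.≃-Reasoning
  lem : ∀ a b → (a + b) * 1ℤ ≡ (a * 1ℤ + b * 1ℤ) * 1ℤ
  lem = solve-∀

↑ℤ-* : ∀ a b → ↑ℤ (a * b) ≡ ↑ℤ a ℚ.* ↑ℤ b
↑ℤ-* a b = ℚP.toℚᵘ-injective (begin
  ℚ.toℚᵘ (↑ℤ (a * b))                        ≈⟨ ↑ℤ-toᵘ (a * b) ⟩
  ℚᵘ.mkℚᵘ (a * b) 0                          ≈⟨ ℚᵘ.*≡* refl ⟩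
  ℚᵘ.mkℚᵘ a 0 ℚᵘ.* ℚᵘ.mkℚᵘ b 0               ≈⟨ ℚᵘP.≃-sym (ℚᵘP.*-cong (↑ℤ-toᵘ a) (↑ℤ-toᵘ b)) ⟩
  ℚ.toℚᵘ (↑ℤ a) ℚᵘ.* ℚ.toℚᵘ (↑ℤ b)           ≈⟨ ℚᵘP.≃-sym (ℚP.toℚᵘ-homo-* (↑ℤ a) (↑ℤ b)) ⟩
  ℚ.toℚᵘ (↑ℤ a ℚ.* ↑ℤ b) ∎)
  where open ℚᵘP.≃-Reasoning

↑ℤ-injective : ∀ {a b} → ↑ℤ a ≡ ↑ℤ b → a ≡ b
↑ℤ-injective {a} {b} e with ℚᵘP.≃-trans (ℚᵘP.≃-sym (↑ℤ-toᵘ a)) (ℚᵘP.≃-trans (ℚᵘP.≃-reflexive (cong ℚ.toℚᵘ e)) (↑ℤ-toᵘ b))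
... | ℚᵘ.*≡* q = ℤP.*-cancelʳ-≡ a b 1ℤ q

↑ℤ-pos : ∀ {a} → 0ℤ < a → 0ℚ ℚ.< ↑ℤ a
↑ℤ-pos {+ suc k} _ = ℚP.toℚᵘ-cancel-< (ℚᵘP.<-respʳ-≃ (ℚᵘP.≃-sym (↑ℤ-toᵘ (+ suc k))) (ℚᵘ.*<* (+<+ (ℕ.s≤s ℕ.z≤n))))
↑ℤ-pos {+ zero} (+<+ ())

ℚ-ring : EvalRing
ℚ-ring = record { isCR = ℚP.+-*-isCommutativeRing ; ι = ↑ℤ ; ι-+ = ↑ℤ-+ ; ι-* = ↑ℤ-* ; ι-0 = refl ; ι-1 = refl }

module ℚEval {n : ℕ} = Eval ℚ-ring {n}

Point : ℕ → Set
Point n = Row n → ℚ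

Positive : ∀ {n} → Point n → Set
Positive ρ = ∀ r → 0ℚ ℚ.< ρ r

module _ {n : ℕ} where
  open ℚEval {n}

  -- Positive integer points already separate polynomials, by `vanishing`. Identities between
  -- fractions can thus be checked at positive points, where the denominators that occur are
  -- invertible.
  faithful : ∀ (p q : Poly n) → (∀ ρ → Positive ρ → eval p ρ ≡ eval q ρ) → p ≈P q
  faithful p q e m = -‿0 (trans (sym (coeff-diff p q m)) (vanishing (p ++ negP q) (λ ρ ρ>0 → begin
    EZ.eval (p ++ negP q) ρ                  ≡⟨ EZ.eval-++ p (negP q) ρ ⟩
    EZ.eval p ρ + EZ.eval (negP q) ρ         ≡⟨ cong (λ w → EZ.eval p ρ + w) (ℤPair.⟨⟩-map _ (- 1ℤ) (λ m → m) (λ _ _ → refl) q _) ⟩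
    EZ.eval p ρ + - 1ℤ * EZ.eval q ρ         ≡⟨ cong₂ _+_ (↑ℤ-injective {EZ.eval p ρ} {EZ.eval q ρ} (trans (sym (FZ.ι-eval p ρ)) (trans (e (λ r → ↑ℤ (ρ r)) (λ r → ↑ℤ-pos (ρ>0 r))) (FZ.ι-eval q ρ)))) (ℤP.-1*i≡-i (EZ.eval q ρ)) ⟩
    EZ.eval q ρ - EZ.eval q ρ                ≡⟨ ℤP.+-inverseʳ (EZ.eval q ρ) ⟩
    0ℤ ∎) m))
    where
    open ≡-Reasoning
    module EZ = Eval ℤ-ring {n}
    module FZ = FromIntegers ℚ-ring {n}

-- Fractions: positivity, valuations and values at points

-- Nonnegativity of the coefficients, phrased through functionals: closure under products is then
-- composition, with no formula for the coefficients of a product.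
record NonnegP {n} (p : Poly n) : Set where
  constructor nonneg
  field
    apply : ∀ φ → (∀ m → 0ℤ ≤ φ m) → 0ℤ ≤ ℤPair.⟨_,_⟩ p φ

module _ {n : ℕ} where
  open ℤPair {n}

  nonneg-term : ∀ m → NonnegP {n} ((1ℤ , m) ∷ [])
  nonneg-term m = nonneg (λ φ p → subst (0ℤ ≤_) (sym (trans (ℤP.+-identityʳ (1ℤ * φ m)) (ℤP.*-identityˡ (φ m)))) (p m))

  nonneg-++ : ∀ {p q : Poly n} → NonnegP p → NonnegP q → NonnegP (p ++ q)
  nonneg-++ {p} {q} (nonneg P) (nonneg Q) = nonneg (λ φ h → subst (0ℤ ≤_) (sym (⟨⟩-++ p q φ)) (0≤+ (P φ h) (Q φ h)))

  nonneg-* : ∀ {p q : Poly n} → NonnegP p → NonnegP q → NonnegP (p *P q)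
  nonneg-* {p} {q} (nonneg P) (nonneg Q) = nonneg (λ φ h → subst (0ℤ ≤_) (sym (⟨⟩-* p q φ)) (P (λ m → ⟨ q , (λ m′ → φ (mulM m m′)) ⟩) (λ m → Q (λ m′ → φ (mulM m m′)) (λ m′ → h (mulM m m′)))))

  nonneg-coeff : ∀ {p : Poly n} → NonnegP p → ∀ m → 0ℤ ≤ coeff p m
  nonneg-coeff {p} (nonneg P) m = subst (0ℤ ≤_) (sym (coeff≡⟨⟩ p m)) (P (indicator m) ind≥0)
    where
    ind≥0 : ∀ m′ → 0ℤ ≤ indicator m m′
    ind≥0 m′ with m′ ≟M m
    ... | yes _ = +≤+ ℕ.z≤n
    ... | no _ = ℤP.≤-refl

  -- Nonnegative coefficients cannot cancel in a sum.
  IsMin-++ : ∀ {w : Weight n} {p q a b} → NonnegP p → NonnegP q → IsMin w p a → IsMin w q b → IsMin w (p ++ q) (a ⊓ b)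
  IsMin-++ {w} {p} {q} {a} {b} np nq P Q = isMin (choose (ℤP.≤-total a b)) low
    where
    open Weight w
    open IsMin
    keep : ∀ m → coeff p m ≢ 0ℤ ⊎ coeff q m ≢ 0ℤ → coeff (p ++ q) m ≢ 0ℤ
    keep m (inj₁ nz) z = ℤP.<-irrefl (sym (trans (sym (coeff-++ p q m)) z)) (0<+≤ (≤∧≢⇒< (nonneg-coeff {p} np m) (≢-sym nz)) (nonneg-coeff {q} nq m))
    keep m (inj₂ nz) z = ℤP.<-irrefl (sym (trans (ℤP.+-comm (coeff q m) (coeff p m)) (trans (sym (coeff-++ p q m)) z))) (0<+≤ (≤∧≢⇒< (nonneg-coeff {q} nq m) (≢-sym nz)) (nonneg-coeff {p} np m))
    choose : a ≤ b ⊎ b ≤ a → ∃ λ m → coeff (p ++ q) m ≢ 0ℤ × wt m ≡ a ⊓ b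
    choose (inj₁ le) = let (m , nz , e) = attained P in m , keep m (inj₁ nz) , trans e (sym (ℤP.i≤j⇒i⊓j≡i le))
    choose (inj₂ le) = let (m , nz , e) = attained Q in m , keep m (inj₂ nz) , trans e (sym (ℤP.i≥j⇒i⊓j≡j le))
    low : ∀ m → coeff (p ++ q) m ≢ 0ℤ → a ⊓ b ≤ wt m
    low m nz with coeff p m ℤ.≟ 0ℤ | coeff q m ℤ.≟ 0ℤ
    ... | no nzp | _ = ℤP.≤-trans (ℤP.i⊓j≤i a b) (lower P m nzp)
    ... | yes _ | no nzq = ℤP.≤-trans (ℤP.i⊓j≤j a b) (lower Q m nzq)
    ... | yes zp | yes zq = ⊥-elim (nz (trans (coeff-++ p q m) (cong₂ _+_ zp zq)))

  coeff-term : ∀ m → coeff {n} ((1ℤ , m) ∷ []) m ≡ 1ℤ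
  coeff-term m with m ≟M m
  ... | yes _ = refl
  ... | no ne = ⊥-elim (ne refl)

  coeff-term-other : ∀ m {m′} → coeff {n} ((1ℤ , m) ∷ []) m′ ≢ 0ℤ → m ≡ m′
  coeff-term-other m {m′} nz with m ≟M m′
  ... | yes e = e
  ... | no _ = ⊥-elim (nz refl)

  IsMin-term : ∀ {w : Weight n} m {a} → Weight.wt w m ≡ a → IsMin w ((1ℤ , m) ∷ []) a
  IsMin-term {w} m e = isMin (m , (λ z → case trans (sym (coeff-term m)) z of λ ()) , e)
    (λ m′ nz → ℤP.≤-reflexive (trans (sym e) (cong (Weight.wt w) (coeff-term-other m nz))))

  one : Monomial n
  one = replicate n 0 , replicate n 0

  wt-one : ∀ (w : Weight n) → Weight.wt w one ≡ 0ℤ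
  wt-one w = lem (trans (cong wt (sym one*one)) (wt-* one one))
    where
    open Weight w
    zeros : ∀ l → zipWith ℕ._+_ (replicate l 0) (replicate l 0) ≡ replicate l 0
    zeros zero = refl
    zeros (suc l) = cong (0 ∷_) (zeros l)
    one*one : mulM one one ≡ one
    one*one = cong₂ _,_ (zeros n) (zeros n)
    lem : ∀ {a} → a ≡ a + a → a ≡ 0ℤ
    lem {a} e = trans (l a) (trans (cong (_- a) (sym e)) (ℤP.+-inverseʳ a))
      where
      l : ∀ a → a ≡ a + a - a
      l = solve-∀

record Val {n} (w : Weight n) (x : Frac n) (a : ℤ) : Set where
  constructor val
  field
    {num den′} : ℤ
    minN : IsMin w (proj₁ x) num
    minD : IsMin w (proj₂ x) den′
    diff : a ≡ num - den′

negW : ∀ {n} → Weight n → Weight n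
negW w = record { wt = λ m → - wt m ; wt-* = λ m m′ → trans (cong -_ (wt-* m m′)) (ℤP.neg-distrib-+ (wt m) (wt m′)) }
  where open Weight w

-- Opposite least weights for w and −w express homogeneity.
record Hom {n} (w : Weight n) (x : Frac n) (a : ℤ) : Set where
  constructor hom
  field
    {num den′} : ℤ
    minN : IsMin w (proj₁ x) num
    maxN : IsMin (negW w) (proj₁ x) (- num)
    minD : IsMin w (proj₂ x) den′
    maxD : IsMin (negW w) (proj₂ x) (- den′)
    diff : a ≡ num - den′

NN : ∀ {n} → Frac n → Set
NN x = NonnegP (proj₁ x) × NonnegP (proj₂ x)

module _ {n : ℕ} where

  NN-* : ∀ {x y : Frac n} → NN x → NN y → NN (x *F y)
  NN-* {a , b} {c , d} (p , q) (r , s) = nonneg-* {p = a} {c} p r , nonneg-* {p = b} {d} q s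

  NN-+ : ∀ {x y : Frac n} → NN x → NN y → NN (x +F y)
  NN-+ {a , b} {c , d} (p , q) (r , s) = nonneg-++ {p = a *P d} {c *P b} (nonneg-* {p = a} {d} p s) (nonneg-* {p = c} {b} r q) , nonneg-* {p = b} {d} q s

  module _ {w : Weight n} where

    Val-one : Val w oneF 0ℤ
    Val-one = val (IsMin-term one refl) (IsMin-term one refl) (sym (ℤP.+-inverseʳ (Weight.wt w one)))

    Val-* : ∀ {x y : Frac n} {a b} → Val w x a → Val w y b → Val w (x *F y) (a + b)
    Val-* (val {p} {q} P Q refl) (val {r} {s} R S refl) = val (IsMin-* P R) (IsMin-* Q S) (lem p q r s)
      where
      lem : ∀ p q r s → (p - q) + (r - s) ≡ (p + r) - (q + s)
      lem = solve-∀

    Val-inv : ∀ {x : Frac n} {a} → Val w x a → Val w (invF x) (- a)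
    Val-inv (val {p} {q} P Q refl) = val Q P (lem p q)
      where
      lem : ∀ p q → - (p - q) ≡ q - p
      lem = solve-∀

    Val-+ : ∀ {x y : Frac n} {a b} → NN x → NN y → Val w x a → Val w y b → Val w (x +F y) (a ⊓ b)
    Val-+ {A , B} {C , D} (nA , nB) (nC , nD) (val {p} {q} P Q refl) (val {r} {s} R S refl) =
      val (IsMin-++ {p = A *P D} {C *P B} (nonneg-* {p = A} {D} nA nD) (nonneg-* {p = C} {B} nC nB) (IsMin-* P S) (IsMin-* R Q)) (IsMin-* Q S) eq
      where
      lem : ∀ p q s → p - q ≡ (p + s) - (q + s)
      lem = solve-∀
      lem′ : ∀ r q s → r - s ≡ (r + q) - (q + s)
      lem′ = solve-∀
      eq : (p - q) ⊓ (r - s) ≡ (p + s) ⊓ (r + q) - (q + s)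
      eq = trans (cong₂ _⊓_ (lem p q s) (lem′ r q s)) (sym (ℤP.mono-≤-distrib-⊓ (ℤP.+-monoˡ-≤ (- (q + s))) (p + s) (r + q)))

    Hom-one : Hom w oneF 0ℤ
    Hom-one = hom (IsMin-term one refl) (IsMin-term one refl) (IsMin-term one refl) (IsMin-term one refl) (sym (ℤP.+-inverseʳ (Weight.wt w one)))

    Hom-* : ∀ {x y : Frac n} {a b} → Hom w x a → Hom w y b → Hom w (x *F y) (a + b)
    Hom-* (hom {p} {q} P P′ Q Q′ refl) (hom {r} {s} R R′ S S′ refl) = hom (IsMin-* P R) (subst (IsMin (negW w) _) (sym (ℤP.neg-distrib-+ p r)) (IsMin-* P′ R′))
      (IsMin-* Q S) (subst (IsMin (negW w) _) (sym (ℤP.neg-distrib-+ q s)) (IsMin-* Q′ S′)) (lem p q r s)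
      where
      lem : ∀ p q r s → (p - q) + (r - s) ≡ (p + r) - (q + s)
      lem = solve-∀

    Hom-inv : ∀ {x : Frac n} {a} → Hom w x a → Hom w (invF x) (- a)
    Hom-inv (hom {p} {q} P P′ Q Q′ refl) = hom Q Q′ P P′ (lem p q)
      where
      lem : ∀ p q → - (p - q) ≡ q - p
      lem = solve-∀

    Hom-+ : ∀ {x y : Frac n} {a} → NN x → NN y → Hom w x a → Hom w y a → Hom w (x +F y) a
    Hom-+ {A , B} {C , D} {a} (nA , nB) (nC , nD) (hom {p} {q} P P′ Q Q′ e) (hom {r} {s} R R′ S S′ e′) =
      hom (subst (IsMin w _) (trans (cong ((p + s) ⊓_) (sym same)) (ℤP.⊓-idem (p + s))) (IsMin-++ {p = A *P D} {C *P B} n₁ n₂ (IsMin-* P S) (IsMin-* R Q)))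
        (subst (IsMin (negW w) _) (trans (cong₂ _⊓_ (sym (ℤP.neg-distrib-+ p s)) (trans (sym (ℤP.neg-distrib-+ r q)) (cong -_ (sym same)))) (ℤP.⊓-idem (- (p + s)))) (IsMin-++ {p = A *P D} {C *P B} n₁ n₂ (IsMin-* P′ S′) (IsMin-* R′ Q′)))
        (IsMin-* Q S) (subst (IsMin (negW w) _) (sym (ℤP.neg-distrib-+ q s)) (IsMin-* Q′ S′)) (trans e (lem p q s))
      where
      n₁ = nonneg-* {p = A} {D} nA nD
      n₂ = nonneg-* {p = C} {B} nC nB
      lem : ∀ p q s → p - q ≡ (p + s) - (q + s)
      lem = solve-∀
      lem′ : ∀ p q r s → p - q ≡ r - s → p + s ≡ r + q
      lem′ p q r s e = trans (l p q s) (trans (cong (_+ (q + s)) e) (l′ q r s))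
        where
        l : ∀ p q s → p + s ≡ (p - q) + (q + s)
        l = solve-∀
        l′ : ∀ q r s → (r - s) + (q + s) ≡ r + q
        l′ = solve-∀
      same : p + s ≡ r + q
      same = lem′ p q r s (trans (sym e) e′)

-- One induction over exchange monomials for every multiplicative property: nonnegativity, orders,
-- degrees and values.
module Products {n : ℕ} {M : Set} (_∙_ : M → M → M) (ε : M) (G : Frac n → M → Set)
  (G-one : G oneF ε) (G-* : ∀ {x y a b} → G x a → G y b → G (x *F y) (a ∙ b)) where

  power : M → ℕ → M
  power a zero = ε
  power a (suc k) = a ∙ power a k

  product : (Row n → M) → (Row n → ℕ) → List (Row n) → M
  product a k = foldr (λ r s → power (a r) (k r) ∙ s) ε

  G-^ : ∀ {x a} → G x a → ∀ k → G (x ^F k) (power a k)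
  G-^ g zero = G-one
  G-^ g (suc k) = G-* g (G-^ g k)

  G-prod : ∀ {z : Row n → Frac n} {a : Row n → M} → (∀ r → G (z r) (a r)) → ∀ k L → G (prodF (map (λ r → z r ^F k r) L)) (product a k L)
  G-prod g k [] = G-one
  G-prod g k (r ∷ L) = G-* (G-^ (g r) (k r)) (G-prod g k L)

  product-++ : (∀ a b c → (a ∙ b) ∙ c ≡ a ∙ (b ∙ c)) → (∀ a → ε ∙ a ≡ a) → ∀ a k L L′ → product a k (L ++ L′) ≡ product a k L ∙ product a k L′
  product-++ as id a k [] L′ = sym (id _)
  product-++ as id a k (r ∷ L) L′ = trans (cong (power (a r) (k r) ∙_) (product-++ as id a k L L′)) (sym (as _ _ _))

opaque
  unfolding ∑
  ∑-tabulate : ∀ {A : Set} {l} (f : A → ℤ) (h : Fin l → A) → foldr (λ r s → f r + s) 0ℤ (Data.List.tabulate h) ≡ ∑ (λ i → f (h i))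
  ∑-tabulate {l = zero} f h = refl
  ∑-tabulate {l = suc l} f h = cong (λ w → f (h zero) + w) (∑-tabulate f (h ∘ suc))

module AdditiveProducts {n : ℕ} (G : Frac n → ℤ → Set) (G-one : G oneF 0ℤ) (G-* : ∀ {x y a b} → G x a → G y b → G (x *F y) (a + b)) where
  open Products _+_ 0ℤ G G-one G-* public

  power≡ : ∀ a k → power a k ≡ + k * a
  power≡ a zero = sym (ℤP.*-zeroˡ a)
  power≡ a (suc k) = trans (cong (λ w → a + w) (power≡ a k)) (lem a (+ k))
    where
    lem : ∀ a k → a + k * a ≡ (1ℤ + k) * a
    lem = solve-∀

  product-map : ∀ {l} (a : Row n → ℤ) k (h : Fin l → Row n) → product a k (map h (allFin l)) ≡ ∑ (λ i → + k (h i) * a (h i))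
  product-map a k h = trans (cong (product a k) (ListP.map-tabulate (λ i → i) h)) (trans (∑-tabulate (λ r → power (a r) (k r)) h) (sum-cong (λ i → power≡ (a (h i)) (k (h i)))))

  rows : ∀ {z : Row n → Frac n} {a : Row n → ℤ} → (∀ r → G (z r) (a r)) → ∀ (k : Row n → ℤ) →
    G (prodF (map (λ r → z r ^F pos (k r)) allRows)) (∑ (λ i → k (inj₁ i) ⁺ * a (inj₁ i)) + ∑ (λ j → k (inj₂ j) ⁺ * a (inj₂ j)))
  rows {z} {a} g k = subst (G _) (trans (product-++ ℤP.+-assoc ℤP.+-identityˡ a (λ r → pos (k r)) (map inj₁ (allFin n)) (map inj₂ (allFin n))) (cong₂ _+_ (product-map a (λ r → pos (k r)) inj₁) (product-map a (λ r → pos (k r)) inj₂)))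
    (G-prod {z} {a} g (λ r → pos (k r)) allRows)

-- Values of fractions with positive denominator

0<⊗ : ∀ {a b} → 0ℚ ℚ.< a → 0ℚ ℚ.< b → 0ℚ ℚ.< a ℚ.* b
0<⊗ {a} {b} p q = subst (ℚ._< a ℚ.* b) (ℚP.*-zeroʳ a) (ℚP.*-monoʳ-<-pos a {{ℚ.positive p}} q)

0<⊕ : ∀ {a b} → 0ℚ ℚ.< a → 0ℚ ℚ.< b → 0ℚ ℚ.< a ℚ.+ b
0<⊕ p q = ℚP.+-mono-< p q

pos≢0 : ∀ {a} → 0ℚ ℚ.< a → a ≢ 0ℚ
pos≢0 p refl = ℚP.<-irrefl refl p

-- Made total by the value 0 at 0, so that the exchange of coordinates is defined at every point; it
-- is an inverse where it matters, at positive numbers.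
inv : ℚ → ℚ
inv a with a ℚP.≟ 0ℚ
... | yes _ = 0ℚ
... | no ne = ℚ.1/_ a {{ℚ.≢-nonZero ne}}

inv-r : ∀ {a} → 0ℚ ℚ.< a → a ℚ.* inv a ≡ 1ℚ
inv-r {a} p with a ℚP.≟ 0ℚ
... | yes e = ⊥-elim (pos≢0 p e)
... | no ne = ℚP.*-inverseʳ a {{ℚ.≢-nonZero ne}}

inv-pos : ∀ {a} → 0ℚ ℚ.< a → 0ℚ ℚ.< inv a
inv-pos {a} p with ℚP.<-cmp 0ℚ (inv a)
... | tri< q _ _ = q
... | tri≈ _ e _ = ⊥-elim (pos≢0 {1ℚ} (ℚ.*<* (+<+ (ℕ.s≤s ℕ.z≤n))) (trans (sym (inv-r p)) (trans (cong (a ℚ.*_) (sym e)) (ℚP.*-zeroʳ a))))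
... | tri> _ _ q = ⊥-elim (ℚP.<-asym {0ℚ} {1ℚ} (ℚ.*<* (+<+ (ℕ.s≤s ℕ.z≤n))) (subst₂ ℚ._<_ (inv-r p) (ℚP.*-zeroʳ a) (ℚP.*-monoʳ-<-pos a {{ℚ.positive p}} q)))

⊗-cancel : ∀ {a b c} → 0ℚ ℚ.< a → a ℚ.* b ≡ a ℚ.* c → b ≡ c
⊗-cancel {a} {b} {c} p e = trans (sym (lem b)) (trans (cong (inv a ℚ.*_) e) (lem c))
  where
  lem : ∀ b → inv a ℚ.* (a ℚ.* b) ≡ b
  lem b = trans (sym (ℚP.*-assoc (inv a) a b)) (trans (cong (ℚ._* b) (trans (ℚP.*-comm (inv a) a) (inv-r p))) (ℚP.*-identityˡ b))

-- The numerator is tied to v without division. Positivity of the denominator is kept by sums and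
-- products, and by inversion when v is positive.
record Ev {n} (ρ : Point n) (x : Frac n) (v : ℚ) : Set where
  constructor ev
  open ℚEval {n}
  field
    value : eval (proj₁ x) ρ ≡ v ℚ.* eval (proj₂ x) ρ
    denom : 0ℚ ℚ.< eval (proj₂ x) ρ

rowMono : ∀ {n} → (Row n → ℕ) → Monomial n
rowMono k = tabulate (k ∘ inj₁) , tabulate (k ∘ inj₂)

module _ {n : ℕ} {ρ : Point n} where
  open ℚEval {n}
  open EvalRing ℚ-ring using (⊗-interchange)

  Ev-poly : ∀ p {v} → eval p ρ ≡ v → Ev ρ (polyF p) v
  Ev-poly p {v} e = ev (trans e (sym (trans (cong (v ℚ.*_) (eval-one ρ)) (ℚP.*-identityʳ v)))) (subst (0ℚ ℚ.<_) (sym (eval-one ρ)) (ℚ.*<* (+<+ (ℕ.s≤s ℕ.z≤n))))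

  Ev-one : Ev ρ oneF 1ℚ
  Ev-one = Ev-poly oneP (eval-one ρ)

  Ev-* : ∀ {x y v u} → Ev ρ x v → Ev ρ y u → Ev ρ (x *F y) (v ℚ.* u)
  Ev-* {a , b} {c , d} {v} {u} (ev p q) (ev r s) = ev
    (trans (eval-* a c ρ) (trans (cong₂ ℚ._*_ p r) (trans (⊗-interchange v (eval b ρ) u (eval d ρ)) (cong (v ℚ.* u ℚ.*_) (sym (eval-* b d ρ))))))
    (subst (0ℚ ℚ.<_) (sym (eval-* b d ρ)) (0<⊗ q s))

  Ev-+ : ∀ {x y v u} → Ev ρ x v → Ev ρ y u → Ev ρ (x +F y) (v ℚ.+ u)
  Ev-+ {a , b} {c , d} {v} {u} (ev p q) (ev r s) = ev
    (begin
      eval ((a *P d) ++ (c *P b)) ρ                                        ≡⟨ eval-++ (a *P d) (c *P b) ρ ⟩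
      eval (a *P d) ρ ℚ.+ eval (c *P b) ρ                                   ≡⟨ cong₂ ℚ._+_ (trans (eval-* a d ρ) (cong (ℚ._* eval d ρ) p)) (trans (eval-* c b ρ) (cong (ℚ._* eval b ρ) r)) ⟩
      v ℚ.* eval b ρ ℚ.* eval d ρ ℚ.+ u ℚ.* eval d ρ ℚ.* eval b ρ           ≡⟨ cong₂ ℚ._+_ (ℚP.*-assoc v (eval b ρ) (eval d ρ)) (trans (ℚP.*-assoc u (eval d ρ) (eval b ρ)) (cong (u ℚ.*_) (ℚP.*-comm (eval d ρ) (eval b ρ)))) ⟩
      v ℚ.* (eval b ρ ℚ.* eval d ρ) ℚ.+ u ℚ.* (eval b ρ ℚ.* eval d ρ)       ≡⟨ sym (ℚP.*-distribʳ-+ (eval b ρ ℚ.* eval d ρ) v u) ⟩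
      (v ℚ.+ u) ℚ.* (eval b ρ ℚ.* eval d ρ)                                ≡⟨ cong ((v ℚ.+ u) ℚ.*_) (sym (eval-* b d ρ)) ⟩
      (v ℚ.+ u) ℚ.* eval (b *P d) ρ ∎)
    (subst (0ℚ ℚ.<_) (sym (eval-* b d ρ)) (0<⊗ q s))
    where open ≡-Reasoning

  Ev-inv : ∀ {x v} → 0ℚ ℚ.< v → Ev ρ x v → Ev ρ (invF x) (inv v)
  Ev-inv {a , b} {v} v>0 (ev p q) = ev
    (sym (trans (cong (inv v ℚ.*_) p) (trans (sym (ℚP.*-assoc (inv v) v (eval b ρ))) (trans (cong (ℚ._* eval b ρ) (trans (ℚP.*-comm (inv v) v) (inv-r v>0))) (ℚP.*-identityˡ (eval b ρ))))))
    (subst (0ℚ ℚ.<_) (sym p) (0<⊗ v>0 q))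

  module EvProducts = Products ℚ._*_ 1ℚ (Ev ρ) Ev-one Ev-*

  Ev-rows : ∀ {z : Row n → Frac n} {τ : Point n} → (∀ r → Ev ρ (z r) (τ r)) → ∀ (k : Row n → ℕ) → Ev ρ (prodF (map (λ r → z r ^F k r) allRows)) (mono (rowMono k) τ)
  Ev-rows {z} {τ} g k = subst (Ev ρ _) (trans (product-++ ℚP.*-assoc ℚP.*-identityˡ τ k (map inj₁ (allFin n)) (map inj₂ (allFin n))) (cong₂ ℚ._*_ (part inj₁) (part inj₂)))
    (G-prod {z} {τ} g k allRows)
    where
    open EvProducts
    power≡ : ∀ a k → power a k ≡ a ↑ k
    power≡ a zero = refl
    power≡ a (suc k) = cong (a ℚ.*_) (power≡ a k)
    part : ∀ {l} (h : Fin l → Row n) → product τ k (map h (allFin l)) ≡ monoV (tabulate (k ∘ h)) (τ ∘ h)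
    part {l} h = trans (cong (product τ k) (ListP.map-tabulate (λ i → i) h)) (go h)
      where
      go : ∀ {l} (h : Fin l → Row n) → product τ k (Data.List.tabulate h) ≡ monoV (tabulate (k ∘ h)) (τ ∘ h)
      go {zero} h = refl
      go {suc l} h = cong₂ ℚ._*_ (power≡ (τ (h zero)) (k (h zero))) (go (h ∘ suc))

-- Degrees and orders of cluster variables

lookup-+ : ∀ {l} (v v′ : Vec ℕ l) i → + lookup (zipWith ℕ._+_ v v′) i ≡ + lookup v i + + lookup v′ i
lookup-+ v v′ i = trans (cong +_ (VecP.lookup-zipWith ℕ._+_ i v v′)) (ℤP.pos-+ (lookup v i) (lookup v′ i))

xw yw : ∀ {n} → Fin n → Weight n
xw l = record { wt = λ m → + lookup (proj₁ m) l ; wt-* = λ (e , _) (e′ , _) → lookup-+ e e′ l }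
yw l = record { wt = λ m → + lookup (proj₂ m) l ; wt-* = λ (_ , f) (_ , f′) → lookup-+ f f′ l }

opaque
  unfolding ∑
  degW : ∀ {n} → Form n → Fin n → Weight n
  degW B l = record { wt = λ m → degM B m l ; wt-* = add }
    where
    lem : ∀ a a′ s s′ → (a + a′) - (s + s′) ≡ (a - s) + (a′ - s′)
    lem = solve-∀
    add : ∀ m m′ → degM B (mulM m m′) l ≡ degM B m l + degM B m′ l
    add (e , f) (e′ , f′) = trans (cong₂ _-_ (lookup-+ e e′ l) (trans (sum-cong (λ j → trans (cong (B l j *_) (lookup-+ f f′ j)) (ℤP.*-distribˡ-+ (B l j) (+ lookup f j) (+ lookup f′ j)))) (sum-+ (λ j → B l j * + lookup f j) (λ j → B l j * + lookup f′ j))))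
      (lem (+ lookup e l) (+ lookup e′ l) (∑ (λ j → B l j * + lookup f j)) (∑ (λ j → B l j * + lookup f′ j)))

  degW-wt : ∀ {n} (B : Form n) l m → Weight.wt (degW B l) m ≡ + lookup (proj₁ m) l - ∑ (λ j → B l j * + lookup (proj₂ m) j)
  degW-wt B l m = refl

  degW-degM : ∀ {n} (B : Form n) l m → Weight.wt (degW B l) m ≡ degM B m l
  degW-degM B l m = refl

lookup-unit : ∀ {n} (i l : Fin n) → + lookup (unitVec i) l ≡ α l i
lookup-unit i l = trans (cong +_ (VecP.lookup∘tabulate (λ j → if ⌊ i ≟ j ⌋ then 1 else 0) l)) (lem i l)
  where
  lem : ∀ {n} (i l : Fin n) → + (if ⌊ i ≟ l ⌋ then 1 else 0) ≡ α l i
  lem i l with i ≟ l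
  ... | yes _ = refl
  ... | no _ = refl

lookup-zero : ∀ {n} (l : Fin n) → + lookup (replicate n 0) l ≡ 0ℤ
lookup-zero {n} l = cong +_ (VecP.lookup-replicate l 0)

α-sym : ∀ {n} (i l : Fin n) → α i l ≡ α l i
α-sym i l with i ≟ l
... | yes refl = α-diag i
... | no ne = α-off (≢-sym ne)

∑-neg* : ∀ {n} (t x : Fin n → ℤ) → ∑ (λ i → t i * - x i) ≡ - ∑ (λ i → t i * x i)
∑-neg* t x = trans (sum-cong (λ i → sym (ℤP.neg-distribʳ-* (t i) (x i)))) (sum-neg (λ i → t i * x i))

∑-*0 : ∀ {n} (t : Fin n → ℤ) → ∑ (λ i → t i * 0ℤ) ≡ 0ℤ
∑-*0 t = sum-0 (λ i → ℤP.*-zeroʳ (t i))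

∑-*α : ∀ {n} (t : Fin n → ℤ) l → ∑ (λ i → t i * α l i) ≡ t l
∑-*α t l = trans (sum-cong (λ i → ℤP.*-comm (t i) (α l i))) (sum-α t l)

module _ {n : ℕ} (s : Seed n) (k : Fin n) where
  private
    m = mat s

  rowSum : (Row n → ℤ) → (Row n → ℤ) → ℤ
  rowSum c a = ∑ (λ i → c (inj₁ i) ⁺ * a (inj₁ i)) + ∑ (λ j → c (inj₂ j) ⁺ * a (inj₂ j))

  S⁺ S⁻ : (Row n → ℤ) → ℤ
  S⁺ = rowSum (λ r → m r k)
  S⁻ = rowSum (λ r → - m r k)

  module _ (nn : ∀ r → NN (zVar s r)) where

    module NNProducts = Products {n} {⊤} (λ _ _ → tt) tt (λ x _ → NN x) (nonneg-term one , nonneg-term one) (λ {x} {y} → NN-* {x = x} {y})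

    rowProd : (Row n → ℤ) → Frac n
    rowProd c = prodF (map (λ r → zVar s r ^F pos (c r)) allRows)

    private
      N⁺ N⁻ : Frac n
      N⁺ = rowProd (λ r → m r k)
      N⁻ = rowProd (λ r → - m r k)

    NN-rows : ∀ c → NN (rowProd c)
    NN-rows c = NNProducts.G-prod {zVar s} {λ _ → tt} nn (λ r → pos (c r)) allRows

    NN-mut : NN (mutVar s k)
    NN-mut = NN-* {x = N⁺ +F N⁻} {invF (clus s k)} (NN-+ {x = N⁺} {N⁻} (NN-rows (λ r → m r k)) (NN-rows (λ r → - m r k))) (proj₂ (nn (inj₁ k)) , proj₁ (nn (inj₁ k)))

    Val-mut : ∀ {w a} → (∀ r → Val w (zVar s r) (a r)) → Val w (mutVar s k) ((S⁺ a ⊓ S⁻ a) - a (inj₁ k))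
    Val-mut {w} {a} v = Val-* {x = N⁺ +F N⁻} {invF (clus s k)} (Val-+ {x = N⁺} {N⁻} (NN-rows (λ r → m r k)) (NN-rows (λ r → - m r k)) (rows {zVar s} {a} v (λ r → m r k)) (rows {zVar s} {a} v (λ r → - m r k))) (Val-inv {x = clus s k} (v (inj₁ k)))
      where open AdditiveProducts (Val w) Val-one Val-*

    Hom-mut : ∀ {w a} → (∀ r → Hom w (zVar s r) (a r)) → S⁺ a ≡ S⁻ a → Hom w (mutVar s k) (S⁺ a - a (inj₁ k))
    Hom-mut {w} {a} v e = Hom-* {x = N⁺ +F N⁻} {invF (clus s k)} (Hom-+ {x = N⁺} {N⁻} (NN-rows (λ r → m r k)) (NN-rows (λ r → - m r k)) (rows {zVar s} {a} v (λ r → m r k)) (subst (Hom w N⁻) (sym e) (rows {zVar s} {a} v (λ r → - m r k)))) (Hom-inv {x = clus s k} (v (inj₁ k)))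
      where open AdditiveProducts (Hom w) Hom-one Hom-*

  Ev-mut : ∀ {ρ τ : Point n} → (∀ r → Ev ρ (zVar s r) (τ r)) → 0ℚ ℚ.< τ (inj₁ k) →
    Ev ρ (mutVar s k) ((ℚEval.mono (rowMono (λ r → pos (m r k))) τ ℚ.+ ℚEval.mono (rowMono (λ r → pos (- m r k))) τ) ℚ.* inv (τ (inj₁ k)))
  Ev-mut {ρ} {τ} v p = Ev-* {x = N⁺ +F N⁻} {invF (clus s k)} (Ev-+ {x = N⁺} {N⁻} (Ev-rows {z = zVar s} {τ} v (λ r → pos (m r k))) (Ev-rows {z = zVar s} {τ} v (λ r → pos (- m r k)))) (Ev-inv {x = clus s k} {τ (inj₁ k)} p (v (inj₁ k)))
    where
    N⁺ N⁻ : Frac n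
    N⁺ = prodF (map (λ r → zVar s r ^F pos (m r k)) allRows)
    N⁻ = prodF (map (λ r → zVar s r ^F pos (- m r k)) allRows)

term-Val : ∀ {n} (w : Weight n) m {a} → Weight.wt w m ≡ a → Val w (polyF ((1ℤ , m) ∷ [])) a
term-Val w m {a} e = val (IsMin-term m e) (IsMin-term one (wt-one w)) (sym (ℤP.+-identityʳ a))

term-Hom : ∀ {n} (w : Weight n) m {a} → Weight.wt w m ≡ a → Hom w (polyF ((1ℤ , m) ∷ [])) a
term-Hom w m {a} e = hom (IsMin-term m e) (IsMin-term m (cong -_ e)) (IsMin-term one (wt-one w)) (IsMin-term one (cong -_ (wt-one w))) (sym (ℤP.+-identityʳ a))

-- The point x = 1, y = 0, where every cluster variable takes the value 1.
ρ₀ : ∀ {n} → Point n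
ρ₀ (inj₁ _) = 1ℚ
ρ₀ (inj₂ _) = 0ℚ

module _ {n : ℕ} where
  open ℚEval {n}

  ↑-1 : ∀ k → 1ℚ ↑ k ≡ 1ℚ
  ↑-1 zero = refl
  ↑-1 (suc k) = trans (ℚP.*-identityˡ (1ℚ ↑ k)) (↑-1 k)

  monoV-ones : ∀ {l} (v : Vec ℕ l) → monoV v (λ _ → 1ℚ) ≡ 1ℚ
  monoV-ones [] = refl
  monoV-ones (e ∷ v) = cong₂ ℚ._*_ (↑-1 e) (monoV-ones v)

  monoV-zeros₁ : ∀ {l} (g : Fin l → ℕ) → (∀ j → g j ≡ 0) → monoV (tabulate g) (λ _ → 0ℚ) ≡ 1ℚ
  monoV-zeros₁ {zero} g z = refl
  monoV-zeros₁ {suc l} g z rewrite z zero = trans (ℚP.*-identityˡ _) (monoV-zeros₁ (g ∘ suc) (z ∘ suc))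

  monoV-zeros₀ : ∀ {l} (g : Fin l → ℕ) j → g j ≢ 0 → monoV (tabulate g) (λ _ → 0ℚ) ≡ 0ℚ
  monoV-zeros₀ g zero nz with g zero
  ... | zero = ⊥-elim (nz refl)
  ... | suc k = trans (cong (ℚ._* monoV (tabulate (g ∘ suc)) (λ _ → 0ℚ)) (ℚP.*-zeroˡ (0ℚ ↑ k))) (ℚP.*-zeroˡ (monoV (tabulate (g ∘ suc)) (λ _ → 0ℚ)))
  monoV-zeros₀ g (suc j) nz = trans (cong (0ℚ ↑ g zero ℚ.*_) (monoV-zeros₀ (g ∘ suc) j nz)) (ℚP.*-zeroʳ (0ℚ ↑ g zero))

pos-0 : ∀ {x} → x ≤ 0ℤ → pos x ≡ 0
pos-0 p = ℤP.+-injective (⁺-neg p)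

-- Invariants of all reachable seeds

module Reachable {n} (B : Form n) (δ : Fin n → ℕ) (skew : SkewSymmetrizable B δ) (acyclic : Acyclic B) (fin : FiniteCartanType B δ) where
  open FromMatrix B δ skew acyclic fin public
  open Mutation 𝓔 public

  -- `dval` and `gval` carry the two vectors to be compared, and `yval` keeps the y_j out of the
  -- denominator. `unit` and `fval`, with the degree, serve to recognize a variable whose e-vector
  -- is an initial one.
  record Tracked (s : Seed n) {e} (V : Valid (mat s) e) : Set where
    open Valid V using (status)
    field
      nn   : ∀ p → NN (clus s p)
      unit : ∀ p → Ev ρ₀ (clus s p) 1ℚ
      dval : ∀ p l → Val (xw l) (clus s p) (- den (status p) l)
      fval : ∀ p l → Val (negW (yw l)) (clus s p) (- plus (status p) l)
      yval : ∀ p l → Val (yw l) (clus s p) 0ℤ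
      gval : ∀ p l → Hom (degW B l) (clus s p) (ν B (e p) l)

  y-deg : ∀ l j → Weight.wt (degW B l) (replicate n 0 , unitVec j) ≡ - B l j
  y-deg l j = trans (degW-wt B l _) (trans (cong₂ _-_ (lookup-zero l) (trans (sum-cong (λ i → cong (B l i *_) (trans (lookup-unit j i) (α-sym i j)))) (∑-*α (B l) j))) (ℤP.+-identityˡ (- B l j)))

  x-deg : ∀ l i → Weight.wt (degW B l) (unitVec i , replicate n 0) ≡ α l i
  x-deg l i = trans (degW-wt B l _) (trans (cong₂ _-_ (lookup-unit i l) (trans (sum-cong (λ j → cong (B l j *_) (lookup-zero j))) (∑-*0 (B l)))) (ℤP.+-identityʳ (α l i)))

  ν-lincomb : ∀ t (e : Fin n → Vect n) l → ∑ (λ i → t i * ν B (e i) l) ≡ ν B (lincomb t e) l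
  ν-lincomb t e l = *-cancelˡ (d>0 l) (begin
    d l * ∑ (λ i → t i * ν B (e i) l)       ≡⟨ sym (sum-* (d l) (λ i → t i * ν B (e i) l)) ⟩
    ∑ (λ i → d l * (t i * ν B (e i) l))     ≡⟨ sum-cong (λ i → trans (lem (d l) (t i) (ν B (e i) l)) (cong (t i *_) (d*ν (e i) l))) ⟩
    ∑ (λ i → t i * - ⟪ F ⟫ (α l) (e i))     ≡⟨ ∑-neg* t (λ i → ⟪ F ⟫ (α l) (e i)) ⟩
    - ∑ (λ i → t i * ⟪ F ⟫ (α l) (e i))     ≡⟨ cong -_ (sym (E-lincombʳ F (α l) t e)) ⟩
    - ⟪ F ⟫ (α l) (lincomb t e)             ≡⟨ sym (d*ν (lincomb t e) l) ⟩
    d l * ν B (lincomb t e) l ∎)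
    where
    open ≡-Reasoning
    lem : ∀ d t x → d * (t * x) ≡ t * (d * x)
    lem = solve-∀

  ν-axpy : ∀ {x y z : Vect n} l → (∀ i → x i ≡ - y i + z i) → ν B x l ≡ ν B z l - ν B y l
  ν-axpy {x} {y} {z} l e = *-cancelˡ (d>0 l) (begin
    d l * ν B x l                                       ≡⟨ d*ν x l ⟩
    - ⟪ F ⟫ (α l) x                                     ≡⟨ cong -_ (trans (E-congʳ F e) (trans (E-+ʳ F (α l) (λ i → - y i) z) (cong (_+ ⟪ F ⟫ (α l) z) (E-negʳ F (α l) y)))) ⟩
    - (- ⟪ F ⟫ (α l) y + ⟪ F ⟫ (α l) z)                 ≡⟨ lem (⟪ F ⟫ (α l) y) (⟪ F ⟫ (α l) z) ⟩
    - ⟪ F ⟫ (α l) z - - ⟪ F ⟫ (α l) y                   ≡⟨ cong₂ _-_ (sym (d*ν z l)) (sym (d*ν y l)) ⟩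
    d l * ν B z l - d l * ν B y l                       ≡⟨ lem′ (d l) (ν B z l) (ν B y l) ⟩
    d l * (ν B z l - ν B y l) ∎)
    where
    open ≡-Reasoning
    lem : ∀ y z → - (- y + z) ≡ - z - - y
    lem = solve-∀
    lem′ : ∀ d a b → d * a - d * b ≡ d * (a - b)
    lem′ = solve-∀

  module _ (s : Seed n) {e} (V : Valid (mat s) e) (T : Tracked s V) (k : Fin n) {e′} (V′ : Valid (mutMat k (mat s)) e′) (St : Step k (mat s) V V′) where
    open Tracked T
    open Step St
    private
      m = mat s
      module V = Valid V
      module V′ = Valid V′
      c = cvec m k

    nnz : ∀ r → NN (zVar s r)
    nnz (inj₁ p) = nn p
    nnz (inj₂ j) = nonneg-term _ , nonneg-term one

    new-d : ∀ l → Val (xw l) (mutVar s k) (- den (V′.status k) l)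
    new-d l = subst (Val (xw l) (mutVar s k)) eq (Val-mut s k nnz {xw l} {a} vals)
      where
      a : Row n → ℤ
      a (inj₁ p) = - den (V.status p) l
      a (inj₂ j) = 0ℤ
      vals : ∀ r → Val (xw l) (zVar s r) (a r)
      vals (inj₁ p) = dval p l
      vals (inj₂ j) = term-Val (xw l) _ (lookup-zero l)
      A = lincomb (exp⁺ m k) (λ q → den (V.status q)) l
      B′ = lincomb (exp⁻ m k) (λ q → den (V.status q)) l
      side : ∀ t (c : Fin n → ℤ) → ∑ (λ i → t i * - den (V.status i) l) + ∑ (λ j → c j * 0ℤ) ≡ - lincomb t (λ q → den (V.status q)) l
      side t c = trans (cong₂ _+_ (∑-neg* t (λ i → den (V.status i) l)) (∑-*0 c)) (ℤP.+-identityʳ _)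
      lem : ∀ x y z → x + y ≡ z → - z - - x ≡ - y
      lem x y _ refl = l′ x y
        where
        l′ : ∀ x y → - (x + y) - - x ≡ - y
        l′ = solve-∀
      eq : (S⁺ s k a ⊓ S⁻ s k a) - a (inj₁ k) ≡ - den (V′.status k) l
      eq = trans (cong (_- a (inj₁ k)) (trans (cong₂ _⊓_ (side (exp⁺ m k) (λ j → (c j) ⁺)) (side (exp⁻ m k) (λ j → (- c j) ⁺))) (sym (ℤP.neg-distrib-⊔-⊓ A B′))))
        (lem (den (V.status k) l) (den (V′.status k) l) (A ⊔ B′) (max-den l))

    new-f : ∀ l → Val (negW (yw l)) (mutVar s k) (- plus (V′.status k) l)
    new-f l = subst (Val (negW (yw l)) (mutVar s k)) eq (Val-mut s k nnz {negW (yw l)} {a} vals)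
      where
      a : Row n → ℤ
      a (inj₁ p) = - plus (V.status p) l
      a (inj₂ j) = - α l j
      vals : ∀ r → Val (negW (yw l)) (zVar s r) (a r)
      vals (inj₁ p) = fval p l
      vals (inj₂ j) = term-Val (negW (yw l)) _ (cong -_ (lookup-unit j l))
      A = lincomb (exp⁺ m k) (λ q → plus (V.status q)) l + (c l) ⁺
      B′ = lincomb (exp⁻ m k) (λ q → plus (V.status q)) l + (- c l) ⁺
      side : ∀ t (g : Fin n → ℤ) → ∑ (λ i → t i * - plus (V.status i) l) + ∑ (λ j → g j * - α l j) ≡ - (lincomb t (λ q → plus (V.status q)) l + g l)
      side t g = trans (cong₂ _+_ (∑-neg* t (λ i → plus (V.status i) l)) (trans (∑-neg* g (α l)) (cong -_ (∑-*α g l)))) (sym (ℤP.neg-distrib-+ (lincomb t (λ q → plus (V.status q)) l) (g l)))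
      lem : ∀ x y z → x + y ≡ z → - z - - x ≡ - y
      lem x y _ refl = l′ x y
        where
        l′ : ∀ x y → - (x + y) - - x ≡ - y
        l′ = solve-∀
      eq : (S⁺ s k a ⊓ S⁻ s k a) - a (inj₁ k) ≡ - plus (V′.status k) l
      eq = trans (cong (_- a (inj₁ k)) (trans (cong₂ _⊓_ (side (exp⁺ m k) (λ j → (c j) ⁺)) (side (exp⁻ m k) (λ j → (- c j) ⁺))) (sym (ℤP.neg-distrib-⊔-⊓ A B′))))
        (lem (plus (V.status k) l) (plus (V′.status k) l) (A ⊔ B′) (max-plus l))

    new-y : ∀ l → Val (yw l) (mutVar s k) 0ℤ
    new-y l = subst (Val (yw l) (mutVar s k)) eq (Val-mut s k nnz {yw l} {a} vals)
      where
      a : Row n → ℤ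
      a (inj₁ p) = 0ℤ
      a (inj₂ j) = α l j
      vals : ∀ r → Val (yw l) (zVar s r) (a r)
      vals (inj₁ p) = yval p l
      vals (inj₂ j) = term-Val (yw l) _ (lookup-unit j l)
      side : ∀ t (g : Fin n → ℤ) → ∑ (λ i → t i * 0ℤ) + ∑ (λ j → g j * α l j) ≡ g l
      side t g = trans (cong₂ _+_ (∑-*0 t) (∑-*α g l)) (ℤP.+-identityˡ (g l))
      eq : (S⁺ s k a ⊓ S⁻ s k a) - a (inj₁ k) ≡ 0ℤ
      eq = trans (ℤP.+-identityʳ _) (trans (cong₂ _⊓_ (side (exp⁺ m k) (λ j → (c j) ⁺)) (side (exp⁻ m k) (λ j → (- c j) ⁺))) (zero-min (⁺-disj (c l))))
        where
        zero-min : (c l) ⁺ ≡ 0ℤ ⊎ (- c l) ⁺ ≡ 0ℤ → (c l) ⁺ ⊓ (- c l) ⁺ ≡ 0ℤ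
        zero-min (inj₁ z) = trans (cong (_⊓ (- c l) ⁺) z) (ℤP.i≤j⇒i⊓j≡i (⁺-nonneg (- c l)))
        zero-min (inj₂ z) = trans (cong ((c l) ⁺ ⊓_) z) (ℤP.i≥j⇒i⊓j≡j (⁺-nonneg (c l)))

    new-g : ∀ l → Hom (degW B l) (mutVar s k) (ν B (e′ k) l)
    new-g l = subst (Hom (degW B l) (mutVar s k)) (by tropical) (Hom-mut s k nnz {degW B l} {a} vals balance)
      where
      a : Row n → ℤ
      a (inj₁ p) = ν B (e p) l
      a (inj₂ j) = - B l j
      vals : ∀ r → Hom (degW B l) (zVar s r) (a r)
      vals (inj₁ p) = gval p l
      vals (inj₂ j) = term-Hom (degW B l) _ (y-deg l j)
      side : ∀ t (g : Fin n → ℤ) → ∑ (λ i → t i * ν B (e i) l) + ∑ (λ j → g j * - B l j) ≡ ν B (lincomb t e) l - ∑ (λ j → g j * B l j)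
      side t g = cong₂ _+_ (ν-lincomb t e l) (∑-neg* g (B l))
      module X = ExchangeVectors 𝓔 V.cseed V.eseed k
      A = ν B (lincomb (exp⁺ m k) e) l
      B′ = ν B (lincomb (exp⁻ m k) e) l
      C⁺ = ∑ (λ j → (c j) ⁺ * B l j)
      C⁻ = ∑ (λ j → (- c j) ⁺ * B l j)
      C-diff : d l * (C⁺ - C⁻) ≡ ⟪ F ⟫ (α l) c - ⟪ F ⟫ c (α l)
      C-diff = begin
        d l * (C⁺ - C⁻)                                            ≡⟨ cong (λ w → d l * (C⁺ + w)) (sym (sum-neg (λ j → (- c j) ⁺ * B l j))) ⟩
        d l * (C⁺ + ∑ (λ j → - ((- c j) ⁺ * B l j)))               ≡⟨ cong (d l *_) (sym (sum-+ (λ j → (c j) ⁺ * B l j) (λ j → - ((- c j) ⁺ * B l j)))) ⟩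
        d l * ∑ (λ j → (c j) ⁺ * B l j + - ((- c j) ⁺ * B l j))    ≡⟨ sym (sum-* (d l) _) ⟩
        ∑ (λ j → d l * ((c j) ⁺ * B l j + - ((- c j) ⁺ * B l j)))  ≡⟨ sum-cong (λ j → trans (lem₁ (d l) ((c j) ⁺) ((- c j) ⁺) (B l j)) (trans (cong₂ _*_ (F-skew l j) (sym (⁺-diff (c j)))) (lem₂ (F l j) (F j l) (c j)))) ⟩
        ∑ (λ j → F l j * c j + - (F j l * c j))                    ≡⟨ trans (sum-+ (λ j → F l j * c j) (λ j → - (F j l * c j))) (cong (λ w → ∑ (λ j → F l j * c j) + w) (sum-neg (λ j → F j l * c j))) ⟩
        ∑ (λ j → F l j * c j) - ∑ (λ j → F j l * c j)              ≡⟨ cong₂ _-_ (sym (E-αˡ F l c)) (sym (E-αʳ F c l)) ⟩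
        ⟪ F ⟫ (α l) c - ⟪ F ⟫ c (α l) ∎
        where
        open ≡-Reasoning
        lem₁ : ∀ d p q b → d * (p * b + - (q * b)) ≡ d * b * (p - q)
        lem₁ = solve-∀
        lem₂ : ∀ f g c → (f - g) * c ≡ f * c + - (g * c)
        lem₂ = solve-∀
      -- After multiplication by `d l` this is `E-B-A` tested on `α l`; the degrees of the y_j
      -- supply the skew-symmetrized pairing with c through `C-diff`.
      balance : S⁺ s k a ≡ S⁻ s k a
      balance = trans (side (exp⁺ m k) (λ j → (c j) ⁺)) (trans (-‿0 (*-cancel-0 (d>0 l) zero-diff)) (sym (side (exp⁻ m k) (λ j → (- c j) ⁺))))
        where
        lem₁ : ∀ d a b p q → d * ((a - p) - (b - q)) ≡ (d * a - d * b) - d * (p - q)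
        lem₁ = solve-∀
        lem₂ : ∀ x y z → (- x - - (x + y - z)) - (y - z) ≡ 0ℤ
        lem₂ = solve-∀
        zero-diff : d l * ((A - C⁺) - (B′ - C⁻)) ≡ 0ℤ
        zero-diff = trans (lem₁ (d l) A B′ C⁺ C⁻) (trans (cong₂ _-_ (cong₂ _-_ (d*ν (lincomb (exp⁺ m k) e) l) (trans (d*ν (lincomb (exp⁻ m k) e) l) (cong -_ (X.E-B-A (α l))))) C-diff)
          (lem₂ (⟪ F ⟫ (α l) (lincomb (exp⁺ m k) e)) (⟪ F ⟫ (α l) c) (⟪ F ⟫ c (α l))))
      drop0 : ∀ {x y z : ℤ} → z ≡ 0ℤ → x - z - y ≡ x - y
      drop0 {x} {y} refl = cong (_- y) (ℤP.+-identityʳ x)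
      by : (Nonneg c × (∀ i → e′ k i ≡ - e k i + lincomb (exp⁻ m k) e i)) ⊎ (Nonpos c × (∀ i → e′ k i ≡ - e k i + lincomb (exp⁺ m k) e i)) → S⁺ s k a - ν B (e k) l ≡ ν B (e′ k) l
      by (inj₁ (p , q)) = trans (cong (_- ν B (e k) l) (trans balance (side (exp⁻ m k) (λ j → (- c j) ⁺)))) (trans (drop0 {B′} (sum-0 (λ j → cong (_* B l j) (⁺-neg (neg-≤0 (p j)))))) (sym (ν-axpy l q)))
      by (inj₂ (p , q)) = trans (cong (_- ν B (e k) l) (side (exp⁺ m k) (λ j → (c j) ⁺))) (trans (drop0 {A} (sum-0 (λ j → cong (_* B l j) (⁺-neg (p j))))) (sym (ν-axpy l q)))

    -- As c k has one sign and is not zero, exactly one of the two exchange monomials contains some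
    -- y_j. At y = 0 it vanishes and the other one equals 1.
    new-unit : Ev ρ₀ (mutVar s k) 1ℚ
    new-unit = subst (Ev ρ₀ (mutVar s k)) (by (V.sign k)) (Ev-mut s k {ρ₀} {ρ₀} vals (ℚ.*<* (+<+ (ℕ.s≤s ℕ.z≤n))))
      where
      open ℚEval {n}
      vals : ∀ r → Ev ρ₀ (zVar s r) (ρ₀ r)
      vals (inj₁ p) = unit p
      vals (inj₂ j) = Ev-poly (yP j) (eval-y j ρ₀)
      M⁺ = mono (rowMono (λ r → pos (m r k))) ρ₀
      M⁻ = mono (rowMono (λ r → pos (- m r k))) ρ₀
      value₁ : ∀ c → (∀ j → pos (c (inj₂ j)) ≡ 0) → mono (rowMono (λ r → pos (c r))) ρ₀ ≡ 1ℚ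
      value₁ c z = cong₂ ℚ._*_ (monoV-ones (tabulate (λ i → pos (c (inj₁ i))))) (monoV-zeros₁ (λ j → pos (c (inj₂ j))) z)
      value₀ : ∀ c j → 0ℤ < c (inj₂ j) → mono (rowMono (λ r → pos (c r))) ρ₀ ≡ 0ℚ
      value₀ c j p = trans (cong₂ ℚ._*_ (monoV-ones (tabulate (λ i → pos (c (inj₁ i))))) (monoV-zeros₀ (λ j → pos (c (inj₂ j))) j (λ z → ℤP.<-irrefl (trans (cong +_ (sym z)) (⁺-pos (ℤP.<⇒≤ p))) p))) (ℚP.*-zeroʳ 1ℚ)
      some-pos : ∀ x → ¬ Nonpos {n} x → ∃ λ j → 0ℤ < x j
      some-pos x np with FinP.any? (λ j → 0ℤ ℤ.<? x j)
      ... | yes r = r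
      ... | no r = ⊥-elim (np (λ j → ℤP.≮⇒≥ (λ q → r (j , q))))
      by : Nonneg c ⊎ Nonpos c → (M⁺ ℚ.+ M⁻) ℚ.* inv 1ℚ ≡ 1ℚ
      by (inj₁ p) = cong (ℚ._* inv 1ℚ) (let (j , q) = some-pos c (V.not-both k p) in cong₂ ℚ._+_ (value₀ (λ r → m r k) j q) (value₁ (λ r → - m r k) (λ j → pos-0 (neg-≤0 (p j)))))
      by (inj₂ p) = cong (ℚ._* inv 1ℚ) (let (j , q) = some-pos (λ j → - c j) (λ q → V.not-both k (λ j → 0≤∣neg (q j)) p) in cong₂ ℚ._+_ (value₁ (λ r → m r k) (λ j → pos-0 (p j))) (value₀ (λ r → - m r k) j q))

    tracked-step : Tracked (mutate k s) V′
    tracked-step = record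
      { nn = λ p → pick p NN (λ _ → nn p) (λ _ → NN-mut s k nnz)
      ; unit = λ p → pick p (λ x → Ev ρ₀ x 1ℚ) (λ _ → unit p) (λ _ → new-unit)
      ; dval = λ p l → pick p (λ x → Val (xw l) x (- den (V′.status p) l))
          (λ ne → subst (λ a → Val (xw l) (clus s p) (- a)) (den-unique 𝓔 (V.status p) (V′.status p) (λ l → sym (e-off p ne l)) l) (dval p l)) (λ { refl → new-d l })
      ; fval = λ p l → pick p (λ x → Val (negW (yw l)) x (- plus (V′.status p) l))
          (λ ne → subst (λ a → Val (negW (yw l)) (clus s p) (- a)) (plus-unique 𝓔 (V.status p) (V′.status p) (λ l → sym (e-off p ne l)) l) (fval p l)) (λ { refl → new-f l })
      ; yval = λ p l → pick p (λ x → Val (yw l) x 0ℤ) (λ _ → yval p l) (λ _ → new-y l)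
      ; gval = λ p l → pick p (λ x → Hom (degW B l) x (ν B (e′ p) l))
          (λ ne → subst (Hom (degW B l) (clus s p)) (ν-cong l (λ i → sym (e-off p ne i))) (gval p l)) (λ { refl → new-g l }) }
      where
      pick : ∀ p (P : Frac n → Set) → (p ≢ k → P (clus s p)) → (p ≡ k → P (mutVar s k)) → P (clus (mutate k s) p)
      pick p P old new with p ≟ k
      ... | yes e = new e
      ... | no ne = old ne
      ν-cong : ∀ {x y : Vect n} l → (∀ i → x i ≡ y i) → ν B x l ≡ ν B y l
      ν-cong {x} {y} l p = *-cancelˡ (d>0 l) (trans (d*ν x l) (trans (cong -_ (E-congʳ F p)) (sym (d*ν y l))))

  valid₀ : Valid (mat (initialSeed B)) e₀
  valid₀ = record { cseed = cseed₀ ; eseed = eseed₀ }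

  tracked₀ : Tracked (initialSeed B) valid₀
  tracked₀ = record
    { nn = λ p → nonneg-term _ , nonneg-term one
    ; unit = λ p → Ev-poly (xP p) (ℚEval.eval-x p ρ₀)
    ; dval = λ p l → term-Val (xw l) _ (trans (lookup-unit p l) (trans (α-sym l p) (trans (sym (ℤP.neg-involutive (α p l))) (cong -_ (den-unique 𝓔 (initial p (initAt₀ p)) (V₀.status p) (λ _ → refl) l)))))
    ; fval = λ p l → term-Val (negW (yw l)) _ (cong -_ (trans (lookup-zero l) (plus-unique 𝓔 (initial p (initAt₀ p)) (V₀.status p) (λ _ → refl) l)))
    ; yval = λ p l → term-Val (yw l) _ (lookup-zero l)
    ; gval = λ p l → term-Hom (degW B l) _ (trans (x-deg l p) (ν₀ l p)) }
    where
    module V₀ = Valid valid₀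
    ν₀ : ∀ l p → α l p ≡ ν B (e₀ p) l
    ν₀ l p = *-cancelˡ (d>0 l) (trans (swap (l ≟ p)) (sym (trans (d*ν (e₀ p) l) (trans (cong -_ (e₀-E p (α l))) (ℤP.neg-involutive (d p * α l p))))))
      where
      swap : Dec (l ≡ p) → d l * α l p ≡ d p * α l p
      swap (yes refl) = refl
      swap (no ne) = trans (cong (d l *_) (α-off (≢-sym ne))) (trans (ℤP.*-zeroʳ (d l)) (sym (trans (cong (d p *_) (α-off (≢-sym ne))) (ℤP.*-zeroʳ (d p)))))

  State : Seed n → Set
  State s = ∃ λ e → Σ (Valid (mat s) e) (Tracked s)

  reach : ∀ ks {s} → State s → State (foldl (λ s k → mutate k s) s ks)
  reach [] st = st
  reach (k ∷ ks) {s} (e , V , T) = let (e′ , V′ , St) = mutation-step k (mat s) V in reach ks (e′ , V′ , tracked-step s V T k V′ St)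

  reachable : ∀ ks → State (mutateSeq B ks)
  reachable ks = reach ks (e₀ , valid₀ , tracked₀)

-- Laurent polynomials as functions on positive points

module ℚR = EvalRing ℚ-ring

module ℚSolver = Data.Rational.Solver.+-*-Solver

module _ {n : ℕ} where
  open ℚEval {n}

  ↑>0 : ∀ {a} k → 0ℚ ℚ.< a → 0ℚ ℚ.< a ↑ k
  ↑>0 zero p = ℚ.*<* (+<+ (ℕ.s≤s ℕ.z≤n))
  ↑>0 (suc k) p = 0<⊗ p (↑>0 k p)

  monoV>0 : ∀ {l} (v : Vec ℕ l) {ρ} → (∀ i → 0ℚ ℚ.< ρ i) → 0ℚ ℚ.< monoV v ρ
  monoV>0 [] p = ℚ.*<* (+<+ (ℕ.s≤s ℕ.z≤n))
  monoV>0 (e ∷ v) p = 0<⊗ (↑>0 e (p zero)) (monoV>0 v (p ∘ suc))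

  mono>0 : ∀ m {ρ} → Positive ρ → 0ℚ ℚ.< mono m ρ
  mono>0 (e , f) p = 0<⊗ (monoV>0 e (p ∘ inj₁)) (monoV>0 f (p ∘ inj₂))

  monoV-cong : ∀ {l} (v : Vec ℕ l) {ρ ρ′} → (∀ i → ρ i ≡ ρ′ i) → monoV v ρ ≡ monoV v ρ′
  monoV-cong [] e = refl
  monoV-cong (x ∷ v) e = cong₂ (λ a b → a ↑ x ℚ.* b) (e zero) (monoV-cong v (e ∘ suc))

  mono-cong : ∀ m {ρ ρ′ : Point n} → (∀ r → ρ r ≡ ρ′ r) → mono m ρ ≡ mono m ρ′
  mono-cong (e , f) p = cong₂ ℚ._*_ (monoV-cong e (p ∘ inj₁)) (monoV-cong f (p ∘ inj₂))

  infixl 7 _·_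
  _·_ : Poly n → Monomial n → Poly n
  p · m = p *P term 1ℤ m

  eval-· : ∀ p m ρ → eval (p · m) ρ ≡ eval p ρ ℚ.* mono m ρ
  eval-· p m ρ = trans (eval-* p (term 1ℤ m) ρ) (cong (eval p ρ ℚ.*_) (eval-term m ρ))

  infixr 8 _^^_
  _^^_ : Monomial n → ℕ → Monomial n
  m ^^ zero = one
  m ^^ suc k = mulM m (m ^^ k)

  mono-one : ∀ ρ → mono one ρ ≡ 1ℚ
  mono-one ρ = trans (cong₂ ℚ._*_ (monoV-0 (ρ ∘ inj₁)) (monoV-0 (ρ ∘ inj₂))) refl

  mono-^^ : ∀ m k ρ → mono (m ^^ k) ρ ≡ mono m ρ ↑ k
  mono-^^ m zero ρ = mono-one ρ
  mono-^^ m (suc k) ρ = trans (mono-* m (m ^^ k) ρ) (cong (mono m ρ ℚ.*_) (mono-^^ m k ρ))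

  module _ (w : Weight n) where
    open Weight w

    truncate : ℤ → Poly n → Poly n
    truncate c [] = []
    truncate c ((a , m) ∷ p) = if ⌊ wt m ℤ.≤? c ⌋ then (a , m) ∷ truncate c p else truncate c p

    below : ℤ → (Monomial n → ℚ) → Monomial n → ℚ
    below c φ m = if ⌊ wt m ℤ.≤? c ⌋ then φ m else 0ℚ

    open Pairing ℚ-ring {n}

    truncate-⟨⟩ : ∀ c p φ → ⟨ truncate c p , φ ⟩ ≡ ⟨ p , below c φ ⟩
    truncate-⟨⟩ c [] φ = refl
    truncate-⟨⟩ c ((a , m) ∷ p) φ with wt m ℤ.≤? c
    ... | yes _ = cong (↑ℤ a ℚ.* φ m ℚ.+_) (truncate-⟨⟩ c p φ)
    ... | no _ = trans (truncate-⟨⟩ c p φ) (sym (trans (cong (ℚ._+ ⟨ p , below c φ ⟩) (ℚP.*-zeroʳ (↑ℤ a))) (ℚP.+-identityˡ _)))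

    below-yes : ∀ {c φ m} → wt m ≤ c → below c φ m ≡ φ m
    below-yes {c} {φ} {m} p with wt m ℤ.≤? c
    ... | yes _ = refl
    ... | no np = ⊥-elim (np p)

    below-no : ∀ {c φ m} → c < wt m → below c φ m ≡ 0ℚ
    below-no {c} {φ} {m} p with wt m ℤ.≤? c
    ... | yes q = ⊥-elim (ℤP.<⇒≱ p q)
    ... | no _ = refl

    wt-^^ : ∀ m k → wt (m ^^ k) ≡ + k * wt m
    wt-^^ m zero = trans (wt-one w) (sym (ℤP.*-zeroˡ (wt m)))
    wt-^^ m (suc k) = trans (wt-* m (m ^^ k)) (trans (cong (λ v → wt m + v) (wt-^^ m k)) (lem (wt m) (+ k)))
      where
      lem : ∀ a k → a + k * a ≡ (1ℤ + k) * a
      lem = solve-∀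

    AtLeast-^ : ∀ {p a} k → AtLeast {w = w} p a → AtLeast {w = w} (p ^P k) (+ k * a)
    AtLeast-^ {a = a} zero h m nz = ℤP.≤-reflexive (trans (ℤP.*-zeroˡ a) (trans (sym (wt-one w)) (cong wt (coeff-term-other one nz))))
    AtLeast-^ {p} {a} (suc k) h = subst (AtLeast {w = w} (p *P (p ^P k))) (lem a (+ k)) (AtLeast-* {w = w} {p = p} {q = p ^P k} h (AtLeast-^ {p} {a} k h))
      where
      lem : ∀ a k → a + k * a ≡ (1ℤ + k) * a
      lem = solve-∀

    AtLeast-term : ∀ m {a} → a ≤ wt m → AtLeast {w = w} (term 1ℤ m) a
    AtLeast-term m {a} p m′ nz = subst (λ m → a ≤ wt m) (coeff-term-other m nz) p

    AtLeast-weaken : ∀ {p a b} → b ≤ a → AtLeast {w = w} p a → AtLeast {w = w} p b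
    AtLeast-weaken le h m nz = ℤP.≤-trans le (h m nz)

    bounded-below : ∀ (p : Poly n) → ∃ λ a → AtLeast {w = w} p a
    bounded-below p with find-support p {λ _ → ⊤} (λ _ → yes tt)
    ... | inj₁ (m , nz , _) = let (a , P) = IsMin-exists {w = w} p (m , nz) in a , IsMin.lower P
    ... | inj₂ none = 0ℤ , λ m nz → ⊥-elim (none m nz tt)

  -- From X (s + W) = Y (r + r′) one gets X sᴺ = (r + r′) S + X (−W)ᴺ. If r, r′ have equal weight and W has
  -- weights above that of s, then for large N truncation by weight removes the last term.
  divide : ∀ (w : Weight n) X Y W s r r′ → Weight.wt w r ≡ Weight.wt w r′ → AtLeast {w = w} W (Weight.wt w s + 1ℤ) →
    (∀ ρ → Positive ρ → eval X ρ ℚ.* (mono s ρ ℚ.+ eval W ρ) ≡ eval Y ρ ℚ.* (mono r ρ ℚ.+ mono r′ ρ)) →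
    ∃ λ N → ∃ λ Z → ∀ ρ → Positive ρ → eval X ρ ℚ.* mono (s ^^ N) ρ ≡ eval Z ρ ℚ.* (mono r ρ ℚ.+ mono r′ ρ)
  divide w X Y W s r r′ wr wW eq = N , Z , result
    where
    open Weight w
    open Pairing ℚ-ring {n}
    V = negP W
    ≤∣∣ : ∀ a → a ≤ + ∣ a ∣
    ≤∣∣ (+ a) = ℤP.≤-refl
    ≤∣∣ -[1+ a ] = ℤ.-≤+
    lo = proj₁ (bounded-below w X)
    hi = - proj₁ (bounded-below (negW w) X)
    X-lo : AtLeast {w = w} X lo
    X-lo = proj₂ (bounded-below w X)
    X-hi : ∀ m → coeff X m ≢ 0ℤ → wt m ≤ hi
    X-hi m nz = subst (_≤ hi) (ℤP.neg-involutive (wt m)) (ℤP.neg-mono-≤ (proj₂ (bounded-below (negW w) X) m nz))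
    -- The terms of X times the N-th power of V weigh at least lo + N (wt s + 1). Since N > hi - lo
    -- this exceeds c, the largest weight possible in X times the N-th power of s.
    N = suc ∣ hi - lo ∣
    c = hi + + N * wt s
    Q : Poly n
    Q = term 1ℤ r ++ term 1ℤ r′
    Q-eval : ∀ ρ → eval Q ρ ≡ mono r ρ ℚ.+ mono r′ ρ
    Q-eval ρ = trans (eval-++ (term 1ℤ r) (term 1ℤ r′) ρ) (cong₂ ℚ._+_ (eval-term r ρ) (eval-term r′ ρ))
    V-eval : ∀ ρ → eval V ρ ≡ ↑ℤ (- 1ℤ) ℚ.* eval W ρ
    V-eval ρ = ⟨⟩-map _ (- 1ℤ) (λ m → m) (λ _ _ → refl) W (λ m → mono m ρ)
    eval-^ : ∀ k ρ → eval (V ^P k) ρ ≡ eval V ρ ↑ k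
    eval-^ zero ρ = eval-one ρ
    eval-^ (suc k) ρ = trans (eval-* V (V ^P k) ρ) (cong (eval V ρ ℚ.*_) (eval-^ k ρ))
    S : ℕ → Poly n
    S zero = []
    S (suc k) = (S k · s) ++ (Y *P (V ^P k))
    step-eq : ∀ ρ → Positive ρ → eval X ρ ℚ.* mono s ρ ≡ eval Y ρ ℚ.* eval Q ρ ℚ.+ eval X ρ ℚ.* eval V ρ
    step-eq ρ p = begin
      eval X ρ ℚ.* mono s ρ
        ≡⟨ lem (eval X ρ) (mono s ρ) (eval W ρ) ⟩
      eval X ρ ℚ.* (mono s ρ ℚ.+ eval W ρ) ℚ.+ eval X ρ ℚ.* (↑ℤ (- 1ℤ) ℚ.* eval W ρ)
        ≡⟨ cong₂ (λ u v → u ℚ.+ eval X ρ ℚ.* v) (trans (eq ρ p) (cong (eval Y ρ ℚ.*_) (sym (Q-eval ρ)))) (sym (V-eval ρ)) ⟩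
      eval Y ρ ℚ.* eval Q ρ ℚ.+ eval X ρ ℚ.* eval V ρ ∎
      where
      open ≡-Reasoning
      lem : ∀ x s v → x ℚ.* s ≡ x ℚ.* (s ℚ.+ v) ℚ.+ x ℚ.* (↑ℤ (- 1ℤ) ℚ.* v)
      lem = solve 3 (λ x s v → x :* s := x :* (s :+ v) :+ x :* (con (↑ℤ (- 1ℤ)) :* v)) refl
        where open ℚSolver
    iterate : ∀ k ρ → Positive ρ → eval X ρ ℚ.* mono s ρ ↑ k ≡ eval Q ρ ℚ.* eval (S k) ρ ℚ.+ eval X ρ ℚ.* eval V ρ ↑ k
    iterate zero ρ p = sym (trans (cong (ℚ._+ eval X ρ ℚ.* 1ℚ) (ℚP.*-zeroʳ (eval Q ρ))) (ℚP.+-identityˡ _))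
    iterate (suc k) ρ p = begin
      x ℚ.* (σ ℚ.* σ ↑ k)                             ≡⟨ lem₁ x σ (σ ↑ k) ⟩
      x ℚ.* σ ↑ k ℚ.* σ                               ≡⟨ cong (ℚ._* σ) (iterate k ρ p) ⟩
      (q ℚ.* t ℚ.+ x ℚ.* v ↑ k) ℚ.* σ                 ≡⟨ lem₂ q t x (v ↑ k) σ ⟩
      q ℚ.* (t ℚ.* σ) ℚ.+ x ℚ.* σ ℚ.* v ↑ k           ≡⟨ cong (λ z → q ℚ.* (t ℚ.* σ) ℚ.+ z ℚ.* v ↑ k) (step-eq ρ p) ⟩
      q ℚ.* (t ℚ.* σ) ℚ.+ (y ℚ.* q ℚ.+ x ℚ.* v) ℚ.* v ↑ k ≡⟨ lem₃ q (t ℚ.* σ) y x v (v ↑ k) ⟩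
      q ℚ.* (t ℚ.* σ ℚ.+ y ℚ.* v ↑ k) ℚ.+ x ℚ.* (v ℚ.* v ↑ k)
        ≡⟨ cong (λ z → q ℚ.* z ℚ.+ x ℚ.* (v ℚ.* v ↑ k)) (sym (trans (eval-++ (S k · s) (Y *P (V ^P k)) ρ) (cong₂ ℚ._+_ (eval-· (S k) s ρ) (trans (eval-* Y (V ^P k) ρ) (cong (y ℚ.*_) (eval-^ k ρ)))))) ⟩
      q ℚ.* eval (S (suc k)) ρ ℚ.+ x ℚ.* (v ℚ.* v ↑ k) ∎
      where
      open ≡-Reasoning
      x = eval X ρ
      y = eval Y ρ
      σ = mono s ρ
      v = eval V ρ
      q = eval Q ρ
      t = eval (S k) ρ
      open ℚSolver
      lem₁ : ∀ x s k → x ℚ.* (s ℚ.* k) ≡ x ℚ.* k ℚ.* s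
      lem₁ = solve 3 (λ x s k → x :* (s :* k) := x :* k :* s) refl
      lem₂ : ∀ q t x v s → (q ℚ.* t ℚ.+ x ℚ.* v) ℚ.* s ≡ q ℚ.* (t ℚ.* s) ℚ.+ x ℚ.* s ℚ.* v
      lem₂ = solve 5 (λ q t x v s → (q :* t :+ x :* v) :* s := q :* (t :* s) :+ x :* s :* v) refl
      lem₃ : ∀ q t y x v k → q ℚ.* t ℚ.+ (y ℚ.* q ℚ.+ x ℚ.* v) ℚ.* k ≡ q ℚ.* (t ℚ.+ y ℚ.* k) ℚ.+ x ℚ.* (v ℚ.* k)
      lem₃ = solve 6 (λ q t y x v k → q :* t :+ (y :* q :+ x :* v) :* k := q :* (t :+ y :* k) :+ x :* (v :* k)) refl
    left right : Poly n
    left = X · s ^^ N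
    right = (Q *P S N) ++ (X *P (V ^P N))
    formal : left ≈P right
    formal = faithful left right (λ ρ p → begin
      eval left ρ                                               ≡⟨ trans (eval-· X (s ^^ N) ρ) (cong (eval X ρ ℚ.*_) (mono-^^ s N ρ)) ⟩
      eval X ρ ℚ.* mono s ρ ↑ N                                 ≡⟨ iterate N ρ p ⟩
      eval Q ρ ℚ.* eval (S N) ρ ℚ.+ eval X ρ ℚ.* eval V ρ ↑ N   ≡⟨ cong₂ ℚ._+_ (sym (eval-* Q (S N) ρ)) (sym (trans (eval-* X (V ^P N) ρ) (cong (eval X ρ ℚ.*_) (eval-^ N ρ)))) ⟩
      eval (Q *P S N) ρ ℚ.+ eval (X *P (V ^P N)) ρ              ≡⟨ sym (eval-++ (Q *P S N) (X *P (V ^P N)) ρ) ⟩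
      eval right ρ ∎)
      where open ≡-Reasoning
    left-low : ∀ m → coeff left m ≢ 0ℤ → wt m ≤ c
    left-low m nz = subst₂ _≤_ (ℤP.neg-involutive (wt m)) (trans (ℤP.neg-distrib-+ (- hi) (- (+ N * wt s))) (cong₂ _+_ (ℤP.neg-involutive hi) (ℤP.neg-involutive (+ N * wt s))))
      (ℤP.neg-mono-≤ (AtLeast-* {w = negW w} {p = X} {q = term 1ℤ (s ^^ N)} (λ m nz → ℤP.neg-mono-≤ (X-hi m nz)) (AtLeast-term (negW w) (s ^^ N) (ℤP.≤-reflexive (cong -_ (sym (wt-^^ w s N))))) m nz))
    V-high : AtLeast {w = w} V (wt s + 1ℤ)
    V-high m nz = wW m (λ z → nz (trans (coeff≡⟨⟩ V m) (trans (ℤPair.⟨⟩-map _ (- 1ℤ) (λ m → m) (λ _ _ → refl) W (indicator m)) (cong (- 1ℤ *_) (trans (sym (coeff≡⟨⟩ W m)) z)))))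
    rest-high : ∀ m → coeff (X *P (V ^P N)) m ≢ 0ℤ → c < wt m
    rest-high m nz = ℤP.<-≤-trans (<by (+ N - (hi - lo)) (0<- (ℤP.≤-<-trans (≤∣∣ (hi - lo)) (+<+ ℕP.≤-refl))) (lem hi lo (+ N) (wt s)))
      (AtLeast-* {w = w} {p = X} {q = V ^P N} X-lo (AtLeast-^ w {p = V} N V-high) m nz)
      where
      lem : ∀ h l N s → l + N * (s + 1ℤ) - (h + N * s) ≡ N - (h - l)
      lem = solve-∀
    -- Multiplication by r or r′ shifts weights by the same amount `wt r`, so cutting the product at
    -- c means cutting `S N` at c - wt r.
    Z : Poly n
    Z = truncate w (c - wt r) (S N)
    result : ∀ ρ → Positive ρ → eval X ρ ℚ.* mono (s ^^ N) ρ ≡ eval Z ρ ℚ.* (mono r ρ ℚ.+ mono r′ ρ)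
    result ρ p = begin
      eval X ρ ℚ.* mono (s ^^ N) ρ                             ≡⟨ sym (eval-· X (s ^^ N) ρ) ⟩
      eval left ρ                                              ≡⟨ ⟨⟩-support left (λ m nz → sym (below-yes w {c} {μ} {m} (left-low m nz))) ⟩
      ⟨ left , φ ⟩                                             ≡⟨ ⟨⟩-≈ {left} {right} formal φ ⟩
      ⟨ right , φ ⟩                                            ≡⟨ ⟨⟩-++ (Q *P S N) (X *P (V ^P N)) φ ⟩
      ⟨ Q *P S N , φ ⟩ ℚ.+ ⟨ X *P (V ^P N) , φ ⟩               ≡⟨ cong (⟨ Q *P S N , φ ⟩ ℚ.+_) (⟨⟩-null (X *P (V ^P N)) (λ m nz → below-no w {c} {μ} {m} (rest-high m nz))) ⟩
      ⟨ Q *P S N , φ ⟩ ℚ.+ 0ℚ                                  ≡⟨ ℚP.+-identityʳ _ ⟩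
      ⟨ Q *P S N , φ ⟩                                         ≡⟨ ⟨⟩-* Q (S N) φ ⟩
      ⟨ Q , (λ m → ⟨ S N , (λ m′ → φ (mulM m m′)) ⟩) ⟩         ≡⟨ ⟨⟩-++ (term 1ℤ r) (term 1ℤ r′) (λ m → ⟨ S N , (λ m′ → φ (mulM m m′)) ⟩) ⟩
      ⟨ term 1ℤ r , (λ m → ⟨ S N , (λ m′ → φ (mulM m m′)) ⟩) ⟩ ℚ.+ ⟨ term 1ℤ r′ , (λ m → ⟨ S N , (λ m′ → φ (mulM m m′)) ⟩) ⟩
        ≡⟨ cong₂ ℚ._+_ (part r refl) (part r′ (sym wr)) ⟩
      mono r ρ ℚ.* eval Z ρ ℚ.+ mono r′ ρ ℚ.* eval Z ρ         ≡⟨ sym (ℚP.*-distribʳ-+ (eval Z ρ) (mono r ρ) (mono r′ ρ)) ⟩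
      (mono r ρ ℚ.+ mono r′ ρ) ℚ.* eval Z ρ                    ≡⟨ ℚP.*-comm (mono r ρ ℚ.+ mono r′ ρ) (eval Z ρ) ⟩
      eval Z ρ ℚ.* (mono r ρ ℚ.+ mono r′ ρ) ∎
      where
      open ≡-Reasoning
      μ φ ψ : Monomial n → ℚ
      μ m = mono m ρ
      φ = below w c μ
      ψ = below w (c - wt r) μ
      g : Monomial n → ℚ
      g m = ⟨ S N , (λ m′ → φ (mulM m m′)) ⟩
      shift : ∀ x → wt x ≡ wt r → ∀ m → φ (mulM x m) ≡ mono x ρ ℚ.* ψ m
      shift x wx m = [ (λ le → trans (below-yes w {c} {μ} {mulM x m} (subst (_≤ c) (sym (wt-* x m)) (subst (λ a → a + wt m ≤ c) (sym wx) (≤by (c - wt r - wt m) (0≤- le) (l c (wt r) (wt m)))))) (trans (mono-* x m ρ) (cong (mono x ρ ℚ.*_) (sym (below-yes w {c - wt r} {μ} {m} le)))))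
        , (λ gt → trans (below-no w {c} {μ} {mulM x m} (subst (c <_) (sym (wt-* x m)) (subst (λ a → c < a + wt m) (sym wx) (<by (wt m - (c - wt r)) (0<- gt) (l′ c (wt r) (wt m)))))) (sym (trans (cong (mono x ρ ℚ.*_) (below-no w {c - wt r} {μ} {m} gt)) (ℚP.*-zeroʳ (mono x ρ))))) ]′ (≤-or-> (wt m) (c - wt r))
        where
        ≤-or-> : ∀ a b → a ≤ b ⊎ b < a
        ≤-or-> a b with a ℤ.≤? b
        ... | yes q = inj₁ q
        ... | no q = inj₂ (ℤP.≰⇒> q)
        l : ∀ c r m → c - (r + m) ≡ c - r - m
        l = solve-∀
        l′ : ∀ c r m → r + m - c ≡ m - (c - r)
        l′ = solve-∀
      part : ∀ x → wt x ≡ wt r → ⟨ term 1ℤ x , (λ m → ⟨ S N , (λ m′ → φ (mulM m m′)) ⟩) ⟩ ≡ mono x ρ ℚ.* eval Z ρ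
      part x wx = begin
        ⟨ term 1ℤ x , (λ m → ⟨ S N , (λ m′ → φ (mulM m m′)) ⟩) ⟩     ≡⟨ trans (ℚP.+-identityʳ (1ℚ ℚ.* g x)) (ℚP.*-identityˡ (g x)) ⟩
        ⟨ S N , (λ m′ → φ (mulM x m′)) ⟩                             ≡⟨ ⟨⟩-cong (S N) (shift x wx) ⟩
        ⟨ S N , (λ m → mono x ρ ℚ.* ψ m) ⟩ ≡⟨ ⟨⟩-⊗ (S N) (mono x ρ) ψ ⟩
        mono x ρ ℚ.* ⟨ S N , ψ ⟩   ≡⟨ cong (mono x ρ ℚ.*_) (sym (truncate-⟨⟩ w (c - wt r) (S N) μ)) ⟩
        mono x ρ ℚ.* eval Z ρ ∎

module _ {n : ℕ} where
  open ℚEval {n}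

  M : (Row n → ℕ) → Point n → ℚ
  M e = mono (rowMono e)

  exponent : Monomial n → Row n → ℕ
  exponent (e , f) (inj₁ i) = lookup e i
  exponent (e , f) (inj₂ i) = lookup f i

  mono≡M : ∀ m ρ → mono m ρ ≡ M (exponent m) ρ
  mono≡M (e , f) ρ = cong₂ (λ e f → mono (e , f) ρ) (sym (VecP.tabulate∘lookup e)) (sym (VecP.tabulate∘lookup f))

  M-cong : ∀ {e f : Row n → ℕ} → (∀ r → e r ≡ f r) → ∀ ρ → M e ρ ≡ M f ρ
  M-cong p ρ = cong₂ (λ e f → mono (e , f) ρ) (VecP.tabulate-cong (p ∘ inj₁)) (VecP.tabulate-cong (p ∘ inj₂))

  private
    zip-tabulate : ∀ {l} (g h : Fin l → ℕ) → tabulate (λ i → g i ℕ.+ h i) ≡ zipWith ℕ._+_ (tabulate g) (tabulate h)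
    zip-tabulate {zero} g h = refl
    zip-tabulate {suc l} g h = cong (g zero ℕ.+ h zero ∷_) (zip-tabulate (g ∘ suc) (h ∘ suc))

    monoV-agree : ∀ {l} (g : Fin l → ℕ) {ρ ρ′ : Fin l → ℚ} → (∀ i → g i ≡ 0 ⊎ ρ i ≡ ρ′ i) → monoV (tabulate g) ρ ≡ monoV (tabulate g) ρ′
    monoV-agree {zero} g p = refl
    monoV-agree {suc l} g {ρ} {ρ′} p = cong₂ ℚ._*_ (head (p zero)) (monoV-agree (g ∘ suc) (p ∘ suc))
      where
      head : g zero ≡ 0 ⊎ ρ zero ≡ ρ′ zero → ρ zero ↑ g zero ≡ ρ′ zero ↑ g zero
      head (inj₁ z) = trans (cong (ρ zero ↑_) z) (sym (cong (ρ′ zero ↑_) z))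
      head (inj₂ q) = cong (_↑ g zero) q

  M-+ : ∀ (e f : Row n → ℕ) ρ → M (λ r → e r ℕ.+ f r) ρ ≡ M e ρ ℚ.* M f ρ
  M-+ e f ρ = trans (cong₂ (λ e f → mono (e , f) ρ) (zip-tabulate (e ∘ inj₁) (f ∘ inj₁)) (zip-tabulate (e ∘ inj₂) (f ∘ inj₂))) (mono-* (rowMono e) (rowMono f) ρ)

  M-agree : ∀ (e : Row n → ℕ) {ρ ρ′} → (∀ r → e r ≡ 0 ⊎ ρ r ≡ ρ′ r) → M e ρ ≡ M e ρ′
  M-agree e p = cong₂ ℚ._*_ (monoV-agree (e ∘ inj₁) (p ∘ inj₁)) (monoV-agree (e ∘ inj₂) (p ∘ inj₂))

  M-0 : ∀ ρ → M (λ _ → 0) ρ ≡ 1ℚ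
  M-0 ρ = trans (M-agree (λ _ → 0) {ρ} {λ _ → 1ℚ} (λ _ → inj₁ refl)) (cong₂ ℚ._*_ (monoV-ones (tabulate {n = n} (λ _ → 0))) (monoV-ones (tabulate {n = n} (λ _ → 0))))

  M-scale : ∀ k (e : Row n → ℕ) ρ → M (λ r → k ℕ.* e r) ρ ≡ M e ρ ↑ k
  M-scale zero e ρ = M-0 ρ
  M-scale (suc k) e ρ = trans (M-+ e (λ r → k ℕ.* e r) ρ) (cong (M e ρ ℚ.*_) (M-scale k e ρ))

  zap only : Fin n → (Row n → ℕ) → Row n → ℕ
  zap j e (inj₁ i) = if ⌊ i ≟ j ⌋ then 0 else e (inj₁ i)
  zap j e (inj₂ i) = e (inj₂ i)
  only j e (inj₁ i) = if ⌊ i ≟ j ⌋ then e (inj₁ i) else 0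
  only j e (inj₂ i) = 0

  zap-same : ∀ j e → zap j e (inj₁ j) ≡ 0
  zap-same j e with j ≟ j
  ... | yes _ = refl
  ... | no ne = ⊥-elim (ne refl)

  zap-other : ∀ j e r → r ≢ inj₁ j → zap j e r ≡ e r
  zap-other j e (inj₁ i) ne with i ≟ j
  ... | yes refl = ⊥-elim (ne refl)
  ... | no _ = refl
  zap-other j e (inj₂ i) ne = refl

  M-split : ∀ j (e : Row n → ℕ) ρ → M e ρ ≡ ρ (inj₁ j) ↑ e (inj₁ j) ℚ.* M (zap j e) ρ
  M-split j e ρ = trans (M-cong split ρ) (trans (M-+ (only j e) (zap j e) ρ) (cong (ℚ._* M (zap j e) ρ)
    (trans (cong₂ ℚ._*_ (monoV-single (only j e ∘ inj₁) j single (ρ ∘ inj₁)) (trans (monoV-agree {n} (λ _ → 0) {ρ ∘ inj₂} {λ _ → 1ℚ} (λ _ → inj₁ refl)) (monoV-ones (tabulate {n = n} (λ _ → 0))))) (trans (ℚP.*-identityʳ _) (cong (ρ (inj₁ j) ↑_) same)))))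
    where
    split : ∀ r → e r ≡ only j e r ℕ.+ zap j e r
    split (inj₁ i) with i ≟ j
    ... | yes _ = sym (ℕP.+-identityʳ (e (inj₁ i)))
    ... | no _ = refl
    split (inj₂ i) = refl
    single : ∀ i → i ≢ j → only j e (inj₁ i) ≡ 0
    single i ne with i ≟ j
    ... | yes q = ⊥-elim (ne q)
    ... | no _ = refl
    same : only j e (inj₁ j) ≡ e (inj₁ j)
    same with j ≟ j
    ... | yes _ = refl
    ... | no ne = ⊥-elim (ne refl)

  M>0 : ∀ e {ρ} → Positive ρ → 0ℚ ℚ.< M e ρ
  M>0 e = mono>0 (rowMono e)

  ↑-⊗ : ∀ a b k → (a ℚ.* b) ↑ k ≡ a ↑ k ℚ.* b ↑ k
  ↑-⊗ a b zero = refl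
  ↑-⊗ a b (suc k) = trans (cong (a ℚ.* b ℚ.*_) (↑-⊗ a b k)) (ℚR.⊗-interchange a b (a ↑ k) (b ↑ k))

  -- A property of functions on positive points, so that passing to another cluster is composition
  -- of functions; `faithful` returns to polynomials at the very end.
  record Laurent (F : Point n → ℚ) : Set where
    constructor laurent
    field
      num      : Poly n
      bottom   : Monomial n
      equation : ∀ ρ → Positive ρ → F ρ ℚ.* mono bottom ρ ≡ eval num ρ

  record Pol (w : Weight n) (a : ℤ) (f : Point n → ℚ) : Set where
    constructor pol
    field
      poly   : Poly n
      agrees : ∀ ρ → eval poly ρ ≡ f ρ
      least  : AtLeast {w = w} poly a

  -- Up to a monomial factor, the part of lowest weight is a single monomial with coefficient 1. The
  -- property is multiplicative and stands in for being prime to a homogeneous binomial.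
  record Monic (w : Weight n) (g : Point n → ℚ) : Set where
    constructor monic
    field
      lead bottom : Monomial n
      {tail}   : Point n → ℚ
      higher   : Pol w (Weight.wt w lead + 1ℤ) tail
      equation : ∀ ρ → Positive ρ → g ρ ℚ.* mono bottom ρ ≡ mono lead ρ ℚ.+ tail ρ

  Laurent-resp : ∀ {F G} → (∀ ρ → Positive ρ → F ρ ≡ G ρ) → Laurent F → Laurent G
  Laurent-resp e (laurent N d q) = laurent N d (λ ρ p → trans (cong (ℚ._* mono d ρ) (sym (e ρ p))) (q ρ p))

  Laurent-const : ∀ c → Laurent (λ _ → ↑ℤ c)
  Laurent-const c = laurent (term c one) one (λ ρ p → sym (ℚP.+-identityʳ (↑ℤ c ℚ.* mono one ρ)))

  Laurent-term : ∀ m → Laurent (mono m)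
  Laurent-term m = laurent (term 1ℤ m) one (λ ρ p → trans (cong (mono m ρ ℚ.*_) (mono-one ρ)) (trans (ℚP.*-identityʳ (mono m ρ)) (sym (eval-term m ρ))))

  Laurent-* : ∀ {F G} → Laurent F → Laurent G → Laurent (λ ρ → F ρ ℚ.* G ρ)
  Laurent-* {F} {G} (laurent N d p) (laurent N′ d′ p′) = laurent (N *P N′) (mulM d d′) (λ ρ h →
    trans (cong (F ρ ℚ.* G ρ ℚ.*_) (mono-* d d′ ρ)) (trans (ℚR.⊗-interchange (F ρ) (G ρ) (mono d ρ) (mono d′ ρ)) (trans (cong₂ ℚ._*_ (p ρ h) (p′ ρ h)) (sym (eval-* N N′ ρ)))))

  Laurent-+ : ∀ {F G} → Laurent F → Laurent G → Laurent (λ ρ → F ρ ℚ.+ G ρ)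
  Laurent-+ {F} {G} (laurent N d p) (laurent N′ d′ p′) = laurent ((N · d′) ++ (N′ · d)) (mulM d d′) (λ ρ h → begin
    (F ρ ℚ.+ G ρ) ℚ.* mono (mulM d d′) ρ                               ≡⟨ cong ((F ρ ℚ.+ G ρ) ℚ.*_) (mono-* d d′ ρ) ⟩
    (F ρ ℚ.+ G ρ) ℚ.* (mono d ρ ℚ.* mono d′ ρ)                         ≡⟨ lem (F ρ) (G ρ) (mono d ρ) (mono d′ ρ) ⟩
    F ρ ℚ.* mono d ρ ℚ.* mono d′ ρ ℚ.+ G ρ ℚ.* mono d′ ρ ℚ.* mono d ρ  ≡⟨ cong₂ (λ u v → u ℚ.* mono d′ ρ ℚ.+ v ℚ.* mono d ρ) (p ρ h) (p′ ρ h) ⟩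
    eval N ρ ℚ.* mono d′ ρ ℚ.+ eval N′ ρ ℚ.* mono d ρ                  ≡⟨ sym (trans (eval-++ (N · d′) (N′ · d) ρ) (cong₂ ℚ._+_ (eval-· N d′ ρ) (eval-· N′ d ρ))) ⟩
    eval ((N · d′) ++ (N′ · d)) ρ ∎)
    where
    open ≡-Reasoning
    lem : ∀ f g a b → (f ℚ.+ g) ℚ.* (a ℚ.* b) ≡ f ℚ.* a ℚ.* b ℚ.+ g ℚ.* b ℚ.* a
    lem = solve 4 (λ f g a b → (f :+ g) :* (a :* b) := f :* a :* b :+ g :* b :* a) refl
      where open ℚSolver

  Laurent-÷ : ∀ {F} m → Laurent (λ ρ → F ρ ℚ.* mono m ρ) → Laurent F
  Laurent-÷ {F} m (laurent N d p) = laurent N (mulM m d) (λ ρ h → trans (cong (F ρ ℚ.*_) (mono-* m d ρ)) (trans (sym (ℚP.*-assoc (F ρ) (mono m ρ) (mono d ρ))) (p ρ h)))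

  module Multiplicative (G : (Point n → ℚ) → Set) (G-1 : G (λ _ → 1ℚ)) (G-* : ∀ {f g} → G f → G g → G (λ ρ → f ρ ℚ.* g ρ)) where
    G-↑ : ∀ {f} → G f → ∀ k → G (λ ρ → f ρ ↑ k)
    G-↑ g zero = G-1
    G-↑ {f} g (suc k) = G-* {f} {λ ρ → f ρ ↑ k} g (G-↑ g k)

    G-monoV : ∀ {l} (v : Vec ℕ l) {h : Point n → Fin l → ℚ} → (∀ i → G (λ ρ → h ρ i)) → G (λ ρ → monoV v (h ρ))
    G-monoV [] g = G-1
    G-monoV (e ∷ v) {h} g = G-* {λ ρ → h ρ zero ↑ e} {λ ρ → monoV v (h ρ ∘ suc)} (G-↑ (g zero) e) (G-monoV v (g ∘ suc))

    G-mono : ∀ m {κ : Point n → Point n} → (∀ r → G (λ ρ → κ ρ r)) → G (λ ρ → mono m (κ ρ))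
    G-mono (e , f) {κ} g = G-* {λ ρ → monoV e (κ ρ ∘ inj₁)} {λ ρ → monoV f (κ ρ ∘ inj₂)} (G-monoV e (g ∘ inj₁)) (G-monoV f (g ∘ inj₂))

  Laurent-eval : ∀ p {κ : Point n → Point n} → (∀ r → Laurent (λ ρ → κ ρ r)) → Laurent (λ ρ → eval p (κ ρ))
  Laurent-eval [] l = Laurent-const 0ℤ
  Laurent-eval ((c , m) ∷ p) {κ} l = Laurent-+ (Laurent-* (Laurent-const c) (Multiplicative.G-mono Laurent (Laurent-const 1ℤ) Laurent-* m {κ} l)) (Laurent-eval p l)

  -- The denominator of F turns into a monomial in the functions κ, which need not be invertible
  -- among Laurent polynomials; hence it stays as a factor.
  substitute : ∀ {F} (l : Laurent F) {κ : Point n → Point n} → (∀ {ρ} → Positive ρ → Positive (κ ρ)) → (∀ r → Laurent (λ ρ → κ ρ r)) →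
    Laurent (λ ρ → F (κ ρ) ℚ.* mono (Laurent.bottom l) (κ ρ))
  substitute (laurent N d p) {κ} κ>0 l = Laurent-resp (λ ρ h → sym (p (κ ρ) (κ>0 h))) (Laurent-eval N l)

  module _ {w : Weight n} where
    open Weight w

    Pol-weaken : ∀ {a b f} → b ≤ a → Pol w a f → Pol w b f
    Pol-weaken le (pol p e l) = pol p e (AtLeast-weaken w {p} le l)

    Pol-resp : ∀ {a f g} → (∀ ρ → f ρ ≡ g ρ) → Pol w a f → Pol w a g
    Pol-resp q (pol p e l) = pol p (λ ρ → trans (e ρ) (q ρ)) l

    Pol-term : ∀ m {a} → a ≤ wt m → Pol w a (mono m)
    Pol-term m le = pol (term 1ℤ m) (eval-term m) (AtLeast-term w m le)

    Pol-0 : ∀ {a} → Pol w a (λ _ → 0ℚ)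
    Pol-0 = pol [] (λ _ → refl) (λ m nz → ⊥-elim (nz refl))

    Pol-+ : ∀ {a f g} → Pol w a f → Pol w a g → Pol w a (λ ρ → f ρ ℚ.+ g ρ)
    Pol-+ (pol p e l) (pol p′ e′ l′) = pol (p ++ p′) (λ ρ → trans (eval-++ p p′ ρ) (cong₂ ℚ._+_ (e ρ) (e′ ρ))) (AtLeast-++ {w = w} {p} {p′} l l′)

    Pol-* : ∀ {a b f g} → Pol w a f → Pol w b g → Pol w (a + b) (λ ρ → f ρ ℚ.* g ρ)
    Pol-* (pol p e l) (pol p′ e′ l′) = pol (p *P p′) (λ ρ → trans (eval-* p p′ ρ) (cong₂ ℚ._*_ (e ρ) (e′ ρ))) (AtLeast-* {w = w} {p} {p′} l l′)

    Pol-↑ : ∀ {a f} → Pol w a f → ∀ k → Pol w (+ k * a) (λ ρ → f ρ ↑ k)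
    Pol-↑ {a} h zero = Pol-resp mono-one (Pol-term one (ℤP.≤-reflexive (trans (ℤP.*-zeroˡ a) (sym (wt-one w)))))
    Pol-↑ {a} h (suc k) = Pol-weaken (ℤP.≤-reflexive (lem a (+ k))) (Pol-* h (Pol-↑ h k))
      where
      lem : ∀ a k → (1ℤ + k) * a ≡ a + k * a
      lem = solve-∀

    Monic-1 : Monic w (λ _ → 1ℚ)
    Monic-1 = monic one one Pol-0 (λ ρ p → trans (ℚP.*-identityˡ (mono one ρ)) (sym (ℚP.+-identityʳ (mono one ρ))))

    Monic-term : ∀ m → Monic w (mono m)
    Monic-term m = monic m one Pol-0 (λ ρ p → trans (cong (mono m ρ ℚ.*_) (mono-one ρ)) (trans (ℚP.*-identityʳ (mono m ρ)) (sym (ℚP.+-identityʳ (mono m ρ)))))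

    Monic-resp : ∀ {f g} → (∀ ρ → Positive ρ → f ρ ≡ g ρ) → Monic w f → Monic w g
    Monic-resp q (monic s d h e) = monic s d h (λ ρ p → trans (cong (ℚ._* mono d ρ) (sym (q ρ p))) (e ρ p))

    Monic-* : ∀ {f g} → Monic w f → Monic w g → Monic w (λ ρ → f ρ ℚ.* g ρ)
    Monic-* {f} {g} (monic s d {h} H e) (monic s′ d′ {h′} H′ e′) = monic (mulM s s′) (mulM d d′)
      (Pol-+ (Pol-+ (Pol-weaken (ℤP.≤-reflexive (trans (cong (_+ 1ℤ) (wt-* s s′)) (lem₁ (wt s) (wt s′)))) (Pol-* (Pol-term s ℤP.≤-refl) H′))
                    (Pol-weaken (ℤP.≤-reflexive (trans (cong (_+ 1ℤ) (wt-* s s′)) (lem₂ (wt s) (wt s′)))) (Pol-* H (Pol-term s′ ℤP.≤-refl))))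
             (Pol-weaken (≤by 1ℤ (+≤+ ℕ.z≤n) (trans (cong (λ v → wt s + 1ℤ + (wt s′ + 1ℤ) - (v + 1ℤ)) (wt-* s s′)) (lem₃ (wt s) (wt s′)))) (Pol-* H H′)))
      (λ ρ p → begin
        f ρ ℚ.* g ρ ℚ.* mono (mulM d d′) ρ                  ≡⟨ cong (f ρ ℚ.* g ρ ℚ.*_) (mono-* d d′ ρ) ⟩
        f ρ ℚ.* g ρ ℚ.* (mono d ρ ℚ.* mono d′ ρ)            ≡⟨ ℚR.⊗-interchange (f ρ) (g ρ) (mono d ρ) (mono d′ ρ) ⟩
        f ρ ℚ.* mono d ρ ℚ.* (g ρ ℚ.* mono d′ ρ)            ≡⟨ cong₂ ℚ._*_ (e ρ p) (e′ ρ p) ⟩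
        (mono s ρ ℚ.+ h ρ) ℚ.* (mono s′ ρ ℚ.+ h′ ρ)         ≡⟨ lem (mono s ρ) (h ρ) (mono s′ ρ) (h′ ρ) ⟩
        mono s ρ ℚ.* mono s′ ρ ℚ.+ (mono s ρ ℚ.* h′ ρ ℚ.+ h ρ ℚ.* mono s′ ρ ℚ.+ h ρ ℚ.* h′ ρ) ≡⟨ cong (ℚ._+ (mono s ρ ℚ.* h′ ρ ℚ.+ h ρ ℚ.* mono s′ ρ ℚ.+ h ρ ℚ.* h′ ρ)) (sym (mono-* s s′ ρ)) ⟩
        mono (mulM s s′) ρ ℚ.+ (mono s ρ ℚ.* h′ ρ ℚ.+ h ρ ℚ.* mono s′ ρ ℚ.+ h ρ ℚ.* h′ ρ) ∎)
      where
      open ≡-Reasoning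
      lem₁ : ∀ a b → a + b + 1ℤ ≡ a + (b + 1ℤ)
      lem₁ = solve-∀
      lem₂ : ∀ a b → a + b + 1ℤ ≡ a + 1ℤ + b
      lem₂ = solve-∀
      lem₃ : ∀ a b → a + 1ℤ + (b + 1ℤ) - (a + b + 1ℤ) ≡ 1ℤ
      lem₃ = solve-∀
      lem : ∀ a b c d → (a ℚ.+ b) ℚ.* (c ℚ.+ d) ≡ a ℚ.* c ℚ.+ (a ℚ.* d ℚ.+ b ℚ.* c ℚ.+ b ℚ.* d)
      lem = solve 4 (λ a b c d → (a :+ b) :* (c :+ d) := a :* c :+ (a :* d :+ b :* c :+ b :* d)) refl
        where open ℚSolver

    Monic-mono : ∀ m {κ : Point n → Point n} → (∀ r → Monic w (λ ρ → κ ρ r)) → Monic w (λ ρ → mono m (κ ρ))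
    Monic-mono = Multiplicative.G-mono (Monic w) Monic-1 Monic-*

    Monic⇒Laurent : ∀ {g} → Monic w g → Laurent g
    Monic⇒Laurent (monic s d (pol p e l) q) = laurent (term 1ℤ s ++ p) d (λ ρ h → trans (q ρ h) (sym (trans (eval-++ (term 1ℤ s) p ρ) (cong₂ ℚ._+_ (eval-term s ρ) (e ρ)))))

    -- Each round clears denominators and applies `divide`, which removes one factor of the binomial
    -- at the price of a power of the lead monomial of g, a unit among Laurent polynomials.
    cancel-binomial : ∀ {F g} r r′ → wt r ≡ wt r′ → Monic w g → Laurent (λ ρ → F ρ ℚ.* g ρ) → ∀ k → Laurent (λ ρ → F ρ ℚ.* (mono r ρ ℚ.+ mono r′ ρ) ↑ k) → Laurent F
    cancel-binomial {F} r r′ eq mg lg zero l = Laurent-resp (λ ρ p → ℚP.*-identityʳ (F ρ)) l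
    cancel-binomial {F} {g} r r′ eq mg@(monic s d {h} (pol W W-eq W-least) mg-eq) lg@(laurent N₂ d₂ e₂) (suc k) l@(laurent N₁ d₁ e₁) =
      cancel-binomial {F} {g} r r′ eq mg lg k (laurent Z (mulM (mulM d₁ d₂) (s ^^ N)) reduced)
      where
      open ≡-Reasoning
      Q : Point n → ℚ
      Q ρ = mono r ρ ℚ.+ mono r′ ρ
      R : Poly n
      R = term 1ℤ r ++ term 1ℤ r′
      R-eval : ∀ ρ → eval R ρ ≡ Q ρ
      R-eval ρ = trans (eval-++ (term 1ℤ r) (term 1ℤ r′) ρ) (cong₂ ℚ._+_ (eval-term r ρ) (eval-term r′ ρ))
      R^-eval : ∀ k ρ → eval (R ^P k) ρ ≡ Q ρ ↑ k
      R^-eval zero ρ = eval-one ρ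
      R^-eval (suc k) ρ = trans (eval-* R (R ^P k) ρ) (cong₂ ℚ._*_ (R-eval ρ) (R^-eval k ρ))
      X Y : Poly n
      X = N₁ · d₂
      Y = ((N₂ · d₁) · d) *P (R ^P k)
      X-eval : ∀ ρ → Positive ρ → eval X ρ ≡ F ρ ℚ.* (Q ρ ℚ.* Q ρ ↑ k) ℚ.* mono d₁ ρ ℚ.* mono d₂ ρ
      X-eval ρ p = trans (eval-· N₁ d₂ ρ) (cong (ℚ._* mono d₂ ρ) (sym (e₁ ρ p)))
      Y-eval : ∀ ρ → Positive ρ → eval Y ρ ≡ F ρ ℚ.* g ρ ℚ.* mono d₂ ρ ℚ.* mono d₁ ρ ℚ.* mono d ρ ℚ.* Q ρ ↑ k
      Y-eval ρ p = trans (eval-* ((N₂ · d₁) · d) (R ^P k) ρ) (cong₂ ℚ._*_ (trans (eval-· (N₂ · d₁) d ρ) (cong (ℚ._* mono d ρ) (trans (eval-· N₂ d₁ ρ) (cong (ℚ._* mono d₁ ρ) (sym (e₂ ρ p)))))) (R^-eval k ρ))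
      lem : ∀ f q v a b g d → f ℚ.* (q ℚ.* v) ℚ.* a ℚ.* b ℚ.* (g ℚ.* d) ≡ f ℚ.* g ℚ.* b ℚ.* a ℚ.* d ℚ.* v ℚ.* q
      lem = solve 7 (λ f q v a b g d → f :* (q :* v) :* a :* b :* (g :* d) := f :* g :* b :* a :* d :* v :* q) refl
        where open ℚSolver
      identity : ∀ ρ → Positive ρ → eval X ρ ℚ.* (mono s ρ ℚ.+ eval W ρ) ≡ eval Y ρ ℚ.* Q ρ
      identity ρ p = trans (cong₂ ℚ._*_ (X-eval ρ p) (trans (cong (mono s ρ ℚ.+_) (W-eq ρ)) (sym (mg-eq ρ p)))) (trans (lem (F ρ) (Q ρ) (Q ρ ↑ k) (mono d₁ ρ) (mono d₂ ρ) (g ρ) (mono d ρ)) (cong (ℚ._* Q ρ) (sym (Y-eval ρ p))))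
      quotient = divide w X Y W s r r′ eq W-least identity
      N = proj₁ quotient
      Z = proj₁ (proj₂ quotient)
      lem′ : ∀ f q v a b c → q ℚ.* (f ℚ.* v ℚ.* (a ℚ.* b ℚ.* c)) ≡ f ℚ.* (q ℚ.* v) ℚ.* a ℚ.* b ℚ.* c
      lem′ = solve 6 (λ f q v a b c → q :* (f :* v :* (a :* b :* c)) := f :* (q :* v) :* a :* b :* c) refl
        where open ℚSolver
      reduced : ∀ ρ → Positive ρ → F ρ ℚ.* Q ρ ↑ k ℚ.* mono (mulM (mulM d₁ d₂) (s ^^ N)) ρ ≡ eval Z ρ
      reduced ρ p = ⊗-cancel (0<⊕ (mono>0 r p) (mono>0 r′ p)) (begin
        Q ρ ℚ.* (F ρ ℚ.* Q ρ ↑ k ℚ.* mono (mulM (mulM d₁ d₂) (s ^^ N)) ρ)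
          ≡⟨ cong (λ v → Q ρ ℚ.* (F ρ ℚ.* Q ρ ↑ k ℚ.* v)) (trans (mono-* (mulM d₁ d₂) (s ^^ N) ρ) (cong (ℚ._* mono (s ^^ N) ρ) (mono-* d₁ d₂ ρ))) ⟩
        Q ρ ℚ.* (F ρ ℚ.* Q ρ ↑ k ℚ.* (mono d₁ ρ ℚ.* mono d₂ ρ ℚ.* mono (s ^^ N) ρ))
          ≡⟨ lem′ (F ρ) (Q ρ) (Q ρ ↑ k) (mono d₁ ρ) (mono d₂ ρ) (mono (s ^^ N) ρ) ⟩
        F ρ ℚ.* (Q ρ ℚ.* Q ρ ↑ k) ℚ.* mono d₁ ρ ℚ.* mono d₂ ρ ℚ.* mono (s ^^ N) ρ
          ≡⟨ cong (ℚ._* mono (s ^^ N) ρ) (sym (X-eval ρ p)) ⟩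
        eval X ρ ℚ.* mono (s ^^ N) ρ
          ≡⟨ proj₂ (proj₂ quotient) ρ p ⟩
        eval Z ρ ℚ.* Q ρ
          ≡⟨ ℚP.*-comm (eval Z ρ) (Q ρ) ⟩
        Q ρ ℚ.* eval Z ρ ∎)

-- Splits off the common part of two exponents with prescribed difference: two monomials with
-- exponent difference c have the ratio of the two monomials of the binomial of c.
common : ∀ a b {c} → + a - + b ≡ c → a ≡ (a ℕ.∸ pos c) ℕ.+ pos c × b ≡ (a ℕ.∸ pos c) ℕ.+ pos (- c)
common a b {c} e = sym (ℕP.m∸n+n≡m le) , ℤP.+-injective (trans (lem (+ a) (+ b)) (trans (cong (λ v → + a - v) e) (trans (cong₂ (λ x y → x - y) (cong +_ (sym (ℕP.m∸n+n≡m le))) (⁺-diff c)) (trans (cong (_- (+ pos c - + pos (- c))) (ℤP.pos-+ (a ℕ.∸ pos c) (pos c))) (trans (lem′ (+ (a ℕ.∸ pos c)) (+ pos c) (+ pos (- c))) (sym (ℤP.pos-+ (a ℕ.∸ pos c) (pos (- c)))))))))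
  where
  lem : ∀ a b → b ≡ a - (a - b)
  lem = solve-∀
  lem′ : ∀ x p q → x + p - (p - q) ≡ x + q
  lem′ = solve-∀
  le : pos c ℕ.≤ a
  le = pos-≤ c (subst (_≤ + a) e (≤by (+ b) (+≤+ ℕ.z≤n) (sub (+ a) (+ b))))
    where
    sub : ∀ a b → a - (a - b) ≡ b
    sub = solve-∀
    pos-≤ : ∀ c → c ≤ + a → pos c ℕ.≤ a
    pos-≤ (+ c) p = ℤP.drop‿+≤+ p
    pos-≤ -[1+ c ] p = ℕ.z≤n

-- Exchange of coordinates between adjacent clusters

module _ {n : ℕ} where
  open ℚEval {n}

  put : Fin n → ℚ → Point n → Point n
  put j v ρ (inj₁ i) = if ⌊ i ≟ j ⌋ then v else ρ (inj₁ i)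
  put j v ρ (inj₂ i) = ρ (inj₂ i)

  put-same : ∀ j v ρ → put j v ρ (inj₁ j) ≡ v
  put-same j v ρ with j ≟ j
  ... | yes _ = refl
  ... | no ne = ⊥-elim (ne refl)

  put-other : ∀ j v ρ r → r ≢ inj₁ j → put j v ρ r ≡ ρ r
  put-other j v ρ (inj₁ i) ne with i ≟ j
  ... | yes refl = ⊥-elim (ne refl)
  ... | no _ = refl
  put-other j v ρ (inj₂ i) ne = refl

  is-inj₁ : ∀ (j : Fin n) (r : Row n) → r ≡ inj₁ j ⊎ r ≢ inj₁ j
  is-inj₁ j (inj₁ i) with i ≟ j
  ... | yes refl = inj₁ refl
  ... | no ne = inj₂ (λ { refl → ne refl })
  is-inj₁ j (inj₂ i) = inj₂ (λ ())

  put>0 : ∀ {j v ρ} → 0ℚ ℚ.< v → Positive ρ → Positive (put j v ρ)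
  put>0 {j} {v} {ρ} p h r = [ (λ { refl → subst (0ℚ ℚ.<_) (sym (put-same j v ρ)) p }) , (λ ne → subst (0ℚ ℚ.<_) (sym (put-other j v ρ r ne)) (h r)) ]′ (is-inj₁ j r)

  e⁺ e⁻ : (Row n → ℤ) → Row n → ℕ
  e⁺ c r = pos (c r)
  e⁻ c r = pos (- c r)

  binomial : (Row n → ℤ) → Point n → ℚ
  binomial c ρ = M (e⁺ c) ρ ℚ.+ M (e⁻ c) ρ

  -- The coordinates of ρ in the cluster adjacent in direction j, where c is the j-th column of the
  -- exchange matrix.
  exchange : (Row n → ℤ) → Fin n → Point n → Point n
  exchange c j ρ = put j (binomial c ρ ℚ.* inv (ρ (inj₁ j))) ρ

  binomial>0 : ∀ c {ρ} → Positive ρ → 0ℚ ℚ.< binomial c ρ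
  binomial>0 c p = 0<⊕ (M>0 (e⁺ c) p) (M>0 (e⁻ c) p)

  exchange>0 : ∀ c j {ρ} → Positive ρ → Positive (exchange c j ρ)
  exchange>0 c j p = put>0 (0<⊗ (binomial>0 c p) (inv-pos (p (inj₁ j)))) p

  M-put : ∀ j v (e : Row n → ℕ) ρ → e (inj₁ j) ≡ 0 → M e (put j v ρ) ≡ M e ρ
  M-put j v e ρ z = M-agree e (λ r → [ (λ { refl → inj₁ z }) , (λ ne → inj₂ (put-other j v ρ r ne)) ]′ (is-inj₁ j r))

  binomial-put : ∀ j v c ρ → c (inj₁ j) ≡ 0ℤ → binomial c (put j v ρ) ≡ binomial c ρ
  binomial-put j v c ρ z = cong₂ ℚ._+_ (M-put j v (e⁺ c) ρ (cong pos z)) (M-put j v (e⁻ c) ρ (cong (λ x → pos (- x)) z))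

  binomial-cong : ∀ {c c′} → (∀ r → c r ≡ c′ r) → ∀ ρ → binomial c ρ ≡ binomial c′ ρ
  binomial-cong p ρ = cong₂ ℚ._+_ (M-cong (λ r → cong pos (p r)) ρ) (M-cong (λ r → cong (λ x → pos (- x)) (p r)) ρ)

  binomial-neg : ∀ c ρ → binomial (λ r → - c r) ρ ≡ binomial c ρ
  binomial-neg c ρ = trans (ℚP.+-comm (M (e⁻ c) ρ) (M (e⁻ (λ r → - c r)) ρ)) (cong (ℚ._+ M (e⁻ c) ρ) (M-cong (λ r → cong pos (ℤP.neg-involutive (c r))) ρ))

  ÷-* : ∀ u {v} → 0ℚ ℚ.< v → u ℚ.* inv v ℚ.* v ≡ u
  ÷-* u {v} p = trans (ℚP.*-assoc u (inv v) v) (trans (cong (u ℚ.*_) (trans (ℚP.*-comm (inv v) v) (inv-r p))) (ℚP.*-identityʳ u))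

  exchange-other : ∀ c j ρ r → r ≢ inj₁ j → exchange c j ρ r ≡ ρ r
  exchange-other c j ρ = put-other j (binomial c ρ ℚ.* inv (ρ (inj₁ j))) ρ

  exchange-relation : ∀ c j {ρ} → Positive ρ → exchange c j ρ (inj₁ j) ℚ.* ρ (inj₁ j) ≡ binomial c ρ
  exchange-relation c j {ρ} p = trans (cong (ℚ._* ρ (inj₁ j)) (put-same j (binomial c ρ ℚ.* inv (ρ (inj₁ j))) ρ)) (÷-* (binomial c ρ) (p (inj₁ j)))

  exchange-cong : ∀ c c′ j {ρ ρ′} → (∀ ρ → binomial c ρ ≡ binomial c′ ρ) → (∀ r → ρ r ≡ ρ′ r) → ∀ r → exchange c j ρ r ≡ exchange c′ j ρ′ r
  exchange-cong c c′ j {ρ} {ρ′} cc h r = [ (λ { refl → trans (put-same j _ ρ) (trans (cong₂ (λ u v → u ℚ.* inv v) (trans (cc ρ) (cong₂ ℚ._+_ (mono-cong (rowMono (e⁺ c′)) h) (mono-cong (rowMono (e⁻ c′)) h))) (h (inj₁ j))) (sym (put-same j _ ρ′))) })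
    , (λ ne → trans (exchange-other c j ρ r ne) (trans (h r) (sym (exchange-other c′ j ρ′ r ne)))) ]′ (is-inj₁ j r)

  exchange-involutive : ∀ c j {ρ} → c (inj₁ j) ≡ 0ℤ → Positive ρ → ∀ r → exchange c j (exchange c j ρ) r ≡ ρ r
  exchange-involutive c j {ρ} z p r = [ (λ { refl → ⊗-cancel (exchange>0 c j p (inj₁ j)) (begin
      ρ′ (inj₁ j) ℚ.* exchange c j ρ′ (inj₁ j)    ≡⟨ ℚP.*-comm (ρ′ (inj₁ j)) (exchange c j ρ′ (inj₁ j)) ⟩
      exchange c j ρ′ (inj₁ j) ℚ.* ρ′ (inj₁ j)    ≡⟨ exchange-relation c j (exchange>0 c j p) ⟩
      binomial c ρ′                               ≡⟨ binomial-put j _ c ρ z ⟩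
      binomial c ρ                                ≡⟨ sym (exchange-relation c j p) ⟩
      ρ′ (inj₁ j) ℚ.* ρ (inj₁ j) ∎) })
    , (λ ne → trans (exchange-other c j ρ′ r ne) (exchange-other c j ρ r ne)) ]′ (is-inj₁ j r)
    where
    open ≡-Reasoning
    ρ′ = exchange c j ρ

  unitM : Row n → Monomial n
  unitM (inj₁ i) = unitVec i , replicate n 0
  unitM (inj₂ i) = replicate n 0 , unitVec i

  mono-unit : ∀ r ρ → mono (unitM r) ρ ≡ ρ r
  mono-unit (inj₁ i) ρ = trans (sym (eval-term (unitM (inj₁ i)) ρ)) (eval-x i ρ)
  mono-unit (inj₂ i) ρ = trans (sym (eval-term (unitM (inj₂ i)) ρ)) (eval-y i ρ)

  Laurent-coordinate : ∀ r → Laurent (λ ρ → ρ r)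
  Laurent-coordinate r = Laurent-resp (λ ρ _ → mono-unit r ρ) (Laurent-term (unitM r))

  Monic-coordinate : ∀ {w} r → Monic w (λ ρ → ρ r)
  Monic-coordinate r = Monic-resp (λ ρ _ → mono-unit r ρ) (Monic-term (unitM r))

  Laurent-binomial : ∀ c → Laurent (binomial c)
  Laurent-binomial c = Laurent-+ (Laurent-term (rowMono (e⁺ c))) (Laurent-term (rowMono (e⁻ c)))

  Laurent-exchange : ∀ c j r → Laurent (λ ρ → exchange c j ρ r)
  Laurent-exchange c j r = [ (λ { refl → Laurent-÷ (unitM (inj₁ j)) (Laurent-resp (λ ρ p → trans (sym (exchange-relation c j p)) (cong (exchange c j ρ (inj₁ j) ℚ.*_) (sym (mono-unit (inj₁ j) ρ)))) (Laurent-binomial c)) })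
    , (λ ne → Laurent-resp (λ ρ _ → sym (exchange-other c j ρ r ne)) (Laurent-coordinate r)) ]′ (is-inj₁ j r)

  -- Points are functions, and exchanging twice gives back a point only entry by entry; invariance
  -- under this has to be asked of G.
  Extensional : (Point n → ℚ) → Set
  Extensional G = ∀ {ρ ρ′} → (∀ r → ρ r ≡ ρ′ r) → G ρ ≡ G ρ′

  -- Expressing G through the variables t of the cluster adjacent in direction j gives a denominator
  -- involving Q = binomial cj; the cluster reached by k then j gives another denominator, prime to Q.
  module Adjacent {j k : Fin n} (j≢k : j ≢ k) (cj ck cj′ : Row n → ℤ) (cj-j : cj (inj₁ j) ≡ 0ℤ) (ck-k : ck (inj₁ k) ≡ 0ℤ) (cj′-j : cj′ (inj₁ j) ≡ 0ℤ) where

    σ τ ω : Point n → Point n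
    σ t = exchange cj j t
    τ t = exchange ck k (σ t)
    ω t = exchange cj′ j (τ t)

    j≢k′ : _≢_ {A = Row n} (inj₁ j) (inj₁ k)
    j≢k′ refl = j≢k refl
    k≢j′ : _≢_ {A = Row n} (inj₁ k) (inj₁ j)
    k≢j′ refl = j≢k refl

    module _ {t : Point n} (t>0 : Positive t) where
      σ>0 : Positive (σ t)
      σ>0 = exchange>0 cj j t>0
      τ>0 : Positive (τ t)
      τ>0 = exchange>0 ck k σ>0
      σ-j : σ t (inj₁ j) ℚ.* t (inj₁ j) ≡ binomial cj t
      σ-j = exchange-relation cj j t>0
      σ-k : σ t (inj₁ k) ≡ t (inj₁ k)
      σ-k = exchange-other cj j t (inj₁ k) k≢j′
      τ-j : τ t (inj₁ j) ≡ σ t (inj₁ j)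
      τ-j = exchange-other ck k (σ t) (inj₁ j) j≢k′
      τ-k : τ t (inj₁ k) ℚ.* t (inj₁ k) ≡ binomial ck (σ t)
      τ-k = trans (cong (τ t (inj₁ k) ℚ.*_) (sym σ-k)) (exchange-relation ck k σ>0)
      ω-k : ω t (inj₁ k) ≡ τ t (inj₁ k)
      ω-k = exchange-other cj′ j (τ t) (inj₁ k) k≢j′
      ω-j : ω t (inj₁ j) ℚ.* σ t (inj₁ j) ≡ binomial cj′ (τ t)
      ω-j = trans (cong (ω t (inj₁ j) ℚ.*_) (sym τ-j)) (exchange-relation cj′ j τ>0)
      ω-other : ∀ r → r ≢ inj₁ j → r ≢ inj₁ k → ω t r ≡ t r
      ω-other r nj nk = trans (exchange-other cj′ j (τ t) r nj) (trans (exchange-other ck k (σ t) r nk) (exchange-other cj j t r nj))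

    module _ {G : Point n → ℚ} (ext : Extensional G) (L₁ : Laurent (λ ρ → G (exchange ck k ρ))) (L₂ : Laurent (λ ρ → G (exchange cj′ j ρ)))
      (w : Weight n) (wt≡ : Weight.wt w (rowMono (e⁺ cj)) ≡ Weight.wt w (rowMono (e⁻ cj)))
      (monic-j : Monic w (λ t → ω t (inj₁ j))) (monic-k : Monic w (λ t → ω t (inj₁ k))) where

      transfer : Laurent (λ t → G (τ t))
      transfer = cancel-binomial {w = w} {λ t → G (τ t)} {λ t → mono (Laurent.bottom L₂) (ω t)} (rowMono (e⁺ cj)) (rowMono (e⁻ cj)) wt≡
        (Monic-mono (Laurent.bottom L₂) {ω} monic-ω)
        (Laurent-resp (λ t p → cong (ℚ._* mono (Laurent.bottom L₂) (ω t)) (ext (exchange-involutive cj′ j cj′-j (τ>0 p)))) (substitute L₂ {ω} (λ p → exchange>0 cj′ j (τ>0 p)) (λ r → Monic⇒Laurent (monic-ω r))))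
        E cleared
        where
        monic-ω : ∀ r → Monic w (λ t → ω t r)
        monic-ω r = [ (λ { refl → monic-j }) , (λ nj → [ (λ { refl → monic-k }) , (λ nk → Monic-resp (λ t p → sym (ω-other p r nj nk)) (Monic-coordinate r)) ]′ (is-inj₁ k r)) ]′ (is-inj₁ j r)
        d = exponent (Laurent.bottom L₁)
        -- The power of the j-th variable in the denominator of `L₁`. In terms of t this variable is
        -- the binomial of `cj` over t_j, so clearing it costs the E-th power of the binomial.
        E = d (inj₁ j)
        cleared : Laurent (λ t → G (τ t) ℚ.* binomial cj t ↑ E)
        cleared = Laurent-÷ (rowMono (zap j d)) (Laurent-resp eq (Laurent-* (substitute L₁ {σ} σ>0 (Laurent-exchange cj j)) (Laurent-term (unitM (inj₁ j) ^^ E))))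
          where
          eq : ∀ t → Positive t → G (τ t) ℚ.* mono (Laurent.bottom L₁) (σ t) ℚ.* mono (unitM (inj₁ j) ^^ E) t ≡ G (τ t) ℚ.* binomial cj t ↑ E ℚ.* M (zap j d) t
          eq t p = begin
            G (τ t) ℚ.* mono (Laurent.bottom L₁) (σ t) ℚ.* mono (unitM (inj₁ j) ^^ E) t
              ≡⟨ cong₂ (λ u v → G (τ t) ℚ.* u ℚ.* v) (trans (mono≡M (Laurent.bottom L₁) (σ t)) (trans (M-split j d (σ t)) (cong (σ t (inj₁ j) ↑ E ℚ.*_) (M-put j _ (zap j d) t (zap-same j d))))) (trans (mono-^^ (unitM (inj₁ j)) E t) (cong (_↑ E) (mono-unit (inj₁ j) t))) ⟩
            G (τ t) ℚ.* (σ t (inj₁ j) ↑ E ℚ.* M (zap j d) t) ℚ.* t (inj₁ j) ↑ E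
              ≡⟨ lem (G (τ t)) (σ t (inj₁ j) ↑ E) (M (zap j d) t) (t (inj₁ j) ↑ E) ⟩
            G (τ t) ℚ.* (σ t (inj₁ j) ↑ E ℚ.* t (inj₁ j) ↑ E) ℚ.* M (zap j d) t
              ≡⟨ cong (λ u → G (τ t) ℚ.* u ℚ.* M (zap j d) t) (trans (sym (↑-⊗ (σ t (inj₁ j)) (t (inj₁ j)) E)) (cong (_↑ E) (σ-j p))) ⟩
            G (τ t) ℚ.* binomial cj t ↑ E ℚ.* M (zap j d) t ∎
            where
            open ≡-Reasoning
            lem : ∀ g s m a → g ℚ.* (s ℚ.* m) ℚ.* a ≡ g ℚ.* (s ℚ.* a) ℚ.* m
            lem = solve 4 (λ g s m a → g :* (s :* m) :* a := g :* (s :* a) :* m) refl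
              where open ℚSolver

    Monic-binomial : ∀ {w} (c : Row n → ℤ) m {g} → Weight.wt w (rowMono (e⁺ c)) ≢ Weight.wt w (rowMono (e⁻ c)) → (∀ t → Positive t → g t ℚ.* mono m t ≡ binomial c t) → Monic w g
    Monic-binomial {w} c m {g} ne eq with ℤP.<-cmp (Weight.wt w (rowMono (e⁺ c))) (Weight.wt w (rowMono (e⁻ c)))
    ... | tri≈ _ e _ = ⊥-elim (ne e)
    ... | tri< lt _ _ = monic (rowMono (e⁺ c)) m (Pol-term (rowMono (e⁻ c)) (subst (_≤ Weight.wt w (rowMono (e⁻ c))) (ℤP.+-comm 1ℤ (Weight.wt w (rowMono (e⁺ c)))) (ℤP.i<j⇒suc[i]≤j lt))) eq
    ... | tri> _ _ gt = monic (rowMono (e⁻ c)) m (Pol-term (rowMono (e⁺ c)) (subst (_≤ Weight.wt w (rowMono (e⁺ c))) (ℤP.+-comm 1ℤ (Weight.wt w (rowMono (e⁻ c)))) (ℤP.i<j⇒suc[i]≤j gt))) (λ t p → trans (eq t p) (ℚP.+-comm (M (e⁺ c) t) (M (e⁻ c) t)))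

    -- The exchanges in directions j and k commute, so the final j-th coordinate is t_j again and
    -- the only binomial left is that of `ck`. The weight has to separate its two monomials while
    -- agreeing on those of `cj`.
    module Commuting (ck-j : ck (inj₁ j) ≡ 0ℤ) (cj-k : cj (inj₁ k) ≡ 0ℤ) (same : ∀ r → cj′ r ≡ cj r) where

      monic-k : ∀ {w} → Weight.wt w (rowMono (e⁺ ck)) ≢ Weight.wt w (rowMono (e⁻ ck)) → Monic w (λ t → ω t (inj₁ k))
      monic-k ne = Monic-binomial ck (unitM (inj₁ k)) ne (λ t p → trans (cong₂ ℚ._*_ (ω-k p) (mono-unit (inj₁ k) t)) (trans (τ-k p) (binomial-put j _ ck t ck-j)))

      monic-j : ∀ {w} → Monic w (λ t → ω t (inj₁ j))
      monic-j = Monic-resp (λ t p → ⊗-cancel (σ>0 p (inj₁ j)) (begin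
        σ t (inj₁ j) ℚ.* t (inj₁ j)    ≡⟨ σ-j p ⟩
        binomial cj t                  ≡⟨ sym (binomial-put j _ cj t cj-j) ⟩
        binomial cj (σ t)              ≡⟨ sym (binomial-put k _ cj (σ t) cj-k) ⟩
        binomial cj (τ t)              ≡⟨ sym (binomial-cong same (τ t)) ⟩
        binomial cj′ (τ t)             ≡⟨ sym (ω-j p) ⟩
        ω t (inj₁ j) ℚ.* σ t (inj₁ j)  ≡⟨ ℚP.*-comm (ω t (inj₁ j)) (σ t (inj₁ j)) ⟩
        σ t (inj₁ j) ℚ.* ω t (inj₁ j) ∎)) (Monic-coordinate (inj₁ j))
        where open ≡-Reasoning

    -- The weight is minus the degree in t_j. The binomial of `cj` is free of t_j, hence
    -- homogeneous, and the highest power of t_j in each new coordinate is a single monomial.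
    module Interacting (γ β₀ : ℕ) (cj-k : cj (inj₁ k) ≡ - + γ) (ck-j : ck (inj₁ j) ≡ + suc β₀) (cj′-k : cj′ (inj₁ k) ≡ + γ)
      (cj′-r : ∀ r → r ≢ inj₁ k → cj′ r ≡ cj r - + γ * + e⁻ ck r) where

      β = suc β₀
      w : Weight n
      w = negW (xw j)
      open Weight w

      wt-row : ∀ (e : Row n → ℕ) → wt (rowMono e) ≡ - + e (inj₁ j)
      wt-row e = cong (λ a → - + a) (VecP.lookup∘tabulate (e ∘ inj₁) j)

      wt-free : ∀ (e : Row n → ℕ) → e (inj₁ j) ≡ 0 → wt (rowMono e) ≡ 0ℤ
      wt-free e z = trans (wt-row e) (cong (λ a → - + a) z)

      Pol-free : ∀ (e : Row n → ℕ) → e (inj₁ j) ≡ 0 → Pol w 0ℤ (M e)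
      Pol-free e z = Pol-term (rowMono e) (ℤP.≤-reflexive (sym (wt-free e z)))

      wt-unit : wt (unitM (inj₁ j)) ≡ - 1ℤ
      wt-unit = cong -_ (trans (lookup-unit j j) (α-diag j))

      neg-j : ∀ {c : Row n → ℤ} → c (inj₁ j) ≡ 0ℤ → e⁻ c (inj₁ j) ≡ 0
      neg-j z = cong (λ x → pos (- x)) z

      wt≡ : wt (rowMono (e⁺ cj)) ≡ wt (rowMono (e⁻ cj))
      wt≡ = trans (wt-free (e⁺ cj) (cong pos cj-j)) (sym (wt-free (e⁻ cj) (neg-j {cj} cj-j)))

      Q : Point n → ℚ
      Q = binomial cj

      Pol-Q : Pol w 0ℤ Q
      Pol-Q = Pol-+ (Pol-free (e⁺ cj) (cong pos cj-j)) (Pol-free (e⁻ cj) (neg-j {cj} cj-j))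

      Pol-Q^ : ∀ g → Pol w 0ℤ (λ t → Q t ↑ g)
      Pol-Q^ g = Pol-weaken (ℤP.≤-reflexive (sym (ℤP.*-zeroʳ (+ g)))) (Pol-↑ Pol-Q g)

      ck⁻-j : e⁻ ck (inj₁ j) ≡ 0
      ck⁻-j = cong (λ x → pos (- x)) ck-j

      q q′ r r′ A z : Point n → ℚ
      q = M (e⁻ cj′)
      q′ = M (e⁻ ck)
      r = M (zap k (e⁺ cj′))
      r′ = M (zap j (e⁺ ck))
      A t = t (inj₁ j)
      z t = t (inj₁ k)

      zap-j : zap k (e⁺ cj′) (inj₁ j) ≡ 0
      zap-j = trans (zap-other k (e⁺ cj′) (inj₁ j) j≢k′) (cong pos cj′-j)

      X Y : Point n → ℚ
      X t = q′ t ℚ.* A t ↑ β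
      Y t = r′ t ℚ.* Q t ↑ β

      -- The exchange relation in direction k, multiplied by the β-th power of t_j to clear the old
      -- variable, which is Q / t_j.
      b-equation : ∀ t → Positive t → τ t (inj₁ k) ℚ.* (z t ℚ.* A t ↑ β) ≡ X t ℚ.+ Y t
      b-equation t p = begin
        τ t (inj₁ k) ℚ.* (z t ℚ.* A t ↑ β)                  ≡⟨ sym (ℚP.*-assoc (τ t (inj₁ k)) (z t) (A t ↑ β)) ⟩
        τ t (inj₁ k) ℚ.* z t ℚ.* A t ↑ β                    ≡⟨ cong (ℚ._* A t ↑ β) (trans (τ-k p) (cong₂ ℚ._+_ plus-part (M-put j _ (e⁻ ck) t ck⁻-j))) ⟩
        (s ↑ β ℚ.* r′ t ℚ.+ q′ t) ℚ.* A t ↑ β               ≡⟨ lem (s ↑ β) (r′ t) (q′ t) (A t ↑ β) ⟩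
        q′ t ℚ.* A t ↑ β ℚ.+ r′ t ℚ.* (s ↑ β ℚ.* A t ↑ β)   ≡⟨ cong (λ v → q′ t ℚ.* A t ↑ β ℚ.+ r′ t ℚ.* v) (trans (sym (↑-⊗ s (A t) β)) (cong (_↑ β) (σ-j p))) ⟩
        X t ℚ.+ Y t ∎
        where
        open ≡-Reasoning
        s = σ t (inj₁ j)
        plus-part : M (e⁺ ck) (σ t) ≡ s ↑ β ℚ.* r′ t
        plus-part = trans (M-split j (e⁺ ck) (σ t)) (cong₂ ℚ._*_ (cong (s ↑_) (cong pos ck-j)) (M-put j _ (zap j (e⁺ ck)) t (zap-same j (e⁺ ck))))
        lem : ∀ s r q a → (s ℚ.* r ℚ.+ q) ℚ.* a ≡ q ℚ.* a ℚ.+ r ℚ.* (s ℚ.* a)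
        lem = solve 4 (λ s r q a → (s :* r :+ q) :* a := q :* a :+ r :* (s :* a)) refl
          where open ℚSolver

      A^ : ℕ → Monomial n
      A^ g = unitM (inj₁ j) ^^ g

      mono-A^ : ∀ g t → mono (A^ g) t ≡ A t ↑ g
      mono-A^ g t = trans (mono-^^ (unitM (inj₁ j)) g t) (cong (_↑ g) (mono-unit (inj₁ j) t))

      wt-A^ : ∀ g → wt (A^ g) ≡ - + g
      wt-A^ g = trans (wt-^^ w (unitM (inj₁ j)) g) (trans (cong (+ g *_) wt-unit) (trans (ℤP.*-comm (+ g) (- 1ℤ)) (ℤP.-1*i≡-i (+ g))))

      Pol-A : Pol w (- 1ℤ) A
      Pol-A = Pol-resp (mono-unit (inj₁ j)) (Pol-term (unitM (inj₁ j)) (ℤP.≤-reflexive (sym wt-unit)))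

      Pol-X : Pol w (- + β) X
      Pol-X = Pol-weaken (ℤP.≤-reflexive (sym (ℤP.+-identityˡ (- + β)))) (Pol-* (Pol-free (e⁻ ck) ck⁻-j) (Pol-resp (mono-A^ β) (Pol-term (A^ β) (ℤP.≤-reflexive (sym (wt-A^ β))))))

      Pol-Y : Pol w 0ℤ Y
      Pol-Y = Pol-* (Pol-free (zap j (e⁺ ck)) (zap-same j (e⁺ ck))) (Pol-Q^ β)

      monic-k : Monic w (λ t → ω t (inj₁ k))
      monic-k = monic (mulM (rowMono (e⁻ ck)) (A^ β)) (mulM (unitM (inj₁ k)) (A^ β))
        (Pol-weaken (subst (_≤ 0ℤ) (cong (_+ 1ℤ) (sym (trans (wt-* (rowMono (e⁻ ck)) (A^ β)) (cong₂ _+_ (wt-free (e⁻ ck) ck⁻-j) (wt-A^ β))))) (≤by (+ β₀) (+≤+ ℕ.z≤n) (lem (+ β₀)))) Pol-Y)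
        (λ t p → trans (cong₂ ℚ._*_ (ω-k p) (trans (mono-* (unitM (inj₁ k)) (A^ β) t) (cong₂ ℚ._*_ (mono-unit (inj₁ k) t) (mono-A^ β t))))
          (trans (b-equation t p) (cong (ℚ._+ Y t) (sym (trans (mono-* (rowMono (e⁻ ck)) (A^ β) t) (cong (q′ t ℚ.*_) (mono-A^ β t)))))))
        where
        lem : ∀ b → 0ℤ - (0ℤ + - (1ℤ + b) + 1ℤ) ≡ b
        lem = solve-∀

      -- The polynomial ((X + Y)^g - X^g) / Y.
      remainder : ℕ → Point n → ℚ
      remainder zero t = 0ℚ
      remainder (suc g) t = X t ↑ g ℚ.+ (X t ℚ.+ Y t) ℚ.* remainder g t

      remainder-eq : ∀ g t → (X t ℚ.+ Y t) ↑ g ≡ X t ↑ g ℚ.+ Y t ℚ.* remainder g t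
      remainder-eq zero t = sym (trans (cong (1ℚ ℚ.+_) (ℚP.*-zeroʳ (Y t))) (ℚP.+-identityʳ 1ℚ))
      remainder-eq (suc g) t = trans (cong ((X t ℚ.+ Y t) ℚ.*_) (remainder-eq g t)) (lem (X t) (Y t) (X t ↑ g) (remainder g t))
        where
        lem : ∀ x y v h → (x ℚ.+ y) ℚ.* (v ℚ.+ y ℚ.* h) ≡ x ℚ.* v ℚ.+ y ℚ.* (v ℚ.+ (x ℚ.+ y) ℚ.* h)
        lem = solve 4 (λ x y v h → (x :+ y) :* (v :+ y :* h) := x :* v :+ y :* (v :+ (x :+ y) :* h)) refl
          where open ℚSolver

      Pol-remainder : ∀ g → Pol w (+ g * - + β + + β) (remainder g)
      Pol-remainder zero = Pol-0
      Pol-remainder (suc g) = Pol-+ (Pol-weaken (ℤP.≤-reflexive (lem (+ g) (+ β))) (Pol-↑ Pol-X g))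
        (Pol-weaken (ℤP.≤-reflexive (lem′ (+ g) (+ β))) (Pol-* (Pol-+ Pol-X (Pol-weaken (neg-≤0 (+≤+ ℕ.z≤n)) Pol-Y)) (Pol-remainder g)))
        where
        lem : ∀ g b → (1ℤ + g) * - b + b ≡ g * - b
        lem = solve-∀
        lem′ : ∀ g b → (1ℤ + g) * - b + b ≡ - b + (g * - b + b)
        lem′ = solve-∀

      -- The monomials r q′ᵞ and q zᵞ differ from those of Q by the common factor u.
      f₁ f₂ u-exp : Row n → ℕ
      f₁ ρ = zap k (e⁺ cj′) ρ ℕ.+ γ ℕ.* e⁻ ck ρ
      f₂ ρ = e⁻ cj′ ρ ℕ.+ γ ℕ.* exponent (unitM (inj₁ k)) ρ
      u-exp ρ = f₁ ρ ℕ.∸ e⁺ cj ρ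

      exponent-unit-other : ∀ ρ → ρ ≢ inj₁ k → exponent (unitM (inj₁ k)) ρ ≡ 0
      exponent-unit-other (inj₁ i) ne = ℤP.+-injective (trans (lookup-unit k i) (α-off (λ e → ne (cong inj₁ (sym e)))))
      exponent-unit-other (inj₂ i) ne = VecP.lookup-replicate i 0

      f-diff : ∀ ρ → + f₁ ρ - + f₂ ρ ≡ cj ρ
      f-diff ρ = [ (λ { refl → at-k }) , off-k ]′ (is-inj₁ k ρ)
        where
        at-k : + f₁ (inj₁ k) - + f₂ (inj₁ k) ≡ cj (inj₁ k)
        at-k = begin
          + f₁ (inj₁ k) - + f₂ (inj₁ k)
            ≡⟨ cong₂ (λ a b → + a - + b) (cong₂ ℕ._+_ (zap-same k (e⁺ cj′)) (cong (γ ℕ.*_) (cong (λ x → pos (- x)) ck-k))) (cong₂ ℕ._+_ (trans (cong (λ x → pos (- x)) cj′-k) (pos-0 (neg-≤0 {+ γ} (+≤+ ℕ.z≤n)))) (cong (γ ℕ.*_) (ℤP.+-injective (trans (lookup-unit k k) (α-diag k))))) ⟩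
          + (γ ℕ.* 0) - + (γ ℕ.* 1)
            ≡⟨ cong₂ (λ a b → + a - + b) (ℕP.*-zeroʳ γ) (ℕP.*-identityʳ γ) ⟩
          0ℤ - + γ
            ≡⟨ ℤP.+-identityˡ (- + γ) ⟩
          - + γ
            ≡⟨ sym cj-k ⟩
          cj (inj₁ k) ∎
          where open ≡-Reasoning
        off-k : ρ ≢ inj₁ k → + f₁ ρ - + f₂ ρ ≡ cj ρ
        off-k ne = begin
          + f₁ ρ - + f₂ ρ
            ≡⟨ cong₂ (λ a b → + (a ℕ.+ γ ℕ.* e⁻ ck ρ) - + (e⁻ cj′ ρ ℕ.+ b)) (zap-other k (e⁺ cj′) ρ ne) (trans (cong (γ ℕ.*_) (exponent-unit-other ρ ne)) (ℕP.*-zeroʳ γ)) ⟩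
          + (e⁺ cj′ ρ ℕ.+ γ ℕ.* e⁻ ck ρ) - + (e⁻ cj′ ρ ℕ.+ 0)
            ≡⟨ cong₂ (λ a b → a - b) (trans (ℤP.pos-+ (e⁺ cj′ ρ) (γ ℕ.* e⁻ ck ρ)) (cong (λ v → + e⁺ cj′ ρ + v) (ℤP.pos-* γ (e⁻ ck ρ)))) (cong +_ (ℕP.+-identityʳ (e⁻ cj′ ρ))) ⟩
          + e⁺ cj′ ρ + + γ * + e⁻ ck ρ - + e⁻ cj′ ρ
            ≡⟨ lem (+ e⁺ cj′ ρ) (+ γ * + e⁻ ck ρ) (+ e⁻ cj′ ρ) ⟩
          (+ e⁺ cj′ ρ - + e⁻ cj′ ρ) + + γ * + e⁻ ck ρ
            ≡⟨ cong (_+ + γ * + e⁻ ck ρ) (trans (sym (⁺-diff (cj′ ρ))) (cj′-r ρ ne)) ⟩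
          cj ρ - + γ * + e⁻ ck ρ + + γ * + e⁻ ck ρ
            ≡⟨ lem′ (cj ρ) (+ γ * + e⁻ ck ρ) ⟩
          cj ρ ∎
          where
          open ≡-Reasoning
          lem : ∀ a b c → a + b - c ≡ (a - c) + b
          lem = solve-∀
          lem′ : ∀ a b → a - b + b ≡ a
          lem′ = solve-∀

      u : Point n → ℚ
      u = M u-exp

      factor : ∀ t → r t ℚ.* q′ t ↑ γ ℚ.+ q t ℚ.* z t ↑ γ ≡ u t ℚ.* Q t
      factor t = begin
        r t ℚ.* q′ t ↑ γ ℚ.+ q t ℚ.* z t ↑ γ
          ≡⟨ cong₂ ℚ._+_ (trans (cong (r t ℚ.*_) (sym (M-scale γ (e⁻ ck) t))) (sym (M-+ (zap k (e⁺ cj′)) (λ ρ → γ ℕ.* e⁻ ck ρ) t)))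
                         (trans (cong (q t ℚ.*_) (trans (cong (_↑ γ) (trans (sym (mono-unit (inj₁ k) t)) (mono≡M (unitM (inj₁ k)) t))) (sym (M-scale γ (exponent (unitM (inj₁ k))) t)))) (sym (M-+ (e⁻ cj′) (λ ρ → γ ℕ.* exponent (unitM (inj₁ k)) ρ) t))) ⟩
        M f₁ t ℚ.+ M f₂ t
          ≡⟨ cong₂ ℚ._+_ (trans (M-cong (λ ρ → proj₁ (common (f₁ ρ) (f₂ ρ) (f-diff ρ))) t) (M-+ u-exp (e⁺ cj) t)) (trans (M-cong (λ ρ → proj₂ (common (f₁ ρ) (f₂ ρ) (f-diff ρ))) t) (M-+ u-exp (e⁻ cj) t)) ⟩
        u t ℚ.* M (e⁺ cj) t ℚ.+ u t ℚ.* M (e⁻ cj) t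
          ≡⟨ sym (ℚP.*-distribˡ-+ (u t) (M (e⁺ cj) t) (M (e⁻ cj) t)) ⟩
        u t ℚ.* Q t ∎
        where open ≡-Reasoning

      u-j : u-exp (inj₁ j) ≡ 0
      u-j = trans (cong (ℕ._∸ e⁺ cj (inj₁ j)) (cong₂ ℕ._+_ zap-j (trans (cong (γ ℕ.*_) ck⁻-j) (ℕP.*-zeroʳ γ)))) (ℕP.0∸n≡0 (e⁺ cj (inj₁ j)))

      -- Proved after multiplication by Q. Modulo Y, the cleared power of the new k-th variable is a
      -- power of X, and this part combines with the other monomial to a multiple of Q by `factor`.
      -- The remaining part contains Y, hence a power of Q with exponent β ≥ 1. So Q cancels, and
      -- the first summand is a monomial.
      a-equation : ∀ t → Positive t → ω t (inj₁ j) ℚ.* (z t ↑ γ ℚ.* (A t ↑ β) ↑ γ) ≡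
        A t ℚ.* ((A t ↑ β) ↑ γ ℚ.* u t) ℚ.+ A t ℚ.* (r t ℚ.* (r′ t ℚ.* (Q t ↑ β₀ ℚ.* remainder γ t)))
      a-equation t p = ⊗-cancel (binomial>0 cj p) (begin
        Q t ℚ.* (a ℚ.* (z t ↑ γ ℚ.* P))
          ≡⟨ cong (ℚ._* (a ℚ.* (z t ↑ γ ℚ.* P))) (sym (σ-j p)) ⟩
        s ℚ.* A t ℚ.* (a ℚ.* (z t ↑ γ ℚ.* P))
          ≡⟨ lem₁ s (A t) a (z t ↑ γ) P ⟩
        A t ℚ.* ((a ℚ.* s) ℚ.* (z t ↑ γ ℚ.* P))
          ≡⟨ cong (λ v → A t ℚ.* (v ℚ.* (z t ↑ γ ℚ.* P))) (trans (ω-j p) (cong₂ ℚ._+_ plus-part minus-part)) ⟩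
        A t ℚ.* ((b ↑ γ ℚ.* r t ℚ.+ q t) ℚ.* (z t ↑ γ ℚ.* P))
          ≡⟨ lem₂ (A t) (b ↑ γ) (r t) (q t) (z t ↑ γ) P ⟩
        A t ℚ.* (r t ℚ.* (b ↑ γ ℚ.* (z t ↑ γ ℚ.* P)) ℚ.+ q t ℚ.* z t ↑ γ ℚ.* P)
          ≡⟨ cong (λ v → A t ℚ.* (r t ℚ.* v ℚ.+ q t ℚ.* z t ↑ γ ℚ.* P)) power ⟩
        A t ℚ.* (r t ℚ.* (q′ t ↑ γ ℚ.* P ℚ.+ r′ t ℚ.* (Q t ℚ.* Q t ↑ β₀) ℚ.* remainder γ t) ℚ.+ q t ℚ.* z t ↑ γ ℚ.* P)
          ≡⟨ lem₃ (A t) (r t) (q′ t ↑ γ) P (r′ t) (Q t) (Q t ↑ β₀) (remainder γ t) (q t) (z t ↑ γ) ⟩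
        A t ℚ.* (P ℚ.* (r t ℚ.* q′ t ↑ γ ℚ.+ q t ℚ.* z t ↑ γ)) ℚ.+ Q t ℚ.* (A t ℚ.* (r t ℚ.* (r′ t ℚ.* (Q t ↑ β₀ ℚ.* remainder γ t))))
          ≡⟨ cong (λ v → A t ℚ.* (P ℚ.* v) ℚ.+ Q t ℚ.* (A t ℚ.* (r t ℚ.* (r′ t ℚ.* (Q t ↑ β₀ ℚ.* remainder γ t))))) (factor t) ⟩
        A t ℚ.* (P ℚ.* (u t ℚ.* Q t)) ℚ.+ Q t ℚ.* (A t ℚ.* (r t ℚ.* (r′ t ℚ.* (Q t ↑ β₀ ℚ.* remainder γ t))))
          ≡⟨ lem₄ (A t) P (u t) (Q t) (A t ℚ.* (r t ℚ.* (r′ t ℚ.* (Q t ↑ β₀ ℚ.* remainder γ t)))) ⟩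
        Q t ℚ.* (A t ℚ.* (P ℚ.* u t) ℚ.+ A t ℚ.* (r t ℚ.* (r′ t ℚ.* (Q t ↑ β₀ ℚ.* remainder γ t)))) ∎)
        where
        open ≡-Reasoning
        a = ω t (inj₁ j)
        s = σ t (inj₁ j)
        b = τ t (inj₁ k)
        P = (A t ↑ β) ↑ γ
        drop : ∀ (e : Row n → ℕ) → e (inj₁ k) ≡ 0 → e (inj₁ j) ≡ 0 → M e (τ t) ≡ M e t
        drop e ek ej = trans (M-put k _ e (σ t) ek) (M-put j _ e t ej)
        plus-part : M (e⁺ cj′) (τ t) ≡ b ↑ γ ℚ.* r t
        plus-part = trans (M-split k (e⁺ cj′) (τ t)) (cong₂ ℚ._*_ (cong (b ↑_) (cong pos cj′-k)) (drop (zap k (e⁺ cj′)) (zap-same k (e⁺ cj′)) zap-j))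
        minus-part : M (e⁻ cj′) (τ t) ≡ q t
        minus-part = drop (e⁻ cj′) (trans (cong (λ x → pos (- x)) cj′-k) (pos-0 (neg-≤0 {+ γ} (+≤+ ℕ.z≤n)))) (neg-j {cj′} cj′-j)
        power : b ↑ γ ℚ.* (z t ↑ γ ℚ.* P) ≡ q′ t ↑ γ ℚ.* P ℚ.+ r′ t ℚ.* (Q t ℚ.* Q t ↑ β₀) ℚ.* remainder γ t
        power = begin
          b ↑ γ ℚ.* (z t ↑ γ ℚ.* P)             ≡⟨ cong (b ↑ γ ℚ.*_) (sym (↑-⊗ (z t) (A t ↑ β) γ)) ⟩
          b ↑ γ ℚ.* (z t ℚ.* A t ↑ β) ↑ γ       ≡⟨ sym (↑-⊗ b (z t ℚ.* A t ↑ β) γ) ⟩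
          (b ℚ.* (z t ℚ.* A t ↑ β)) ↑ γ         ≡⟨ cong (_↑ γ) (b-equation t p) ⟩
          (X t ℚ.+ Y t) ↑ γ                     ≡⟨ remainder-eq γ t ⟩
          X t ↑ γ ℚ.+ Y t ℚ.* remainder γ t     ≡⟨ cong (ℚ._+ Y t ℚ.* remainder γ t) (↑-⊗ (q′ t) (A t ↑ β) γ) ⟩
          q′ t ↑ γ ℚ.* P ℚ.+ Y t ℚ.* remainder γ t ∎
        lem₁ : ∀ s A a z P → s ℚ.* A ℚ.* (a ℚ.* (z ℚ.* P)) ≡ A ℚ.* ((a ℚ.* s) ℚ.* (z ℚ.* P))
        lem₁ = solve 5 (λ s A a z P → s :* A :* (a :* (z :* P)) := A :* ((a :* s) :* (z :* P))) refl
          where open ℚSolver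
        lem₂ : ∀ A b r q z P → A ℚ.* ((b ℚ.* r ℚ.+ q) ℚ.* (z ℚ.* P)) ≡ A ℚ.* (r ℚ.* (b ℚ.* (z ℚ.* P)) ℚ.+ q ℚ.* z ℚ.* P)
        lem₂ = solve 6 (λ A b r q z P → A :* ((b :* r :+ q) :* (z :* P)) := A :* (r :* (b :* (z :* P)) :+ q :* z :* P)) refl
          where open ℚSolver
        lem₃ : ∀ A r p P r′ Q Q₀ h q z → A ℚ.* (r ℚ.* (p ℚ.* P ℚ.+ r′ ℚ.* (Q ℚ.* Q₀) ℚ.* h) ℚ.+ q ℚ.* z ℚ.* P) ≡
          A ℚ.* (P ℚ.* (r ℚ.* p ℚ.+ q ℚ.* z)) ℚ.+ Q ℚ.* (A ℚ.* (r ℚ.* (r′ ℚ.* (Q₀ ℚ.* h))))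
        lem₃ = solve 10 (λ A r p P r′ Q Q₀ h q z → A :* (r :* (p :* P :+ r′ :* (Q :* Q₀) :* h) :+ q :* z :* P) := A :* (P :* (r :* p :+ q :* z)) :+ Q :* (A :* (r :* (r′ :* (Q₀ :* h))))) refl
          where open ℚSolver
        lem₄ : ∀ A P u Q v → A ℚ.* (P ℚ.* (u ℚ.* Q)) ℚ.+ Q ℚ.* v ≡ Q ℚ.* (A ℚ.* (P ℚ.* u) ℚ.+ v)
        lem₄ = solve 5 (λ A P u Q v → A :* (P :* (u :* Q)) :+ Q :* v := Q :* (A :* (P :* u) :+ v)) refl
          where open ℚSolver

      monic-j : Monic w (λ t → ω t (inj₁ j))
      monic-j = monic (mulM (unitM (inj₁ j)) (mulM (A^ β ^^ γ) (rowMono u-exp))) (mulM (unitM (inj₁ k) ^^ γ) (A^ β ^^ γ))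
        (Pol-weaken lead< (Pol-* Pol-A (Pol-* (Pol-free (zap k (e⁺ cj′)) zap-j) (Pol-* (Pol-free (zap j (e⁺ ck)) (zap-same j (e⁺ ck))) (Pol-* (Pol-Q^ β₀) (Pol-remainder γ))))))
        (λ t p → trans (cong (ω t (inj₁ j) ℚ.*_) (trans (mono-* (unitM (inj₁ k) ^^ γ) (A^ β ^^ γ) t) (cong₂ ℚ._*_ (trans (mono-^^ (unitM (inj₁ k)) γ t) (cong (_↑ γ) (mono-unit (inj₁ k) t))) (P-eq t))))
          (trans (a-equation t p) (cong (ℚ._+ A t ℚ.* (r t ℚ.* (r′ t ℚ.* (Q t ↑ β₀ ℚ.* remainder γ t)))) (sym (trans (mono-* (unitM (inj₁ j)) (mulM (A^ β ^^ γ) (rowMono u-exp)) t) (cong₂ ℚ._*_ (mono-unit (inj₁ j) t) (trans (mono-* (A^ β ^^ γ) (rowMono u-exp) t) (cong (ℚ._* u t) (P-eq t)))))))))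
        where
        P-eq : ∀ t → mono (A^ β ^^ γ) t ≡ (A t ↑ β) ↑ γ
        P-eq t = trans (mono-^^ (A^ β) γ t) (cong (_↑ γ) (mono-A^ β t))
        lem : ∀ g b → - 1ℤ + (0ℤ + (0ℤ + (0ℤ + (g * - (1ℤ + b) + (1ℤ + b))))) - (- 1ℤ + (g * - (1ℤ + b) + 0ℤ) + 1ℤ) ≡ b
        lem = solve-∀
        -- The lead monomial has weight -1 - γβ and the tail at least β more; the slack is β₀
        -- because β ≥ 1.
        lead< : wt (mulM (unitM (inj₁ j)) (mulM (A^ β ^^ γ) (rowMono u-exp))) + 1ℤ ≤ - 1ℤ + (0ℤ + (0ℤ + (0ℤ + (+ γ * - + β + + β))))
        lead< = ≤by (+ β₀) (+≤+ ℕ.z≤n) (trans (cong (λ v → - 1ℤ + (0ℤ + (0ℤ + (0ℤ + (+ γ * - + β + + β)))) - (v + 1ℤ))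
          (trans (wt-* (unitM (inj₁ j)) (mulM (A^ β ^^ γ) (rowMono u-exp))) (cong₂ _+_ wt-unit (trans (wt-* (A^ β ^^ γ) (rowMono u-exp)) (cong₂ _+_ (trans (wt-^^ w (A^ β) γ) (cong (+ γ *_) (wt-A^ β))) (wt-free u-exp u-j))))))
          (lem (+ γ) (+ β₀)))

-- The Laurent phenomenon along a sequence of mutations

column : ∀ {n} → (Row n → Fin n → ℤ) → Fin n → Row n → ℤ
column m j r = m r j

-- For y = e k the duality with c-vectors makes the binomial of every column j ≠ k homogeneous,
-- while the monomials of column k differ in weight by δ k. This is the coprimality that principal
-- coefficients provide.
frozenW : ∀ {n} → Form n → Vect n → Weight n
frozenW F y = record { wt = λ m → ⟪ F ⟫ (λ l → + lookup (proj₂ m) l) y ; wt-* = λ (_ , f) (_ , f′) → trans (E-congˡ F (λ l → lookup-+ f f′ l)) (E-+ˡ F (λ l → + lookup f l) (λ l → + lookup f′ l) y) }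

module _ {n} (F : Form n) (y : Vect n) where
  open Weight (frozenW F y)

  frozenW-row : ∀ (e : Row n → ℕ) → wt (rowMono e) ≡ ⟪ F ⟫ (λ l → + e (inj₂ l)) y
  frozenW-row e = E-congˡ F (λ l → cong +_ (VecP.lookup∘tabulate (e ∘ inj₂) l))

  frozenW-column : ∀ c → wt (rowMono (e⁺ c)) ≡ wt (rowMono (e⁻ c)) + ⟪ F ⟫ (λ l → c (inj₂ l)) y
  frozenW-column c = trans (frozenW-row (e⁺ c)) (trans (trans (E-congˡ F (λ l → lem (c (inj₂ l)))) (E-+ˡ F (λ l → + e⁻ c (inj₂ l)) (λ l → c (inj₂ l)) y)) (cong (_+ ⟪ F ⟫ (λ l → c (inj₂ l)) y) (sym (frozenW-row (e⁻ c)))))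
    where
    l₁ : ∀ p q → q + (p - q) ≡ p
    l₁ = solve-∀
    lem : ∀ x → + pos x ≡ + pos (- x) + x
    lem x = sym (trans (cong (λ v → + pos (- x) + v) (⁺-diff x)) (l₁ (+ pos x) (+ pos (- x))))

module LaurentPhenomenon {n} (𝓔 : EulerForm n) where
  open EulerForm 𝓔
  open Mutation 𝓔

  -- The upper bound of the cluster with exchange matrix m, in the sense of Berenstein, Fomin and Zelevinsky.
  UpperBound : (Row n → Fin n → ℤ) → (Point n → ℚ) → Set
  UpperBound m G = Laurent G × (∀ j → Laurent (λ ρ → G (exchange (column m j) j ρ)))

  0<⇒suc : ∀ {x} → 0ℤ < x → ∃ λ k → x ≡ + suc k
  0<⇒suc {+ suc k} _ = k , refl
  0<⇒suc {+ zero} (+<+ ())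

  flip-sign : ∀ {m e} (V : Valid m e) j k → m (inj₁ k) j < 0ℤ → 0ℤ < m (inj₁ j) k
  flip-sign {m} V j k p = *-cancel-0< (δ>0 j) (subst (0ℤ <_) (trans (sym (ℤP.neg-distribʳ-* (δ k) (m (inj₁ k) j))) (sym (Valid.b-skew V j k))) (0<* (δ>0 k) (ℤP.neg-mono-< p)))

  module _ {m : Row n → Fin n → ℤ} {k : Fin n} {e e′ : Fin n → Vect n} (V : Valid m e) (V′ : Valid (mutMat k m) e′) {G : Point n → ℚ} (ext : Extensional G) where
    private
      m′ = mutMat k m
      c c′ : Fin n → Row n → ℤ
      c = column m
      c′ = column m′

      AdjacentLaurent : (cj ck cj′ : Row n → ℤ) → Fin n → Set
      AdjacentLaurent cj ck cj′ j = Laurent (λ ρ → G (exchange ck k ρ)) → Laurent (λ ρ → G (exchange cj′ j ρ)) → Laurent (λ ρ → G (exchange ck k (exchange cj j ρ)))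

      commuting : ∀ j → j ≢ k → m (inj₁ k) j ≡ 0ℤ → AdjacentLaurent (c j) (c k) (c′ j) j
      commuting j ne z L₁ L₂ = A.transfer ext L₁ L₂ W wt≡ C.monic-j (C.monic-k wt≢)
        where
        module A = Adjacent ne (c j) (c k) (c′ j) (Valid.b-diag V j) (Valid.b-diag V k) (Valid.b-diag V′ j)
        z′ : m (inj₁ j) k ≡ 0ℤ
        z′ = *-cancel-0 (δ>0 j) (trans (Valid.b-skew V j k) (cong -_ (trans (cong (δ k *_) z) (ℤP.*-zeroʳ (δ k)))))
        same : ∀ r → c′ j r ≡ c j r
        same r = [ (λ { refl → trans (mutMat-row k m j) (trans (cong -_ z) (sym z)) }) , (λ nk → trans (mutMat-off k m r j nk ne) (trans (cong (λ v → m r j + (m r k * v ⁺ + (- m r k) ⁺ * v)) z) (lem (m r j) (m r k) ((- m r k) ⁺)))) ]′ (is-inj₁ k r)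
          where
          lem : ∀ a b c → a + (b * 0ℤ + c * 0ℤ) ≡ a
          lem = solve-∀
        module C = A.Commuting z′ z same
        W = frozenW F (e k)
        wt≡ : Weight.wt W (rowMono (e⁺ (c j))) ≡ Weight.wt W (rowMono (e⁻ (c j)))
        wt≡ = trans (frozenW-column F (e k) (c j)) (trans (cong (λ v → Weight.wt W (rowMono (e⁻ (c j))) + v) (ESeed.pair-off (Valid.eseed V) j k ne)) (ℤP.+-identityʳ _))
        wt≢ : Weight.wt W (rowMono (e⁺ (c k))) ≢ Weight.wt W (rowMono (e⁻ (c k)))
        wt≢ q = ℤP.<-irrefl (sym (lem (trans (sym q) (trans (frozenW-column F (e k) (c k)) (cong (λ v → Weight.wt W (rowMono (e⁻ (c k))) + v) (ESeed.pair-diag (Valid.eseed V) k)))))) (δ>0 k)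
          where
          lem : ∀ {a d} → a ≡ a + - d → d ≡ 0ℤ
          lem {a} {d} p = trans (l a d) (trans (cong (λ v → a - v) (sym p)) (ℤP.+-inverseʳ a))
            where
            l : ∀ a d → d ≡ a - (a + - d)
            l = solve-∀

      interacting : ∀ j → j ≢ k → ∀ cj ck cj′ → cj (inj₁ j) ≡ 0ℤ → ck (inj₁ k) ≡ 0ℤ → cj′ (inj₁ j) ≡ 0ℤ → ∀ γ β₀ → cj (inj₁ k) ≡ - + γ → ck (inj₁ j) ≡ + suc β₀ → cj′ (inj₁ k) ≡ + γ →
        (∀ r → r ≢ inj₁ k → cj′ r ≡ cj r - + γ * + e⁻ ck r) → AdjacentLaurent cj ck cj′ j
      interacting j ne cj ck cj′ z₁ z₂ z₃ γ β₀ p₁ p₂ p₃ p₄ L₁ L₂ = A.transfer ext L₁ L₂ I.w I.wt≡ I.monic-j I.monic-k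
        where
        module A = Adjacent ne cj ck cj′ z₁ z₂ z₃
        module I = A.Interacting γ β₀ p₁ p₂ p₃ p₄

      negative : ∀ j → j ≢ k → m (inj₁ k) j < 0ℤ → AdjacentLaurent (c j) (c k) (c′ j) j
      negative j ne p = interacting j ne (c j) (c k) (c′ j) (Valid.b-diag V j) (Valid.b-diag V k) (Valid.b-diag V′ j) (suc γ₀) β₀
        (trans (sym (ℤP.neg-involutive (m (inj₁ k) j))) (cong -_ γ≡)) β≡ (trans (mutMat-row k m j) γ≡)
        (λ r nk → trans (mutMat-off k m r j nk ne) (trans (cong (λ v → m r j + (m r k * v ⁺ + (- m r k) ⁺ * v)) (trans (sym (ℤP.neg-involutive (m (inj₁ k) j))) (cong -_ γ≡))) (lem (m r j) (m r k) ((- m r k) ⁺) (+ suc γ₀))))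
        where
        γ₀ = proj₁ (0<⇒suc (ℤP.neg-mono-< p))
        γ≡ = proj₂ (0<⇒suc (ℤP.neg-mono-< p))
        β₀ = proj₁ (0<⇒suc (flip-sign V j k p))
        β≡ = proj₂ (0<⇒suc (flip-sign V j k p))
        lem : ∀ a b c g → a + (b * 0ℤ + c * - g) ≡ a - g * c
        lem = solve-∀

      -- Reversing all signs reduces this case to the previous one.
      positive : ∀ j → j ≢ k → 0ℤ < m (inj₁ k) j → AdjacentLaurent (c j) (c k) (c′ j) j
      positive j ne p L₁ L₂ = Laurent-resp (λ ρ _ → ext (exchange-cong (opp (c k)) (c k) k (neg (c k)) (exchange-cong (opp (c j)) (c j) j {ρ} (neg (c j)) (λ _ → refl))))
        (interacting j ne (opp (c j)) (opp (c k)) (opp (c′ j)) (cong -_ (Valid.b-diag V j)) (cong -_ (Valid.b-diag V k)) (cong -_ (Valid.b-diag V′ j)) (suc γ₀) β₀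
          (cong -_ γ≡) β≡ (trans (cong -_ (mutMat-row k m j)) (trans (ℤP.neg-involutive (m (inj₁ k) j)) γ≡))
          (λ r nk → trans (cong -_ (trans (mutMat-off k m r j nk ne) (trans (cong (λ v → m r j + (m r k * v ⁺ + (- m r k) ⁺ * v)) γ≡) (cong (λ v → m r j + (v * + suc γ₀ + (- m r k) ⁺ * + suc γ₀)) (⁺-diff (m r k))))))
            (trans (lem (m r j) ((m r k) ⁺) ((- m r k) ⁺) (+ suc γ₀)) (cong (λ v → - m r j - + suc γ₀ * v ⁺) (sym (ℤP.neg-involutive (m r k))))))
          (Laurent-resp (λ ρ _ → ext (exchange-cong (c k) (opp (c k)) k {ρ} (λ ρ → sym (neg (c k) ρ)) (λ _ → refl))) L₁) (Laurent-resp (λ ρ _ → ext (exchange-cong (c′ j) (opp (c′ j)) j {ρ} (λ ρ → sym (neg (c′ j) ρ)) (λ _ → refl))) L₂))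
        where
        opp : (Row n → ℤ) → Row n → ℤ
        opp c r = - c r
        neg : ∀ c ρ → binomial (opp c) ρ ≡ binomial c ρ
        neg = binomial-neg
        flipped : m (inj₁ j) k < 0ℤ
        flipped = subst (_< 0ℤ) (ℤP.neg-involutive (m (inj₁ j) k)) (ℤP.neg-mono-< (*-cancel-0< (δ>0 j) (subst (0ℤ <_) eq (0<* (δ>0 k) p))))
          where
          eq : δ k * m (inj₁ k) j ≡ δ j * - m (inj₁ j) k
          eq = trans (sym (ℤP.neg-involutive (δ k * m (inj₁ k) j))) (trans (cong -_ (sym (Valid.b-skew V j k))) (ℤP.neg-distribʳ-* (δ j) (m (inj₁ j) k)))
        γ₀ = proj₁ (0<⇒suc p)
        γ≡ = proj₂ (0<⇒suc p)
        β₀ = proj₁ (0<⇒suc (ℤP.neg-mono-< flipped))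
        β≡ = proj₂ (0<⇒suc (ℤP.neg-mono-< flipped))
        lem : ∀ a p q g → - (a + ((p - q) * g + q * g)) ≡ - a - g * p
        lem = solve-∀

    -- In direction k one returns to the later cluster, because exchanging twice is the identity. In
    -- the other directions the sign of the entry in row k and column j decides between `negative`,
    -- `commuting` and `positive`.
    mutate-UpperBound : UpperBound m′ G → UpperBound m (λ ρ → G (exchange (c k) k ρ))
    mutate-UpperBound (L , Ls) = L₁ , adjacent
      where
      L₁ : Laurent (λ ρ → G (exchange (c k) k ρ))
      L₁ = Laurent-resp (λ ρ _ → ext (exchange-cong (c′ k) (c k) k {ρ} (λ ρ → trans (binomial-cong (mutMat-col k m) ρ) (binomial-neg (c k) ρ)) (λ _ → refl))) (Ls k)
      adjacent : ∀ j → Laurent (λ ρ → G (exchange (c k) k (exchange (c j) j ρ)))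
      adjacent j with j ≟ k
      ... | yes refl = Laurent-resp (λ ρ p → sym (ext (exchange-involutive (c k) k (Valid.b-diag V k) p))) L
      ... | no ne with ℤP.<-cmp (m (inj₁ k) j) 0ℤ
      ...   | tri< lt _ _ = negative j ne lt L₁ (Ls j)
      ...   | tri≈ _ z _ = commuting j ne z L₁ (Ls j)
      ...   | tri> _ _ gt = positive j ne gt L₁ (Ls j)

  coordinates : List (Fin n) → (Row n → Fin n → ℤ) → Point n → Point n
  coordinates [] m ρ = ρ
  coordinates (k ∷ ks) m ρ = coordinates ks (mutMat k m) (exchange (column m k) k ρ)

  coordinates-cong : ∀ ks m {ρ ρ′} → (∀ r → ρ r ≡ ρ′ r) → ∀ r → coordinates ks m ρ r ≡ coordinates ks m ρ′ r
  coordinates-cong [] m p = p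
  coordinates-cong (k ∷ ks) m p = coordinates-cong ks (mutMat k m) (exchange-cong (column m k) (column m k) k (λ _ → refl) p)

  -- The induction runs backwards: a coordinate lies in the upper bound of its own cluster, and this
  -- is pulled back one mutation at a time to the initial cluster.
  coordinates-UpperBound : ∀ ks {m e} → Valid m e → ∀ r → UpperBound m (λ ρ → coordinates ks m ρ r)
  coordinates-UpperBound [] {m} V r = Laurent-coordinate r , λ j → Laurent-exchange (column m j) j r
  coordinates-UpperBound (k ∷ ks) {m} V r = let (e′ , V′ , _) = mutation-step k m V in
    mutate-UpperBound V V′ {λ ρ → coordinates ks (mutMat k m) ρ r} (λ p → coordinates-cong ks (mutMat k m) p r) (coordinates-UpperBound ks V′ r)

  coordinates-value : ∀ ks s {ρ τ} → (∀ r → Ev ρ (zVar s r) (τ r)) → Positive τ → ∀ r → Ev ρ (zVar (foldl (λ s k → mutate k s) s ks) r) (coordinates ks (mat s) τ r)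
  coordinates-value [] s v p = v
  coordinates-value (k ∷ ks) s {ρ} {τ} v p = coordinates-value ks (mutate k s) new (exchange>0 (column (mat s) k) k p)
    where
    new : ∀ r → Ev ρ (zVar (mutate k s) r) (exchange (column (mat s) k) k τ r)
    new (inj₁ i) with i ≟ k
    ... | yes _ = Ev-mut s k {ρ} {τ} v (p (inj₁ k))
    ... | no _ = v (inj₁ i)
    new (inj₂ i) = v (inj₂ i)

  laurent-expansion : ∀ {B e} → Valid (mat (initialSeed B)) e → ∀ ks k → let x = clus (mutateSeq B ks) k in
    ∃ λ N → ∃ λ d → (proj₁ x · d) ≈P (N *P proj₂ x)
  laurent-expansion {B} V ks k = N , d , faithful (proj₁ x · d) (N *P proj₂ x) (λ ρ p → let open Ev (value ρ p) renaming (value to eq) in begin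
    eval (proj₁ x · d) ρ                           ≡⟨ eval-· (proj₁ x) d ρ ⟩
    eval (proj₁ x) ρ ℚ.* mono d ρ                  ≡⟨ cong (ℚ._* mono d ρ) eq ⟩
    G ρ ℚ.* eval (proj₂ x) ρ ℚ.* mono d ρ          ≡⟨ trans (ℚP.*-assoc (G ρ) (eval (proj₂ x) ρ) (mono d ρ)) (trans (cong (G ρ ℚ.*_) (ℚP.*-comm (eval (proj₂ x) ρ) (mono d ρ))) (sym (ℚP.*-assoc (G ρ) (mono d ρ) (eval (proj₂ x) ρ)))) ⟩
    G ρ ℚ.* mono d ρ ℚ.* eval (proj₂ x) ρ          ≡⟨ cong (ℚ._* eval (proj₂ x) ρ) (Laurent.equation L ρ p) ⟩
    eval N ρ ℚ.* eval (proj₂ x) ρ                  ≡⟨ sym (eval-* N (proj₂ x) ρ) ⟩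
    eval (N *P proj₂ x) ρ ∎)
    where
    open ≡-Reasoning
    open ℚEval {n}
    x = clus (mutateSeq B ks) k
    G : Point n → ℚ
    G ρ = coordinates ks (mat (initialSeed B)) ρ (inj₁ k)
    L : Laurent G
    L = proj₁ (coordinates-UpperBound ks V (inj₁ k))
    N = Laurent.num L
    d = Laurent.bottom L
    value : ∀ ρ → Positive ρ → Ev ρ x (G ρ)
    value ρ p = coordinates-value ks (initialSeed B) {ρ} {ρ} start p (inj₁ k)
      where
      start : ∀ r → Ev ρ (zVar (initialSeed B) r) (ρ r)
      start (inj₁ i) = Ev-poly (xP i) (eval-x i ρ)
      start (inj₂ i) = Ev-poly (yP i) (eval-y i ρ)

-- Numerators and denominator vectors

module _ {n : ℕ} where
  open ℚEval {n}

  exponents : (Fin n → ℕ) → Row n → ℕ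
  exponents e (inj₁ i) = e i
  exponents e (inj₂ _) = 0

  eval-xMon-M : ∀ e ρ → eval (xMon e) ρ ≡ M (exponents e) ρ
  eval-xMon-M e ρ = trans (eval-term (tabulate e , replicate n 0) ρ) (cong (λ v → mono (tabulate e , v) ρ) (zeros n))
    where
    zeros : ∀ l → replicate l 0 ≡ tabulate (λ _ → 0)
    zeros zero = refl
    zeros (suc l) = cong (0 ∷_) (zeros l)

  module _ {w : Weight n} where
    open Weight w

    IsMin-quotient : ∀ {p q r a b} → p ≈P (q *P r) → IsMin w p a → IsMin w r b → IsMin w q (a - b)
    IsMin-quotient {p} {q} {r} {a} {b} e P R with find-support q {λ _ → ⊤} (λ _ → yes tt)
    ... | inj₁ (m , nz , _) = let (c , Q) = IsMin-exists {w = w} q (m , nz) in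
      subst (IsMin w q) (trans (lem c b) (cong (_- b) (IsMin-unique {w = w} {q *P r} {p} (λ m → sym (e m)) (IsMin-* Q R) P))) Q
      where
      lem : ∀ c b → c ≡ c + b - b
      lem = solve-∀
    ... | inj₂ none = let (m , nz , _) = IsMin.attained P in ⊥-elim (nz (trans (e m) (trans (coeff≡⟨⟩ (q *P r) m) (trans (ℤPair.⟨⟩-* q r (indicator m)) (ℤPair.⟨⟩-null q (λ m′ nz′ → ⊥-elim (none m′ nz′ tt)))))))

  wt≥0 : ∀ i (m : Monomial n) → 0ℤ ≤ Weight.wt (xw i) m
  wt≥0 i m = +≤+ ℕ.z≤n

  not-divisible : ∀ {i N} → IsMin (xw i) N 0ℤ → ¬ (xP i ∣P N)
  not-divisible {i} {N} P (r , e) = let (m , nz , z) = IsMin.attained P in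
    ℤP.<⇒≱ (+<+ (ℕ.s≤s ℕ.z≤n)) (subst (1ℤ + 0ℤ ≤_) z (AtLeast-* {w = xw i} {p = xP i} {q = r}
      (AtLeast-term (xw i) (unitM (inj₁ i)) (ℤP.≤-reflexive (sym (trans (lookup-unit i i) (α-diag i))))) (λ m _ → wt≥0 i m) m (λ z → nz (trans (e m) z))))

  -- The subtraction is exact on the support when `μ` bounds it below. Listed terms that cancel are
  -- lowered too, but equal monomials stay equal, so they still cancel. The factor `1ℤ` fits the
  -- shape required by `⟨⟩-map`.
  lower : (Row n → ℕ) → Poly n → Poly n
  lower μ = map (λ (c , m) → (1ℤ * c , rowMono (λ r → exponent m r ℕ.∸ μ r)))

  lower-· : ∀ μ N → (∀ m → coeff N m ≢ 0ℤ → ∀ r → μ r ℕ.≤ exponent m r) → N ≈P (lower μ N · rowMono μ)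
  lower-· μ N le = faithful N (lower μ N · rowMono μ) (λ ρ _ → sym (begin
    eval (lower μ N · rowMono μ) ρ                            ≡⟨ eval-· (lower μ N) (rowMono μ) ρ ⟩
    eval (lower μ N) ρ ℚ.* M μ ρ                              ≡⟨ cong (ℚ._* M μ ρ) (trans (⟨⟩-map _ 1ℤ (λ m → rowMono (λ r → exponent m r ℕ.∸ μ r)) (λ _ _ → refl) N (λ m → mono m ρ)) (ℚP.*-identityˡ (⟨ N , (λ m → M (λ r → exponent m r ℕ.∸ μ r) ρ) ⟩))) ⟩
    ⟨ N , (λ m → M (λ r → exponent m r ℕ.∸ μ r) ρ) ⟩ ℚ.* M μ ρ ≡⟨ ℚP.*-comm _ (M μ ρ) ⟩
    M μ ρ ℚ.* ⟨ N , (λ m → M (λ r → exponent m r ℕ.∸ μ r) ρ) ⟩ ≡⟨ sym (⟨⟩-⊗ N (M μ ρ) (λ m → M (λ r → exponent m r ℕ.∸ μ r) ρ)) ⟩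
    ⟨ N , (λ m → M μ ρ ℚ.* M (λ r → exponent m r ℕ.∸ μ r) ρ) ⟩ ≡⟨ ⟨⟩-support N (λ m nz → trans (sym (M-+ μ (λ r → exponent m r ℕ.∸ μ r) ρ)) (trans (M-cong (λ r → ℕP.m+[n∸m]≡n (le m nz r)) ρ) (sym (mono≡M m ρ)))) ⟩
    eval N ρ ∎))
    where
    open ≡-Reasoning
    open Pairing ℚ-ring {n}

  divisible : ∀ {i} N → (∀ m → coeff N m ≢ 0ℤ → 1 ℕ.≤ lookup (proj₁ m) i) → xP i ∣P N
  divisible {i} N le = lower μ N , λ m → trans (lower-· μ N μ≤ m) (faithful (lower μ N · rowMono μ) (xP i *P lower μ N) (λ ρ _ → trans (eval-· (lower μ N) (rowMono μ) ρ) (trans (ℚP.*-comm (eval (lower μ N) ρ) (M μ ρ))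
    (trans (cong (ℚ._* eval (lower μ N) ρ) (trans (sym (mono≡M (unitM (inj₁ i)) ρ)) (trans (mono-unit (inj₁ i) ρ) (sym (eval-x i ρ))))) (sym (eval-* (xP i) (lower μ N) ρ))))) m)
    where
    μ = exponent (unitM (inj₁ i))
    μ≤ : ∀ m → coeff N m ≢ 0ℤ → ∀ r → μ r ℕ.≤ exponent m r
    μ≤ m nz (inj₂ l) = subst (ℕ._≤ lookup (proj₂ m) l) (sym (VecP.lookup-replicate l 0)) ℕ.z≤n
    μ≤ m nz (inj₁ l) with l ≟ i
    ... | yes refl = subst (ℕ._≤ lookup (proj₁ m) l) (ℤP.+-injective (sym (trans (lookup-unit l l) (α-diag l)))) (le m nz)
    ... | no ne = subst (ℕ._≤ lookup (proj₁ m) l) (ℤP.+-injective (sym (trans (lookup-unit i l) (α-off (≢-sym ne))))) ℕ.z≤n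

  module _ {x : Frac n} {N : Poly n} {d : Vect n} (eq : x ≃ (N *P xMon (λ i → pos (- d i)) , xMon (λ i → pos (d i)))) where
    private
      d⁺ d⁻ : Monomial n
      d⁺ = tabulate (λ i → pos (d i)) , replicate n 0
      d⁻ = tabulate (λ i → pos (- d i)) , replicate n 0

    Val-numerator : ∀ {w a} → Val w x a → IsMin w N (a + Weight.wt w d⁺ - Weight.wt w d⁻)
    Val-numerator {w} {a} (val {p} {q} P Q e) = subst (IsMin w N) (trans (lem p q (wt d⁺) (wt d⁻)) (cong (λ v → v + wt d⁺ - wt d⁻) (sym e)))
      (IsMin-quotient {p = N *P term 1ℤ d⁻} (λ _ → refl) (IsMin-quotient {p = proj₁ x *P term 1ℤ d⁺} {N *P term 1ℤ d⁻} {proj₂ x} eq (IsMin-* P (IsMin-term d⁺ refl)) Q) (IsMin-term d⁻ refl))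
      where
      open Weight w
      lem : ∀ p q s t → p + s - q - t ≡ p - q + s - t
      lem = solve-∀

    -- N has order d i - a along x_i. For a polynomial this is ≥ 0, and if it were positive x_i
    -- would divide N.
    denominator-unique : (∀ i → ¬ (xP i ∣P N)) → ∀ {i a} → Val (xw i) x (- a) → d i ≡ a
    denominator-unique nd {i} {a} v = ℤP.≤-antisym (ℤP.≮⇒≥ (λ lt → nd i (divisible N (λ m nz → ℤP.drop‿+≤+ (ℤP.≤-trans (0<⇒1≤ (0<- lt)) (IsMin.lower minN m nz))))))
      (let (m , _ , e) = IsMin.attained minN in ≤by (Weight.wt (xw i) m) (wt≥0 i m) (sym e))
      where
      lem : ∀ a p q → - a + p - q ≡ (p - q) - a
      lem = solve-∀
      minN : IsMin (xw i) N (d i - a)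
      minN = subst (IsMin (xw i) N) (trans (cong₂ (λ s t → - a + + s - + t) (VecP.lookup∘tabulate (λ i → pos (d i)) i) (VecP.lookup∘tabulate (λ i → pos (- d i)) i))
        (trans (lem a (d i ⁺) ((- d i) ⁺)) (cong (_- a) (sym (⁺-diff (d i)))))) (Val-numerator v)

  -- Strip N of the monomial `μ` of its lowest exponents. Since x has order a along the x_i with
  -- opposite sign and 0 along the y_i, `μ` and d differ exactly by the exponents a, and no y_i is
  -- left; `u` is the common part that cancels.
  denominator-exists : ∀ {x : Frac n} {N d} (a : Vect n) → (proj₁ x · d) ≈P (N *P proj₂ x) → (∀ i → Val (xw i) x (- a i)) → (∀ i → Val (yw i) x 0ℤ) → IsDenominatorVector x a
  denominator-exists {x} {N} {d} a eq vx vy = N′ , faithful (proj₁ x *P xMon a⁺) ((N′ *P xMon a⁻) *P proj₂ x) equation , λ i → not-divisible (minN′ i)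
    where
    open ≡-Reasoning
    a⁺ a⁻ : Fin n → ℕ
    a⁺ i = pos (a i)
    a⁻ i = pos (- a i)
    row : Row n → ℤ
    row (inj₁ i) = a i
    row (inj₂ _) = 0ℤ
    minN : ∀ {w b} → Val w x b → IsMin w N (b + Weight.wt w d)
    minN {w} (val {p} {q} P Q refl) = subst (IsMin w N) (lem p q (Weight.wt w d)) (IsMin-quotient {p = proj₁ x *P term 1ℤ d} {N} {proj₂ x} eq (IsMin-* P (IsMin-term d refl)) Q)
      where
      lem : ∀ p q s → p + s - q ≡ p - q + s
      lem = solve-∀
    μ : Row n → ℕ
    μ (inj₁ i) = ∣ - a i + + lookup (proj₁ d) i ∣
    μ (inj₂ i) = lookup (proj₂ d) i
    μx : ∀ i → + μ (inj₁ i) ≡ - a i + + lookup (proj₁ d) i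
    μx i = let (m , _ , e) = IsMin.attained (minN (vx i)) in ℤP.0≤i⇒+∣i∣≡i (subst (0ℤ ≤_) e (wt≥0 i m))
    μ≤ : ∀ m → coeff N m ≢ 0ℤ → ∀ r → μ r ℕ.≤ exponent m r
    μ≤ m nz (inj₁ i) = ℤP.drop‿+≤+ (subst (_≤ + lookup (proj₁ m) i) (sym (μx i)) (IsMin.lower (minN (vx i)) m nz))
    μ≤ m nz (inj₂ i) = ℤP.drop‿+≤+ (subst (_≤ + lookup (proj₂ m) i) (ℤP.+-identityˡ (+ lookup (proj₂ d) i)) (IsMin.lower (minN (vy i)) m nz))
    N′ = lower μ N
    minN′ : ∀ i → IsMin (xw i) N′ 0ℤ
    minN′ i = subst (IsMin (xw i) N′) (trans (cong (λ v → - a i + + lookup (proj₁ d) i - v) (trans (cong +_ (VecP.lookup∘tabulate (μ ∘ inj₁) i)) (μx i))) (ℤP.+-inverseʳ (- a i + + lookup (proj₁ d) i)))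
      (IsMin-quotient {p = N} {N′} {term 1ℤ (rowMono μ)} (lower-· μ N μ≤) (minN (vx i)) (IsMin-term (rowMono μ) refl))
    diff : ∀ r → + exponent d r - + μ r ≡ row r
    diff (inj₁ i) = trans (cong (λ v → + lookup (proj₁ d) i - v) (μx i)) (lem (+ lookup (proj₁ d) i) (a i))
      where
      lem : ∀ e a → e - (- a + e) ≡ a
      lem = solve-∀
    diff (inj₂ i) = ℤP.+-inverseʳ (+ lookup (proj₂ d) i)
    u : Row n → ℕ
    u r = exponent d r ℕ.∸ pos (row r)
    split⁺ : ∀ ρ → mono d ρ ≡ M u ρ ℚ.* eval (xMon a⁺) ρ
    split⁺ ρ = trans (mono≡M d ρ) (trans (M-cong (λ r → proj₁ (common (exponent d r) (μ r) (diff r))) ρ) (trans (M-+ u (λ r → pos (row r)) ρ) (cong (M u ρ ℚ.*_) (sym (eval-xMon-M a⁺ ρ)))))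
    split⁻ : ∀ ρ → M μ ρ ≡ M u ρ ℚ.* eval (xMon a⁻) ρ
    split⁻ ρ = trans (M-cong (λ r → proj₂ (common (exponent d r) (μ r) (diff r))) ρ) (trans (M-+ u (λ r → pos (- row r)) ρ) (cong (M u ρ ℚ.*_) (trans (M-cong {n} {λ r → pos (- row r)} {exponents a⁻} (λ { (inj₁ i) → refl ; (inj₂ i) → refl }) ρ) (sym (eval-xMon-M a⁻ ρ)))))
    equation : ∀ ρ → Positive ρ → eval (proj₁ x *P xMon a⁺) ρ ≡ eval ((N′ *P xMon a⁻) *P proj₂ x) ρ
    equation ρ p = ⊗-cancel (M>0 u p) (begin
      U ℚ.* eval (proj₁ x *P xMon a⁺) ρ                   ≡⟨ cong (U ℚ.*_) (eval-* (proj₁ x) (xMon a⁺) ρ) ⟩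
      U ℚ.* (P ℚ.* eval (xMon a⁺) ρ)                      ≡⟨ lem₁ U P (eval (xMon a⁺) ρ) ⟩
      P ℚ.* (U ℚ.* eval (xMon a⁺) ρ)                      ≡⟨ cong (P ℚ.*_) (sym (split⁺ ρ)) ⟩
      P ℚ.* mono d ρ                                      ≡⟨ sym (eval-· (proj₁ x) d ρ) ⟩
      eval (proj₁ x · d) ρ                                ≡⟨ eval-≈ {proj₁ x · d} {N *P proj₂ x} eq ρ ⟩
      eval (N *P proj₂ x) ρ                               ≡⟨ eval-* N (proj₂ x) ρ ⟩
      eval N ρ ℚ.* Q                                      ≡⟨ cong (ℚ._* Q) (trans (eval-≈ {N} {N′ · rowMono μ} (lower-· μ N μ≤) ρ) (trans (eval-· N′ (rowMono μ) ρ) (cong (eval N′ ρ ℚ.*_) (split⁻ ρ)))) ⟩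
      eval N′ ρ ℚ.* (U ℚ.* eval (xMon a⁻) ρ) ℚ.* Q        ≡⟨ lem₂ (eval N′ ρ) U (eval (xMon a⁻) ρ) Q ⟩
      U ℚ.* (eval N′ ρ ℚ.* eval (xMon a⁻) ρ ℚ.* Q)        ≡⟨ cong (U ℚ.*_) (sym (trans (eval-* (N′ *P xMon a⁻) (proj₂ x) ρ) (cong (ℚ._* Q) (eval-* N′ (xMon a⁻) ρ)))) ⟩
      U ℚ.* eval ((N′ *P xMon a⁻) *P proj₂ x) ρ ∎)
      where
      U = M u ρ
      P = eval (proj₁ x) ρ
      Q = eval (proj₂ x) ρ
      lem₁ : ∀ u p e → u ℚ.* (p ℚ.* e) ≡ p ℚ.* (u ℚ.* e)
      lem₁ = solve 3 (λ u p e → u :* (p :* e) := p :* (u :* e)) refl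
        where open ℚSolver
      lem₂ : ∀ v u e q → v ℚ.* (u ℚ.* e) ℚ.* q ≡ u ℚ.* (v ℚ.* e ℚ.* q)
      lem₂ = solve 4 (λ v u e q → v :* (u :* e) :* q := u :* (v :* e :* q)) refl
        where open ℚSolver

  module _ (B : Form n) {x : Frac n} {g : Vect n} (h : ∀ l → Hom (degW B l) x (g l)) where

    private
      nonzero : ∀ {w : Weight n} {p a} → IsMin w p a → NonzeroP p
      nonzero P z = let (m , nz , _) = IsMin.attained P in nz (z m)

      homogeneous : ∀ {p l a} → IsMin (degW B l) p a → IsMin (negW (degW B l)) p (- a) → ∀ m → coeff p m ≢ 0ℤ → degM B m l ≡ a
      homogeneous {l = l} {a} P P′ m nz = trans (sym (degW-degM B l m)) (ℤP.≤-antisym (ℤP.neg-cancel-≤ (IsMin.lower P′ m nz)) (IsMin.lower P m nz))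

      minimal : ∀ {p b} → NonzeroP p → HomogP B p b → ∀ l → IsMin (degW B l) p (b l)
      minimal {p} {b} nz hp l with find-support p {λ _ → ⊤} (λ _ → yes tt)
      ... | inj₁ (m , nzm , _) = isMin (m , nzm , trans (degW-degM B l m) (hp m nzm l)) (λ m′ nz′ → ℤP.≤-reflexive (sym (trans (degW-degM B l m′) (hp m′ nz′ l))))
      ... | inj₂ none = ⊥-elim (nz (λ m → decidable-stable (coeff p m ℤ.≟ 0ℤ) (λ nzm → none m nzm tt)))

    -- The index only selects a weight whose `Hom` record witnesses that numerator and denominator
    -- are nonzero.
    degree-exists : Fin n → HasDegree B x g
    degree-exists k = proj₁ x , proj₂ x , (λ l → Hom.num (h l)) , (λ l → Hom.den′ (h l)) , nonzero (Hom.minN (h k)) , nonzero (Hom.minD (h k)) , (λ _ → refl) ,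
      (λ m nz l → homogeneous (Hom.minN (h l)) (Hom.maxN (h l)) m nz) , (λ m nz l → homogeneous (Hom.minD (h l)) (Hom.maxD (h l)) m nz) , λ l → Hom.diff (h l)

    degree-unique : ∀ {g′} → HasDegree B x g′ → ∀ l → g′ l ≡ g l
    degree-unique (P , Q , a , b , nzP , nzQ , e , hP , hQ , diff) l = trans (diff l) (trans (lem (a l) (b l) (Hom.num (h l)) (Hom.den′ (h l))
      (IsMin-unique {w = degW B l} {proj₁ x *P Q} {P *P proj₂ x} e (IsMin-* (Hom.minN (h l)) (minimal {Q} nzQ hQ l)) (IsMin-* (minimal {P} nzP hP l) (Hom.minD (h l))))) (sym (Hom.diff (h l))))
      where
      lem : ∀ a b p q → p + b ≡ a + q → a - b ≡ p - q
      lem a b p q e = trans (l₁ a b q) (trans (cong (λ v → v - q - b) (sym e)) (l₂ b p q))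
        where
        l₁ : ∀ a b q → a - b ≡ a + q - q - b
        l₁ = solve-∀
        l₂ : ∀ b p q → p + b - q - b ≡ p - q
        l₂ = solve-∀

-- Recognition of the initial variables

module _ {n} (B : Form n) (δ : Fin n → ℕ) (skew : SkewSymmetrizable B δ) (acyclic : Acyclic B) (fin : FiniteCartanType B δ) where
  private
    module R = Reachable B δ skew acyclic fin
  open R using (𝓔; F; d; d>0; d*ν)
  open ℚEval {n}

  ν-cong : ∀ {y z : Vect n} → (∀ i → y i ≡ z i) → ∀ l → ν B y l ≡ ν B z l
  ν-cong {y} {z} p l = *-cancelˡ (d>0 l) (trans (d*ν y l) (trans (cong -_ (E-congʳ F p)) (sym (d*ν z l))))

  ν-initial : ∀ {c y i} → InitAt 𝓔 c y i → ∀ l → ν B y l ≡ α i l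
  ν-initial {y = y} {i} I l = *-cancelˡ (d>0 l) (trans (d*ν y l) (trans (cong -_ (coord I (α l))) (trans (ℤP.neg-involutive (d i * α l i)) (swap (l ≟ i)))))
    where
    swap : Dec (l ≡ i) → d i * α l i ≡ d l * α i l
    swap (yes refl) = refl
    swap (no ne) = trans (cong (d i *_) (α-off (≢-sym ne))) (trans (ℤP.*-zeroʳ (d i)) (sym (trans (cong (d l *_) (α-off ne)) (ℤP.*-zeroʳ (d l)))))

  -- The numerator involves no y_j since plus vanishes, hence, being homogeneous of degree 0, no x_i;
  -- its value at ρ₀ is 1.
  initial-variable : ∀ {x : Frac n} {i} → IsDenominatorVector x (λ l → - α i l) → Ev ρ₀ x 1ℚ → (∀ l → Val (negW (yw l)) x 0ℤ) → (∀ l → Hom (degW B l) x (α i l)) → x ≃ polyF (xP i)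
  initial-variable {x} {i} (N , eq , _) (ev value denom) fv gv = faithful (proj₁ x *P oneP) (xP i *P proj₂ x) (λ ρ _ → begin
    eval (proj₁ x *P oneP) ρ
      ≡⟨ trans (eval-* (proj₁ x) oneP ρ) (cong (eval (proj₁ x) ρ ℚ.*_) (trans (eval-one ρ) (sym (eval-e⁺ ρ)))) ⟩
    eval (proj₁ x) ρ ℚ.* eval (xMon e₊) ρ
      ≡⟨ sym (eval-* (proj₁ x) (xMon e₊) ρ) ⟩
    eval (proj₁ x *P xMon e₊) ρ
      ≡⟨ eval-≈ {proj₁ x *P xMon e₊} {(N *P xMon e₋) *P proj₂ x} eq ρ ⟩
    eval ((N *P xMon e₋) *P proj₂ x) ρ
      ≡⟨ trans (eval-* (N *P xMon e₋) (proj₂ x) ρ) (cong (ℚ._* eval (proj₂ x) ρ) (trans (eval-* N (xMon e₋) ρ) (cong₂ ℚ._*_ (trans (eval-N ρ) N-value) (eval-e⁻ ρ)))) ⟩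
    1ℚ ℚ.* ρ (inj₁ i) ℚ.* eval (proj₂ x) ρ
      ≡⟨ cong (ℚ._* eval (proj₂ x) ρ) (trans (ℚP.*-identityˡ (ρ (inj₁ i))) (sym (eval-x i ρ))) ⟩
    eval (xP i) ρ ℚ.* eval (proj₂ x) ρ
      ≡⟨ sym (eval-* (xP i) (proj₂ x) ρ) ⟩
    eval (xP i *P proj₂ x) ρ ∎)
    where
    open ≡-Reasoning
    e₊ e₋ : Fin n → ℕ
    e₊ l = pos (- α i l)
    e₋ l = pos (- - α i l)
    m₊ m₋ : Monomial n
    m₊ = tabulate e₊ , replicate n 0
    m₋ = tabulate e₋ , replicate n 0
    e₋-off : ∀ l → l ≢ i → e₋ l ≡ 0
    e₋-off l ne = cong (λ a → pos (- - a)) (α-off ne)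
    e₊≡0 : ∀ l → e₊ l ≡ 0
    e₊≡0 l = pos-0 (neg-≤0 (α-nonneg i l))
      where
      α-nonneg : ∀ (i l : Fin n) → 0ℤ ≤ α i l
      α-nonneg i l with i ≟ l
      ... | yes refl = subst (0ℤ ≤_) (sym (α-diag i)) (+≤+ ℕ.z≤n)
      ... | no ne = ℤP.≤-reflexive (sym (α-off (≢-sym ne)))
    eval-e⁺ : ∀ ρ → eval (xMon e₊) ρ ≡ 1ℚ
    eval-e⁺ ρ = trans (eval-xMon e₊ ρ) (trans (monoV-single e₊ i (λ l _ → e₊≡0 l) (ρ ∘ inj₁)) (cong (ρ (inj₁ i) ↑_) (e₊≡0 i)))
    eval-e⁻ : ∀ ρ → eval (xMon e₋) ρ ≡ ρ (inj₁ i)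
    eval-e⁻ ρ = trans (eval-xMon e₋ ρ) (trans (monoV-single e₋ i e₋-off (ρ ∘ inj₁)) (trans (cong (λ a → ρ (inj₁ i) ↑ pos (- - a)) (α-diag i)) (ℚP.*-identityʳ (ρ (inj₁ i)))))
    minN : ∀ {w a} → Val w x a → IsMin w N (a + Weight.wt w m₊ - Weight.wt w m₋)
    minN = Val-numerator {x = x} {N} {λ l → - α i l} eq
    yfree : ∀ m → coeff N m ≢ 0ℤ → ∀ l → lookup (proj₂ m) l ≡ 0
    yfree m nz l = ℕP.n≤0⇒n≡0 (ℤP.drop‿+≤+ (ℤP.neg-cancel-≤ (subst (_≤ - + lookup (proj₂ m) l) (cong (λ a → 0ℤ + - a - - a) (lookup-zero l)) (IsMin.lower (minN (fv l)) m nz))))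
    degree : ∀ l (e : Fin n → ℕ) → Weight.wt (degW B l) (tabulate e , replicate n 0) ≡ + e l
    degree l e = trans (degW-wt B l _) (trans (cong₂ _-_ (cong +_ (VecP.lookup∘tabulate e l)) (trans (sum-cong (λ j → cong (B l j *_) (lookup-zero j))) (∑-*0 (B l)))) (ℤP.+-identityʳ (+ e l)))
    zero-degree : ∀ l → α i l + Weight.wt (degW B l) m₊ - Weight.wt (degW B l) m₋ ≡ 0ℤ
    zero-degree l = trans (cong₂ (λ s t → α i l + s - t) (degree l e₊) (degree l e₋)) (trans (lem (α i l) (+ e₊ l) (+ e₋ l)) (trans (cong (λ v → α i l + v) (sym (⁺-diff (- α i l)))) (ℤP.+-inverseʳ (α i l))))
      where
      lem : ∀ a s t → a + s - t ≡ a + (s - t)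
      lem = solve-∀
    homogeneous : ∀ m → coeff N m ≢ 0ℤ → ∀ l → Weight.wt (degW B l) m ≡ 0ℤ
    homogeneous m nz l = let (hom {p} {q} P P′ Q Q′ e) = gv l in ℤP.≤-antisym
      (ℤP.neg-cancel-≤ (subst (_≤ - Weight.wt (degW B l) m) (trans (lem (α i l) (Weight.wt (degW B l) m₊) (Weight.wt (degW B l) m₋)) (cong -_ (zero-degree l)))
        (IsMin.lower (minN (val {w = negW (degW B l)} P′ Q′ (trans (cong -_ e) (lem′ p q)))) m nz)))
      (subst (_≤ Weight.wt (degW B l) m) (zero-degree l) (IsMin.lower (minN (val P Q e)) m nz))
      where
      lem : ∀ a s t → - a + - s - - t ≡ - (a + s - t)
      lem = solve-∀
      lem′ : ∀ p q → - (p - q) ≡ - p - - q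
      lem′ = solve-∀
    xfree : ∀ m → coeff N m ≢ 0ℤ → ∀ l → lookup (proj₁ m) l ≡ 0
    xfree m nz l = ℤP.+-injective (trans (sym (trans (degW-wt B l m) (trans (cong (λ v → + lookup (proj₁ m) l - v) (trans (sum-cong (λ j → cong (λ a → B l j * + a) (yfree m nz j))) (∑-*0 (B l)))) (ℤP.+-identityʳ (+ lookup (proj₁ m) l))))) (homogeneous m nz l))
    only-one : ∀ m → coeff N m ≢ 0ℤ → m ≡ one
    only-one m nz = cong₂ _,_ (zeros (proj₁ m) (xfree m nz)) (zeros (proj₂ m) (yfree m nz))
      where
      zeros : ∀ {l} (v : Vec ℕ l) → (∀ i → lookup v i ≡ 0) → v ≡ replicate l 0
      zeros [] z = refl
      zeros (a ∷ v) z = cong₂ _∷_ (z zero) (zeros v (z ∘ suc))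
    c = coeff N one
    eval-N : ∀ ρ → eval N ρ ≡ ↑ℤ c
    eval-N ρ = trans (eval-≈ {N} {term c one} same ρ) (trans (ℚP.+-identityʳ (↑ℤ c ℚ.* mono one ρ)) (trans (cong (↑ℤ c ℚ.*_) (mono-one ρ)) (ℚP.*-identityʳ (↑ℤ c))))
      where
      same : N ≈P term c one
      same m with one ≟M m
      ... | yes refl = sym (ℤP.+-identityʳ c)
      ... | no ne = decidable-stable (coeff N m ℤ.≟ 0ℤ) (λ nz → ne (sym (only-one m nz)))
    N-value : ↑ℤ c ≡ 1ℚ
    N-value = sym (⊗-cancel denom (begin
      q₀ ℚ.* 1ℚ                                          ≡⟨ trans (ℚP.*-comm q₀ 1ℚ) (sym value) ⟩
      eval (proj₁ x) ρ₀                                  ≡⟨ sym (ℚP.*-identityʳ (eval (proj₁ x) ρ₀)) ⟩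
      eval (proj₁ x) ρ₀ ℚ.* 1ℚ                           ≡⟨ cong (eval (proj₁ x) ρ₀ ℚ.*_) (sym (eval-e⁺ ρ₀)) ⟩
      eval (proj₁ x) ρ₀ ℚ.* eval (xMon e₊) ρ₀            ≡⟨ sym (eval-* (proj₁ x) (xMon e₊) ρ₀) ⟩
      eval (proj₁ x *P xMon e₊) ρ₀                       ≡⟨ eval-≈ {proj₁ x *P xMon e₊} {(N *P xMon e₋) *P proj₂ x} eq ρ₀ ⟩
      eval ((N *P xMon e₋) *P proj₂ x) ρ₀                ≡⟨ trans (eval-* (N *P xMon e₋) (proj₂ x) ρ₀) (cong (ℚ._* q₀) (trans (eval-* N (xMon e₋) ρ₀) (trans (cong₂ ℚ._*_ (eval-N ρ₀) (eval-e⁻ ρ₀)) (ℚP.*-identityʳ (↑ℤ c))))) ⟩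
      ↑ℤ c ℚ.* q₀                                        ≡⟨ ℚP.*-comm (↑ℤ c) q₀ ⟩
      q₀ ℚ.* ↑ℤ c ∎))
      where
      q₀ = eval (proj₂ x) ρ₀

  den-noninitial : ∀ {c y} (s : Status 𝓔 c y) {x : Frac n} → IsDenominatorVector x (den s) → Ev ρ₀ x 1ℚ → (∀ l → Val (negW (yw l)) x (- plus s l)) → (∀ l → Hom (degW B l) x (ν B y l)) →
    (∀ i → ¬ (x ≃ polyF (xP i))) → ∀ l → den s l ≡ y l
  den-noninitial (noninitial _) dv un fv gv not l = refl
  den-noninitial (initial i I) {x} dv un fv gv not l = ⊥-elim (not i (initial-variable {x} dv un fv (λ l → subst (Hom (degW B l) x) (ν-initial I l) (gv l))))

theorem5p29 : ∀ {n} (B : Fin n → Fin n → ℤ) (δ : Fin n → ℕ) →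
    SkewSymmetrizable B δ → Acyclic B → FiniteCartanType B δ →
    (x : Frac n) → IsClusterVariable B x → (∀ i → ¬ (x ≃ polyF (xP i))) →
    (∃ λ d → IsDenominatorVector x d) × (∃ λ g → HasDegree B x g) ×
    (∀ d g → IsDenominatorVector x d → HasDegree B x g → ∀ i → g i ≡ ν B d i)
-- Both vectors are forced: g is ν (e k) by uniqueness of the degree, and d is `den s`, which equals
-- e k because x is not initial.
theorem5p29 {n} B δ skew acyclic fin x (ks , k , refl) noninitial-x = (den s , dv) , (ν B (e k) , degree-exists B gv k) ,
  λ d g (N , eq , nd) hg i → trans (degree-unique B gv hg i) (ν-cong B δ skew acyclic fin (λ l → sym (trans (denominator-unique {x = x} {N} {d} eq nd (T.dval k l)) (den-noninitial B δ skew acyclic fin s {x} dv (T.unit k) (T.fval k) gv noninitial-x l))) i)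
  where
  module R = Reachable B δ skew acyclic fin
  state = R.reachable ks
  e = proj₁ state
  V = proj₁ (proj₂ state)
  module T = R.Tracked (proj₂ (proj₂ state))
  s = R.Valid.status V k
  gv : ∀ l → Hom (degW B l) x (ν B (e k) l)
  gv l = T.gval k l
  expansion = LaurentPhenomenon.laurent-expansion R.𝓔 {B} R.valid₀ ks k
  dv : IsDenominatorVector x (den s)
  dv = denominator-exists {x = x} {proj₁ expansion} {proj₁ (proj₂ expansion)} (den s) (proj₂ (proj₂ expansion)) (T.dval k) (T.yval k)
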